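{- Let $P \subseteq \mathbb{R}^3$ be a $3$-dimensional smooth lattice polytope that is centrally symmetric, i.e. $P = -P$. Then $P$ has the integer decomposition property (IDP).
   Context: A lattice polytope in $\mathbb{R}^d$ is the convex hull of finitely many points of $\mathbb{Z}^d$. A lattice polytope $P$ has the integer decomposition property (is IDP) if for every integer $n \ge 1$ and every lattice point $p \in nP \cap \mathbb{Z}^d$ there exist lattice points $p_1,\dots,p_n \in P \cap \mathbb{Z}^d$ with $p = p_1 + \dots + p_n$. A lattice polytope $P$ is smooth if it is simple and at every vertex the primitive edge directions (primitive lattice vectors along the edges emanating from the vertex) form a basis of the lattice $(\operatorname{aff} P) \cap \mathbb{Z}^d$ (translated to the origin). -}

module Defs where

open import Data.Nat using (ℕ; zero; suc)
import Data.Nat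
open import Data.Fin using (Fin; zero; suc)
open import Data.Integer as ℤ using (ℤ; +_; ∣_∣)
open import Data.Rational as ℚ using (ℚ; 0ℚ; 1ℚ; _/_)
open import Data.Product using (Σ; ∃; _×_; _,_)
open import Relation.Binary.PropositionalEquality using (_≡_)
open import Relation.Nullary using (¬_)

ℤ³ : Set
ℤ³ = Fin 3 → ℤ

ℚ³ : Set
ℚ³ = Fin 3 → ℚ

ιℤ : ℤ → ℚ
ιℤ z = z / 1

ι : ℤ³ → ℚ³
ι v i = ιℤ (v i)

sumℚ : ∀ {m} → (Fin m → ℚ) → ℚ
sumℚ {zero}  f = 0ℚ
sumℚ {suc m} f = f zero ℚ.+ sumℚ (λ j → f (suc j))

sumℤ : ∀ {m} → (Fin m → ℤ) → ℤ
sumℤ {zero}  f = + 0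
sumℤ {suc m} f = f zero ℤ.+ sumℤ (λ j → f (suc j))

_≐_ : ℚ³ → ℚ³ → Set
x ≐ y = ∀ i → x i ≡ y i

lerp : ℚ → ℚ³ → ℚ³ → ℚ³
lerp t x y i = (1ℚ ℚ.- t) ℚ.* x i ℚ.+ t ℚ.* y i

-- The lattice polytope P = conv {V j | j : Fin m}, V j ∈ ℤ³.
-- Membership of a (rational) point x in P: x is a convex combination of the V j.
_∈P_ : ∀ {m} → ℚ³ → (Fin m → ℤ³) → Set
_∈P_ {m} x V =
  Σ (Fin m → ℚ) λ c →
    (∀ j → 0ℚ ℚ.≤ c j) × (sumℚ c ≡ 1ℚ) ×
    (∀ i → sumℚ (λ j → c j ℚ.* ι (V j) i) ≡ x i)

_∈Seg_,_ : ℚ³ → ℚ³ → ℚ³ → Set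
x ∈Seg v , w = Σ ℚ λ t → (0ℚ ℚ.≤ t) × (t ℚ.≤ 1ℚ) × (x ≐ lerp t v w)

IsVertex : ∀ {m} → (Fin m → ℤ³) → ℤ³ → Set
IsVertex V v =
  (ι v ∈P V) ×
  (∀ (y z : ℚ³) (t : ℚ) → y ∈P V → z ∈P V → 0ℚ ℚ.< t → t ℚ.< 1ℚ →
     ι v ≐ lerp t y z → (y ≐ ι v) × (z ≐ ι v))

-- [v, w] is an edge of P: v, w distinct vertices and the segment [v, w] is a face of P
-- (if a relative-interior point of a segment in P lies in [v,w], the whole segment does).
IsEdge : ∀ {m} → (Fin m → ℤ³) → ℤ³ → ℤ³ → Set
IsEdge V v w =
  IsVertex V v × IsVertex V w × ¬ (∀ i → v i ≡ w i) ×
  (∀ (y z : ℚ³) (t : ℚ) → y ∈P V → z ∈P V → 0ℚ ℚ.< t → t ℚ.< 1ℚ →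
     lerp t y z ∈Seg ι v , ι w → (y ∈Seg ι v , ι w) × (z ∈Seg ι v , ι w))

Primitive : ℤ³ → Set
Primitive d = ∀ (k : ℤ) (d' : ℤ³) → (∀ i → d i ≡ k ℤ.* d' i) → ∣ k ∣ ≡ 1

PrimEdgeDir : ∀ {m} → (Fin m → ℤ³) → ℤ³ → ℤ³ → Set
PrimEdgeDir V v d =
  Primitive d ×
  ∃ λ (w : ℤ³) → IsEdge V v w × ∃ λ (n : ℕ) → ∀ i → w i ℤ.- v i ≡ + suc n ℤ.* d i

IsBasis : ∀ {k} → (Fin k → ℤ³) → Set
IsBasis e =
  (∀ (z : ℤ³) → ∃ λ (c : Fin _ → ℤ) → ∀ i → sumℤ (λ j → c j ℤ.* e j i) ≡ z i) ×
  (∀ (c c' : Fin _ → ℤ) →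
     (∀ i → sumℤ (λ j → c j ℤ.* e j i) ≡ sumℤ (λ j → c' j ℤ.* e j i)) →
     ∀ j → c j ≡ c' j)

Dim3 : ∀ {m} → (Fin m → ℤ³) → Set
Dim3 V = ∃ λ (p : Fin 4 → ℚ³) → (∀ j → p j ∈P V) ×
  (∀ (c : Fin 3 → ℚ) → (∀ i → sumℚ (λ j → c j ℚ.* (p (suc j) i ℚ.- p zero i)) ≡ 0ℚ) →
     ∀ j → c j ≡ 0ℚ)

-- P is smooth (P full-dimensional, so aff P ∩ ℤ³ = ℤ³): at every vertex the primitive
-- edge directions are exactly three vectors e 0, e 1, e 2 forming a lattice basis of ℤ³
-- (in particular every vertex lies on exactly 3 = dim P edges, i.e. P is simple).
Smooth : ∀ {m} → (Fin m → ℤ³) → Set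
Smooth V = ∀ (v : ℤ³) → IsVertex V v →
  ∃ λ (e : Fin 3 → ℤ³) → IsBasis e × (∀ j → PrimEdgeDir V v (e j)) ×
    (∀ d → PrimEdgeDir V v d → ∃ λ j → ∀ i → d i ≡ e j i)

CentSym : ∀ {m} → (Fin m → ℤ³) → Set
CentSym V = (∀ x → x ∈P V → (λ i → ℚ.- x i) ∈P V) × (∀ x → (λ i → ℚ.- x i) ∈P V → x ∈P V)

_∈_·P_ : ∀ {m} → ℤ³ → ℕ → (Fin m → ℤ³) → Set
p ∈ n ·P V = ∃ λ (x : ℚ³) → x ∈P V × (∀ i → ιℤ (+ n) ℚ.* x i ≡ ι p i)

IDP : ∀ {m} → (Fin m → ℤ³) → Set
IDP V = ∀ (n : ℕ) → 1 Data.Nat.≤ n → ∀ (p : ℤ³) → p ∈ n ·P V →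
  ∃ λ (q : Fin n → ℤ³) → (∀ j → ι (q j) ∈P V) × (∀ i → sumℤ (λ j → q j i) ≡ p i)

{-# OPTIONS --safe #-}

-- For a lattice parallelogram S in a facet, conv (S ∪ -S) is a lattice parallelepiped inside P, and
-- lattice parallelepipeds have the IDP.  So let the ray through a point of n P leave P in a facet F
-- and look for such an S through the exit point.  The exit point lies in a unimodular triangle T of
-- F.  If one of the three reflections of T lies in F, it completes T to a parallelogram.  Otherwise
-- all lattice points of F lie in the cones opposite to T at its vertices, and the determinant of a
-- smooth corner of F is too large unless F is itself a unimodular triangle.  In that case the slices
-- of P parallel to F lie in the triangles F, (1+k)F, (1+2k)F, ..., where k ≥ 1 because 0 is an
-- interior lattice point.  The layer between F and (1+k)F is cut greedily into lattice points, and
-- below it the argument runs again with (1+k)F, which is covered by parallelograms, in place of F.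
--
-- That the tangent cone at a vertex is spanned by the edges is the correctness of one step of the
-- simplex method; all vertices and edges arise as lexicographic minima, and the only separation
-- theorem needed is Gordan's, by Fourier-Motzkin elimination.
module Submission where

open import Defs
open import Data.Bool using (Bool; true; false)
open import Data.Nat as ℕ using (ℕ; zero; suc)
import Data.Nat.Properties as ℕP
import Data.Nat.GCD as GCD
import Data.Nat.Divisibility as ℕD
open import Data.Fin using (Fin; zero; suc)
open import Data.Integer as ℤ using (ℤ; +_; -[1+_]; 0ℤ; 1ℤ; -1ℤ; ∣_∣)
import Data.Integer.Properties as ℤP
import Data.Integer.DivMod as ℤDM
import Data.Integer.Divisibility.Signed as ℤD
import Data.Integer.Tactic.RingSolver as ℤR
open import Data.Rational as ℚ using (ℚ; 0ℚ; 1ℚ; ½)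
import Data.Rational.Properties as ℚP
import Data.Rational.Unnormalised as ℚᵘ
import Data.Rational.Unnormalised.Properties as ℚᵘP
open import Data.Maybe using (Maybe; just; nothing)
open import Data.Product using (Σ; ∃; _×_; _,_; proj₁; proj₂)
import Data.Sum
open import Data.Sum using (_⊎_; inj₁; inj₂)
open import Data.Empty using (⊥; ⊥-elim)
open import Data.Unit using (⊤; tt)
open import Data.List using (List; []; _∷_; _++_; map; filter; concatMap; cartesianProductWith; allFin)
open import Data.List.Membership.Propositional using (_∈_; lose)
open import Data.List.Membership.Propositional.Properties
open import Data.List.Relation.Unary.Any using (here; there)
open import Level using (0ℓ)
open import Relation.Nullary using (¬_; Dec; yes; no)
open import Relation.Nullary.Decidable using (¬?)
open import Relation.Binary using (tri<; tri≈; tri>)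
open import Relation.Binary.PropositionalEquality using (_≡_; refl; sym; trans; cong; cong₂; subst; subst₂)
open import Tactic.RingSolver using (solve-∀; solve)
import Tactic.RingSolver.Core.AlmostCommutativeRing as ACR

-- The triangular facet is a genuine obstacle: for a unimodular triangle T the octahedron conv (T ∪
-- -T) can fail the IDP. With vertices (1,0,0), (0,1,0), (1,1,2), the point (1,1,1) lies in its
-- double but not in the lattice generated by its lattice points. A parallelepiped of any volume
-- behaves better, because its edge coordinates can be lowered by 0 or 1 independently of each
-- other. Central symmetry enters twice: it provides -S, and together with integrality it puts 0 at
-- lattice distance at least 1 from every facet, since the values of a facet functional at q and -q
-- average to its value at 0. All computations take place in the cone over P in ℚ⁴, so that dilates,
-- their points and affine functionals become linear. A facet is encoded by a corner of P on it, its
-- inner normal being the dual vector of the edge that leaves the facet; no face lattice is built.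

ℚ-ring : ACR.AlmostCommutativeRing 0ℓ 0ℓ
ℚ-ring = ACR.fromCommutativeRing ℚP.+-*-commutativeRing isZero
  where
  isZero : (x : ℚ) → Maybe (0ℚ ≡ x)
  isZero x with 0ℚ ℚP.≟ x
  ... | yes p = just p
  ... | no _ = nothing

-- Order on the rationals.

module OrderedField where

  open import Data.Rational using (_+_; _*_; _-_; -_; _≤_; _<_)

  infixl 4 _by_ _<by_
  infixl 6 _⊹_
  infixl 7 _⊛_

  -- The shape of nearly all estimates below: nonnegative terms are added by `⊹` and multiplied by
  -- `⊛`, and `by` carries the result to the wanted expression along a ring identity. What stands
  -- before `by` is the certificate of the inequality.
  _by_ : ∀ {a b} → 0ℚ ≤ a → a ≡ b → 0ℚ ≤ b
  p by refl = p

  _<by_ : ∀ {a b} → 0ℚ < a → a ≡ b → 0ℚ < b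
  p <by refl = p

  _⊹_ : ∀ {a b} → 0ℚ ≤ a → 0ℚ ≤ b → 0ℚ ≤ a + b
  p ⊹ q = ℚP.+-mono-≤ p q

  _⊛_ : ∀ {a b} → 0ℚ ≤ a → 0ℚ ≤ b → 0ℚ ≤ a * b
  _⊛_ {a} {b} p q =
    ℚP.nonNegative⁻¹ (a * b) {{ℚP.nonNeg*nonNeg⇒nonNeg a {{ℚ.nonNegative p}} b {{ℚ.nonNegative q}}}}

  pos+ : ∀ {a b} → 0ℚ < a → 0ℚ ≤ b → 0ℚ < a + b
  pos+ p q = ℚP.+-mono-<-≤ p q

  pos* : ∀ {a b} → 0ℚ < a → 0ℚ < b → 0ℚ < a * b
  pos* {a} {b} p q = ℚP.positive⁻¹ (a * b) {{ℚP.pos*pos⇒pos a {{ℚ.positive p}} b {{ℚ.positive q}}}}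

  private
    -+-cancel : ∀ a b → b - a + a ≡ b
    -+-cancel = solve-∀ ℚ-ring

  undiff : ∀ {a b} → 0ℚ ≤ b - a → a ≤ b
  undiff {a} {b} p = subst₂ _≤_ (ℚP.+-identityˡ a) (-+-cancel a b) (ℚP.+-monoˡ-≤ a p)

  diff< : ∀ {a b} → a < b → 0ℚ < b - a
  diff< {a} {b} p = subst (_< b - a) (ℚP.+-inverseʳ a) (ℚP.+-monoˡ-< (- a) p)

  undiff< : ∀ {a b} → 0ℚ < b - a → a < b
  undiff< {a} {b} p = subst₂ _<_ (ℚP.+-identityˡ a) (-+-cancel a b) (ℚP.+-monoˡ-< a p)

  pos≰0 : ∀ {a} → 0ℚ < a → 0ℚ ≤ - a → ⊥
  pos≰0 {a} p q = ℚP.<-irrefl refl (pos+ p q <by ℚP.+-inverseʳ a)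

  neg≰ : ¬ (0ℚ < 0ℚ)
  neg≰ = ℚP.<-irrefl refl

  data Sign (a : ℚ) : Set where
    neg : 0ℚ < - a → Sign a
    nul : a ≡ 0ℚ → Sign a
    pos : 0ℚ < a → Sign a

  sign : ∀ a → Sign a
  sign a with ℚP.<-cmp a 0ℚ
  ... | tri< p _ _ = neg (ℚP.neg-antimono-< p)
  ... | tri≈ _ p _ = nul p
  ... | tri> _ _ p = pos p

  nonneg? : ∀ a → (0ℚ ≤ a) ⊎ (0ℚ < - a)
  nonneg? a with sign a
  ... | neg p = inj₂ p
  ... | nul p = inj₁ (ℚP.≤-reflexive (sym p))
  ... | pos p = inj₁ (ℚP.<⇒≤ p)

  0≤0 : 0ℚ ≤ 0ℚ
  0≤0 = ℚP.≤-refl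

  0<1 : 0ℚ < 1ℚ
  0<1 = ℚP.positive⁻¹ 1ℚ

  0≤1 : 0ℚ ≤ 1ℚ
  0≤1 = ℚP.<⇒≤ 0<1

  abstract
    pos⇒inverse : ∀ a → 0ℚ < a → ∃ λ b → 0ℚ < b × b * a ≡ 1ℚ
    pos⇒inverse a p =
      ℚ.1/_ a {{ℚP.pos⇒nonZero a {{ℚ.positive p}}}} ,
      ℚP.positive⁻¹ _ {{ℚP.1/pos⇒pos a {{ℚ.positive p}}}} ,
      ℚP.*-inverseˡ a {{ℚP.pos⇒nonZero a {{ℚ.positive p}}}}

  *≡0 : ∀ {a b} → 0ℚ < a → a * b ≡ 0ℚ → b ≡ 0ℚ
  *≡0 {a} {b} p q with pos⇒inverse a p
  ... | i , _ , e = trans (trans (sym (ℚP.*-identityˡ b)) (cong (_* b) (sym e)))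
                      (trans (ℚP.*-assoc i a b) (trans (cong (i *_) q) (ℚP.*-zeroʳ i)))

  *-pos⁻¹ : ∀ {a b} → 0ℚ < a → 0ℚ < a * b → 0ℚ < b
  *-pos⁻¹ {a} {b} p q with sign b
  ... | pos r = r
  ... | nul r = ⊥-elim (neg≰ (q <by trans (cong (a *_) r) (ℚP.*-zeroʳ a)))
  ... | neg r = ⊥-elim (neg≰ (pos+ (pos* p r) (ℚP.<⇒≤ q) <by solve (a ∷ b ∷ []) ℚ-ring))

  *-nonneg⁻¹ : ∀ {a b} → 0ℚ < a → 0ℚ ≤ a * b → 0ℚ ≤ b
  *-nonneg⁻¹ {a} {b} p q with nonneg? b
  ... | inj₁ r = r
  ... | inj₂ r = ⊥-elim (neg≰ (pos+ (pos* p r) q <by solve (a ∷ b ∷ []) ℚ-ring))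

  sum≡0ˡ : ∀ {a b} → 0ℚ ≤ a → 0ℚ ≤ b → a + b ≡ 0ℚ → a ≡ 0ℚ
  sum≡0ˡ {a} {b} p q e = ℚP.≤-antisym (undiff (q by trans (h a b) (cong (_- a) e))) p
    where
    h : ∀ a b → b ≡ a + b - a
    h = solve-∀ ℚ-ring

  sum≡0ʳ : ∀ {a b} → 0ℚ ≤ a → 0ℚ ≤ b → a + b ≡ 0ℚ → b ≡ 0ℚ
  sum≡0ʳ {a} {b} p q e = sum≡0ˡ q p (trans (ℚP.+-comm b a) e)

open OrderedField

-- The integers as an ordered subring of the rationals.

module IntegerEmbedding where

  open import Data.Rational using (_+_; _*_; _-_; -_; _≤_; _<_)

  private
    u : ℤ → ℚᵘ.ℚᵘ
    u z = ℚᵘ.mkℚᵘ z 0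

    u≃ : ∀ z → ℚ.toℚᵘ (ιℤ z) ℚᵘ.≃ u z
    u≃ z = ℚP.toℚᵘ-fromℚᵘ (u z)

  abstract
    ι-+ : ∀ a b → ιℤ (a ℤ.+ b) ≡ ιℤ a + ιℤ b
    ι-+ a b = ℚP.toℚᵘ-injective (ℚᵘP.≃-trans (u≃ (a ℤ.+ b)) (ℚᵘP.≃-trans
      (ℚᵘ.*≡* (cong (ℤ._* 1ℤ) (cong₂ ℤ._+_ (sym (ℤP.*-identityʳ a)) (sym (ℤP.*-identityʳ b)))))
      (ℚᵘP.≃-trans (ℚᵘP.+-cong (ℚᵘP.≃-sym (u≃ a)) (ℚᵘP.≃-sym (u≃ b)))
        (ℚᵘP.≃-sym (ℚP.toℚᵘ-homo-+ (ιℤ a) (ιℤ b))))))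

    ι-* : ∀ a b → ιℤ (a ℤ.* b) ≡ ιℤ a * ιℤ b
    ι-* a b = ℚP.toℚᵘ-injective (ℚᵘP.≃-trans (u≃ (a ℤ.* b)) (ℚᵘP.≃-trans
      (ℚᵘ.*≡* refl)
      (ℚᵘP.≃-trans (ℚᵘP.*-cong (ℚᵘP.≃-sym (u≃ a)) (ℚᵘP.≃-sym (u≃ b)))
        (ℚᵘP.≃-sym (ℚP.toℚᵘ-homo-* (ιℤ a) (ιℤ b))))))

    ι-neg : ∀ a → ιℤ (ℤ.- a) ≡ - ιℤ a
    ι-neg a = ℚP.toℚᵘ-injective (ℚᵘP.≃-trans (u≃ (ℤ.- a)) (ℚᵘP.≃-trans (ℚᵘ.*≡* refl)
      (ℚᵘP.≃-trans (ℚᵘP.-‿cong (ℚᵘP.≃-sym (u≃ a))) (ℚᵘP.≃-sym (ℚP.toℚᵘ-homo‿- (ιℤ a))))))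

    ι-mono : ∀ {a} → 0ℤ ℤ.≤ a → 0ℚ ≤ ιℤ a
    ι-mono {a} p = ℚP.toℚᵘ-cancel-≤ (ℚᵘP.≤-respʳ-≃ (ℚᵘP.≃-sym (u≃ a))
      (ℚᵘ.*≤* (subst (0ℤ ℤ.≤_) (sym (ℤP.*-identityʳ a)) p)))

    ι-reflect : ∀ {a} → 0ℚ ≤ ιℤ a → 0ℤ ℤ.≤ a
    ι-reflect {a} p with ℚᵘP.≤-respʳ-≃ (u≃ a) (ℚP.toℚᵘ-mono-≤ p)
    ... | ℚᵘ.*≤* q = subst (0ℤ ℤ.≤_) (ℤP.*-identityʳ a) q

    ι-injective : ∀ {a b} → ιℤ a ≡ ιℤ b → a ≡ b
    ι-injective {a} {b} p with ℚᵘP.≃-trans (ℚᵘP.≃-sym (u≃ a)) (ℚᵘP.≃-trans (ℚP.toℚᵘ-cong p) (u≃ b))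
    ... | ℚᵘ.*≡* q = trans (sym (ℤP.*-identityʳ a)) (trans q (ℤP.*-identityʳ b))

  ι-- : ∀ a b → ιℤ (a ℤ.- b) ≡ ιℤ a - ιℤ b
  ι-- a b = trans (ι-+ a (ℤ.- b)) (cong (_+_ (ιℤ a)) (ι-neg b))

  ι-pos : ∀ {a} → 1ℤ ℤ.≤ a → 0ℚ < ιℤ a
  ι-pos {a} p = pos+ 0<1 (ι-mono (ℤP.i≤j⇒0≤j-i p))
    <by trans (cong (_+_ 1ℚ) (ι-- a 1ℤ)) (h (ιℤ a))
    where
    h : ∀ x → 1ℚ + (x - 1ℚ) ≡ x
    h = solve-∀ ℚ-ring

  ι-expand : ∀ {z} p q r e f g → p ℤ.* e ℤ.+ (q ℤ.* f ℤ.+ r ℤ.* g) ≡ z →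
             ιℤ z ≡ ιℤ p * ιℤ e + (ιℤ q * ιℤ f + ιℤ r * ιℤ g)
  ι-expand p q r e f g refl = trans (ι-+ (p ℤ.* e) _) (cong₂ _+_ (ι-* p e)
    (trans (ι-+ (q ℤ.* f) (r ℤ.* g)) (cong₂ _+_ (ι-* q f) (ι-* r g))))

open IntegerEmbedding

-- Homogeneous coordinates: vectors and functionals on ℚ⁴.

module Vectors where

  open import Data.Rational using (_+_; _*_; _-_; -_; _≤_; _<_)

  H : Set
  H = Fin 4 → ℚ

  pattern 0F = zero
  pattern 1F = suc zero
  pattern 2F = suc (suc zero)
  pattern 3F = suc (suc (suc zero))

  infix 4 _≋_
  infixl 6 _⊕_ _⊝_
  infixl 7 _⊙_ _∙_

  _≋_ : H → H → Set
  x ≋ y = ∀ i → x i ≡ y i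

  ≋-sym : ∀ {x y} → x ≋ y → y ≋ x
  ≋-sym p i = sym (p i)

  _⊕_ _⊝_ : H → H → H
  (x ⊕ y) i = x i + y i
  (x ⊝ y) i = x i - y i

  _⊙_ : ℚ → H → H
  (t ⊙ x) i = t * x i

  𝟎 : H
  𝟎 _ = 0ℚ

  abstract
    -- Abstract, so that pairings stay opaque in goals; outside this block only the linearity laws
    -- and `∙-def` are available.
    _∙_ : H → H → ℚ
    φ ∙ x = φ 0F * x 0F + φ 1F * x 1F + φ 2F * x 2F + φ 3F * x 3F

    ∙-def : ∀ φ x → φ ∙ x ≡ φ 0F * x 0F + φ 1F * x 1F + φ 2F * x 2F + φ 3F * x 3F
    ∙-def φ x = refl

    ∙-comm : ∀ φ x → φ ∙ x ≡ x ∙ φ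
    ∙-comm φ x = h (φ 0F) (φ 1F) (φ 2F) (φ 3F) (x 0F) (x 1F) (x 2F) (x 3F)
      where
      h : ∀ a b c d p q r s → a * p + b * q + c * r + d * s ≡ p * a + q * b + r * c + s * d
      h = solve-∀ ℚ-ring

    ∙-⊕ : ∀ φ x y → φ ∙ (x ⊕ y) ≡ φ ∙ x + φ ∙ y
    ∙-⊕ φ x y = h (φ 0F) (φ 1F) (φ 2F) (φ 3F) (x 0F) (x 1F) (x 2F) (x 3F) (y 0F) (y 1F) (y 2F) (y 3F)
      where
      h : ∀ a b c d p q r s p' q' r' s' →
          a * (p + p') + b * (q + q') + c * (r + r') + d * (s + s') ≡
          (a * p + b * q + c * r + d * s) + (a * p' + b * q' + c * r' + d * s')
      h = solve-∀ ℚ-ring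

    ∙-⊙ : ∀ φ t x → φ ∙ (t ⊙ x) ≡ t * (φ ∙ x)
    ∙-⊙ φ t x = h (φ 0F) (φ 1F) (φ 2F) (φ 3F) t (x 0F) (x 1F) (x 2F) (x 3F)
      where
      h : ∀ a b c d t p q r s →
          a * (t * p) + b * (t * q) + c * (t * r) + d * (t * s) ≡ t * (a * p + b * q + c * r + d * s)
      h = solve-∀ ℚ-ring

    ∙-⊝ : ∀ φ x y → φ ∙ (x ⊝ y) ≡ φ ∙ x - φ ∙ y
    ∙-⊝ φ x y = h (φ 0F) (φ 1F) (φ 2F) (φ 3F) (x 0F) (x 1F) (x 2F) (x 3F) (y 0F) (y 1F) (y 2F) (y 3F)
      where
      h : ∀ a b c d p q r s p' q' r' s' →
          a * (p - p') + b * (q - q') + c * (r - r') + d * (s - s') ≡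
          (a * p + b * q + c * r + d * s) - (a * p' + b * q' + c * r' + d * s')
      h = solve-∀ ℚ-ring

    ∙-cong : ∀ φ {x y} → x ≋ y → φ ∙ x ≡ φ ∙ y
    ∙-cong φ p rewrite p 0F | p 1F | p 2F | p 3F = refl

    ∙-𝟎 : ∀ φ → φ ∙ 𝟎 ≡ 0ℚ
    ∙-𝟎 φ = h (φ 0F) (φ 1F) (φ 2F) (φ 3F)
      where
      h : ∀ a b c d → a * 0ℚ + b * 0ℚ + c * 0ℚ + d * 0ℚ ≡ 0ℚ
      h = solve-∀ ℚ-ring

  ⊕-∙ : ∀ φ ψ x → (φ ⊕ ψ) ∙ x ≡ φ ∙ x + ψ ∙ x
  ⊕-∙ φ ψ x = trans (∙-comm (φ ⊕ ψ) x) (trans (∙-⊕ x φ ψ) (cong₂ _+_ (∙-comm x φ) (∙-comm x ψ)))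

  ⊝-∙ : ∀ φ ψ x → (φ ⊝ ψ) ∙ x ≡ φ ∙ x - ψ ∙ x
  ⊝-∙ φ ψ x = trans (∙-comm (φ ⊝ ψ) x) (trans (∙-⊝ x φ ψ) (cong₂ _-_ (∙-comm x φ) (∙-comm x ψ)))

  ⊙-∙ : ∀ t φ x → (t ⊙ φ) ∙ x ≡ t * (φ ∙ x)
  ⊙-∙ t φ x = trans (∙-comm (t ⊙ φ) x) (trans (∙-⊙ x t φ) (cong (_*_ t) (∙-comm x φ)))

  π : Fin 4 → H
  π 0F 0F = 1ℚ
  π 0F _ = 0ℚ
  π 1F 1F = 1ℚ
  π 1F _ = 0ℚ
  π 2F 2F = 1ℚ
  π 2F _ = 0ℚ
  π 3F 3F = 1ℚ
  π 3F _ = 0ℚ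

  π-∙ : ∀ i x → π i ∙ x ≡ x i
  π-∙ 0F x = trans (∙-def (π 0F) x) (h (x 0F) (x 1F) (x 2F) (x 3F))
    where
    h : ∀ p q r s → 1ℚ * p + 0ℚ * q + 0ℚ * r + 0ℚ * s ≡ p
    h = solve-∀ ℚ-ring
  π-∙ 1F x = trans (∙-def (π 1F) x) (h (x 0F) (x 1F) (x 2F) (x 3F))
    where
    h : ∀ p q r s → 0ℚ * p + 1ℚ * q + 0ℚ * r + 0ℚ * s ≡ q
    h = solve-∀ ℚ-ring
  π-∙ 2F x = trans (∙-def (π 2F) x) (h (x 0F) (x 1F) (x 2F) (x 3F))
    where
    h : ∀ p q r s → 0ℚ * p + 0ℚ * q + 1ℚ * r + 0ℚ * s ≡ r
    h = solve-∀ ℚ-ring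
  π-∙ 3F x = trans (∙-def (π 3F) x) (h (x 0F) (x 1F) (x 2F) (x 3F))
    where
    h : ∀ p q r s → 0ℚ * p + 0ℚ * q + 0ℚ * r + 1ℚ * s ≡ s
    h = solve-∀ ℚ-ring

  -- Coordinate 0 holds the dilation factor; a linear functional on ℚ⁴ restricted to factor 1 is an
  -- affine functional on ℚ³.
  hom : ℚ → ℚ³ → H
  hom r x zero = r
  hom r x (suc i) = x i

  hat : ℤ³ → H
  hat v = hom 1ℚ (ι v)

open Vectors

-- Linearity of finite sums.

module Sums where

  open import Data.Rational using (_+_; _*_; _-_; -_; _≤_; _<_)

  sum-cong : ∀ {m} {f g : Fin m → ℚ} → (∀ j → f j ≡ g j) → sumℚ f ≡ sumℚ g
  sum-cong {zero} p = refl
  sum-cong {suc m} p = cong₂ _+_ (p zero) (sum-cong (λ j → p (suc j)))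

  sum-+ : ∀ {m} (f g : Fin m → ℚ) → sumℚ (λ j → f j + g j) ≡ sumℚ f + sumℚ g
  sum-+ {zero} f g = refl
  sum-+ {suc m} f g = trans (cong (_+_ (f zero + g zero)) (sum-+ (λ j → f (suc j)) (λ j → g (suc j))))
                        (h (f zero) (g zero) _ _)
    where
    h : ∀ a b c d → a + b + (c + d) ≡ a + c + (b + d)
    h = solve-∀ ℚ-ring

  sum-* : ∀ {m} t (f : Fin m → ℚ) → sumℚ (λ j → t * f j) ≡ t * sumℚ f
  sum-* {zero} t f = sym (ℚP.*-zeroʳ t)
  sum-* {suc m} t f = trans (cong (_+_ (t * f zero)) (sum-* t (λ j → f (suc j))))
                        (sym (ℚP.*-distribˡ-+ t (f zero) _))

  sum-0 : ∀ m → sumℚ {m} (λ _ → 0ℚ) ≡ 0ℚ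
  sum-0 zero = refl
  sum-0 (suc m) = trans (ℚP.+-identityˡ _) (sum-0 m)

open Sums

-- The cone over the polytope.

module Cones where

  open import Data.Rational using (_+_; _*_; _-_; -_; _≤_; _<_)

  -- Written so that `Cone V (hom 1ℚ x)` unfolds to `x ∈P V`; the two are used interchangeably.
  Cone : ∀ {m} → (Fin m → ℤ³) → H → Set
  Cone {m} V h =
    Σ (Fin m → ℚ) λ c →
      (∀ j → 0ℚ ≤ c j) × (sumℚ c ≡ h zero) ×
      (∀ i → sumℚ (λ j → c j * ι (V j) i) ≡ h (suc i))

  cone-resp : ∀ {m} {V : Fin m → ℤ³} {x y} → x ≋ y → Cone V x → Cone V y
  cone-resp e (c , p , q , r) = c , p , trans q (e zero) , λ i → trans (r i) (e (suc i))

  cone-𝟎 : ∀ {m} {V : Fin m → ℤ³} → Cone V 𝟎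
  cone-𝟎 {m} {V} = (λ _ → 0ℚ) , (λ _ → 0≤0) , sum-0 m ,
    λ i → trans (sum-cong (λ j → ℚP.*-zeroˡ (ι (V j) i))) (sum-0 m)

  cone-⊕ : ∀ {m} {V : Fin m → ℤ³} {x y} → Cone V x → Cone V y → Cone V (x ⊕ y)
  cone-⊕ {V = V} (c , p , q , r) (c' , p' , q' , r') =
    (λ j → c j + c' j) , (λ j → p j ⊹ p' j) ,
    trans (sum-+ c c') (cong₂ _+_ q q') ,
    λ i → trans (sum-cong (λ j → ℚP.*-distribʳ-+ (ι (V j) i) (c j) (c' j)))
            (trans (sum-+ (λ j → c j * ι (V j) i) _) (cong₂ _+_ (r i) (r' i)))

  cone-⊙ : ∀ {m} {V : Fin m → ℤ³} {t x} → 0ℚ ≤ t → Cone V x → Cone V (t ⊙ x)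
  cone-⊙ {V = V} {t} t≥0 (c , p , q , r) =
    (λ j → t * c j) , (λ j → t≥0 ⊛ p j) ,
    trans (sum-* t c) (cong (_*_ t) q) ,
    λ i → trans (sum-cong (λ j → ℚP.*-assoc t (c j) (ι (V j) i)))
            (trans (sum-* t (λ j → c j * ι (V j) i)) (cong (_*_ t) (r i)))

  cone-gen : ∀ {m} (V : Fin m → ℤ³) j → Cone V (hat (V j))
  cone-gen {suc m} V zero with cone-𝟎 {m} {λ j → V (suc j)}
  ... | c , p , q , r = (λ { zero → 1ℚ ; (suc j) → c j }) ,
    (λ { zero → 0≤1 ; (suc j) → p j }) ,
    trans (cong (_+_ 1ℚ) q) (ℚP.+-identityʳ 1ℚ) ,
    λ i → trans (cong (_+_ (1ℚ * ι (V zero) i)) (r i)) (trans (ℚP.+-identityʳ _) (ℚP.*-identityˡ _))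
  cone-gen {suc m} V (suc j) with cone-gen (λ j → V (suc j)) j
  ... | c , p , q , r = (λ { zero → 0ℚ ; (suc j) → c j }) ,
    (λ { zero → 0≤0 ; (suc j) → p j }) ,
    trans (ℚP.+-identityˡ _) q ,
    λ i → trans (cong (_+ sumℚ (λ j → c j * ι (V (suc j)) i)) (ℚP.*-zeroˡ (ι (V zero) i)))
            (trans (ℚP.+-identityˡ _) (r i))

  -- Spares later proofs the coefficient functions. `Q` often pairs the nonnegativity of a
  -- functional with a claim about its zeros: when the functional vanishes on a sum, every generator
  -- with positive coefficient lies in its kernel.
  cone-ind : ∀ {m} (V : Fin m → ℤ³) (Q : H → Set) →
             (∀ {x y} → x ≋ y → Q x → Q y) → Q 𝟎 →
             (∀ j c {x} → 0ℚ ≤ c → Q x → Q ((c ⊙ hat (V j)) ⊕ x)) →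
             ∀ {h} → Cone V h → Q h
  cone-ind {zero} V Q resp base step (c , p , q , r) = resp (λ { zero → q ; (suc i) → r i }) base
  cone-ind {suc m} V Q resp base step {h} (c , p , q , r) =
    resp eq (step zero (c zero) (p zero)
      (cone-ind (λ j → V (suc j)) Q resp base (λ j → step (suc j)) {rest}
        ((λ j → c (suc j)) , (λ j → p (suc j)) , refl , λ i → refl)))
    where
    rest : H
    rest = hom (sumℚ (λ j → c (suc j))) (λ i → sumℚ (λ j → c (suc j) * ι (V (suc j)) i))
    eq : (c zero ⊙ hat (V zero)) ⊕ rest ≋ h
    eq zero = trans (cong (_+ sumℚ (λ j → c (suc j))) (ℚP.*-identityʳ (c zero))) q
    eq (suc i) = r i

  cone-nonneg : ∀ {m} {V : Fin m → ℤ³} φ → (∀ j → 0ℚ ≤ φ ∙ hat (V j)) → ∀ {h} → Cone V h → 0ℚ ≤ φ ∙ h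
  cone-nonneg {V = V} φ p = cone-ind V (λ h → 0ℚ ≤ φ ∙ h)
    (λ {x} {y} e q → q by ∙-cong φ e) (0≤0 by sym (∙-𝟎 φ))
    λ j c {x} c≥0 q → (c≥0 ⊛ p j) ⊹ q
      by trans (cong (_+ φ ∙ x) (sym (∙-⊙ φ c (hat (V j))))) (sym (∙-⊕ φ (c ⊙ hat (V j)) x))

open Cones

-- The lexicographic order given by a list of functionals.

module Lexicographic where

  open import Data.Rational using (_+_; _*_; _-_; -_; _≤_; _<_)

  LexNN : List H → H → Set
  LexNN [] x = ⊤
  LexNN (φ ∷ φs) x = (0ℚ < φ ∙ x) ⊎ (φ ∙ x ≡ 0ℚ × LexNN φs x)

  Vanish : List H → H → Set
  Vanish [] x = ⊤
  Vanish (φ ∷ φs) x = φ ∙ x ≡ 0ℚ × Vanish φs x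

  vanish⇒lex : ∀ φs {x} → Vanish φs x → LexNN φs x
  vanish⇒lex [] _ = tt
  vanish⇒lex (φ ∷ φs) (p , q) = inj₂ (p , vanish⇒lex φs q)

  vanish-𝟎 : ∀ φs → Vanish φs 𝟎
  vanish-𝟎 [] = tt
  vanish-𝟎 (φ ∷ φs) = ∙-𝟎 φ , vanish-𝟎 φs

  vanish-resp : ∀ φs {x y} → x ≋ y → Vanish φs x → Vanish φs y
  vanish-resp [] e _ = tt
  vanish-resp (φ ∷ φs) e (p , q) = trans (∙-cong φ (≋-sym e)) p , vanish-resp φs e q

  lex-resp : ∀ φs {x y} → x ≋ y → LexNN φs x → LexNN φs y
  lex-resp [] e _ = tt
  lex-resp (φ ∷ φs) e (inj₁ p) = inj₁ (p <by ∙-cong φ e)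
  lex-resp (φ ∷ φs) e (inj₂ (p , q)) = inj₂ (trans (∙-cong φ (≋-sym e)) p , lex-resp φs e q)

  lex-⊕ : ∀ φs {x y} → LexNN φs x → LexNN φs y → LexNN φs (x ⊕ y)
  lex-⊕ [] _ _ = tt
  lex-⊕ (φ ∷ φs) {x} {y} (inj₁ p) (inj₁ q) = inj₁ (pos+ p (ℚP.<⇒≤ q) <by sym (∙-⊕ φ x y))
  lex-⊕ (φ ∷ φs) {x} {y} (inj₁ p) (inj₂ (q , _)) =
    inj₁ (pos+ p (0≤0 by sym q) <by sym (∙-⊕ φ x y))
  lex-⊕ (φ ∷ φs) {x} {y} (inj₂ (p , _)) (inj₁ q) =
    inj₁ (pos+ q (0≤0 by sym p) <by trans (ℚP.+-comm (φ ∙ y) (φ ∙ x)) (sym (∙-⊕ φ x y)))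
  lex-⊕ (φ ∷ φs) {x} {y} (inj₂ (p , p')) (inj₂ (q , q')) =
    inj₂ (trans (∙-⊕ φ x y) (cong₂ _+_ p q) , lex-⊕ φs p' q')

  lex-⊙ : ∀ φs {t x} → 0ℚ ≤ t → LexNN φs x → LexNN φs (t ⊙ x)
  lex-⊙ [] _ _ = tt
  lex-⊙ (φ ∷ φs) {t} {x} t≥0 p with sign t
  ... | neg t<0 = ⊥-elim (neg≰ (pos+ t<0 t≥0 <by ℚP.+-inverseˡ t))
  ... | nul refl = vanish⇒lex (φ ∷ φs) (vanish-resp (φ ∷ φs) (λ i → sym (ℚP.*-zeroˡ (x i))) (vanish-𝟎 (φ ∷ φs)))
  lex-⊙ (φ ∷ φs) {t} {x} t≥0 (inj₁ p) | pos t>0 = inj₁ (pos* t>0 p <by sym (∙-⊙ φ t x))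
  lex-⊙ (φ ∷ φs) {t} {x} t≥0 (inj₂ (p , q)) | pos t>0 =
    inj₂ (trans (∙-⊙ φ t x) (trans (cong (_*_ t) p) (ℚP.*-zeroʳ t)) , lex-⊙ φs t≥0 q)

  lex-total : ∀ φs x y → LexNN φs (x ⊝ y) ⊎ LexNN φs (y ⊝ x)
  lex-total [] x y = inj₁ tt
  lex-total (φ ∷ φs) x y with sign (φ ∙ (x ⊝ y))
  ... | pos p = inj₁ (inj₁ p)
  ... | neg p = inj₂ (inj₁ (p <by trans (cong -_ (∙-⊝ φ x y)) (trans (h (φ ∙ x) (φ ∙ y)) (sym (∙-⊝ φ y x)))))
    where
    h : ∀ a b → - (a - b) ≡ b - a
    h = solve-∀ ℚ-ring
  ... | nul p with lex-total φs x y
  ...   | inj₁ q = inj₁ (inj₂ (p , q))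
  ...   | inj₂ q = inj₂ (inj₂ (trans (∙-⊝ φ y x) (trans (h (φ ∙ x) (φ ∙ y))
                     (cong -_ (trans (sym (∙-⊝ φ x y)) p))) , q))
    where
    h : ∀ a b → b - a ≡ - (a - b)
    h = solve-∀ ℚ-ring

  -- This is what makes the common zeros of `φs` a face. At the first functional two nonnegative
  -- terms add up to zero, so both vanish, and the next functional takes over.
  lex-antisym : ∀ φs {s t x y} → 0ℚ < s → 0ℚ < t → LexNN φs x → LexNN φs y →
                Vanish φs ((s ⊙ x) ⊕ (t ⊙ y)) → Vanish φs x × Vanish φs y
  lex-antisym [] _ _ _ _ _ = tt , tt
  lex-antisym (φ ∷ φs) {s} {t} {x} {y} s>0 t>0 lx ly (z , zs) = go lx ly
    where
    sum0 : s * (φ ∙ x) + t * (φ ∙ y) ≡ 0ℚ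
    sum0 = trans (sym (trans (∙-⊕ φ (s ⊙ x) (t ⊙ y)) (cong₂ _+_ (∙-⊙ φ s x) (∙-⊙ φ t y)))) z
    head≥0 : ∀ {x} → LexNN (φ ∷ φs) x → 0ℚ ≤ φ ∙ x
    head≥0 (inj₁ p) = ℚP.<⇒≤ p
    head≥0 (inj₂ (p , _)) = 0≤0 by sym p
    x≥0 = ℚP.<⇒≤ s>0 ⊛ head≥0 lx
    y≥0 = ℚP.<⇒≤ t>0 ⊛ head≥0 ly
    x≡0 : φ ∙ x ≡ 0ℚ
    x≡0 = *≡0 s>0 (sum≡0ˡ x≥0 y≥0 sum0)
    y≡0 : φ ∙ y ≡ 0ℚ
    y≡0 = *≡0 t>0 (sum≡0ʳ x≥0 y≥0 sum0)
    go : LexNN (φ ∷ φs) x → LexNN (φ ∷ φs) y → Vanish (φ ∷ φs) x × Vanish (φ ∷ φs) y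
    go (inj₁ p) _ = ⊥-elim (neg≰ (p <by x≡0))
    go (inj₂ _) (inj₁ q) = ⊥-elim (neg≰ (q <by y≡0))
    go (inj₂ (p , lx')) (inj₂ (q , ly')) with lex-antisym φs s>0 t>0 lx' ly' zs
    ... | vx , vy = (p , vx) , (q , vy)

  lex-min : ∀ {A : Set} (φs : List H) (f : A → H) (a : A) (as : List A) →
            ∃ λ b → b ∈ (a ∷ as) × (∀ {c} → c ∈ (a ∷ as) → LexNN φs (f c ⊝ f b))
  lex-min φs f a [] = a , here refl , λ { (here refl) → self }
    where
    self : LexNN φs (f a ⊝ f a)
    self = vanish⇒lex φs (vanish-resp φs (λ i → sym (ℚP.+-inverseʳ (f a i))) (vanish-𝟎 φs))
  lex-min {A} φs f a (a' ∷ as) with lex-min φs f a' as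
  ... | b , b∈ , min with lex-total φs (f a) (f b)
  ...   | inj₁ p = b , there b∈ , λ { (here refl) → p ; (there c∈) → min c∈ }
  ...   | inj₂ p = a , here refl , λ { (here refl) → self ; (there c∈) → step c∈ }
    where
    self : LexNN φs (f a ⊝ f a)
    self = vanish⇒lex φs (vanish-resp φs (λ i → sym (ℚP.+-inverseʳ (f a i))) (vanish-𝟎 φs))
    h' : ∀ x y z → (x - y) + (y - z) ≡ x - z
    h' = solve-∀ ℚ-ring
    h : ∀ x y z → (x ⊝ y) ⊕ (y ⊝ z) ≋ x ⊝ z
    h x y z i = h' (x i) (y i) (z i)
    step : ∀ {c} → c ∈ (a' ∷ as) → LexNN φs (f c ⊝ f a)
    step {c} c∈ = lex-resp φs (h (f c) (f b) (f a)) (lex-⊕ φs {f c ⊝ f b} {f b ⊝ f a} (min c∈) p)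

open Lexicographic

-- Gordan's alternative by elimination.

module GordanAlternative where

  open import Data.Rational using (_+_; _*_; _-_; -_; _≤_; _<_)

  -- Each constructor retains a generator with positive coefficient, so combinations are nontrivial
  -- without a side condition.
  data PosComb (ds : List H) : H → Set where
    gen   : ∀ {d} → d ∈ ds → PosComb ds d
    add   : ∀ {x y} → PosComb ds x → PosComb ds y → PosComb ds (x ⊕ y)
    scale : ∀ {t x} → 0ℚ < t → PosComb ds x → PosComb ds (t ⊙ x)

  bind : ∀ {ds es x} → (∀ {d} → d ∈ ds → PosComb es d) → PosComb ds x → PosComb es x
  bind f (gen m) = f m
  bind f (add p q) = add (bind f p) (bind f q)
  bind f (scale t p) = scale t (bind f p)

  vanish-bind : ∀ {ds ψ x} → (∀ {d} → d ∈ ds → ψ ∙ d ≡ 0ℚ) → PosComb ds x → ψ ∙ x ≡ 0ℚ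
  vanish-bind f (gen m) = f m
  vanish-bind {ψ = ψ} f (add {x} {y} p q) = trans (∙-⊕ ψ x y) (cong₂ _+_ (vanish-bind f p) (vanish-bind f q))
  vanish-bind {ψ = ψ} f (scale {t} {x} _ p) =
    trans (∙-⊙ ψ t x) (trans (cong (_*_ t) (vanish-bind f p)) (ℚP.*-zeroʳ t))

  Between : List ℚ → List ℚ → Set
  Between ls us = ∃ λ τ → (∀ {l} → l ∈ ls → l < τ) × (∀ {u} → u ∈ us → τ < u)

  below : ∀ us → ∃ λ m → ∀ {u} → u ∈ us → m < u
  below [] = 0ℚ , λ ()
  below (u ∷ us) with below us
  ... | m , p with ℚP.<-cmp m u
  ...   | tri< m<u _ _ = m , λ { (here refl) → m<u ; (there q) → p q }
  ...   | tri≈ _ refl _ = m - 1ℚ , λ { (here refl) → m-1<m ; (there q) → ℚP.<-trans m-1<m (p q) }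
    where
    h : ∀ m → 1ℚ ≡ m - (m - 1ℚ)
    h = solve-∀ ℚ-ring
    m-1<m : m - 1ℚ < m
    m-1<m = undiff< (0<1 <by h m)
  ...   | tri> _ _ u<m = u - 1ℚ , λ { (here refl) → u-1<u ; (there q) → ℚP.<-trans u-1<u (ℚP.<-trans u<m (p q)) }
    where
    h : ∀ m → 1ℚ ≡ m - (m - 1ℚ)
    h = solve-∀ ℚ-ring
    u-1<u : u - 1ℚ < u
    u-1<u = undiff< (0<1 <by h u)

  gap : ∀ m us → (∀ {u} → u ∈ us → m < u) → ∃ λ τ → m < τ × (∀ {u} → u ∈ us → τ < u)
  gap m [] _ = m + 1ℚ , undiff< (0<1 <by h m) , λ ()
    where
    h : ∀ m → 1ℚ ≡ m + 1ℚ - m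
    h = solve-∀ ℚ-ring
  gap m (u ∷ us) p with gap m us (λ q → p (there q))
  ... | τ , m<τ , q with ℚP.<-cmp τ u
  ...   | tri< τ<u _ _ = τ , m<τ , λ { (here refl) → τ<u ; (there r) → q r }
  ...   | tri≈ _ refl _ with ℚP.<-dense m<τ
  ...     | σ , m<σ , σ<τ = σ , m<σ , λ { (here refl) → σ<τ ; (there r) → ℚP.<-trans σ<τ (q r) }
  gap m (u ∷ us) p | τ , m<τ , q | tri> _ _ u<τ with ℚP.<-dense (p (here refl))
  ...     | σ , m<σ , σ<u = σ , m<σ ,
              λ { (here refl) → σ<u ; (there r) → ℚP.<-trans σ<u (ℚP.<-trans u<τ (q r)) }

  -- Either list may be empty, so no extremal elements are taken: bounds are inserted one by one,
  -- and density of ℚ restores a strict gap whenever one is met.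
  between : ∀ ls us → (∀ {l u} → l ∈ ls → u ∈ us → l < u) → Between ls us
  between [] us p with below us
  ... | m , q = m , (λ ()) , q
  between (l ∷ ls) us p with between ls us (λ a b → p (there a) b)
  ... | τ , q , r with ℚP.<-cmp l τ
  ...   | tri< l<τ _ _ = τ , (λ { (here refl) → l<τ ; (there a) → q a }) , r
  ...   | tri≈ _ refl _ with gap l us r
  ...     | σ , l<σ , s = σ , (λ { (here refl) → l<σ ; (there a) → ℚP.<-trans (q a) l<σ }) , s
  between (l ∷ ls) us p | τ , q , r | tri> _ _ τ<l with gap l us (p (here refl))
  ...     | σ , l<σ , s = σ , (λ { (here refl) → l<σ ; (there a) → ℚP.<-trans (q a) (ℚP.<-trans τ<l l<σ) }) , s

  -- Total, with the junk value 0 at 0, so that it can be mapped over lists without carrying sign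
  -- proofs.
  recip : ℚ → ℚ
  recip x with sign x
  ... | neg p = - proj₁ (pos⇒inverse (- x) p)
  ... | nul _ = 0ℚ
  ... | pos p = proj₁ (pos⇒inverse x p)

  recip-pos : ∀ {x} → 0ℚ < x → 0ℚ < recip x × recip x * x ≡ 1ℚ
  recip-pos {x} q with sign x
  ... | neg p = ⊥-elim (neg≰ (pos+ p (ℚP.<⇒≤ q) <by ℚP.+-inverseˡ x))
  ... | nul refl = ⊥-elim (neg≰ q)
  ... | pos p = proj₂ (pos⇒inverse x p)

  recip-neg : ∀ {x} → 0ℚ < - x → 0ℚ < - recip x × recip x * x ≡ 1ℚ
  recip-neg {x} q with sign x
  ... | pos p = ⊥-elim (neg≰ (pos+ p (ℚP.<⇒≤ q) <by ℚP.+-inverseʳ x))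
  ... | nul refl = ⊥-elim (neg≰ q)
  ... | neg p = (proj₁ (proj₂ inv) <by h (proj₁ inv)) , trans (h' (proj₁ inv) x) (proj₂ (proj₂ inv))
    where
    inv = pos⇒inverse (- x) p
    h : ∀ b → b ≡ - (- b)
    h = solve-∀ ℚ-ring
    h' : ∀ b x → - b * x ≡ b * (- x)
    h' = solve-∀ ℚ-ring

  -- Fourier-Motzkin elimination of the functional ψ: every pair of vectors on opposite
  -- sides of ker ψ is replaced by its positive combination inside ker ψ.
  gordan : (ψs ds : List H) →
           (∃ λ φ → ∀ {d} → d ∈ ds → 0ℚ < φ ∙ d) ⊎
           (∃ λ x → PosComb ds x × Vanish ψs x)
  gordan [] [] = inj₁ (𝟎 , λ ())
  gordan [] (d ∷ ds) = inj₂ (d , gen (here refl) , tt)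
  gordan (ψ ∷ ψs) ds = go (gordan ψs es)
    where
    zer? : ∀ d → Dec (ψ ∙ d ≡ 0ℚ)
    zer? d = ψ ∙ d ℚP.≟ 0ℚ
    pos? : ∀ d → Dec (0ℚ < ψ ∙ d)
    pos? d = 0ℚ ℚP.<? ψ ∙ d
    neg? : ∀ d → Dec (0ℚ < - (ψ ∙ d))
    neg? d = 0ℚ ℚP.<? - (ψ ∙ d)
    zs = filter zer? ds
    ps = filter pos? ds
    ns = filter neg? ds
    cross : H → H → H
    cross p q = ((- (ψ ∙ q)) ⊙ p) ⊕ ((ψ ∙ p) ⊙ q)
    es = zs ++ cartesianProductWith cross ps ns

    ψ-cross : ∀ p q → ψ ∙ cross p q ≡ 0ℚ
    ψ-cross p q = trans (∙-⊕ ψ ((- (ψ ∙ q)) ⊙ p) ((ψ ∙ p) ⊙ q)) (trans (cong₂ _+_ (∙-⊙ ψ (- (ψ ∙ q)) p) (∙-⊙ ψ (ψ ∙ p) q)) (h (ψ ∙ p) (ψ ∙ q)))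
      where
      h : ∀ a b → - b * a + a * b ≡ 0ℚ
      h = solve-∀ ℚ-ring

    es⊂ : ∀ {d} → d ∈ es → PosComb ds d × ψ ∙ d ≡ 0ℚ
    es⊂ {d} m with ∈-++⁻ zs m
    ... | inj₁ z with ∈-filter⁻ zer? {xs = ds} z
    ...   | d∈ , e = gen d∈ , e
    es⊂ {d} m | inj₂ c with ∈-cartesianProductWith⁻ cross ps ns c
    ...   | p , q , p∈ , q∈ , refl with ∈-filter⁻ pos? {xs = ds} p∈ | ∈-filter⁻ neg? {xs = ds} q∈
    ...     | p∈ds , ψp | q∈ds , ψq = add (scale ψq (gen p∈ds)) (scale ψp (gen q∈ds)) , ψ-cross p q

    go : (∃ λ φ → ∀ {d} → d ∈ es → 0ℚ < φ ∙ d) ⊎ (∃ λ x → PosComb es x × Vanish ψs x) →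
         (∃ λ φ → ∀ {d} → d ∈ ds → 0ℚ < φ ∙ d) ⊎ (∃ λ x → PosComb ds x × Vanish (ψ ∷ ψs) x)
    go (inj₂ (x , c , v)) = inj₂ (x , bind (λ m → proj₁ (es⊂ m)) c , vanish-bind (λ m → proj₂ (es⊂ m)) c , v)
    -- Positivity of `φ ⊕ (τ ⊙ ψ)` on `d` bounds `τ` from below if `ψ ∙ d` is positive and from
    -- above if it is negative. Positivity of `φ` on the cross combinations says that every lower
    -- bound is below every upper bound.
    go (inj₁ (φ , P)) with between (map bound ps) (map bound ns) sep
      where
      bound : H → ℚ
      bound d = - (φ ∙ d) * recip (ψ ∙ d)
      sep : ∀ {l u} → l ∈ map bound ps → u ∈ map bound ns → l < u
      sep l∈ u∈ with ∈-map⁻ bound l∈ | ∈-map⁻ bound u∈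
      ... | p , p∈ , refl | q , q∈ , refl
        with ∈-filter⁻ pos? {xs = ds} p∈ | ∈-filter⁻ neg? {xs = ds} q∈
      ... | _ , ψp | _ , ψq = undiff< (pos* (pos* rp nq) φc <by h2)
        where
        rp = proj₁ (recip-pos ψp)
        nq = proj₁ (recip-neg ψq)
        φc : 0ℚ < - (ψ ∙ q) * (φ ∙ p) + (ψ ∙ p) * (φ ∙ q)
        φc = P (∈-++⁺ʳ zs (∈-cartesianProductWith⁺ cross p∈ q∈))
          <by trans (∙-⊕ φ ((- (ψ ∙ q)) ⊙ p) ((ψ ∙ p) ⊙ q)) (cong₂ _+_ (∙-⊙ φ (- (ψ ∙ q)) p) (∙-⊙ φ (ψ ∙ p) q))
        h : ∀ rp rq a b x y → rp * a ≡ 1ℚ → rq * b ≡ 1ℚ →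
            rp * (- rq) * (- b * x + a * y) ≡ - y * rq - - x * rp
        h rp rq a b x y e f = trans (k rp rq a b x y) (trans (cong₂ (λ u v → rp * x * v - rq * y * u) e f) (k' rp rq x y))
          where
          k : ∀ rp rq a b x y → rp * (- rq) * (- b * x + a * y) ≡ rp * x * (rq * b) - rq * y * (rp * a)
          k = solve-∀ ℚ-ring
          k' : ∀ rp rq x y → rp * x * 1ℚ - rq * y * 1ℚ ≡ - y * rq - - x * rp
          k' = solve-∀ ℚ-ring
        h2 = h (recip (ψ ∙ p)) (recip (ψ ∙ q)) (ψ ∙ p) (ψ ∙ q) (φ ∙ p) (φ ∙ q)
               (proj₂ (recip-pos ψp)) (proj₂ (recip-neg ψq))
    ... | τ , lo , hi = inj₁ (φ ⊕ (τ ⊙ ψ) , λ {d} d∈ → ok d d∈ (sign (ψ ∙ d)) <by sym (eval d))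
      where
      bound : H → ℚ
      bound d = - (φ ∙ d) * recip (ψ ∙ d)
      eval : ∀ d → (φ ⊕ (τ ⊙ ψ)) ∙ d ≡ φ ∙ d + τ * (ψ ∙ d)
      eval d = trans (⊕-∙ φ (τ ⊙ ψ) d) (cong (_+_ (φ ∙ d)) (⊙-∙ τ ψ d))
      k : ∀ r a x → r * a ≡ 1ℚ → a * (τ - - x * r) ≡ x + τ * a
      k r a x e = trans (k₁ r a x τ) (trans (cong (λ u → τ * a + x * u) e) (k₂ a x τ))
        where
        k₁ : ∀ r a x τ → a * (τ - - x * r) ≡ τ * a + x * (r * a)
        k₁ = solve-∀ ℚ-ring
        k₂ : ∀ a x τ → τ * a + x * 1ℚ ≡ x + τ * a
        k₂ = solve-∀ ℚ-ring
      flip : ∀ a x y → - a * (x - y) ≡ a * (y - x)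
      flip = solve-∀ ℚ-ring
      ok : ∀ d → d ∈ ds → Sign (ψ ∙ d) → 0ℚ < φ ∙ d + τ * (ψ ∙ d)
      ok d d∈ (nul e) = P (∈-++⁺ˡ (∈-filter⁺ zer? d∈ e))
        <by trans (k₀ (φ ∙ d) τ) (cong (λ u → φ ∙ d + τ * u) (sym e))
        where
        k₀ : ∀ x τ → x ≡ x + τ * 0ℚ
        k₀ = solve-∀ ℚ-ring
      ok d d∈ (pos p) = pos* p (diff< (lo (∈-map⁺ bound (∈-filter⁺ pos? d∈ p))))
        <by k (recip (ψ ∙ d)) (ψ ∙ d) (φ ∙ d) (proj₂ (recip-pos p))
      ok d d∈ (neg p) = pos* p (diff< (hi (∈-map⁺ bound (∈-filter⁺ neg? d∈ p))))
        <by trans (flip (ψ ∙ d) (bound d) τ) (k (recip (ψ ∙ d)) (ψ ∙ d) (φ ∙ d) (proj₂ (recip-neg p)))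

open GordanAlternative using (PosComb; gen; add; scale; gordan; recip; recip-pos)

-- Faces cut out by lexicographically nonnegative functionals.

module Faces where

  open import Data.Rational using (_+_; _*_; _-_; -_; _≤_; _<_)

  lex-++ˡ : ∀ φs {ψs x} → LexNN (φs ++ ψs) x → LexNN φs x
  lex-++ˡ [] _ = tt
  lex-++ˡ (φ ∷ φs) (inj₁ p) = inj₁ p
  lex-++ˡ (φ ∷ φs) (inj₂ (p , q)) = inj₂ (p , lex-++ˡ φs q)

  lex-last : ∀ φs {ψ x} → Vanish φs x → LexNN (φs ++ ψ ∷ []) x → 0ℚ ≤ ψ ∙ x
  lex-last [] _ (inj₁ p) = ℚP.<⇒≤ p
  lex-last [] _ (inj₂ (p , _)) = 0≤0 by sym p
  lex-last (φ ∷ φs) (p , _) (inj₁ q) = ⊥-elim (neg≰ (q <by p))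
  lex-last (φ ∷ φs) (_ , v) (inj₂ (_ , l)) = lex-last φs v l

  lex-head : ∀ {φ φs x} → LexNN (φ ∷ φs) x → 0ℚ ≤ φ ∙ x
  lex-head (inj₁ p) = ℚP.<⇒≤ p
  lex-head (inj₂ (p , _)) = 0≤0 by sym p

  lex-map : ∀ (T : H → H) φs {x y} → (∀ φ → T φ ∙ x ≡ φ ∙ y) → LexNN φs y → LexNN (map T φs) x
  lex-map T [] e _ = tt
  lex-map T (φ ∷ φs) e (inj₁ p) = inj₁ (p <by sym (e φ))
  lex-map T (φ ∷ φs) e (inj₂ (p , q)) = inj₂ (trans (e φ) p , lex-map T φs e q)

  vanish-map : ∀ (T : H → H) φs {x y} → (∀ φ → T φ ∙ x ≡ φ ∙ y) → Vanish φs y → Vanish (map T φs) x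
  vanish-map T [] e _ = tt
  vanish-map T (φ ∷ φs) e (p , q) = trans (e φ) p , vanish-map T φs e q

  vanish-map⁻ : ∀ (T : H → H) φs {x y} → (∀ φ → T φ ∙ x ≡ φ ∙ y) → Vanish (map T φs) x → Vanish φs y
  vanish-map⁻ T [] e _ = tt
  vanish-map⁻ T (φ ∷ φs) e (p , q) = trans (sym (e φ)) p , vanish-map⁻ T φs e q

  vanish-comb : ∀ φs {s t x y} → Vanish φs x → Vanish φs y → Vanish φs ((s ⊙ x) ⊕ (t ⊙ y))
  vanish-comb [] _ _ = tt
  vanish-comb (φ ∷ φs) {s} {t} {x} {y} (p , p') (q , q') =
    trans (∙-⊕ φ (s ⊙ x) (t ⊙ y))
      (trans (cong₂ _+_ (trans (∙-⊙ φ s x) (trans (cong (_*_ s) p) (ℚP.*-zeroʳ s)))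
                        (trans (∙-⊙ φ t y) (trans (cong (_*_ t) q) (ℚP.*-zeroʳ t))))
             (ℚP.+-identityʳ 0ℚ)) ,
    vanish-comb φs {s} {t} p' q'

  cone-lex : ∀ {m} {V : Fin m → ℤ³} Ψ → (∀ j → LexNN Ψ (hat (V j))) → ∀ {h} → Cone V h → LexNN Ψ h
  cone-lex {V = V} Ψ p = cone-ind V (LexNN Ψ) (lex-resp Ψ) (vanish⇒lex Ψ (vanish-𝟎 Ψ))
    λ j c {x} c≥0 q → lex-⊕ Ψ {c ⊙ hat (V j)} {x} (lex-⊙ Ψ c≥0 (p j)) q

  hom-lerp : ∀ t y z → hom 1ℚ (lerp t y z) ≋ ((1ℚ - t) ⊙ hom 1ℚ y) ⊕ (t ⊙ hom 1ℚ z)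
  hom-lerp t y z zero = h t
    where
    h : ∀ t → 1ℚ ≡ (1ℚ - t) * 1ℚ + t * 1ℚ
    h = solve-∀ ℚ-ring
  hom-lerp t y z (suc i) = refl

  hom-cong : ∀ {x y} → x ≐ y → hom 1ℚ x ≋ hom 1ℚ y
  hom-cong e zero = refl
  hom-cong e (suc i) = e i

  -- The extremality clause of `IsVertex` and `IsEdge`. It is proved for lists of functionals
  -- because ties in the search for an edge are broken lexicographically, so a face arises with a
  -- list and not with one supporting functional.
  face : ∀ {m} {V : Fin m → ℤ³} Ψ → (∀ j → LexNN Ψ (hat (V j))) →
         ∀ {y z t} → y ∈P V → z ∈P V → 0ℚ < t → t < 1ℚ → Vanish Ψ (hom 1ℚ (lerp t y z)) →
         Vanish Ψ (hom 1ℚ y) × Vanish Ψ (hom 1ℚ z)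
  face {V = V} Ψ p {y} {z} {t} y∈ z∈ t>0 t<1 v =
    lex-antisym Ψ (diff< t<1) t>0 (cone-lex {V = V} Ψ p y∈) (cone-lex {V = V} Ψ p z∈) (vanish-resp Ψ (hom-lerp t y z) v)

  isVertex : ∀ {m} {V : Fin m → ℤ³} {v} Ψ → (∀ j → LexNN Ψ (hat (V j))) → ι v ∈P V →
             Vanish Ψ (hat v) → (∀ {y} → y ∈P V → Vanish Ψ (hom 1ℚ y) → y ≐ ι v) → IsVertex V v
  isVertex {V = V} {v = v} Ψ p v∈ vv uniq = v∈ , λ y z t y∈ z∈ t>0 t<1 e →
    let vy , vz = face {V = V} Ψ p y∈ z∈ t>0 t<1 (vanish-resp Ψ (hom-cong e) vv)
    in uniq y∈ vy , uniq z∈ vz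

  isEdge : ∀ {m} {V : Fin m → ℤ³} {v w} Ψ → IsVertex V v → IsVertex V w → ¬ (∀ i → v i ≡ w i) →
           (∀ j → LexNN Ψ (hat (V j))) → Vanish Ψ (hat v) → Vanish Ψ (hat w) →
           (∀ {y} → y ∈P V → Vanish Ψ (hom 1ℚ y) → y ∈Seg ι v , ι w) → IsEdge V v w
  isEdge {V = V} {v = v} {w} Ψ iv iw v≢w p vv vw seg = iv , iw , v≢w , λ { y z t y∈ z∈ t>0 t<1 (τ , _ , _ , e) →
    let on = vanish-resp Ψ (λ i → sym (trans (hom-cong e i) (hom-lerp τ (ι v) (ι w) i)))
               (vanish-comb Ψ {1ℚ - τ} {τ} vv vw)
        vy , vz = face {V = V} Ψ p y∈ z∈ t>0 t<1 on
    in seg y∈ vy , seg z∈ vz }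

open Faces

-- Vertices, edges and one step of the simplex method.

module Vertices {m} (V : Fin m → ℤ³) where

  open import Data.Rational using (_+_; _*_; _-_; -_; _≤_; _<_)

  same? : ∀ (x y : ℤ³) → Dec (∀ i → x i ≡ y i)
  same? x y with x 0F ℤP.≟ y 0F | x 1F ℤP.≟ y 1F | x 2F ℤP.≟ y 2F
  ... | yes p | yes q | yes r = yes λ { 0F → p ; 1F → q ; 2F → r }
  ... | no p | _ | _ = no λ e → p (e 0F)
  ... | yes _ | no p | _ = no λ e → p (e 1F)
  ... | yes _ | yes _ | no p = no λ e → p (e 2F)

  hat-cong : ∀ {x y : ℤ³} → (∀ i → x i ≡ y i) → hat x ≋ hat y
  hat-cong e zero = refl
  hat-cong e (suc i) = cong ιℤ (e i)

  others : ℤ³ → List (Fin m)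
  others v = filter (λ k → ¬? (same? (V k) v)) (allFin m)

  directions : ℤ³ → List H
  directions v = map (λ k → hat (V k) ⊝ hat v) (others v)

  coordinates : List H
  coordinates = π 0F ∷ π 1F ∷ π 2F ∷ π 3F ∷ []

  -- A functional exposing `v`. The family `V` may list the same point several times, hence the
  -- comparison of points and not of indices.
  record Strict (v : ℤ³) (σ : H) : Set where
    field
      at-v  : σ ∙ hat v ≡ 0ℚ
      off-v : ∀ {k} → ¬ (∀ i → V k i ≡ v i) → 0ℚ < σ ∙ hat (V k)

    nonneg : ∀ k → 0ℚ ≤ σ ∙ hat (V k)
    nonneg k = decide (same? (V k) v)
      where
      decide : Dec (∀ i → V k i ≡ v i) → 0ℚ ≤ σ ∙ hat (V k)
      decide (yes e) = 0≤0 by sym (trans (∙-cong σ (hat-cong e)) at-v)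
      decide (no n) = ℚP.<⇒≤ (off-v n)

  -- `π 0F` is 1 on every `hat`, so subtracting a multiple of it makes the functional vanish at `v`
  -- and changes no value on a difference.
  strict : ∀ {v φ} → (∀ {d} → d ∈ directions v → 0ℚ < φ ∙ d) →
           Strict v (φ ⊝ ((φ ∙ hat v) ⊙ π 0F))
  strict {v} {φ} p = record
    { at-v = trans (eval (hat v)) (h (φ ∙ hat v))
    ; off-v = λ {k} n → p (∈-map⁺ _ (∈-filter⁺ _ (∈-allFin k) n))
        <by trans (∙-⊝ φ (hat (V k)) (hat v)) (trans (h' (φ ∙ hat (V k)) (φ ∙ hat v)) (sym (eval (hat (V k)))))
    }
    where
    eval : ∀ x → (φ ⊝ ((φ ∙ hat v) ⊙ π 0F)) ∙ x ≡ φ ∙ x - (φ ∙ hat v) * x 0F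
    eval x = trans (⊝-∙ φ _ x) (cong (λ a → φ ∙ x - a)
               (trans (⊙-∙ (φ ∙ hat v) (π 0F) x) (cong (_*_ (φ ∙ hat v)) (π-∙ 0F x))))
    h : ∀ a → a - a * 1ℚ ≡ 0ℚ
    h = solve-∀ ℚ-ring
    h' : ∀ a b → a - b ≡ a - b * 1ℚ
    h' = solve-∀ ℚ-ring

  strict⇒vertex : ∀ {j σ} → Strict (V j) σ → IsVertex V (V j)
  strict⇒vertex {j} {σ} S = isVertex {V = V} {v = V j} (σ ∷ []) lex (cone-gen V j) (at-v , tt) uniq
    where
    open Strict S
    v = V j
    lex : ∀ k → LexNN (σ ∷ []) (hat (V k))
    lex k = decide (same? (V k) v)
      where
      decide : Dec (∀ i → V k i ≡ v i) → LexNN (σ ∷ []) (hat (V k))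
      decide (yes e) = inj₂ (trans (∙-cong σ (hat-cong e)) at-v , tt)
      decide (no n) = inj₁ (off-v n)
    -- For cone points that are not normalised, uniqueness of the minimum reads: where `σ` vanishes,
    -- the point lies on the ray through `hat v`.
    Q : H → Set
    Q x = 0ℚ ≤ σ ∙ x × (σ ∙ x ≡ 0ℚ → x ≋ x 0F ⊙ hat v)
    step : ∀ k c {x} → 0ℚ ≤ c → Q x → Q ((c ⊙ hat (V k)) ⊕ x)
    step k c {x} c≥0 (x≥0 , q) = (cs≥0 ⊹ x≥0 by sym eval) , λ z → goal (trans (sym eval) z)
      where
      cs≥0 = c≥0 ⊛ nonneg k
      eval : σ ∙ ((c ⊙ hat (V k)) ⊕ x) ≡ c * (σ ∙ hat (V k)) + σ ∙ x
      eval = trans (∙-⊕ σ (c ⊙ hat (V k)) x) (cong (_+ σ ∙ x) (∙-⊙ σ c (hat (V k))))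
      h : ∀ c a x → c * a + x * a ≡ (c * 1ℚ + x) * a
      h = solve-∀ ℚ-ring
      goal : c * (σ ∙ hat (V k)) + σ ∙ x ≡ 0ℚ →
             (c ⊙ hat (V k)) ⊕ x ≋ (c * 1ℚ + x 0F) ⊙ hat v
      goal z i = decide (same? (V k) v)
        where
        xi : x i ≡ x 0F * hat v i
        xi = q (sum≡0ʳ cs≥0 x≥0 z) i
        decide : Dec (∀ i → V k i ≡ v i) → c * hat (V k) i + x i ≡ (c * 1ℚ + x 0F) * hat v i
        decide (yes e) = trans (cong₂ (λ a b → c * a + b) (hat-cong e i) xi) (h c (hat v i) (x 0F))
        decide (no n) = trans (cong₂ (λ a b → a * hat (V k) i + b) c≡0 xi)
          (trans (h'' (x 0F) (hat (V k) i) (hat v i)) (cong (λ a → (a * 1ℚ + x 0F) * hat v i) (sym c≡0)))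
          where
          c≡0 : c ≡ 0ℚ
          c≡0 = *≡0 (off-v n) (trans (ℚP.*-comm (σ ∙ hat (V k)) c) (sum≡0ˡ cs≥0 x≥0 z))
          h'' : ∀ x b a → 0ℚ * b + x * a ≡ (0ℚ * 1ℚ + x) * a
          h'' = solve-∀ ℚ-ring
    uniq : ∀ {y} → y ∈P V → Vanish (σ ∷ []) (hom 1ℚ y) → y ≐ ι v
    uniq {y} y∈ (z , _) i = trans (proj₂ (cone-ind V Q resp base step y∈) z (suc i)) (ℚP.*-identityˡ _)
      where
      resp : ∀ {x y} → x ≋ y → Q x → Q y
      resp e (p , q) = (p by ∙-cong σ e) , λ z i →
        trans (sym (e i)) (trans (q (trans (∙-cong σ e) z) i) (cong (_* hat v i) (e 0F)))
      base : Q 𝟎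
      base = (0≤0 by sym (∙-𝟎 σ)) , λ _ i → sym (ℚP.*-zeroˡ (hat v i))

  -- The edge is found by the lexicographic minimum of the vertex figure {x / σ x}; the last
  -- key, x₀ / σ x, is minimal at the generator farthest along the edge.
  improving-edge : ∀ {j σ} → Strict (V j) σ → ∀ φ → φ ∙ hat (V j) ≡ 0ℚ →
                   ∀ k → 0ℚ < - (φ ∙ hat (V k)) →
                   ∃ λ w → IsEdge V (V j) w × 0ℚ < - (φ ∙ hat w)
  improving-edge {j} {σ} S φ φv k φk<0 = w , edge , φw<0
    where
    open Strict S
    v = V j

    -- Displacement from `v`, homogenised to vanish at `hat v`. All keys but the last thus vanish at
    -- `v`: four keys will cut out the edge, and the fifth its far end.
    μ : Fin 3 → H
    μ i = π (suc i) ⊝ (ιℤ (v i) ⊙ π 0F)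
    μ-∙ : ∀ i x → μ i ∙ x ≡ x (suc i) - ιℤ (v i) * x 0F
    μ-∙ i x = trans (⊝-∙ (π (suc i)) _ x) (cong₂ _-_ (π-∙ (suc i) x)
                (trans (⊙-∙ (ιℤ (v i)) (π 0F) x) (cong (_*_ (ιℤ (v i))) (π-∙ 0F x))))

    Φ₄ = φ ∷ μ 0F ∷ μ 1F ∷ μ 2F ∷ []
    Φ = Φ₄ ++ π 0F ∷ []

    s : Fin m → ℚ
    s k = σ ∙ hat (V k)
    point : Fin m → H
    point k = recip (s k) ⊙ hat (V k)

    k≢v : ¬ (∀ i → V k i ≡ v i)
    k≢v e = neg≰ (φk<0 <by cong -_ (trans (∙-cong φ (hat-cong e)) φv))

    found = lex-min Φ point k (others v)
    b = proj₁ found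
    w = V b
    b≢v : ¬ (∀ i → w i ≡ v i)
    b≢v = off (proj₁ (proj₂ found))
      where
      off : ∀ {b} → b ∈ (k ∷ others v) → ¬ (∀ i → V b i ≡ v i)
      off (here refl) = k≢v
      off (there b∈) = proj₂ (∈-filter⁻ (λ k → ¬? (same? (V k) v)) {xs = allFin m} b∈)
    min : ∀ {k'} → k' ∈ (k ∷ others v) → LexNN Φ (point k' ⊝ point b)
    min = proj₂ (proj₂ found)

    n : H
    n = point b
    ρ = recip (s b)
    sb>0 : 0ℚ < s b
    sb>0 = off-v b≢v
    ρ>0 : 0ℚ < ρ
    ρ>0 = proj₁ (recip-pos sb>0)
    ρs : ρ * s b ≡ 1ℚ
    ρs = proj₂ (recip-pos sb>0)

    -- `proj` projects along `n` onto the kernel of `σ`, and `T` is its transpose. A generator with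
    -- σ > 0 projects to σ times its difference from the minimum `n` in the vertex figure, so
    -- minimality becomes lexicographic nonnegativity of the transposed keys on P.
    T : H → H
    T ψ = ψ ⊝ ((ψ ∙ n) ⊙ σ)
    proj : H → H
    proj x = x ⊝ ((σ ∙ x) ⊙ n)
    T-∙ : ∀ ψ x → T ψ ∙ x ≡ ψ ∙ proj x
    T-∙ ψ x = trans (⊝-∙ ψ ((ψ ∙ n) ⊙ σ) x) (trans (cong (λ a → ψ ∙ x - a)
                (trans (⊙-∙ (ψ ∙ n) σ x) (trans (ℚP.*-comm (ψ ∙ n) (σ ∙ x)) (sym (∙-⊙ ψ (σ ∙ x) n)))))
                (sym (∙-⊝ ψ x ((σ ∙ x) ⊙ n))))

    Ψ₄ = map T Φ₄
    Ψ = map T Φ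

    proj-v : proj (hat v) ≋ hat v
    proj-v i = trans (cong (λ a → hat v i - a * n i) at-v) (h (hat v i) (n i))
      where
      h : ∀ a b → a - 0ℚ * b ≡ a
      h = solve-∀ ℚ-ring

    van-μv : ∀ i → μ i ∙ hat v ≡ 0ℚ
    van-μv i = trans (μ-∙ i (hat v)) (h (ιℤ (v i)))
      where
      h : ∀ a → a - a * 1ℚ ≡ 0ℚ
      h = solve-∀ ℚ-ring

    Φ₄-v : Vanish Φ₄ (hat v)
    Φ₄-v = φv , van-μv 0F , van-μv 1F , van-μv 2F , tt

    Φ-v : LexNN Φ (hat v)
    Φ-v = inj₂ (φv , inj₂ (van-μv 0F , inj₂ (van-μv 1F , inj₂ (van-μv 2F ,
            inj₁ (0<1 <by sym (π-∙ 0F (hat v)))))))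

    proj-w : proj (hat w) ≋ 𝟎
    proj-w i = trans (h (hat w i) (s b) ρ) (trans (cong (λ a → hat w i - a * hat w i) ρs) (h' (hat w i)))
      where
      h : ∀ a s r → a - s * (r * a) ≡ a - (r * s) * a
      h = solve-∀ ℚ-ring
      h' : ∀ a → a - 1ℚ * a ≡ 0ℚ
      h' = solve-∀ ℚ-ring

    lexΨ : ∀ k' → LexNN Ψ (hat (V k'))
    lexΨ k' = decide (same? (V k') v)
      where
      decide : Dec (∀ i → V k' i ≡ v i) → LexNN Ψ (hat (V k'))
      decide (yes e) = lex-resp Ψ (≋-sym (hat-cong e))
                    (lex-map T Φ (λ ψ → T-∙ ψ (hat v)) (lex-resp Φ (≋-sym proj-v) Φ-v))
      decide (no k'≢v) = lex-map T Φ (λ ψ → T-∙ ψ (hat (V k')))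
                        (lex-resp Φ scaled (lex-⊙ Φ (ℚP.<⇒≤ sk>0) (min k'∈)))
        where
        k'∈ : k' ∈ (k ∷ others v)
        k'∈ = there (∈-filter⁺ (λ k → ¬? (same? (V k) v)) (∈-allFin k') k'≢v)
        sk>0 : 0ℚ < s k'
        sk>0 = off-v k'≢v
        scaled : s k' ⊙ (point k' ⊝ n) ≋ proj (hat (V k'))
        scaled i = trans (h (s k') (recip (s k')) (hat (V k') i) (n i))
                     (trans (cong (λ a → a * hat (V k') i - s k' * n i) (proj₂ (recip-pos sk>0)))
                       (h' (hat (V k') i) (s k' * n i)))
          where
          h : ∀ s r a b → s * (r * a - b) ≡ r * s * a - s * b
          h = solve-∀ ℚ-ring
          h' : ∀ a c → 1ℚ * a - c ≡ a - c
          h' = solve-∀ ℚ-ring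

    -- The `μ` keys put `y` on the line through `v` and `w` with parameter `σ ∙ hom 1ℚ y * ρ`. By
    -- `last` the fifth key is 1 minus this parameter, so the parameter is at most 1, and it is 1
    -- only at `w`.
    on-ray : ∀ {y} → Vanish Ψ₄ (hom 1ℚ y) →
             ∀ i → y i - ιℤ (v i) ≡ σ ∙ hom 1ℚ y * ρ * (ιℤ (w i) - ιℤ (v i))
    on-ray {y} vz i = h (y i) (ιℤ (v i)) (ιℤ (w i)) ρ (σ ∙ hom 1ℚ y)
        (trans (sym (μ-∙ i (proj (hom 1ℚ y)))) (pick i (vanish-map⁻ T Φ₄ (λ ψ → T-∙ ψ (hom 1ℚ y)) vz)))
      where
      pick : ∀ i {x} → Vanish Φ₄ x → μ i ∙ x ≡ 0ℚ
      pick 0F (_ , p , _) = p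
      pick 1F (_ , _ , p , _) = p
      pick 2F (_ , _ , _ , p , _) = p
      h : ∀ y v w ρ σ → (y - σ * (ρ * w)) - v * (1ℚ - σ * (ρ * 1ℚ)) ≡ 0ℚ → y - v ≡ σ * ρ * (w - v)
      h y v w ρ σ e = trans (h₁ y v w ρ σ) (trans (cong (λ a → a + σ * ρ * (w - v)) e) (ℚP.+-identityˡ _))
        where
        h₁ : ∀ y v w ρ σ → y - v ≡ (y - σ * (ρ * w)) - v * (1ℚ - σ * (ρ * 1ℚ)) + σ * ρ * (w - v)
        h₁ = solve-∀ ℚ-ring

    last : ∀ {y} → T (π 0F) ∙ hom 1ℚ y ≡ 1ℚ - σ ∙ hom 1ℚ y * ρ
    last {y} = trans (T-∙ (π 0F) (hom 1ℚ y)) (trans (π-∙ 0F (proj (hom 1ℚ y)))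
                 (cong (λ a → 1ℚ - σ ∙ hom 1ℚ y * a) (ℚP.*-identityʳ ρ)))

    w-vertex : IsVertex V w
    w-vertex = isVertex {V = V} {v = w} Ψ lexΨ (cone-gen V b)
      (vanish-map T Φ (λ ψ → T-∙ ψ (hat w)) (vanish-resp Φ (≋-sym proj-w) (vanish-𝟎 Φ)))
      λ {y} y∈ (v₀ , v₁ , v₂ , v₃ , v₄ , _) i →
        h (y i) (ιℤ (v i)) (ιℤ (w i)) (σ ∙ hom 1ℚ y * ρ) (trans (sym (last {y})) v₄)
          (on-ray (v₀ , v₁ , v₂ , v₃ , tt) i)
      where
      h : ∀ y v w t → 1ℚ - t ≡ 0ℚ → y - v ≡ t * (w - v) → y ≡ w
      h y v w t e f = trans (h₁ y v) (trans (cong (_+ v) f) (trans (h₂ v w t) (trans (cong (λ a → w - a * (w - v)) e) (h₃ v w))))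
        where
        h₁ : ∀ y v → y ≡ y - v + v
        h₁ = solve-∀ ℚ-ring
        h₂ : ∀ v w t → t * (w - v) + v ≡ w - (1ℚ - t) * (w - v)
        h₂ = solve-∀ ℚ-ring
        h₃ : ∀ v w → w - 0ℚ * (w - v) ≡ w
        h₃ = solve-∀ ℚ-ring

    edge : IsEdge V v w
    edge = isEdge {V = V} {v = v} {w} Ψ₄ (strict⇒vertex S) w-vertex (λ e → b≢v (λ i → sym (e i)))
      (λ k → lex-++ˡ Ψ₄ (lexΨ k))
      (vanish-map T Φ₄ (λ ψ → T-∙ ψ (hat v)) (vanish-resp Φ₄ (≋-sym proj-v) Φ₄-v))
      (vanish-map T Φ₄ (λ ψ → T-∙ ψ (hat w)) (vanish-resp Φ₄ (≋-sym proj-w) (vanish-𝟎 Φ₄)))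
      λ {y} y∈ vz → σ ∙ hom 1ℚ y * ρ ,
        (cone-nonneg {V = V} σ nonneg y∈ ⊛ ℚP.<⇒≤ ρ>0) ,
        undiff (lex-last Ψ₄ vz (cone-lex {V = V} Ψ lexΨ y∈) by last {y}) ,
        λ i → h (y i) (ιℤ (v i)) (ιℤ (w i)) (σ ∙ hom 1ℚ y * ρ) (on-ray vz i)
      where
      h : ∀ y v w t → y - v ≡ t * (w - v) → y ≡ (1ℚ - t) * v + t * w
      h y v w t e = trans (h₁ y v) (trans (cong (_+ v) e) (h₂ v w t))
        where
        h₁ : ∀ y v → y ≡ y - v + v
        h₁ = solve-∀ ℚ-ring
        h₂ : ∀ v w t → t * (w - v) + v ≡ (1ℚ - t) * v + t * w
        h₂ = solve-∀ ℚ-ring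

    -- `k` heads the list that was searched, so the first key at `b` is at most its negative value
    -- at `k`.
    φw<0 : 0ℚ < - (φ ∙ hat w)
    φw<0 = *-pos⁻¹ ρ>0 (pos+ (pos* ρk>0 φk<0) (lex-head (min (here refl)) by e) <by h (recip (s k)) (φ ∙ hat (V k)) ρ (φ ∙ hat w))
      where
      ρk>0 : 0ℚ < recip (s k)
      ρk>0 = proj₁ (recip-pos (off-v k≢v))
      e : φ ∙ (point k ⊝ point b) ≡ recip (s k) * (φ ∙ hat (V k)) - ρ * (φ ∙ hat w)
      e = trans (∙-⊝ φ (point k) (point b)) (cong₂ _-_ (∙-⊙ φ (recip (s k)) (hat (V k))) (∙-⊙ φ ρ (hat w)))
      h : ∀ r a ρ b → r * - a + (r * a - ρ * b) ≡ ρ * - b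
      h = solve-∀ ℚ-ring

-- Order on the integers.

module OrderedIntegers where

  infixl 4 _byᶻ_
  infixl 6 _⊹ᶻ_
  infixl 7 _⊛ᶻ_

  _byᶻ_ : ∀ {a b} → 0ℤ ℤ.≤ a → a ≡ b → 0ℤ ℤ.≤ b
  p byᶻ refl = p

  _⊹ᶻ_ : ∀ {a b} → 0ℤ ℤ.≤ a → 0ℤ ℤ.≤ b → 0ℤ ℤ.≤ a ℤ.+ b
  p ⊹ᶻ q = ℤP.+-mono-≤ p q

  _⊛ᶻ_ : ∀ {a b} → 0ℤ ℤ.≤ a → 0ℤ ℤ.≤ b → 0ℤ ℤ.≤ a ℤ.* b
  _⊛ᶻ_ {a} {b} p q = subst (ℤ._≤ a ℤ.* b) (ℤP.*-zeroʳ a) (ℤP.*-monoˡ-≤-nonNeg a {{ℤ.nonNegative p}} q)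

  -- Over ℤ the dichotomy has a gap of one, which replaces all strict inequalities.
  split : ∀ a → 0ℤ ℤ.≤ a ⊎ 0ℤ ℤ.≤ ℤ.- a ℤ.- 1ℤ
  split (+ n) = inj₁ (ℤ.+≤+ ℕ.z≤n)
  split -[1+ n ] = inj₂ (ℤ.+≤+ ℕ.z≤n)

  absurdᶻ : ∀ {a} → 0ℤ ℤ.≤ a → a ≡ ℤ.- 1ℤ → ⊥
  absurdᶻ p refl with p
  ... | ()

  +≥0 : ∀ n → 0ℤ ℤ.≤ + n
  +≥0 n = ℤ.+≤+ ℕ.z≤n

  0≤0ᶻ : 0ℤ ℤ.≤ 0ℤ
  0≤0ᶻ = ℤP.≤-refl

  0≤1ᶻ : 0ℤ ℤ.≤ 1ℤ
  0≤1ᶻ = ℤ.+≤+ ℕ.z≤n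

open OrderedIntegers

-- Integer vectors and integral affine functionals.

module IntegerVectors where

  open import Data.Rational using (_+_; _*_; _-_; -_; _≤_; _<_)

  infixl 7 _·_
  infixl 6 _-ᵛ_ _+ᵛ_

  _·_ : ℤ³ → ℤ³ → ℤ
  u · z = u 0F ℤ.* z 0F ℤ.+ (u 1F ℤ.* z 1F ℤ.+ u 2F ℤ.* z 2F)

  _-ᵛ_ _+ᵛ_ : ℤ³ → ℤ³ → ℤ³
  (x -ᵛ y) i = x i ℤ.- y i
  (x +ᵛ y) i = x i ℤ.+ y i

  δ : Fin 3 → ℤ³
  δ 0F 0F = 1ℤ
  δ 0F _ = 0ℤ
  δ 1F 1F = 1ℤ
  δ 1F _ = 0ℤ
  δ 2F 2F = 1ℤ
  δ 2F _ = 0ℤ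

  -- The affine functional x ↦ u · (x - v), homogenised.
  fun : ℤ³ → ℤ³ → H
  fun u v zero = - ιℤ (u · v)
  fun u v (suc i) = ιℤ (u i)

  ι-· : ∀ u z → ιℤ (u · z) ≡ ιℤ (u 0F) * ιℤ (z 0F) + (ιℤ (u 1F) * ιℤ (z 1F) + ιℤ (u 2F) * ιℤ (z 2F))
  ι-· u z = ι-expand (u 0F) (u 1F) (u 2F) (z 0F) (z 1F) (z 2F) refl

  fun-hom : ∀ u v h → fun u v ∙ h ≡
            ιℤ (u 0F) * h 1F + (ιℤ (u 1F) * h 2F + ιℤ (u 2F) * h 3F) - h 0F * ιℤ (u · v)
  fun-hom u v h = trans (∙-def (fun u v) h) (k (ιℤ (u · v)) (ιℤ (u 0F)) (ιℤ (u 1F)) (ιℤ (u 2F)) (h 0F) (h 1F) (h 2F) (h 3F))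
    where
    k : ∀ c a₀ a₁ a₂ r x y z → - c * r + a₀ * x + a₁ * y + a₂ * z ≡ a₀ * x + (a₁ * y + a₂ * z) - r * c
    k = solve-∀ ℚ-ring

  ·-- : ∀ u x y → u · (x -ᵛ y) ≡ u · x ℤ.- u · y
  ·-- u x y = k (u 0F) (u 1F) (u 2F) (x 0F) (x 1F) (x 2F) (y 0F) (y 1F) (y 2F)
    where
    k : ∀ a b c x y z x' y' z' →
        a ℤ.* (x ℤ.- x') ℤ.+ (b ℤ.* (y ℤ.- y') ℤ.+ c ℤ.* (z ℤ.- z')) ≡
        (a ℤ.* x ℤ.+ (b ℤ.* y ℤ.+ c ℤ.* z)) ℤ.- (a ℤ.* x' ℤ.+ (b ℤ.* y' ℤ.+ c ℤ.* z'))
    k = ℤR.solve-∀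

  ·-+ : ∀ u x y → u · (x +ᵛ y) ≡ u · x ℤ.+ u · y
  ·-+ u x y = k (u 0F) (u 1F) (u 2F) (x 0F) (x 1F) (x 2F) (y 0F) (y 1F) (y 2F)
    where
    k : ∀ a b c x y z x' y' z' →
        a ℤ.* (x ℤ.+ x') ℤ.+ (b ℤ.* (y ℤ.+ y') ℤ.+ c ℤ.* (z ℤ.+ z')) ≡
        (a ℤ.* x ℤ.+ (b ℤ.* y ℤ.+ c ℤ.* z)) ℤ.+ (a ℤ.* x' ℤ.+ (b ℤ.* y' ℤ.+ c ℤ.* z'))
    k = ℤR.solve-∀

  ·-cong : ∀ u {x y : ℤ³} → (∀ i → x i ≡ y i) → u · x ≡ u · y
  ·-cong u e = cong₂ ℤ._+_ (cong (u 0F ℤ.*_) (e 0F)) (cong₂ ℤ._+_ (cong (u 1F ℤ.*_) (e 1F)) (cong (u 2F ℤ.*_) (e 2F)))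

  ·-scale : ∀ u k (z : ℤ³) → u · (λ i → k ℤ.* z i) ≡ k ℤ.* (u · z)
  ·-scale u k z = h k (u 0F) (u 1F) (u 2F) (z 0F) (z 1F) (z 2F)
    where
    h : ∀ k a b c x y z → a ℤ.* (k ℤ.* x) ℤ.+ (b ℤ.* (k ℤ.* y) ℤ.+ c ℤ.* (k ℤ.* z)) ≡
                          k ℤ.* (a ℤ.* x ℤ.+ (b ℤ.* y ℤ.+ c ℤ.* z))
    h = ℤR.solve-∀

  ·-edge : ∀ (x w y v : ℤ³) → x · ((w +ᵛ y) -ᵛ v) ≡ x · (w -ᵛ v) ℤ.+ x · y
  ·-edge x w y v = trans (·-cong x (λ i → k (w i) (y i) (v i))) (·-+ x (w -ᵛ v) y)
    where
    k : ∀ w y v → w ℤ.+ y ℤ.- v ≡ w ℤ.- v ℤ.+ y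
    k = ℤR.solve-∀

  ·-rebase : ∀ (x q w v : ℤ³) → x · (q -ᵛ w) ≡ x · (q -ᵛ v) ℤ.- x · (w -ᵛ v)
  ·-rebase x q w v = trans (·-cong x (λ i → k (q i) (w i) (v i))) (·-- x (q -ᵛ v) (w -ᵛ v))
    where
    k : ∀ q w v → q ℤ.- w ≡ (q ℤ.- v) ℤ.- (w ℤ.- v)
    k = ℤR.solve-∀

  ·-expand : ∀ x (e f g : ℤ³) {z : ℤ³} p q r → (∀ t → p ℤ.* e t ℤ.+ (q ℤ.* f t ℤ.+ r ℤ.* g t) ≡ z t) →
             x · z ≡ p ℤ.* (x · e) ℤ.+ (q ℤ.* (x · f) ℤ.+ r ℤ.* (x · g))
  ·-expand x e f g p q r eq = trans (sym (·-cong x eq))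
      (k (x 0F) (x 1F) (x 2F) p q r (e 0F) (e 1F) (e 2F) (f 0F) (f 1F) (f 2F) (g 0F) (g 1F) (g 2F))
    where
    k : ∀ x y z p q r a b c a′ b′ c′ a″ b″ c″ →
        x ℤ.* (p ℤ.* a ℤ.+ (q ℤ.* a′ ℤ.+ r ℤ.* a″)) ℤ.+ (y ℤ.* (p ℤ.* b ℤ.+ (q ℤ.* b′ ℤ.+ r ℤ.* b″)) ℤ.+ z ℤ.* (p ℤ.* c ℤ.+ (q ℤ.* c′ ℤ.+ r ℤ.* c″))) ≡
        p ℤ.* (x ℤ.* a ℤ.+ (y ℤ.* b ℤ.+ z ℤ.* c)) ℤ.+ (q ℤ.* (x ℤ.* a′ ℤ.+ (y ℤ.* b′ ℤ.+ z ℤ.* c′)) ℤ.+ r ℤ.* (x ℤ.* a″ ℤ.+ (y ℤ.* b″ ℤ.+ z ℤ.* c″)))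
    k = ℤR.solve-∀

  fun-hat : ∀ u v z → fun u v ∙ hat z ≡ ιℤ (u · (z -ᵛ v))
  fun-hat u v z = trans (fun-hom u v (hat z)) (trans (cong₂ _-_ (sym (ι-· u z)) (ℚP.*-identityˡ (ιℤ (u · v))))
                    (trans (sym (ι-- (u · z) (u · v))) (cong ιℤ (sym (·-- u z v)))))

  abstract
    -- Division by the gcd of the coordinates; a further factor `k` would make ∣ k ∣ times the gcd a
    -- common divisor. It lets an edge found by `improving-edge` be compared with the directions
    -- that smoothness provides.
    primitive-part : (z : ℤ³) → ¬ (∀ i → z i ≡ 0ℤ) →
                     ∃ λ n → ∃ λ d → Primitive d × (∀ i → z i ≡ + suc n ℤ.* d i)
    primitive-part z z≢0 = go G refl
      where
      G₁₂ G : ℕ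
      G₁₂ = GCD.gcd ∣ z 1F ∣ ∣ z 2F ∣
      G = GCD.gcd ∣ z 0F ∣ G₁₂
      G∣ : ∀ i → G ℕD.∣ ∣ z i ∣
      G∣ 0F = GCD.gcd[m,n]∣m ∣ z 0F ∣ G₁₂
      G∣ 1F = ℕD.∣-trans (GCD.gcd[m,n]∣n ∣ z 0F ∣ G₁₂) (GCD.gcd[m,n]∣m ∣ z 1F ∣ ∣ z 2F ∣)
      G∣ 2F = ℕD.∣-trans (GCD.gcd[m,n]∣n ∣ z 0F ∣ G₁₂) (GCD.gcd[m,n]∣n ∣ z 1F ∣ ∣ z 2F ∣)
      greatest : ∀ {c} → (∀ i → c ℕD.∣ ∣ z i ∣) → c ℕD.∣ G
      greatest p = GCD.gcd-greatest (p 0F) (GCD.gcd-greatest (p 1F) (p 2F))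
      go : ∀ g → g ≡ G → ∃ λ n → ∃ λ d → Primitive d × (∀ i → z i ≡ + suc n ℤ.* d i)
      go zero e = ⊥-elim (z≢0 λ i → ℤP.∣i∣≡0⇒i≡0 (ℕD.0∣⇒≡0 (subst (ℕD._∣ ∣ z i ∣) (sym e) (G∣ i))))
      go (suc n) e = n , (λ i → ℤD._∣_.quotient (q i)) , prim , λ i → trans (ℤD._∣_.equality (q i)) (ℤP.*-comm (ℤD._∣_.quotient (q i)) (+ suc n))
        where
        q : ∀ i → (+ suc n) ℤD.∣ z i
        q i = ℤD.∣ᵤ⇒∣ (subst (ℕD._∣ ∣ z i ∣) (sym e) (G∣ i))
        prim : Primitive (λ i → ℤD._∣_.quotient (q i))
        prim k d' f = ℕD.∣1⇒≡1 (ℕD.*-cancelʳ-∣ (suc n)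
            (subst (∣ k ∣ ℕ.* suc n ℕD.∣_) (trans (sym e) (sym (ℕP.*-identityˡ (suc n)))) (greatest kg∣)))
          where
          kg∣ : ∀ i → (∣ k ∣ ℕ.* suc n) ℕD.∣ ∣ z i ∣
          kg∣ i = ℕD.divides ∣ d' i ∣ (trans (cong ∣_∣ (trans (ℤD._∣_.equality (q i))
                    (trans (cong (ℤ._* + suc n) (f i)) (h k (d' i) (+ suc n)))))
                    (trans (ℤP.abs-* (d' i) (k ℤ.* + suc n)) (cong (∣ d' i ∣ ℕ.*_) (ℤP.abs-* k (+ suc n)))))
            where
            h : ∀ k d g → k ℤ.* d ℤ.* g ≡ d ℤ.* (k ℤ.* g)
            h = ℤR.solve-∀

open IntegerVectors

-- A vertex with the basis `e` of its edge directions and the dual basis `u`. `inside` says that P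
-- lies in the tangent cone spanned by the edges. Read with `u 0F` as inner normal, a corner also
-- stands for a facet through `v`.
record Corner {m} (V : Fin m → ℤ³) : Set where
  field
    v      : ℤ³
    e u    : Fin 3 → ℤ³
    v∈P    : ι v ∈P V
    e∈P    : ∀ i → ι (v +ᵛ e i) ∈P V
    dual   : ∀ i j → u i · e j ≡ δ i j
    expand : ∀ z t → (u 0F · z) ℤ.* e 0F t ℤ.+ ((u 1F · z) ℤ.* e 1F t ℤ.+ (u 2F · z) ℤ.* e 2F t) ≡ z t
    inside : ∀ i k → 0ℤ ℤ.≤ u i · (V k -ᵛ v)

-- Smooth corners and their tangent cones.

module Corners {m} (V : Fin m → ℤ³) (smooth : Smooth V) where

  open import Data.Rational using (_+_; _*_; _-_; -_; _≤_; _<_)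

  open Vertices V

  corner : ∀ {j σ} → Strict (V j) σ → Corner V
  corner {j} {σ} S = record
    { v = v ; e = e ; u = u ; v∈P = cone-gen V j ; e∈P = e∈P
    ; dual = dual ; expand = expand ; inside = inside }
    where
    v = V j
    local = smooth v (strict⇒vertex S)
    e = proj₁ local
    span = proj₁ (proj₁ (proj₂ local))
    indep = proj₂ (proj₁ (proj₂ local))
    dirs = proj₁ (proj₂ (proj₂ local))
    only = proj₂ (proj₂ (proj₂ local))

    -- The rows of the inverse of the edge matrix, read off from the expansions of the unit vectors;
    -- independence of the edges makes them dual.
    u : Fin 3 → ℤ³
    u i t = proj₁ (span (δ t)) i

    unit-sum : ∀ t s → u 0F t ℤ.* e 0F s ℤ.+ (u 1F t ℤ.* e 1F s ℤ.+ (u 2F t ℤ.* e 2F s ℤ.+ 0ℤ)) ≡ δ t s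
    unit-sum t s = proj₂ (span (δ t)) s

    expand : ∀ z t → (u 0F · z) ℤ.* e 0F t ℤ.+ ((u 1F · z) ℤ.* e 1F t ℤ.+ (u 2F · z) ℤ.* e 2F t) ≡ z t
    expand z s = trans (h (u 0F 0F) (u 0F 1F) (u 0F 2F) (u 1F 0F) (u 1F 1F) (u 1F 2F) (u 2F 0F) (u 2F 1F) (u 2F 2F)
                   (z 0F) (z 1F) (z 2F) (e 0F s) (e 1F s) (e 2F s))
                   (trans (cong₂ ℤ._+_ (cong (z 0F ℤ.*_) (unit-sum 0F s)) (cong₂ ℤ._+_ (cong (z 1F ℤ.*_) (unit-sum 1F s)) (cong (z 2F ℤ.*_) (unit-sum 2F s)))) (k s))
      where
      h : ∀ a b c a' b' c' a'' b'' c'' x y z p q r →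
          (a ℤ.* x ℤ.+ (b ℤ.* y ℤ.+ c ℤ.* z)) ℤ.* p ℤ.+
          ((a' ℤ.* x ℤ.+ (b' ℤ.* y ℤ.+ c' ℤ.* z)) ℤ.* q ℤ.+ (a'' ℤ.* x ℤ.+ (b'' ℤ.* y ℤ.+ c'' ℤ.* z)) ℤ.* r) ≡
          x ℤ.* (a ℤ.* p ℤ.+ (a' ℤ.* q ℤ.+ (a'' ℤ.* r ℤ.+ 0ℤ))) ℤ.+
          (y ℤ.* (b ℤ.* p ℤ.+ (b' ℤ.* q ℤ.+ (b'' ℤ.* r ℤ.+ 0ℤ))) ℤ.+
           z ℤ.* (c ℤ.* p ℤ.+ (c' ℤ.* q ℤ.+ (c'' ℤ.* r ℤ.+ 0ℤ))))
      h = ℤR.solve-∀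
      h₀ : ∀ x y z → x ℤ.* 1ℤ ℤ.+ (y ℤ.* 0ℤ ℤ.+ z ℤ.* 0ℤ) ≡ x
      h₀ = ℤR.solve-∀
      h₁ : ∀ x y z → x ℤ.* 0ℤ ℤ.+ (y ℤ.* 1ℤ ℤ.+ z ℤ.* 0ℤ) ≡ y
      h₁ = ℤR.solve-∀
      h₂ : ∀ x y z → x ℤ.* 0ℤ ℤ.+ (y ℤ.* 0ℤ ℤ.+ z ℤ.* 1ℤ) ≡ z
      h₂ = ℤR.solve-∀
      k : ∀ s → z 0F ℤ.* δ 0F s ℤ.+ (z 1F ℤ.* δ 1F s ℤ.+ z 2F ℤ.* δ 2F s) ≡ z s
      k 0F = h₀ (z 0F) (z 1F) (z 2F)
      k 1F = h₁ (z 0F) (z 1F) (z 2F)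
      k 2F = h₂ (z 0F) (z 1F) (z 2F)

    dual : ∀ i j → u i · e j ≡ δ i j
    dual i j = indep (λ i → u i · e j) (λ i → δ i j)
        (λ s → trans (h ((u 0F · e j) ℤ.* e 0F s) ((u 1F · e j) ℤ.* e 1F s) ((u 2F · e j) ℤ.* e 2F s)) (trans (expand (e j) s) (sym (k j s)))) i
      where
      h : ∀ a b c → a ℤ.+ (b ℤ.+ (c ℤ.+ 0ℤ)) ≡ a ℤ.+ (b ℤ.+ c)
      h = ℤR.solve-∀
      h₀ : ∀ x y z → 1ℤ ℤ.* x ℤ.+ (0ℤ ℤ.* y ℤ.+ (0ℤ ℤ.* z ℤ.+ 0ℤ)) ≡ x
      h₀ = ℤR.solve-∀
      h₁ : ∀ x y z → 0ℤ ℤ.* x ℤ.+ (1ℤ ℤ.* y ℤ.+ (0ℤ ℤ.* z ℤ.+ 0ℤ)) ≡ y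
      h₁ = ℤR.solve-∀
      h₂ : ∀ x y z → 0ℤ ℤ.* x ℤ.+ (0ℤ ℤ.* y ℤ.+ (1ℤ ℤ.* z ℤ.+ 0ℤ)) ≡ z
      h₂ = ℤR.solve-∀
      k : ∀ j s → sumℤ (λ i → δ i j ℤ.* e i s) ≡ e j s
      k 0F s = h₀ (e 0F s) (e 1F s) (e 2F s)
      k 1F s = h₁ (e 0F s) (e 1F s) (e 2F s)
      k 2F s = h₂ (e 0F s) (e 1F s) (e 2F s)

    δ≥0 : ∀ i j → 0ℤ ℤ.≤ δ i j
    δ≥0 0F 0F = 0≤1ᶻ
    δ≥0 0F 1F = 0≤0ᶻ
    δ≥0 0F 2F = 0≤0ᶻ
    δ≥0 1F 0F = 0≤0ᶻ
    δ≥0 1F 1F = 0≤1ᶻ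
    δ≥0 1F 2F = 0≤0ᶻ
    δ≥0 2F 0F = 0≤0ᶻ
    δ≥0 2F 1F = 0≤0ᶻ
    δ≥0 2F 2F = 0≤1ᶻ

    -- The edge is `suc n` primitive steps long, so one step ends at (n v + w) / (n + 1).
    e∈P : ∀ i → ι (v +ᵛ e i) ∈P V
    e∈P i = cone-resp {V = V} on-edge
        (cone-⊕ {V = V} {x = (b * ιℤ (+ n)) ⊙ hat v} {y = b ⊙ hat w}
          (cone-⊙ {V = V} {x = hat v} (b≥0 ⊛ ι-mono (+≥0 n)) (cone-gen V j))
          (cone-⊙ {V = V} {x = hat w} b≥0 w∈P))
      where
      edge = proj₂ (dirs i)
      w = proj₁ edge
      w∈P : ι w ∈P V
      w∈P = proj₁ (proj₁ (proj₂ (proj₁ (proj₂ edge))))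
      n = proj₁ (proj₂ (proj₂ edge))
      w-v = proj₂ (proj₂ (proj₂ edge))
      inverse = pos⇒inverse (ιℤ (+ suc n)) (ι-pos {+ suc n} (ℤ.+≤+ (ℕ.s≤s ℕ.z≤n)))
      b = proj₁ inverse
      b≥0 = ℚP.<⇒≤ (proj₁ (proj₂ inverse))
      bN : b * (1ℚ + ιℤ (+ n)) ≡ 1ℚ
      bN = trans (cong (_*_ b) (sym (ι-+ 1ℤ (+ n)))) (proj₂ (proj₂ inverse))
      on-edge : ((b * ιℤ (+ n)) ⊙ hat v) ⊕ (b ⊙ hat w) ≋ hat (v +ᵛ e i)
      on-edge zero = trans (h b (ιℤ (+ n))) bN
        where
        h : ∀ b n → b * n * 1ℚ + b * 1ℚ ≡ b * (1ℚ + n)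
        h = solve-∀ ℚ-ring
      on-edge (suc t) = trans (cong (λ x → b * ιℤ (+ n) * ιℤ (v t) + b * x) w≡)
          (trans (h b (ιℤ (+ n)) (ιℤ (v t)) (ιℤ (e i t)))
            (trans (cong (_* (ιℤ (v t) + ιℤ (e i t))) bN)
              (trans (ℚP.*-identityˡ _) (sym (ι-+ (v t) (e i t))))))
        where
        w≡ : ιℤ (w t) ≡ ιℤ (v t) + (1ℚ + ιℤ (+ n)) * ιℤ (e i t)
        w≡ = trans (cong ιℤ (trans (k (w t) (v t)) (cong (λ x → v t ℤ.+ x) (w-v t))))
               (trans (ι-+ (v t) _) (cong (_+_ (ιℤ (v t))) (trans (ι-* (+ suc n) (e i t)) (cong (_* ιℤ (e i t)) (ι-+ 1ℤ (+ n))))))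
          where
          k : ∀ w v → w ≡ v ℤ.+ (w ℤ.- v)
          k = ℤR.solve-∀
        h : ∀ b n v e → b * n * v + b * (v + (1ℚ + n) * e) ≡ b * (1ℚ + n) * (v + e)
        h = solve-∀ ℚ-ring

    -- A violating `V k` would yield an edge from `v` along which `u i` decreases. Its primitive
    -- direction is some `e j`, where `u i` is 0 or 1.
    inside : ∀ i k → 0ℤ ℤ.≤ u i · (V k -ᵛ v)
    inside i k = decide (split (u i · (V k -ᵛ v)))
      where
      φ = fun (u i) v
      decide : 0ℤ ℤ.≤ u i · (V k -ᵛ v) ⊎ 0ℤ ℤ.≤ ℤ.- (u i · (V k -ᵛ v)) ℤ.- 1ℤ → 0ℤ ℤ.≤ u i · (V k -ᵛ v)
      decide (inj₁ p) = p
      decide (inj₂ p) = ⊥-elim (neg≰ (pos+ φw<0 (ι-mono {u i · (w -ᵛ v)} uw≥0) <by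
          trans (cong (λ x → - (φ ∙ hat w) + x) (sym (fun-hat (u i) v w))) (ℚP.+-inverseˡ (φ ∙ hat w))))
        where
        φv : φ ∙ hat v ≡ 0ℚ
        φv = trans (fun-hat (u i) v v) (cong ιℤ (trans (·-- (u i) v v) (ℤP.+-inverseʳ (u i · v))))
        φk : 0ℚ < - (φ ∙ hat (V k))
        φk = ι-pos {ℤ.- (u i · (V k -ᵛ v))} (ℤP.0≤i-j⇒j≤i p) <by trans (ι-neg (u i · (V k -ᵛ v))) (cong -_ (sym (fun-hat (u i) v (V k))))
        found = improving-edge S φ φv k φk
        w = proj₁ found
        edge = proj₁ (proj₂ found)
        φw<0 = proj₂ (proj₂ found)
        v≢w : ¬ (∀ i → v i ≡ w i)
        v≢w = proj₁ (proj₂ (proj₂ edge))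
        part = primitive-part (w -ᵛ v) λ z → v≢w λ t → sym (ℤP.i-j≡0⇒i≡j (w t) (v t) (z t))
        n = proj₁ part
        d = proj₁ (proj₂ part)
        d-prim = proj₁ (proj₂ (proj₂ part))
        w-v = proj₂ (proj₂ (proj₂ part))
        which = only d (d-prim , w , edge , n , w-v)
        uw≥0 : 0ℤ ℤ.≤ u i · (w -ᵛ v)
        uw≥0 = +≥0 (suc n) ⊛ᶻ δ≥0 i (proj₁ which) byᶻ sym
          (trans (·-cong (u i) w-v) (trans (·-scale (u i) (+ suc n) d)
            (cong (+ suc n ℤ.*_) (trans (·-cong (u i) (proj₂ which)) (dual i (proj₁ which))))))

  -- What Gordan's alternative leaves when no functional exposes `V j`: this point is a convex
  -- combination of other listed points.
  Degenerate : Fin m → Set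
  Degenerate j = ∃ λ x → PosComb (directions (V j)) x × Vanish coordinates x

  decide-corner : ∀ j → (∃ λ (C : Corner V) → Corner.v C ≡ V j) ⊎ Degenerate j
  decide-corner j = go (gordan coordinates (directions (V j)))
    where
    go : _ → (∃ λ (C : Corner V) → Corner.v C ≡ V j) ⊎ Degenerate j
    go (inj₁ (φ , p)) = inj₁ (corner (strict p) , refl)
    go (inj₂ d) = inj₂ d

  pick : ∀ {j} → (∃ λ (C : Corner V) → Corner.v C ≡ V j) ⊎ Degenerate j → List (Corner V)
  pick (inj₁ (C , _)) = C ∷ []
  pick (inj₂ _) = []

  corners : List (Corner V)
  corners = concatMap (λ j → pick (decide-corner j)) (allFin m)

  -- The source of all vertices. With the coordinates appended to the keys the minimiser is a single
  -- point, and every direction from it is lexicographically positive. A positive combination of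
  -- such directions cannot vanish, which excludes degeneracy.
  lex-min-corner : Fin m → ∀ φs →
    ∃ λ C → C ∈ corners × (∃ λ j → Corner.v C ≡ V j) × (∀ k → LexNN φs (hat (V k) ⊝ hat (Corner.v C)))
  lex-min-corner j₀ φs = go (decide-corner j) refl
    where
    Φ = φs ++ coordinates
    found = lex-min Φ (λ k → hat (V k)) j₀ (allFin m)
    j = proj₁ found
    min : ∀ k → LexNN Φ (hat (V k) ⊝ hat (V j))
    min k = proj₂ (proj₂ found) (there (∈-allFin k))

    vanish-++ʳ : ∀ φs {ψs x} → Vanish (φs ++ ψs) x → Vanish ψs x
    vanish-++ʳ [] p = p
    vanish-++ʳ (φ ∷ φs) (_ , p) = vanish-++ʳ φs p

    lex : ∀ {x} → PosComb (directions (V j)) x → LexNN Φ x × ¬ Vanish Φ x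
    lex (gen d∈) = gen-case (∈-map⁻ (λ k → hat (V k) ⊝ hat (V j)) d∈)
      where
      gen-case : ∀ {d} → (∃ λ k → k ∈ others (V j) × d ≡ hat (V k) ⊝ hat (V j)) → LexNN Φ d × ¬ Vanish Φ d
      gen-case (k , k∈ , refl) = min k , λ z →
          proj₂ (∈-filter⁻ (λ k → ¬? (same? (V k) (V j))) {xs = allFin m} k∈) (eq (vanish-++ʳ φs z))
        where
        x = hat (V k) ⊝ hat (V j)
        coord : ∀ i → π (suc i) ∙ x ≡ 0ℚ → V k i ≡ V j i
        coord i z = ι-injective (h (ιℤ (V k i)) (ιℤ (V j i)) (trans (sym (π-∙ (suc i) x)) z))
          where
          h : ∀ a b → a - b ≡ 0ℚ → a ≡ b
          h a b e = trans (h₁ a b) (trans (cong (_+ b) e) (ℚP.+-identityˡ b))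
            where
            h₁ : ∀ a b → a ≡ a - b + b
            h₁ = solve-∀ ℚ-ring
        eq : Vanish coordinates x → ∀ i → V k i ≡ V j i
        eq (_ , p , _) 0F = coord 0F p
        eq (_ , _ , p , _) 1F = coord 1F p
        eq (_ , _ , _ , p , _) 2F = coord 2F p
    lex (add {x} {y} p q) = combine (lex p) (lex q)
      where
      one : ∀ x y → 1ℚ * x + 1ℚ * y ≡ x + y
      one = solve-∀ ℚ-ring
      combine : _ → _ → LexNN Φ (x ⊕ y) × ¬ Vanish Φ (x ⊕ y)
      combine (lx , nx) (ly , ny) = lex-⊕ Φ {x} {y} lx ly , λ z →
        nx (proj₁ (lex-antisym Φ {1ℚ} {1ℚ} 0<1 0<1 lx ly (vanish-resp Φ (λ i → sym (one (x i) (y i))) z)))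
    lex (scale {t} {x} t>0 p) = combine (lex p)
      where
      half : ∀ t x → t * x ≡ t * x + 1ℚ * 0ℚ
      half = solve-∀ ℚ-ring
      combine : _ → LexNN Φ (t ⊙ x) × ¬ Vanish Φ (t ⊙ x)
      combine (lx , nx) = lex-⊙ Φ (ℚP.<⇒≤ t>0) lx , λ z →
        nx (proj₁ (lex-antisym Φ {t} {1ℚ} {x} {𝟎} t>0 0<1 lx (vanish⇒lex Φ (vanish-𝟎 Φ))
          (vanish-resp Φ (λ i → half t (x i)) z)))

    vanish-all : ∀ φs {x} → x ≋ 𝟎 → Vanish φs x
    vanish-all φs e = vanish-resp φs (≋-sym e) (vanish-𝟎 φs)

    go : (d : (∃ λ (C : Corner V) → Corner.v C ≡ V j) ⊎ Degenerate j) → d ≡ decide-corner j →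
         ∃ λ C → C ∈ corners × (∃ λ j → Corner.v C ≡ V j) × (∀ k → LexNN φs (hat (V k) ⊝ hat (Corner.v C)))
    go (inj₁ (C , e)) eq = C ,
      ∈-concatMap⁺ (λ j → pick (decide-corner j)) (lose (∈-allFin j) (subst (λ d → C ∈ pick d) eq (here refl))) , (j , e) ,
      λ k → subst (λ v → LexNN φs (hat (V k) ⊝ hat v)) (sym e) (lex-++ˡ φs (min k))
    go (inj₂ (x , c , z₀ , z₁ , z₂ , z₃ , _)) _ = ⊥-elim (proj₂ (lex c) (vanish-all Φ zero-x))
      where
      zero-x : x ≋ 𝟎
      zero-x 0F = trans (sym (π-∙ 0F x)) z₀
      zero-x 1F = trans (sym (π-∙ 1F x)) z₁
      zero-x 2F = trans (sym (π-∙ 2F x)) z₂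
      zero-x 3F = trans (sym (π-∙ 3F x)) z₃

-- Smooth lattice polygons up to unimodular maps.

module Polygons where

  open import Data.Integer using (_+_; _*_; _-_; -_; _≤_)

  squeeze : ∀ {a} → 0ℤ ≤ a → 0ℤ ≤ - a → a ≡ 0ℤ
  squeeze {a} p q = ℤP.≤-antisym (ℤP.neg-cancel-≤ q) p

  pick≡0 : ∀ {a b} → 0ℤ ≤ a → 0ℤ ≤ b → a + b ≡ 0ℤ → a ≡ 0ℤ
  pick≡0 {a} {b} p q e = squeeze p (q byᶻ trans (h a b) (trans (cong (_- a) e) (ℤP.+-identityˡ (- a))))
    where
    h : ∀ a b → b ≡ a + b - a
    h = ℤR.solve-∀

  affine-combination : ∀ a f g N n₁ n₂ n₃ x₁ y₁ x₂ y₂ x₃ y₃ x y →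
         n₁ + n₂ + n₃ ≡ N → n₁ * x₁ + n₂ * x₂ + n₃ * x₃ ≡ N * x → n₁ * y₁ + n₂ * y₂ + n₃ * y₃ ≡ N * y →
         n₁ * (a + x₁ * f + y₁ * g) + n₂ * (a + x₂ * f + y₂ * g) + n₃ * (a + x₃ * f + y₃ * g) ≡
         N * (a + x * f + y * g)
  affine-combination a f g N n₁ n₂ n₃ x₁ y₁ x₂ y₂ x₃ y₃ x y p q r =
    trans (h a f g n₁ n₂ n₃ x₁ y₁ x₂ y₂ x₃ y₃)
      (trans (cong₂ (λ u v → u * a + v * f + (n₁ * y₁ + n₂ * y₂ + n₃ * y₃) * g) p q)
        (trans (cong (λ u → N * a + N * x * f + u * g) r) (h' a f g N x y)))
    where
    h : ∀ a f g n₁ n₂ n₃ x₁ y₁ x₂ y₂ x₃ y₃ →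
        n₁ * (a + x₁ * f + y₁ * g) + n₂ * (a + x₂ * f + y₂ * g) + n₃ * (a + x₃ * f + y₃ * g) ≡
        (n₁ + n₂ + n₃) * a + (n₁ * x₁ + n₂ * x₂ + n₃ * x₃) * f + (n₁ * y₁ + n₂ * y₂ + n₃ * y₃) * g
    h = ℤR.solve-∀
    h' : ∀ a f g N x y → N * a + N * x * f + N * y * g ≡ N * (a + x * f + y * g)
    h' = ℤR.solve-∀

  -- The corner maximising α x + β y, with edges `f`, `g` in positive orientation. The determinants
  -- in `coneᶠ` and `coneᵍ` are the coordinates of a point along `f` and `g`.
  record Corner₂ (L : ℤ → ℤ → Set) (α β : ℤ) : Set where
    field
      wx wy fx fy gx gy : ℤ
      w∈  : L wx wy
      f∈  : L (wx + fx) (wy + fy)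
      g∈  : L (wx + gx) (wy + gy)
      det : fx * gy - fy * gx ≡ 1ℤ
      coneᶠ : ∀ {x y} → L x y → 0ℤ ≤ (x - wx) * gy - (y - wy) * gx
      coneᵍ : ∀ {x y} → L x y → 0ℤ ≤ fx * (y - wy) - fy * (x - wx)
      max : ∀ {x y} → L x y → 0ℤ ≤ α * (wx - x) + β * (wy - y)

  -- A polygon seen through its lattice points only. Convexity has integer weights over a common
  -- denominator `N`, which keeps the planar argument free of rationals.
  record Polygon (L : ℤ → ℤ → Set) : Set where
    field
      dec : ∀ x y → Dec (L x y)
      convex : ∀ N {n₁ n₂ n₃ x₁ y₁ x₂ y₂ x₃ y₃ x y} →
               0ℤ ≤ N - 1ℤ → 0ℤ ≤ n₁ → 0ℤ ≤ n₂ → 0ℤ ≤ n₃ →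
               L x₁ y₁ → L x₂ y₂ → L x₃ y₃ →
               n₁ + n₂ + n₃ ≡ N →
               n₁ * x₁ + n₂ * x₂ + n₃ * x₃ ≡ N * x →
               n₁ * y₁ + n₂ * y₂ + n₃ * y₃ ≡ N * y → L x y
      corner : ∀ α β → Corner₂ L α β

  record Triangle (L : ℤ → ℤ → Set) : Set where
    field
      x₁ y₁ x₂ y₂ x₃ y₃ : ℤ
      p₁∈ : L x₁ y₁
      p₂∈ : L x₂ y₂
      p₃∈ : L x₃ y₃
      det : (x₂ - x₁) * (y₃ - y₁) - (y₂ - y₁) * (x₃ - x₁) ≡ 1ℤ
      only : ∀ {x y} → L x y → (x ≡ x₁ × y ≡ y₁) ⊎ ((x ≡ x₂ × y ≡ y₂) ⊎ (x ≡ x₃ × y ≡ y₃))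

  mirror : ∀ {L} → Polygon L → Polygon (λ x y → L y x)
  mirror {L} P = record
    { dec = λ x y → dec y x
    ; convex = λ N N≥ n₁≥ n₂≥ n₃≥ p q r e f g → convex N N≥ n₁≥ n₂≥ n₃≥ p q r e g f
    ; corner = λ α β → flip α β (corner β α)
    }
    where
    open Polygon P
    flip : ∀ α β → Corner₂ L β α → Corner₂ (λ x y → L y x) α β
    flip α β C = record
      { wx = wy ; wy = wx ; fx = gy ; fy = gx ; gx = fy ; gy = fx
      ; w∈ = w∈ ; f∈ = g∈ ; g∈ = f∈
      ; det = trans (h₁ gy fx gx fy) det
      ; coneᶠ = λ {x} {y} p → coneᵍ p byᶻ h₂ fx fy (x - wy) (y - wx)
      ; coneᵍ = λ {x} {y} p → coneᶠ p byᶻ h₃ gx gy (x - wy) (y - wx)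
      ; max = λ {x} {y} p → max p byᶻ ℤP.+-comm (β * (wx - y)) (α * (wy - x))
      }
      where
      open Corner₂ C
      h₁ : ∀ a b c d → a * b - c * d ≡ b * a - d * c
      h₁ = ℤR.solve-∀
      h₂ : ∀ a b x y → a * x - b * y ≡ x * a - y * b
      h₂ = ℤR.solve-∀
      h₃ : ∀ a b x y → y * b - x * a ≡ b * y - a * x
      h₃ = ℤR.solve-∀

  mirror-triangle : ∀ {L} → Triangle (λ x y → L y x) → Triangle L
  mirror-triangle T = record
    { x₁ = y₁ ; y₁ = x₁ ; x₂ = y₃ ; y₂ = x₃ ; x₃ = y₂ ; y₃ = x₂
    ; p₁∈ = p₁∈ ; p₂∈ = p₃∈ ; p₃∈ = p₂∈
    ; det = trans (h (y₃ - y₁) (x₂ - x₁) (x₃ - x₁) (y₂ - y₁)) det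
    ; only = λ p → flip (only p)
    }
    where
    open Triangle T
    h : ∀ a b c d → a * b - c * d ≡ b * a - d * c
    h = ℤR.solve-∀
    flip : ∀ {x y} → (y ≡ x₁ × x ≡ y₁) ⊎ ((y ≡ x₂ × x ≡ y₂) ⊎ (y ≡ x₃ × x ≡ y₃)) →
           (x ≡ y₁ × y ≡ x₁) ⊎ ((x ≡ y₃ × y ≡ x₃) ⊎ (x ≡ y₂ × y ≡ x₂))
    flip (inj₁ (a , b)) = inj₁ (b , a)
    flip (inj₂ (inj₁ (a , b))) = inj₂ (inj₂ (b , a))
    flip (inj₂ (inj₂ (a , b))) = inj₂ (inj₁ (b , a))

  -- Affine coordinates with origin `a` and basis `f`, `g`: `S`, `T` enter them and `X`, `Y` leave
  -- them.
  module Frame (ax ay fx fy gx gy : ℤ) (unimodular : fx * gy - fy * gx ≡ 1ℤ) where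

    X Y : ℤ → ℤ → ℤ
    X x y = ax + x * fx + y * gx
    Y x y = ay + x * fy + y * gy

    S T : ℤ → ℤ → ℤ
    S x y = (x - ax) * gy - (y - ay) * gx
    T x y = fx * (y - ay) - fy * (x - ax)

    private
      d = fx * gy - fy * gx

      -- The ring solver cannot use `unimodular`, so identities are stated with the determinant
      -- visible, and 1 is substituted for it afterwards.
      by-det : ∀ (F : ℤ → ℤ) {a b} → a ≡ F d → F 1ℤ ≡ b → a ≡ b
      by-det F p q = trans p (trans (cong F unimodular) q)

    XST : ∀ x y → X (S x y) (T x y) ≡ x
    XST x y = by-det (λ d → ax + (x - ax) * d) (h ax ay fx fy gx gy x y) (h' ax x)
      where
      h : ∀ ax ay fx fy gx gy x y →
          ax + ((x - ax) * gy - (y - ay) * gx) * fx + (fx * (y - ay) - fy * (x - ax)) * gx ≡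
          ax + (x - ax) * (fx * gy - fy * gx)
      h = ℤR.solve-∀
      h' : ∀ a x → a + (x - a) * 1ℤ ≡ x
      h' = ℤR.solve-∀

    YST : ∀ x y → Y (S x y) (T x y) ≡ y
    YST x y = by-det (λ d → ay + (y - ay) * d) (h ax ay fx fy gx gy x y) (h' ay y)
      where
      h : ∀ ax ay fx fy gx gy x y →
          ay + ((x - ax) * gy - (y - ay) * gx) * fy + (fx * (y - ay) - fy * (x - ax)) * gy ≡
          ay + (y - ay) * (fx * gy - fy * gx)
      h = ℤR.solve-∀
      h' : ∀ a x → a + (x - a) * 1ℤ ≡ x
      h' = ℤR.solve-∀

    module _ {L : ℤ → ℤ → Set} where

      L′ : ℤ → ℤ → Set
      L′ x y = L (X x y) (Y x y)

      into : ∀ {x y} → L x y → L′ (S x y) (T x y)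
      into {x} {y} = subst₂ L (sym (XST x y)) (sym (YST x y))

      frame : Polygon L → Polygon L′
      frame P = record
        { dec = λ x y → dec (X x y) (Y x y)
        ; convex = λ N {n₁} {n₂} {n₃} {x₁} {y₁} {x₂} {y₂} {x₃} {y₃} {x} {y} N≥ n₁≥ n₂≥ n₃≥ p q r e f g →
            convex N N≥ n₁≥ n₂≥ n₃≥ p q r e
              (affine-combination ax fx gx N n₁ n₂ n₃ x₁ y₁ x₂ y₂ x₃ y₃ x y e f g)
              (affine-combination ay fy gy N n₁ n₂ n₃ x₁ y₁ x₂ y₂ x₃ y₃ x y e f g)
        -- The linear part of α S + β T in the outer coordinates.
        ; corner = λ α β → pull α β (corner (α * gy - β * fy) (β * fx - α * gx))
        }
        where
        open Polygon P
        pull : ∀ α β → Corner₂ L (α * gy - β * fy) (β * fx - α * gx) → Corner₂ L′ α β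
        pull α β C = record
          { wx = S C.wx C.wy ; wy = T C.wx C.wy
          ; fx = s C.fx C.fy ; fy = t C.fx C.fy ; gx = s C.gx C.gy ; gy = t C.gx C.gy
          ; w∈ = into C.w∈
          ; f∈ = subst₂ L′ (S+ C.fx C.fy) (T+ C.fx C.fy) (into C.f∈)
          ; g∈ = subst₂ L′ (S+ C.gx C.gy) (T+ C.gx C.gy) (into C.g∈)
          ; det = by-det (λ d → d * (C.fx * C.gy - C.fy * C.gx)) (h₁ fx fy gx gy C.fx C.fy C.gx C.gy)
              (trans (ℤP.*-identityˡ _) C.det)
          ; coneᶠ = λ {x} {y} p → C.coneᶠ p byᶻ
              trans (h₃ ax ay fx fy gx gy x y C.wx C.wy C.gx C.gy)
               (trans (cong (λ u → (((X x y - C.wx) * C.gy - (Y x y - C.wy) * C.gx) - u * ((X x y - C.wx) * C.gy - (Y x y - C.wy) * C.gx)) + ((x * u - S C.wx C.wy) * t C.gx C.gy - (y * u - T C.wx C.wy) * s C.gx C.gy)) unimodular)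
                 (h₄ ((X x y - C.wx) * C.gy - (Y x y - C.wy) * C.gx) x y (S C.wx C.wy) (T C.wx C.wy) (s C.gx C.gy) (t C.gx C.gy)))
          ; coneᵍ = λ {x} {y} p → C.coneᵍ p byᶻ
              trans (h₅ ax ay fx fy gx gy x y C.wx C.wy C.fx C.fy)
               (trans (cong (λ u → ((C.fx * (Y x y - C.wy) - C.fy * (X x y - C.wx)) - u * (C.fx * (Y x y - C.wy) - C.fy * (X x y - C.wx))) + (s C.fx C.fy * (y * u - T C.wx C.wy) - t C.fx C.fy * (x * u - S C.wx C.wy))) unimodular)
                 (h₆ (C.fx * (Y x y - C.wy) - C.fy * (X x y - C.wx)) x y (S C.wx C.wy) (T C.wx C.wy) (s C.fx C.fy) (t C.fx C.fy)))
          ; max = λ {x} {y} p → C.max p byᶻ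
              by-det (λ u → α * (S C.wx C.wy - x * u) + β * (T C.wx C.wy - y * u))
                (h₇ ax ay fx fy gx gy x y C.wx C.wy α β) (h₈ α β (S C.wx C.wy) (T C.wx C.wy) x y)
          }
          where
          module C = Corner₂ C
          s t : ℤ → ℤ → ℤ
          s p q = p * gy - q * gx
          t p q = fx * q - fy * p
          S+ : ∀ p q → S (C.wx + p) (C.wy + q) ≡ S C.wx C.wy + s p q
          S+ p q = h ax ay gx gy C.wx C.wy p q
            where
            h : ∀ ax ay gx gy wx wy p q → (wx + p - ax) * gy - (wy + q - ay) * gx ≡
                ((wx - ax) * gy - (wy - ay) * gx) + (p * gy - q * gx)
            h = ℤR.solve-∀
          T+ : ∀ p q → T (C.wx + p) (C.wy + q) ≡ T C.wx C.wy + t p q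
          T+ p q = h ax ay fx fy C.wx C.wy p q
            where
            h : ∀ ax ay fx fy wx wy p q → fx * (wy + q - ay) - fy * (wx + p - ax) ≡
                (fx * (wy - ay) - fy * (wx - ax)) + (fx * q - fy * p)
            h = ℤR.solve-∀
          h₁ : ∀ a b c d p q r s → (p * d - q * c) * (a * s - b * r) - (a * q - b * p) * (r * d - s * c) ≡
               (a * d - b * c) * (p * s - q * r)
          h₁ = ℤR.solve-∀
          -- A quantity q is split as (q - d q) + d q with d the determinant of the frame. The first
          -- part cancels at d = 1, and the second is the same determinant in the new coordinates.
          h₃ : ∀ ax ay fx fy gx gy x y wx wy kx ky →
               (ax + x * fx + y * gx - wx) * ky - (ay + x * fy + y * gy - wy) * kx ≡
               (((ax + x * fx + y * gx - wx) * ky - (ay + x * fy + y * gy - wy) * kx)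
                - (fx * gy - fy * gx) * ((ax + x * fx + y * gx - wx) * ky - (ay + x * fy + y * gy - wy) * kx))
               + ((x * (fx * gy - fy * gx) - ((wx - ax) * gy - (wy - ay) * gx)) * (fx * ky - fy * kx)
                  - (y * (fx * gy - fy * gx) - (fx * (wy - ay) - fy * (wx - ax))) * (kx * gy - ky * gx))
          h₃ = ℤR.solve-∀
          h₄ : ∀ q x y S T k l → (q - 1ℤ * q) + ((x * 1ℤ - S) * l - (y * 1ℤ - T) * k) ≡ (x - S) * l - (y - T) * k
          h₄ = ℤR.solve-∀
          h₅ : ∀ ax ay fx fy gx gy x y wx wy kx ky →
               kx * (ay + x * fy + y * gy - wy) - ky * (ax + x * fx + y * gx - wx) ≡
               ((kx * (ay + x * fy + y * gy - wy) - ky * (ax + x * fx + y * gx - wx))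
                - (fx * gy - fy * gx) * (kx * (ay + x * fy + y * gy - wy) - ky * (ax + x * fx + y * gx - wx)))
               + ((kx * gy - ky * gx) * (y * (fx * gy - fy * gx) - (fx * (wy - ay) - fy * (wx - ax)))
                  - (fx * ky - fy * kx) * (x * (fx * gy - fy * gx) - ((wx - ax) * gy - (wy - ay) * gx)))
          h₅ = ℤR.solve-∀
          h₆ : ∀ q x y S T k l → (q - 1ℤ * q) + (k * (y * 1ℤ - T) - l * (x * 1ℤ - S)) ≡ k * (y - T) - l * (x - S)
          h₆ = ℤR.solve-∀
          h₇ : ∀ ax ay fx fy gx gy x y wx wy α β →
               (α * gy - β * fy) * (wx - (ax + x * fx + y * gx)) + (β * fx - α * gx) * (wy - (ay + x * fy + y * gy)) ≡
               α * (((wx - ax) * gy - (wy - ay) * gx) - x * (fx * gy - fy * gx)) +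
               β * ((fx * (wy - ay) - fy * (wx - ax)) - y * (fx * gy - fy * gx))
          h₇ = ℤR.solve-∀
          h₈ : ∀ α β S T x y → α * (S - x * 1ℤ) + β * (T - y * 1ℤ) ≡ α * (S - x) + β * (T - y)
          h₈ = ℤR.solve-∀

      frame-triangle : Triangle L′ → Triangle L
      frame-triangle Δ = record
        { x₁ = X x₁ y₁ ; y₁ = Y x₁ y₁ ; x₂ = X x₂ y₂ ; y₂ = Y x₂ y₂ ; x₃ = X x₃ y₃ ; y₃ = Y x₃ y₃
        ; p₁∈ = p₁∈ ; p₂∈ = p₂∈ ; p₃∈ = p₃∈
        ; det = trans (h ax ay fx fy gx gy x₁ y₁ x₂ y₂ x₃ y₃) (trans (cong₂ _*_ unimodular det) refl)
        ; only = λ {x} {y} p → Data.Sum.map (back {x} {y}) (Data.Sum.map (back {x} {y}) (back {x} {y})) (only (into p))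
        }
        where
        open Triangle Δ
        h : ∀ ax ay fx fy gx gy x₁ y₁ x₂ y₂ x₃ y₃ →
            ((ax + x₂ * fx + y₂ * gx) - (ax + x₁ * fx + y₁ * gx)) * ((ay + x₃ * fy + y₃ * gy) - (ay + x₁ * fy + y₁ * gy))
            - ((ay + x₂ * fy + y₂ * gy) - (ay + x₁ * fy + y₁ * gy)) * ((ax + x₃ * fx + y₃ * gx) - (ax + x₁ * fx + y₁ * gx)) ≡
            (fx * gy - fy * gx) * ((x₂ - x₁) * (y₃ - y₁) - (y₂ - y₁) * (x₃ - x₁))
        h = ℤR.solve-∀
        back : ∀ {x y a b} → S x y ≡ a × T x y ≡ b → x ≡ X a b × y ≡ Y a b
        back {x} {y} (p , q) = trans (sym (XST x y)) (cong₂ X p q) , trans (sym (YST x y)) (cong₂ Y p q)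

-- The reflections of a unimodular triangle in a polygon.

module UnimodularTriangles where

  open import Data.Integer using (_+_; _*_; _-_; -_; _≤_)
  open Polygons

  split₁ : ∀ a → 0ℤ ≤ a - 1ℤ ⊎ 0ℤ ≤ - a
  split₁ a = Data.Sum.map₂ (λ p → p byᶻ h a) (split (a - 1ℤ))
    where
    h : ∀ a → - (a - 1ℤ) - 1ℤ ≡ - a
    h = ℤR.solve-∀

  ≥1⇒≥0 : ∀ {a} → 0ℤ ≤ a - 1ℤ → 0ℤ ≤ a
  ≥1⇒≥0 {a} p = p ⊹ᶻ 0≤1ᶻ byᶻ h a
    where
    h : ∀ a → a - 1ℤ + 1ℤ ≡ a
    h = ℤR.solve-∀

  clash : ∀ {a} → 0ℤ ≤ a - 1ℤ → 0ℤ ≤ - a → ⊥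
  clash {a} p q = absurdᶻ (p ⊹ᶻ q) (h a)
    where
    h : ∀ a → a - 1ℤ + - a ≡ - 1ℤ
    h = ℤR.solve-∀

  unit-factors : ∀ a b → 0ℤ ≤ a → 0ℤ ≤ b - 1ℤ → a * b ≡ 1ℤ → a ≡ 1ℤ × b ≡ 1ℤ
  unit-factors a b p q e = go (split₁ a)
    where
    go : _ → a ≡ 1ℤ × b ≡ 1ℤ
    go (inj₂ r) = ⊥-elim (absurdᶻ (r ⊛ᶻ ≥1⇒≥0 q) (trans (h a b) (cong -_ e)))
      where
      h : ∀ a b → - a * b ≡ - (a * b)
      h = ℤR.solve-∀
    go (inj₁ r) = a≡1 , b≡1
      where
      expand₀ : (b - 1ℤ) + (a - 1ℤ) * b ≡ 0ℤ
      expand₀ = trans (h a b) (cong (_- 1ℤ) e)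
        where
        h : ∀ a b → (b - 1ℤ) + (a - 1ℤ) * b ≡ a * b - 1ℤ
        h = ℤR.solve-∀
      b≡1 : b ≡ 1ℤ
      b≡1 = ℤP.i-j≡0⇒i≡j b 1ℤ (pick≡0 q (r ⊛ᶻ ≥1⇒≥0 q) expand₀)
      a≡1 : a ≡ 1ℤ
      a≡1 = trans (sym (ℤP.*-identityʳ a)) (trans (cong (a *_) (sym b≡1)) e)

  conv : ∀ {L} → Polygon L → ∀ N n₁ n₂ n₃ x₁ y₁ x₂ y₂ x₃ y₃ x y →
         0ℤ ≤ N - 1ℤ → 0ℤ ≤ n₁ → 0ℤ ≤ n₂ → 0ℤ ≤ n₃ →
         L x₁ y₁ → L x₂ y₂ → L x₃ y₃ →
         n₁ + n₂ + n₃ ≡ N →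
         n₁ * x₁ + n₂ * x₂ + n₃ * x₃ ≡ N * x →
         n₁ * y₁ + n₂ * y₂ + n₃ * y₃ ≡ N * y → L x y
  conv P N n₁ n₂ n₃ x₁ y₁ x₂ y₂ x₃ y₃ x y = Polygon.convex P N

  -- (1,1) lies in the triangle of the three given points; the weights are the doubled areas of the
  -- triangles that it spans with the sides.
  push : ∀ {L} → Polygon L → L 1ℤ 0ℤ → L 0ℤ 1ℤ → ∀ {x y} → L x y → 0ℤ ≤ x - 1ℤ → 0ℤ ≤ y - 1ℤ → L 1ℤ 1ℤ
  push {L} P e n {x} {y} p x≥1 y≥1 =
    conv P (x + y - 1ℤ) 1ℤ (y - 1ℤ) (x - 1ℤ) x y 1ℤ 0ℤ 0ℤ 1ℤ 1ℤ 1ℤ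
      (x≥1 ⊹ᶻ y≥1 byᶻ h₀ x y) 0≤1ᶻ y≥1 x≥1 p e n (h₁ x y) (h₂ x y) (h₃ x y)
    where
    h₀ : ∀ x y → x - 1ℤ + (y - 1ℤ) ≡ x + y - 1ℤ - 1ℤ
    h₀ = ℤR.solve-∀
    h₁ : ∀ x y → 1ℤ + (y - 1ℤ) + (x - 1ℤ) ≡ x + y - 1ℤ
    h₁ = ℤR.solve-∀
    h₂ : ∀ x y → 1ℤ * x + (y - 1ℤ) * 1ℤ + (x - 1ℤ) * 0ℤ ≡ (x + y - 1ℤ) * 1ℤ
    h₂ = ℤR.solve-∀
    h₃ : ∀ x y → 1ℤ * y + (y - 1ℤ) * 0ℤ + (x - 1ℤ) * 1ℤ ≡ (x + y - 1ℤ) * 1ℤ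
    h₃ = ℤR.solve-∀

  push↘ : ∀ {L} → Polygon L → L 0ℤ 0ℤ → L 1ℤ 0ℤ → ∀ {x y} → L x y →
          0ℤ ≤ x - 1ℤ → 0ℤ ≤ - y - 1ℤ → 0ℤ ≤ - (x + y) → L 1ℤ -1ℤ
  push↘ {L} P o e {x} {y} p x≥1 y≤-1 s =
    conv P (- y) 1ℤ (- (x + y)) (x - 1ℤ) x y 1ℤ 0ℤ 0ℤ 0ℤ 1ℤ -1ℤ
      y≤-1 0≤1ᶻ s x≥1 p e o (h₁ x y) (h₂ x y) (h₃ x y)
    where
    h₁ : ∀ x y → 1ℤ + - (x + y) + (x - 1ℤ) ≡ - y
    h₁ = ℤR.solve-∀
    h₂ : ∀ x y → 1ℤ * x + - (x + y) * 1ℤ + (x - 1ℤ) * 0ℤ ≡ - y * 1ℤ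
    h₂ = ℤR.solve-∀
    h₃ : ∀ x y → 1ℤ * y + - (x + y) * 0ℤ + (x - 1ℤ) * 0ℤ ≡ - y * -1ℤ
    h₃ = ℤR.solve-∀

  -- Points strictly below the axis in the cones opposite at (1,0) and at (0,0) span with (1,0) a
  -- triangle around (1,-1). The weights are again doubled areas.
  push₂ : ∀ {L} → Polygon L → L 1ℤ 0ℤ → ∀ {x₁ y₁ x₂ y₂} → L x₁ y₁ → L x₂ y₂ →
          0ℤ ≤ x₁ - 1ℤ → 0ℤ ≤ - y₁ - 1ℤ → 0ℤ ≤ x₁ + y₁ - 1ℤ → 0ℤ ≤ - x₂ → 0ℤ ≤ - y₂ - 1ℤ → L 1ℤ -1ℤ
  push₂ {L} P e {x₁} {y₁} {x₂} {y₂} p q a b c d f =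
    conv P N (1ℤ - x₂) (x₁ - 1ℤ) N₃ x₁ y₁ x₂ y₂ 1ℤ 0ℤ 1ℤ -1ℤ
      (N≥1 byᶻ h₀ x₁ y₁ x₂ y₂) (0≤1ᶻ ⊹ᶻ d) a (N₃≥0 byᶻ h₄ x₁ y₁ x₂ y₂) p q e
      (h₁ x₁ y₁ x₂ y₂) (h₂ x₁ y₁ x₂ y₂) (h₃ x₁ y₁ x₂ y₂)
    where
    N = (1ℤ - x₂) * (- y₁) + (x₁ - 1ℤ) * (- y₂)
    N₃ = (x₁ - 1ℤ) * (- y₂ - x₂) - (x₁ + y₁) * (1ℤ - x₂)
    N₃≥0 : 0ℤ ≤ (- y₁ - 1ℤ) * ((- y₂ - 1ℤ) + 1ℤ + - x₂) + ((x₁ + y₁ - 1ℤ) + 1ℤ) * (- y₂ - 1ℤ)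
    N₃≥0 = (b ⊛ᶻ (f ⊹ᶻ 0≤1ᶻ ⊹ᶻ d)) ⊹ᶻ ((c ⊹ᶻ 0≤1ᶻ) ⊛ᶻ f)
    N≥1 : 0ℤ ≤ (- x₂ + 1ℤ) * (- y₁ - 1ℤ) + - x₂ + (x₁ - 1ℤ) * ((- y₂ - 1ℤ) + 1ℤ)
    N≥1 = ((d ⊹ᶻ 0≤1ᶻ) ⊛ᶻ b) ⊹ᶻ d ⊹ᶻ (a ⊛ᶻ (f ⊹ᶻ 0≤1ᶻ))
    h₀ : ∀ x₁ y₁ x₂ y₂ → (- x₂ + 1ℤ) * (- y₁ - 1ℤ) + - x₂ + (x₁ - 1ℤ) * ((- y₂ - 1ℤ) + 1ℤ) ≡
         (1ℤ - x₂) * (- y₁) + (x₁ - 1ℤ) * (- y₂) - 1ℤ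
    h₀ = ℤR.solve-∀
    h₁ : ∀ x₁ y₁ x₂ y₂ → (1ℤ - x₂) + (x₁ - 1ℤ) + ((x₁ - 1ℤ) * (- y₂ - x₂) - (x₁ + y₁) * (1ℤ - x₂)) ≡
         (1ℤ - x₂) * (- y₁) + (x₁ - 1ℤ) * (- y₂)
    h₁ = ℤR.solve-∀
    h₂ : ∀ x₁ y₁ x₂ y₂ → (1ℤ - x₂) * x₁ + (x₁ - 1ℤ) * x₂ + ((x₁ - 1ℤ) * (- y₂ - x₂) - (x₁ + y₁) * (1ℤ - x₂)) * 1ℤ ≡
         ((1ℤ - x₂) * (- y₁) + (x₁ - 1ℤ) * (- y₂)) * 1ℤ
    h₂ = ℤR.solve-∀
    h₃ : ∀ x₁ y₁ x₂ y₂ → (1ℤ - x₂) * y₁ + (x₁ - 1ℤ) * y₂ + ((x₁ - 1ℤ) * (- y₂ - x₂) - (x₁ + y₁) * (1ℤ - x₂)) * 0ℤ ≡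
         ((1ℤ - x₂) * (- y₁) + (x₁ - 1ℤ) * (- y₂)) * -1ℤ
    h₃ = ℤR.solve-∀
    h₄ : ∀ x₁ y₁ x₂ y₂ → (- y₁ - 1ℤ) * ((- y₂ - 1ℤ) + 1ℤ + - x₂) + ((x₁ + y₁ - 1ℤ) + 1ℤ) * (- y₂ - 1ℤ) ≡
         (x₁ - 1ℤ) * (- y₂ - x₂) - (x₁ + y₁) * (1ℤ - x₂)
    h₄ = ℤR.solve-∀

  module SmallCorner {L} (P : Polygon L) (o : L 0ℤ 0ℤ) (e : L 1ℤ 0ℤ) (n : L 0ℤ 1ℤ)
                     (x≥0 : ∀ {x y} → L x y → 0ℤ ≤ x) (y≥0 : ∀ {x y} → L x y → 0ℤ ≤ y)
                     (no₁₁ : ¬ L 1ℤ 1ℤ) where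

    axis : ∀ {x y} → L x y → 0ℤ ≤ x - 1ℤ → 0ℤ ≤ y - 1ℤ → ⊥
    axis p a b = no₁₁ (push P e n p a b)

    -- No lattice point has both coordinates positive. So the rightmost corner is (a,0), and its
    -- edge off the axis reaches the line x = 0 in one primitive step. Since the other edge lies in
    -- the axis, unimodularity gives this one the direction (-a,1), and its cone inequality is x + a
    -- y ≤ a.
    slope : ∃ λ a → 0ℤ ≤ a - 1ℤ × L a 0ℤ × (∀ {x y} → L x y → 0ℤ ≤ a - x - a * y)
    slope = wx , a≥1 , subst (L wx) wy≡0 w∈ ,
        λ {x} {y} p → coneᵍ p byᶻ h x y wx wy fx fy fx≡ fy≡1 wy≡0
      where
      open Corner₂ (Polygon.corner P 1ℤ 0ℤ)
      h : ∀ x y wx wy fx fy → fx ≡ - wx → fy ≡ 1ℤ → wy ≡ 0ℤ → fx * (y - wy) - fy * (x - wx) ≡ wx - x - wx * y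
      h x y wx wy fx fy refl refl refl = ℤR.solve (x ∷ y ∷ wx ∷ [])
      h₁ : ∀ x x' y → 1ℤ * (x - x') + 0ℤ * y ≡ x - x'
      h₁ = ℤR.solve-∀
      below : ∀ {x y} → L x y → 0ℤ ≤ wx - x
      below {x} {y} p = max p byᶻ h₁ wx x (wy - y)
      a≥1 : 0ℤ ≤ wx - 1ℤ
      a≥1 = below e
      step≤0 : ∀ {k} → 0ℤ ≤ wx - (wx + k) → 0ℤ ≤ - k
      step≤0 {k} p = p byᶻ k₁ wx k
        where
        k₁ : ∀ a b → a - (a + b) ≡ - b
        k₁ = ℤR.solve-∀
      wy≡0 : wy ≡ 0ℤ
      wy≡0 = go (split₁ wy)
        where
        go : _ → wy ≡ 0ℤ
        go (inj₁ q) = ⊥-elim (axis w∈ a≥1 q)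
        go (inj₂ q) = squeeze (y≥0 w∈) q
      height : ∀ {k} → 0ℤ ≤ wy + k → 0ℤ ≤ k
      height {k} p = p byᶻ trans (cong (_+ k) wy≡0) (ℤP.+-identityˡ k)
      fy≥0 : 0ℤ ≤ fy
      fy≥0 = height (y≥0 f∈)
      gy≥0 : 0ℤ ≤ gy
      gy≥0 = height (y≥0 g∈)
      fy≥1 : 0ℤ ≤ fy - 1ℤ
      fy≥1 = go (split₁ fy)
        where
        go : _ → 0ℤ ≤ fy - 1ℤ
        go (inj₁ q) = q
        go (inj₂ q) = ⊥-elim (absurdᶻ (step≤0 (below f∈) ⊛ᶻ gy≥0) (k fx fy gx gy det (squeeze fy≥0 q)))
          where
          k : ∀ fx fy gx gy → fx * gy - fy * gx ≡ 1ℤ → fy ≡ 0ℤ → - fx * gy ≡ - 1ℤ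
          k fx fy gx gy d refl = trans (k' fx gx gy) (cong -_ d)
            where
            k' : ∀ fx gx gy → - fx * gy ≡ - (fx * gy - 0ℤ * gx)
            k' = ℤR.solve-∀
      fx≡ : fx ≡ - wx
      fx≡ = go (split₁ (wx + fx))
        where
        raised : ∀ a b → b ≡ 0ℤ → a - 1ℤ ≡ b + a - 1ℤ
        raised a b refl = cong (_- 1ℤ) (sym (ℤP.+-identityˡ a))
        k : ∀ a b → b ≡ (a + b) - a
        k = ℤR.solve-∀
        go : _ → fx ≡ - wx
        go (inj₁ q) = ⊥-elim (axis f∈ q (fy≥1 byᶻ raised fy wy wy≡0))
        go (inj₂ q) = trans (k wx fx) (trans (cong (_- wx) (squeeze (x≥0 f∈) q)) (ℤP.+-identityˡ (- wx)))
      gy≡0 : gy ≡ 0ℤ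
      gy≡0 = go (split₁ gy)
        where
        go : _ → gy ≡ 0ℤ
        go (inj₂ q) = squeeze gy≥0 q
        go (inj₁ q) = ⊥-elim (absurdᶻ (coneᶠ o ⊹ᶻ (a≥1 ⊛ᶻ q) ⊹ᶻ a≥1 ⊹ᶻ q) (k wx wy gx gy wy≡0))
          where
          k : ∀ wx wy gx gy → wy ≡ 0ℤ → (0ℤ - wx) * gy - (0ℤ - wy) * gx + (wx - 1ℤ) * (gy - 1ℤ) + (wx - 1ℤ) + (gy - 1ℤ) ≡ - 1ℤ
          k wx wy gx gy refl = ℤR.solve (wx ∷ gx ∷ gy ∷ [])
      fy≡1 : fy ≡ 1ℤ
      fy≡1 = proj₂ (unit-factors (- gx) fy (step≤0 (below g∈)) fy≥1 (k fx fy gx gy gy≡0 det))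
        where
        k : ∀ fx fy gx gy → gy ≡ 0ℤ → fx * gy - fy * gx ≡ 1ℤ → - gx * fy ≡ 1ℤ
        k fx fy gx gy refl d = trans (k' fx fy gx) d
          where
          k' : ∀ fx fy gx → - gx * fy ≡ fx * 0ℤ - fy * gx
          k' = ℤR.solve-∀

  -- `slope` along both axes gives x + a y ≤ a and y + b x ≤ b. The point (0,b) in the first forces
  -- b = 1.
  small-corner : ∀ {L} → Polygon L → L 0ℤ 0ℤ → L 1ℤ 0ℤ → L 0ℤ 1ℤ →
                 (∀ {x y} → L x y → 0ℤ ≤ x) → (∀ {x y} → L x y → 0ℤ ≤ y) → ¬ L 1ℤ 1ℤ →
                 ∀ {x y} → L x y → 0ℤ ≤ 1ℤ - x - y
  small-corner {L} P o e n x≥0 y≥0 no₁₁ {x} {y} p =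
      combine (SmallCorner.slope P o e n x≥0 y≥0 no₁₁)
              (SmallCorner.slope (mirror P) o n e y≥0 x≥0 no₁₁)
    where
    combine : (∃ λ a → 0ℤ ≤ a - 1ℤ × L a 0ℤ × (∀ {x y} → L x y → 0ℤ ≤ a - x - a * y)) →
              (∃ λ b → 0ℤ ≤ b - 1ℤ × L 0ℤ b × (∀ {y x} → L x y → 0ℤ ≤ b - y - b * x)) → 0ℤ ≤ 1ℤ - x - y
    combine (a , a≥1 , _ , ha) (b , b≥1 , b∈ , hb) = hb p byᶻ k₂ x y b b≡1
      where
      k₁ : ∀ a b → a - 0ℤ - a * b + (a - 1ℤ) * (b - 1ℤ) ≡ - (b - 1ℤ)
      k₁ = ℤR.solve-∀
      k₂ : ∀ x y b → b ≡ 1ℤ → b - y - b * x ≡ 1ℤ - x - y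
      k₂ x y b refl = ℤR.solve (x ∷ y ∷ [])
      b≡1 : b ≡ 1ℤ
      b≡1 = ℤP.i-j≡0⇒i≡j b 1ℤ (squeeze b≥1 (ha b∈ ⊹ᶻ (a≥1 ⊛ᶻ b≥1) byᶻ k₁ a b))

  -- `small-corner` in the frame of `C`: without the fourth vertex of the parallelogram only three
  -- points remain.
  corner-square : ∀ {L} → Polygon L → ∀ {α β} (C : Corner₂ L α β) → let open Corner₂ C in
                  L (wx + fx + gx) (wy + fy + gy) ⊎ Triangle L
  corner-square {L} P C = go (Polygon.dec P′ 1ℤ 1ℤ)
    where
    open Corner₂ C
    open Frame wx wy fx fy gx gy det
    P′ : Polygon (L′ {L})
    P′ = frame P
    at : ∀ x y {a b} → X x y ≡ a → Y x y ≡ b → L a b → L′ {L} x y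
    at x y p q = subst₂ L (sym p) (sym q)
    h₀₀ : ∀ w f g → w + 0ℤ * f + 0ℤ * g ≡ w
    h₀₀ = ℤR.solve-∀
    h₁₀ : ∀ w f g → w + 1ℤ * f + 0ℤ * g ≡ w + f
    h₁₀ = ℤR.solve-∀
    h₀₁ : ∀ w f g → w + 0ℤ * f + 1ℤ * g ≡ w + g
    h₀₁ = ℤR.solve-∀
    h₁₁ : ∀ w f g → w + 1ℤ * f + 1ℤ * g ≡ w + f + g
    h₁₁ = ℤR.solve-∀
    o = at 0ℤ 0ℤ (h₀₀ wx fx gx) (h₀₀ wy fy gy) w∈
    e = at 1ℤ 0ℤ (h₁₀ wx fx gx) (h₁₀ wy fy gy) f∈
    n = at 0ℤ 1ℤ (h₀₁ wx fx gx) (h₀₁ wy fy gy) g∈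
    x≥0 : ∀ x y → L′ {L} x y → 0ℤ ≤ x
    x≥0 x y p = coneᶠ p byᶻ trans (h wx wy fx fy gx gy x y) (trans (cong (x *_) det) (ℤP.*-identityʳ x))
      where
      h : ∀ wx wy fx fy gx gy x y → (wx + x * fx + y * gx - wx) * gy - (wy + x * fy + y * gy - wy) * gx ≡
          x * (fx * gy - fy * gx)
      h = ℤR.solve-∀
    y≥0 : ∀ x y → L′ {L} x y → 0ℤ ≤ y
    y≥0 x y p = coneᵍ p byᶻ trans (h wx wy fx fy gx gy x y) (trans (cong (y *_) det) (ℤP.*-identityʳ y))
      where
      h : ∀ wx wy fx fy gx gy x y → fx * (wy + x * fy + y * gy - wy) - fy * (wx + x * fx + y * gx - wx) ≡
          y * (fx * gy - fy * gx)
      h = ℤR.solve-∀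
    go : Dec (L′ {L} 1ℤ 1ℤ) → L (wx + fx + gx) (wy + fy + gy) ⊎ Triangle L
    go (yes p) = inj₁ (subst₂ L (h₁₁ wx fx gx) (h₁₁ wy fy gy) p)
    go (no no₁₁) = inj₂ (frame-triangle record
      { x₁ = 0ℤ ; y₁ = 0ℤ ; x₂ = 1ℤ ; y₂ = 0ℤ ; x₃ = 0ℤ ; y₃ = 1ℤ
      ; p₁∈ = o ; p₂∈ = e ; p₃∈ = n ; det = refl
      ; only = λ {x} {y} p → which x y (x≥0 x y p) (y≥0 x y p)
          (small-corner P′ o e n (λ {x} {y} → x≥0 x y) (λ {x} {y} → y≥0 x y) no₁₁ {x} {y} p)
      })
      where
      which : ∀ x y → 0ℤ ≤ x → 0ℤ ≤ y → 0ℤ ≤ 1ℤ - x - y →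
              (x ≡ 0ℤ × y ≡ 0ℤ) ⊎ ((x ≡ 1ℤ × y ≡ 0ℤ) ⊎ (x ≡ 0ℤ × y ≡ 1ℤ))
      which x y p q r = case (split₁ x) (split₁ y)
        where
        k₁ : ∀ x y → 1ℤ - x - y + (x - 1ℤ) ≡ - y
        k₁ = ℤR.solve-∀
        k₂ : ∀ x y → 1ℤ - x - y + y ≡ - (x - 1ℤ)
        k₂ = ℤR.solve-∀
        k₃ : ∀ x y → 1ℤ - x - y + x ≡ - (y - 1ℤ)
        k₃ = ℤR.solve-∀
        case : _ → _ → (x ≡ 0ℤ × y ≡ 0ℤ) ⊎ ((x ≡ 1ℤ × y ≡ 0ℤ) ⊎ (x ≡ 0ℤ × y ≡ 1ℤ))
        case (inj₁ a) _ = inj₂ (inj₁ (ℤP.i-j≡0⇒i≡j x 1ℤ (squeeze a (r ⊹ᶻ q byᶻ k₂ x y)) , squeeze q (r ⊹ᶻ a byᶻ k₁ x y)))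
        case (inj₂ a) (inj₁ b) = inj₂ (inj₂ (squeeze p a , ℤP.i-j≡0⇒i≡j y 1ℤ (squeeze b (r ⊹ᶻ p byᶻ k₃ x y))))
        case (inj₂ a) (inj₂ b) = inj₁ (squeeze p a , squeeze q b)

  -- Write the triangle as e₂ = (0,0), e₁ = (1,0), e₃ = (0,1).  When none of its three reflections
  -- lies in the polygon, every lattice point lies in a cone opposite to the triangle at some eᵢ.
  data Region (x z : ℤ) : Set where
    at-e₁ : 0ℤ ≤ x - 1ℤ → 0ℤ ≤ - z → 0ℤ ≤ x + z - 1ℤ → Region x z
    at-e₂ : 0ℤ ≤ - x → 0ℤ ≤ - z → Region x z
    at-e₃ : 0ℤ ≤ z - 1ℤ → 0ℤ ≤ - x → 0ℤ ≤ x + z - 1ℤ → Region x z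

  region : ∀ {L} → Polygon L → L 0ℤ 0ℤ → L 1ℤ 0ℤ → L 0ℤ 1ℤ →
           ¬ L 1ℤ 1ℤ → ¬ L 1ℤ -1ℤ → ¬ L -1ℤ 1ℤ → ∀ {x z} → L x z → Region x z
  region {L} P o e n n₁ n₂ n₃ {x} {z} p = go (split₁ x) (split₁ z) (split₁ (x + z))
    where
    go : _ → _ → _ → Region x z
    go (inj₁ a) (inj₁ b) _ = ⊥-elim (n₁ (push P e n p a b))
    go (inj₁ a) (inj₂ b) (inj₁ c) = at-e₁ a b c
    go (inj₁ a) (inj₂ b) (inj₂ c) = ⊥-elim (n₂ (push↘ P o e p a (a ⊹ᶻ c byᶻ h x z) c))
      where
      h : ∀ x z → x - 1ℤ + - (x + z) ≡ - z - 1ℤ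
      h = ℤR.solve-∀
    go (inj₂ a) (inj₂ b) _ = at-e₂ a b
    go (inj₂ a) (inj₁ b) (inj₁ c) = at-e₃ b a c
    go (inj₂ a) (inj₁ b) (inj₂ c) = ⊥-elim (n₃ (push↘ (mirror P) o n p b (b ⊹ᶻ c byᶻ h x z) (c byᶻ cong -_ (ℤP.+-comm x z))))
      where
      h : ∀ x z → z - 1ℤ + - (x + z) ≡ - x - 1ℤ
      h = ℤR.solve-∀

  -- The determinant argument. The rising edge `g` ends in the cone at e₃. The coefficients `μ`, `ν`
  -- express (1,0) - w in the edges and keep `f` from rising too, so `f` ends in the cone at e₁ or
  -- on the line z = 0. In either case a determinant of absolute value 1 forces f and g to add up to
  -- (1,1) - w. `D` may be -1 because either edge of the corner can be the rising one.
  square-at-corner : ∀ wx wz fx fz gx gz D μ ν → wz ≡ 0ℤ → 0ℤ ≤ - wx → 0ℤ ≤ gz - 1ℤ →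
    fx * gz - fz * gx ≡ D → D ≡ 1ℤ ⊎ D ≡ - 1ℤ → 0ℤ ≤ μ → 0ℤ ≤ ν →
    μ * fx + ν * gx ≡ 1ℤ - wx → μ * fz + ν * gz ≡ 0ℤ →
    Region (wx + fx) (wz + fz) → Region (wx + gx) (wz + gz) →
    (0ℤ ≤ - (wx + fx) → 0ℤ ≤ - (wz + fz) → 0ℤ ≤ wz + fz) → 0ℤ ≤ fx + fz →
    wx + fx + gx ≡ 1ℤ × wz + fz + gz ≡ 1ℤ
  square-at-corner wx _ fx fz gx gz D μ ν refl s gz≥1 det D±1 μ≥0 ν≥0 ex ez Rf Rg flat f≥0 =
      go (split₁ fz)
    where
    Goal = wx + fx + gx ≡ 1ℤ × 0ℤ + fz + gz ≡ 1ℤ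

    g-above : 0ℤ ≤ - (wx + gx) × 0ℤ ≤ wx + gx + (0ℤ + gz) - 1ℤ
    g-above = case Rg
      where
      case : _ → 0ℤ ≤ - (wx + gx) × 0ℤ ≤ wx + gx + (0ℤ + gz) - 1ℤ
      case (at-e₁ _ q _) = ⊥-elim (clash gz≥1 (q byᶻ cong -_ (ℤP.+-identityˡ gz)))
      case (at-e₂ _ q) = ⊥-elim (clash gz≥1 (q byᶻ cong -_ (ℤP.+-identityˡ gz)))
      case (at-e₃ _ q r) = q , r
    i≥0 = proj₁ g-above
    j≥0 = proj₂ g-above

    go : _ → Goal
    go (inj₁ fz≥1) = ⊥-elim (absurdᶻ s (k₂ wx fx gx μ ν μ≡0 ν≡0 ex))
      where
      k₁ : ∀ μ ν fz gz → μ + (μ * (fz - 1ℤ) + (ν + ν * (gz - 1ℤ))) ≡ μ * fz + ν * gz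
      k₁ = ℤR.solve-∀
      k₁′ : ∀ μ ν fz gz → ν + (ν * (gz - 1ℤ) + (μ + μ * (fz - 1ℤ))) ≡ μ * fz + ν * gz
      k₁′ = ℤR.solve-∀
      μ≡0 : μ ≡ 0ℤ
      μ≡0 = pick≡0 μ≥0 ((μ≥0 ⊛ᶻ fz≥1) ⊹ᶻ (ν≥0 ⊹ᶻ (ν≥0 ⊛ᶻ gz≥1))) (trans (k₁ μ ν fz gz) ez)
      ν≡0 : ν ≡ 0ℤ
      ν≡0 = pick≡0 ν≥0 ((ν≥0 ⊛ᶻ gz≥1) ⊹ᶻ (μ≥0 ⊹ᶻ (μ≥0 ⊛ᶻ fz≥1))) (trans (k₁′ μ ν fz gz) ez)
      k₂ : ∀ wx fx gx μ ν → μ ≡ 0ℤ → ν ≡ 0ℤ → μ * fx + ν * gx ≡ 1ℤ - wx → - wx ≡ - 1ℤ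
      k₂ wx fx gx μ ν refl refl e = trans (k₃ wx) (cong (_- 1ℤ) (sym (trans (k₄ fx gx) e)))
        where
        k₃ : ∀ wx → - wx ≡ 1ℤ - wx - 1ℤ
        k₃ = ℤR.solve-∀
        k₄ : ∀ fx gx → 0ℤ ≡ 0ℤ * fx + 0ℤ * gx
        k₄ = ℤR.solve-∀
    go (inj₂ fz≤0) = case Rf
      where
      case : _ → Goal
      case (at-e₃ q _ _) = ⊥-elim (clash q (fz≤0 byᶻ cong -_ (sym (ℤP.+-identityˡ fz))))
      case (at-e₁ _ _ b≥0) = orientation D±1
        where
        -- The slacks of the inequalities that place w, w + f and w + g. In terms of them D - 1 is a
        -- polynomial with nonnegative coefficients, whose terms of degree 2 form `rest`; hence D =
        -- 1 annihilates every slack.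
        b c i j σ : ℤ
        σ = - wx
        b = wx + fx + (0ℤ + fz) - 1ℤ
        c = - fz
        i = - (wx + gx)
        j = wx + gx + (0ℤ + gz) - 1ℤ
        rest = σ * (i + j) + b * (i + j) + c * j + c * σ
        rest≥0 = (s ⊛ᶻ (i≥0 ⊹ᶻ j≥0)) ⊹ᶻ (b≥0 ⊛ᶻ (i≥0 ⊹ᶻ j≥0)) ⊹ᶻ (fz≤0 ⊛ᶻ j≥0) ⊹ᶻ (fz≤0 ⊛ᶻ s)
        tail₄ = j≥0 ⊹ᶻ rest≥0
        tail₃ = i≥0 ⊹ᶻ tail₄
        tail₂ = fz≤0 ⊹ᶻ tail₃
        tail₁ = b≥0 ⊹ᶻ tail₂
        det-expand : ∀ wx fx fz gx gz →
          - wx + ((wx + fx + (0ℤ + fz) - 1ℤ) + (- fz + (- (wx + gx) + ((wx + gx + (0ℤ + gz) - 1ℤ) +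
            (- wx * (- (wx + gx) + (wx + gx + (0ℤ + gz) - 1ℤ)) + (wx + fx + (0ℤ + fz) - 1ℤ) * (- (wx + gx) + (wx + gx + (0ℤ + gz) - 1ℤ))
             + - fz * (wx + gx + (0ℤ + gz) - 1ℤ) + - fz * - wx))))) ≡ fx * gz - fz * gx - 1ℤ
        det-expand = ℤR.solve-∀
        total : σ + (b + (c + (i + (j + rest)))) ≡ D - 1ℤ
        total = trans (det-expand wx fx fz gx gz) (cong (_- 1ℤ) det)
        orientation : _ → Goal
        orientation (inj₂ e) = ⊥-elim (absurdᶻ (s ⊹ᶻ tail₁ ⊹ᶻ 0≤1ᶻ) (trans (cong (_+ 1ℤ) total) (cong (λ D → D - 1ℤ + 1ℤ) e)))
        orientation (inj₁ e) = k₅ wx fx gx σ≡0 b≡0 c≡0 i≡0 , k₆ wx fz gx gz c≡0 i≡0 j≡0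
          where
          total₀ : σ + (b + (c + (i + (j + rest)))) ≡ 0ℤ
          total₀ = trans total (cong (_- 1ℤ) e)
          drop : ∀ {a b} → 0ℤ ≤ a → 0ℤ ≤ b → a + b ≡ 0ℤ → b ≡ 0ℤ
          drop {a} {b} p q e = pick≡0 q p (trans (ℤP.+-comm b a) e)
          σ≡0 = pick≡0 s tail₁ total₀
          total₁ = drop s tail₁ total₀
          b≡0 = pick≡0 b≥0 tail₂ total₁
          total₂ = drop b≥0 tail₂ total₁
          c≡0 = pick≡0 fz≤0 tail₃ total₂
          total₃ = drop fz≤0 tail₃ total₂
          i≡0 = pick≡0 i≥0 tail₄ total₃
          j≡0 = pick≡0 j≥0 rest≥0 (drop i≥0 tail₄ total₃)
          k₅ : ∀ wx fx gx → - wx ≡ 0ℤ → wx + fx + (0ℤ + fz) - 1ℤ ≡ 0ℤ → - fz ≡ 0ℤ → - (wx + gx) ≡ 0ℤ → wx + fx + gx ≡ 1ℤ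
          k₅ wx fx gx p q r t = trans (k wx fx gx fz) (cong₂ _+_ (cong₂ _+_ (cong₂ _+_ q r) (cong -_ t)) (cong (_+ 1ℤ) p))
            where
            k : ∀ wx fx gx fz → wx + fx + gx ≡ (wx + fx + (0ℤ + fz) - 1ℤ) + - fz + - (- (wx + gx)) + (- wx + 1ℤ)
            k = ℤR.solve-∀
          k₆ : ∀ wx fz gx gz → - fz ≡ 0ℤ → - (wx + gx) ≡ 0ℤ → wx + gx + (0ℤ + gz) - 1ℤ ≡ 0ℤ → 0ℤ + fz + gz ≡ 1ℤ
          k₆ wx fz gx gz p q r = trans (k wx fz gx gz) (cong₂ _+_ (cong₂ _+_ (cong -_ p) q) (cong (_+ 1ℤ) r))
            where
            k : ∀ wx fz gx gz → 0ℤ + fz + gz ≡ - (- fz) + - (wx + gx) + ((wx + gx + (0ℤ + gz) - 1ℤ) + 1ℤ)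
            k = ℤR.solve-∀
      case (at-e₂ p q) = orientation D±1
        where
        fz≡0 : fz ≡ 0ℤ
        fz≡0 = squeeze (flat p q byᶻ ℤP.+-identityˡ fz) fz≤0
        fx≥0 : 0ℤ ≤ fx
        fx≥0 = f≥0 byᶻ trans (cong (_+_ fx) fz≡0) (ℤP.+-identityʳ fx)
        prod : fx * gz ≡ D
        prod = k fx fz gx gz fz≡0 det
          where
          k : ∀ fx fz gx gz → fz ≡ 0ℤ → fx * gz - fz * gx ≡ D → fx * gz ≡ D
          k fx fz gx gz refl d = trans (k' fx gx gz) d
            where
            k' : ∀ fx gx gz → fx * gz ≡ fx * gz - 0ℤ * gx
            k' = ℤR.solve-∀
        orientation : _ → Goal
        orientation (inj₂ e) = ⊥-elim (absurdᶻ (fx≥0 ⊛ᶻ ≥1⇒≥0 gz≥1) (trans prod e))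
        orientation (inj₁ e) = k₅ wx fx gx (proj₁ units) i≡0 , k₆ fz gz fz≡0 (proj₂ units)
          where
          units = unit-factors fx gz fx≥0 gz≥1 (trans prod e)
          k₇ : ∀ wx gx gz → gz ≡ 1ℤ → wx + gx + (0ℤ + gz) - 1ℤ ≡ - (- (wx + gx))
          k₇ wx gx gz refl = ℤR.solve (wx ∷ gx ∷ [])
          i≡0 : - (wx + gx) ≡ 0ℤ
          i≡0 = squeeze i≥0 (j≥0 byᶻ k₇ wx gx gz (proj₂ units))
          k₅ : ∀ wx fx gx → fx ≡ 1ℤ → - (wx + gx) ≡ 0ℤ → wx + fx + gx ≡ 1ℤ
          k₅ wx fx gx refl z = trans (k wx gx) (cong (λ a → - a + 1ℤ) z)
            where
            k : ∀ wx gx → wx + 1ℤ + gx ≡ - (- (wx + gx)) + 1ℤ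
            k = ℤR.solve-∀
          k₆ : ∀ fz gz → fz ≡ 0ℤ → gz ≡ 1ℤ → 0ℤ + fz + gz ≡ 1ℤ
          k₆ fz gz refl refl = refl

  -- The corner `w` minimising x + z lies in the cone at e₂, hence by flatness on the line z = 0.
  -- The fourth vertex of its parallelogram would be (1,1), so `corner-square` leaves only the
  -- triangle.
  flat-corner : ∀ {L} → Polygon L → L 0ℤ 0ℤ → L 1ℤ 0ℤ → L 0ℤ 1ℤ → ¬ L 1ℤ 1ℤ →
                (∀ {x z} → L x z → Region x z) →
                (∀ {x z} → L x z → 0ℤ ≤ - x → 0ℤ ≤ - z → 0ℤ ≤ z) → Triangle L
  flat-corner {L} P o e n no₁₁ regions flat = go (corner-square P C)
    where
    C : Corner₂ L (- 1ℤ) (- 1ℤ)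
    C = Polygon.corner P (- 1ℤ) (- 1ℤ)
    open Corner₂ C renaming (wy to wz; fy to fz; gy to gz)
    top : 0ℤ ≤ - 1ℤ * (wx - 0ℤ) + - 1ℤ * (wz - 0ℤ)
    top = max o
    k₁ : ∀ x z → - 1ℤ * (x - 0ℤ) + - 1ℤ * (z - 0ℤ) + (x + z - 1ℤ) ≡ - 1ℤ
    k₁ = ℤR.solve-∀
    w-low : 0ℤ ≤ - wx × 0ℤ ≤ - wz
    w-low = case (regions w∈)
      where
      case : Region wx wz → 0ℤ ≤ - wx × 0ℤ ≤ - wz
      case (at-e₁ _ _ q) = ⊥-elim (absurdᶻ (top ⊹ᶻ q) (k₁ wx wz))
      case (at-e₂ p q) = p , q
      case (at-e₃ _ _ q) = ⊥-elim (absurdᶻ (top ⊹ᶻ q) (k₁ wx wz))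
    wz≡0 : wz ≡ 0ℤ
    wz≡0 = squeeze (flat w∈ (proj₁ w-low) (proj₂ w-low)) (proj₂ w-low)
    k₂ : ∀ x z a b → - 1ℤ * (x - (x + a)) + - 1ℤ * (z - (z + b)) ≡ a + b
    k₂ = ℤR.solve-∀
    μ-at ν-at : ℤ → ℤ → ℤ
    μ-at x z = (x - wx) * gz - (z - wz) * gx
    ν-at x z = fx * (z - wz) - fz * (x - wx)
    x-at : ∀ x z → μ-at x z * fx + ν-at x z * gx ≡ x - wx
    x-at x z = trans (h wx wz fx fz gx gz x z) (trans (cong ((x - wx) *_) det) (ℤP.*-identityʳ (x - wx)))
      where
      h : ∀ wx wz fx fz gx gz x z →
          ((x - wx) * gz - (z - wz) * gx) * fx + (fx * (z - wz) - fz * (x - wx)) * gx ≡ (x - wx) * (fx * gz - fz * gx)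
      h = ℤR.solve-∀
    z-at : ∀ x z → μ-at x z * fz + ν-at x z * gz ≡ z - wz
    z-at x z = trans (h wx wz fx fz gx gz x z) (trans (cong ((z - wz) *_) det) (ℤP.*-identityʳ (z - wz)))
      where
      h : ∀ wx wz fx fz gx gz x z →
          ((x - wx) * gz - (z - wz) * gx) * fz + (fx * (z - wz) - fz * (x - wx)) * gz ≡ (z - wz) * (fx * gz - fz * gx)
      h = ℤR.solve-∀
    z-at₀ : μ-at 1ℤ 0ℤ * fz + ν-at 1ℤ 0ℤ * gz ≡ 0ℤ
    z-at₀ = trans (z-at 1ℤ 0ℤ) (trans (cong (λ z → 0ℤ - z) wz≡0) refl)
    raised : 0ℤ ≤ fz - 1ℤ ⊎ 0ℤ ≤ gz - 1ℤ
    raised = case (split₁ fz) (split₁ gz)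
      where
      k₃ : ∀ μ ν fz gz wz → wz ≡ 0ℤ → μ * fz + ν * gz ≡ 1ℤ - wz → μ * - fz + ν * - gz ≡ - 1ℤ
      k₃ μ ν fz gz _ refl e = trans (k μ ν fz gz) (cong -_ e)
        where
        k : ∀ μ ν fz gz → μ * - fz + ν * - gz ≡ - (μ * fz + ν * gz)
        k = ℤR.solve-∀
      case : _ → _ → 0ℤ ≤ fz - 1ℤ ⊎ 0ℤ ≤ gz - 1ℤ
      case (inj₁ p) _ = inj₁ p
      case (inj₂ _) (inj₁ q) = inj₂ q
      case (inj₂ p) (inj₂ q) = ⊥-elim (absurdᶻ ((coneᶠ n ⊛ᶻ p) ⊹ᶻ (coneᵍ n ⊛ᶻ q))
        (k₃ (μ-at 0ℤ 1ℤ) (ν-at 0ℤ 1ℤ) fz gz wz wz≡0 (z-at 0ℤ 1ℤ)))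
    reach : wx + fx + gx ≡ 1ℤ × wz + fz + gz ≡ 1ℤ
    reach = case raised
      where
      k : ∀ a b c → a + b + c ≡ a + c + b
      k = ℤR.solve-∀
      case : _ → wx + fx + gx ≡ 1ℤ × wz + fz + gz ≡ 1ℤ
      case (inj₂ gz≥1) = square-at-corner wx wz fx fz gx gz 1ℤ (μ-at 1ℤ 0ℤ) (ν-at 1ℤ 0ℤ) wz≡0 (proj₁ w-low) gz≥1
        det (inj₁ refl) (coneᶠ e) (coneᵍ e) (x-at 1ℤ 0ℤ) z-at₀ (regions f∈) (regions g∈)
        (flat f∈) (max f∈ byᶻ k₂ wx wz fx fz)
      case (inj₁ fz≥1) = trans (k wx fx gx) (proj₁ swapped) , trans (k wz fz gz) (proj₂ swapped)
        where
        k′ : ∀ a b c d → a * b + c * d ≡ c * d + a * b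
        k′ = ℤR.solve-∀
        swapped = square-at-corner wx wz gx gz fx fz (- 1ℤ) (ν-at 1ℤ 0ℤ) (μ-at 1ℤ 0ℤ) wz≡0 (proj₁ w-low) fz≥1
          (trans (k″ gx fz gz fx) (cong -_ det)) (inj₂ refl) (coneᵍ e) (coneᶠ e)
          (trans (k′ (ν-at 1ℤ 0ℤ) gx (μ-at 1ℤ 0ℤ) fx) (x-at 1ℤ 0ℤ))
          (trans (k′ (ν-at 1ℤ 0ℤ) gz (μ-at 1ℤ 0ℤ) fz) z-at₀)
          (regions g∈) (regions f∈) (flat g∈) (max g∈ byᶻ k₂ wx wz gx gz)
          where
          k″ : ∀ a b c d → a * b - c * d ≡ - (d * c - b * a)
          k″ = ℤR.solve-∀
    go : _ → Triangle L
    go (inj₂ Δ) = Δ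
    go (inj₁ p) = ⊥-elim (no₁₁ (subst₂ L (proj₁ reach) (proj₂ reach) p))

  -- By `push₂` the cones at e₁ and e₂ cannot both contain points below the axis, so one of them is
  -- flat. The lowest corner decides which one.
  reflection-or-triangle : ∀ {L} → Polygon L → L 0ℤ 0ℤ → L 1ℤ 0ℤ → L 0ℤ 1ℤ →
                           (L 1ℤ 1ℤ ⊎ (L 1ℤ -1ℤ ⊎ L -1ℤ 1ℤ)) ⊎ Triangle L
  reflection-or-triangle {L} P o e n = go (dec 1ℤ 1ℤ) (dec 1ℤ -1ℤ) (dec -1ℤ 1ℤ)
    where
    open Polygon P
    go : Dec (L 1ℤ 1ℤ) → Dec (L 1ℤ -1ℤ) → Dec (L -1ℤ 1ℤ) → _
    go (yes p) _ _ = inj₁ (inj₁ p)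
    go (no _) (yes p) _ = inj₁ (inj₂ (inj₁ p))
    go (no _) (no _) (yes p) = inj₁ (inj₂ (inj₂ p))
    go (no n₁) (no n₂) (no n₃) = inj₂ (bottom (split₁ (- wz)) )
      where
      C : Corner₂ L 0ℤ (- 1ℤ)
      C = corner 0ℤ (- 1ℤ)
      open Corner₂ C using (wx; w∈; max) renaming (wy to wz)
      regions : ∀ {x z} → L x z → Region x z
      regions = region P o e n n₁ n₂ n₃
      here-flat : (∀ {x z} → L x z → 0ℤ ≤ - x → 0ℤ ≤ - z → 0ℤ ≤ z) → Triangle L
      here-flat = flat-corner P o e n n₁ regions

      -- The map (x,z) ↦ (1 - x - z, z) exchanges e₁ and e₂ and fixes e₃. It reverses orientation
      -- and is therefore composed of a `mirror` and a frame.
      open Frame 0ℤ 1ℤ 0ℤ -1ℤ 1ℤ -1ℤ refl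
      P″ : Polygon (L′ {λ x z → L z x})
      P″ = frame (mirror P)
      h₁ : ∀ x z → 1ℤ + x * -1ℤ + z * -1ℤ ≡ 1ℤ - x - z
      h₁ = ℤR.solve-∀
      h₂ : ∀ x z → 0ℤ + x * 0ℤ + z * 1ℤ ≡ z
      h₂ = ℤR.solve-∀
      regions″ : ∀ {x z} → L′ {λ x z → L z x} x z → Region x z
      regions″ {x} {z} p = turn (subst₂ Region (h₁ x z) (h₂ x z) (regions p))
        where
        t₁ : ∀ x z → 1ℤ - x - z - 1ℤ + z ≡ - x
        t₁ = ℤR.solve-∀
        t₂ : ∀ x z → 1ℤ - x - z + z - 1ℤ ≡ - x
        t₂ = ℤR.solve-∀
        t₃ : ∀ x z → - (1ℤ - x - z) ≡ x + z - 1ℤ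
        t₃ = ℤR.solve-∀
        t₄ : ∀ x z → (x + z - 1ℤ) + - z ≡ x - 1ℤ
        t₄ = ℤR.solve-∀
        turn : Region (1ℤ - x - z) z → Region x z
        turn (at-e₁ a b c) = at-e₂ (c byᶻ t₂ x z) b
        turn (at-e₂ a b) = at-e₁ ((a byᶻ t₃ x z) ⊹ᶻ b byᶻ t₄ x z) b (a byᶻ t₃ x z)
        turn (at-e₃ a b c) = at-e₃ a (c byᶻ t₂ x z) (b byᶻ t₃ x z)
      there-flat : (∀ {x z} → L x z → 0ℤ ≤ x - 1ℤ → 0ℤ ≤ - z → 0ℤ ≤ x + z - 1ℤ → 0ℤ ≤ z) → Triangle L
      there-flat flat = mirror-triangle (frame-triangle (flat-corner P″ e o n n₃ regions″ flat″))
        where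
        t₁ : ∀ x z → - x ≡ 1ℤ + x * -1ℤ + z * -1ℤ + (0ℤ + x * 0ℤ + z * 1ℤ) - 1ℤ
        t₁ = ℤR.solve-∀
        t₃ : ∀ x z → - x + - z ≡ 1ℤ + x * -1ℤ + z * -1ℤ - 1ℤ
        t₃ = ℤR.solve-∀
        flat″ : ∀ {x z} → L′ {λ x z → L z x} x z → 0ℤ ≤ - x → 0ℤ ≤ - z → 0ℤ ≤ z
        flat″ {x} {z} p a b = flat p (a ⊹ᶻ b byᶻ t₃ x z) (b byᶻ cong -_ (sym (h₂ x z))) (a byᶻ t₁ x z) byᶻ h₂ x z

      low : ∀ {x z} → L x z → 0ℤ ≤ z - wz
      low {x} {z} p = max p byᶻ h x z wx wz
        where
        h : ∀ x z wx wz → 0ℤ * (wx - x) + - 1ℤ * (wz - z) ≡ z - wz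
        h = ℤR.solve-∀

      deep : ∀ {z} → 0ℤ ≤ - z - 1ℤ ⊎ 0ℤ ≤ z
      deep {z} = Data.Sum.map₂ (λ p → p byᶻ h z) (split₁ (- z))
        where
        h : ∀ z → - (- z) ≡ z
        h = ℤR.solve-∀

      bottom : 0ℤ ≤ - wz - 1ℤ ⊎ 0ℤ ≤ - (- wz) → Triangle L
      bottom (inj₂ wz≥0) = here-flat λ {x} {z} p _ _ → low p ⊹ᶻ wz≥0 byᶻ h z wz
        where
        h : ∀ z w → z - w + - (- w) ≡ z
        h = ℤR.solve-∀
      bottom (inj₁ wz<0) = case (regions w∈)
        where
        case : Region wx wz → Triangle L
        case (at-e₁ a b c) = here-flat λ {x} {z} p x≤0 z≤0 → use p x≤0 (deep {z})
          where
          use : ∀ {x z} → L x z → 0ℤ ≤ - x → 0ℤ ≤ - z - 1ℤ ⊎ 0ℤ ≤ z → 0ℤ ≤ z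
          use p x≤0 (inj₂ q) = q
          use p x≤0 (inj₁ q) = ⊥-elim (n₂ (push₂ P e w∈ p a wz<0 c x≤0 q))
        case (at-e₂ a b) = there-flat λ {x} {z} p x≥1 z≤0 s → use p x≥1 s (deep {z})
          where
          use : ∀ {x z} → L x z → 0ℤ ≤ x - 1ℤ → 0ℤ ≤ x + z - 1ℤ → 0ℤ ≤ - z - 1ℤ ⊎ 0ℤ ≤ z → 0ℤ ≤ z
          use p x≥1 s (inj₂ q) = q
          use p x≥1 s (inj₁ q) = ⊥-elim (n₂ (push₂ P e p w∈ x≥1 q s a wz<0))
        case (at-e₃ a _ _) = ⊥-elim (clash a (≥1⇒≥0 { - wz} wz<0))

-- The ratio test.

module MinimalRatio where

  open import Data.Rational using (_+_; _*_; _-_; -_; _≤_; _<_)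

  affine-between : ∀ {x b κ κ′} → 0ℚ ≤ x → 0ℚ ≤ x - κ * b → 0ℚ ≤ κ′ → 0ℚ ≤ κ - κ′ → 0ℚ ≤ x - κ′ * b
  affine-between {x} {b} {κ} {κ′} x≥0 p q r = go (nonneg? b)
    where
    go : _ → 0ℚ ≤ x - κ′ * b
    go (inj₁ b≥0) = p ⊹ (r ⊛ b≥0) by h x b κ κ′
      where
      h : ∀ x b κ κ′ → x - κ * b + (κ - κ′) * b ≡ x - κ′ * b
      h = solve-∀ ℚ-ring
    go (inj₂ b<0) = x≥0 ⊹ (q ⊛ ℚP.<⇒≤ b<0) by h x b κ′
      where
      h : ∀ x b κ → x + κ * - b ≡ x - κ * b
      h = solve-∀ ℚ-ring

  -- `κ` is the largest step along -b from `x` that stays in the nonnegative orthant, and `i` is a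
  -- coordinate that blocks it.
  MinRatio : (Fin 3 → ℚ) → (Fin 3 → ℚ) → Set
  MinRatio x b = ∃ λ i → ∃ λ κ → 0ℚ ≤ κ × 0ℚ < b i × x i ≡ κ * b i × (∀ j → 0ℚ ≤ x j - κ * b j)

  private
    Partial : (Fin 3 → ℚ) → (Fin 3 → ℚ) → (Fin 3 → Set) → Set
    Partial x b S = ∃ λ i → ∃ λ κ → 0ℚ ≤ κ × 0ℚ < b i × x i ≡ κ * b i × (∀ j → S j → 0ℚ ≤ x j - κ * b j)

    extend : ∀ {x b S} k → (∀ j → 0ℚ ≤ x j) →
             (∀ j → S j → 0ℚ ≤ - b j) ⊎ Partial x b S →
             (∀ j → S j ⊎ j ≡ k → 0ℚ ≤ - b j) ⊎ Partial x b (λ j → S j ⊎ j ≡ k)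
    extend {x} {b} {S} k x≥0 st = go (sign (b k)) st
      where
      low : 0ℚ ≤ - b k → (∀ j → S j → 0ℚ ≤ - b j) ⊎ Partial x b S → _
      low bk≤0 (inj₁ p) = inj₁ λ { j (inj₁ s) → p j s ; j (inj₂ refl) → bk≤0 }
      low bk≤0 (inj₂ (i , κ , κ≥0 , bi , e , p)) = inj₂ (i , κ , κ≥0 , bi , e ,
        λ { j (inj₁ s) → p j s ; j (inj₂ refl) → x≥0 j ⊹ (κ≥0 ⊛ bk≤0) by h (x j) (b j) κ })
        where
        h : ∀ x b κ → x + κ * - b ≡ x - κ * b
        h = solve-∀ ℚ-ring
      go : Sign (b k) → (∀ j → S j → 0ℚ ≤ - b j) ⊎ Partial x b S → _
      go (neg p) st = low (ℚP.<⇒≤ p) st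
      go (nul p) st = low (0≤0 by cong -_ (sym p)) st
      go (pos bk>0) st = compare st
        where
        inv = pos⇒inverse (b k) bk>0
        κ′ = x k * proj₁ inv
        κ′≥0 : 0ℚ ≤ κ′
        κ′≥0 = x≥0 k ⊛ ℚP.<⇒≤ (proj₁ (proj₂ inv))
        xk≡ : x k ≡ κ′ * b k
        xk≡ = trans (sym (ℚP.*-identityʳ (x k))) (trans (cong (x k *_) (sym (proj₂ (proj₂ inv)))) (sym (ℚP.*-assoc (x k) (proj₁ inv) (b k))))
        h₀ : ∀ x y → x ≡ y → 0ℚ ≡ x - y
        h₀ x _ refl = sym (ℚP.+-inverseʳ x)
        compare : (∀ j → S j → 0ℚ ≤ - b j) ⊎ Partial x b S → _
        compare (inj₁ p) = inj₂ (k , κ′ , κ′≥0 , bk>0 , xk≡ ,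
          λ { j (inj₁ s) → x≥0 j ⊹ (κ′≥0 ⊛ p j s) by h (x j) (b j) κ′ ; j (inj₂ refl) → 0≤0 by h₀ _ _ xk≡ })
          where
          h : ∀ x b κ → x + κ * - b ≡ x - κ * b
          h = solve-∀ ℚ-ring
        compare (inj₂ (i , κ , κ≥0 , bi , e , p)) = pick (nonneg? (κ - κ′))
          where
          pick : _ → _
          pick (inj₁ r) = inj₂ (k , κ′ , κ′≥0 , bk>0 , xk≡ ,
            λ { j (inj₁ s) → affine-between {x j} {b j} {κ} {κ′} (x≥0 j) (p j s) κ′≥0 r ; j (inj₂ refl) → 0≤0 by h₀ _ _ xk≡ })
          pick (inj₂ r) = inj₂ (i , κ , κ≥0 , bi , e ,
            λ { j (inj₁ s) → p j s
              ; j (inj₂ refl) → affine-between {x j} {b j} {κ′} {κ} (x≥0 j) (0≤0 by h₀ _ _ xk≡) κ≥0 (ℚP.<⇒≤ r by h κ κ′) })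
            where
            h : ∀ a b → - (a - b) ≡ b - a
            h = solve-∀ ℚ-ring

  minimal-ratio : ∀ x b → (∀ j → 0ℚ ≤ x j) → (∀ j → 0ℚ ≤ - b j) ⊎ MinRatio x b
  minimal-ratio x b x≥0 = finish (extend 2F x≥0 (extend 1F x≥0 (extend 0F x≥0 (inj₁ λ _ ()))))
    where
    All : Fin 3 → Set
    All j = ((⊥ ⊎ j ≡ 0F) ⊎ j ≡ 1F) ⊎ j ≡ 2F
    all : ∀ j → All j
    all 0F = inj₁ (inj₁ (inj₂ refl))
    all 1F = inj₁ (inj₂ refl)
    all 2F = inj₂ refl
    finish : (∀ j → All j → 0ℚ ≤ - b j) ⊎ Partial x b All → (∀ j → 0ℚ ≤ - b j) ⊎ MinRatio x b
    finish (inj₁ p) = inj₁ λ j → p j (all j)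
    finish (inj₂ (i , κ , κ≥0 , bi , e , p)) = inj₂ (i , κ , κ≥0 , bi , e , λ j → p j (all j))

-- Covering a point by a unimodular triangle.

module TriangleDescent where

  open import Data.Rational using (_+_; _*_; _-_; -_; _≤_; _<_)
  open Polygons
  open UnimodularTriangles
  open MinimalRatio

  area : (x₁ y₁ x₂ y₂ x₃ y₃ : ℤ) → ℤ
  area x₁ y₁ x₂ y₂ x₃ y₃ = (x₂ ℤ.- x₁) ℤ.* (y₃ ℤ.- y₁) ℤ.- (y₂ ℤ.- y₁) ℤ.* (x₃ ℤ.- x₁)

  -- homogeneous coordinates: the point (X , Y) / r is covered by the triangle
  record Covered (L : ℤ → ℤ → Set) (D : ℤ) (r X Y : ℚ) : Set where
    constructor covered
    field
      {x₁ y₁ x₂ y₂ x₃ y₃} : ℤ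
      {a₁ a₂ a₃} : ℚ
      p₁∈ : L x₁ y₁
      p₂∈ : L x₂ y₂
      p₃∈ : L x₃ y₃
      det : area x₁ y₁ x₂ y₂ x₃ y₃ ≡ D
      a₁≥0 : 0ℚ ≤ a₁
      a₂≥0 : 0ℚ ≤ a₂
      a₃≥0 : 0ℚ ≤ a₃
      sum-r : a₁ + a₂ + a₃ ≡ r
      sum-X : a₁ * ιℤ x₁ + a₂ * ιℤ x₂ + a₃ * ιℤ x₃ ≡ X
      sum-Y : a₁ * ιℤ y₁ + a₂ * ιℤ y₂ + a₃ * ιℤ y₃ ≡ Y

  rotate : ∀ {L D r X Y} → Covered L D r X Y → Covered L D r X Y
  rotate (covered {x₁} {y₁} {x₂} {y₂} {x₃} {y₃} {a₁} {a₂} {a₃} p q s d a b c er eX eY) =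
    covered q s p (trans (h x₁ y₁ x₂ y₂ x₃ y₃) d) b c a
      (trans (k a₂ a₃ a₁) er) (trans (k (a₂ * ιℤ x₂) (a₃ * ιℤ x₃) (a₁ * ιℤ x₁)) eX)
      (trans (k (a₂ * ιℤ y₂) (a₃ * ιℤ y₃) (a₁ * ιℤ y₁)) eY)
    where
    h : ∀ x₁ y₁ x₂ y₂ x₃ y₃ →
        (x₃ ℤ.- x₂) ℤ.* (y₁ ℤ.- y₂) ℤ.- (y₃ ℤ.- y₂) ℤ.* (x₁ ℤ.- x₂) ≡
        (x₂ ℤ.- x₁) ℤ.* (y₃ ℤ.- y₁) ℤ.- (y₂ ℤ.- y₁) ℤ.* (x₃ ℤ.- x₁)
    h = ℤR.solve-∀
    k : ∀ a b c → a + b + c ≡ c + a + b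
    k = solve-∀ ℚ-ring

  swap : ∀ {L D r X Y} → Covered L D r X Y → Covered L (ℤ.- D) r X Y
  swap (covered {x₁} {y₁} {x₂} {y₂} {x₃} {y₃} {a₁} {a₂} {a₃} p q s d a b c er eX eY) =
    covered p s q (trans (h x₁ y₁ x₂ y₂ x₃ y₃) (cong ℤ.-_ d)) a c b
      (trans (k a₁ a₃ a₂) er) (trans (k (a₁ * ιℤ x₁) (a₃ * ιℤ x₃) (a₂ * ιℤ x₂)) eX)
      (trans (k (a₁ * ιℤ y₁) (a₃ * ιℤ y₃) (a₂ * ιℤ y₂)) eY)
    where
    h : ∀ x₁ y₁ x₂ y₂ x₃ y₃ →
        (x₃ ℤ.- x₁) ℤ.* (y₂ ℤ.- y₁) ℤ.- (y₃ ℤ.- y₁) ℤ.* (x₂ ℤ.- x₁) ≡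
        ℤ.- ((x₂ ℤ.- x₁) ℤ.* (y₃ ℤ.- y₁) ℤ.- (y₂ ℤ.- y₁) ℤ.* (x₃ ℤ.- x₁))
    h = ℤR.solve-∀
    k : ∀ a b c → a + b + c ≡ a + c + b
    k = solve-∀ ℚ-ring

  -- The αᵢ are D times the barycentric coordinates of (x,y), as signed doubled areas.
  module Barycentric {L D r X Y} (T : Covered L D r X Y) (x y : ℤ) where
    open Covered T public

    α₁ α₂ α₃ : ℤ
    α₁ = area x y x₂ y₂ x₃ y₃
    α₂ = area x y x₃ y₃ x₁ y₁
    α₃ = area x y x₁ y₁ x₂ y₂

    α-sum : α₁ ℤ.+ α₂ ℤ.+ α₃ ≡ D
    α-sum = trans (h x y x₁ y₁ x₂ y₂ x₃ y₃) det
      where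
      h : ∀ x y x₁ y₁ x₂ y₂ x₃ y₃ →
          ((x₂ ℤ.- x) ℤ.* (y₃ ℤ.- y) ℤ.- (y₂ ℤ.- y) ℤ.* (x₃ ℤ.- x)) ℤ.+
          ((x₃ ℤ.- x) ℤ.* (y₁ ℤ.- y) ℤ.- (y₃ ℤ.- y) ℤ.* (x₁ ℤ.- x)) ℤ.+
          ((x₁ ℤ.- x) ℤ.* (y₂ ℤ.- y) ℤ.- (y₁ ℤ.- y) ℤ.* (x₂ ℤ.- x)) ≡
          (x₂ ℤ.- x₁) ℤ.* (y₃ ℤ.- y₁) ℤ.- (y₂ ℤ.- y₁) ℤ.* (x₃ ℤ.- x₁)
      h = ℤR.solve-∀

    α-x : α₁ ℤ.* x₁ ℤ.+ α₂ ℤ.* x₂ ℤ.+ α₃ ℤ.* x₃ ≡ D ℤ.* x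
    α-x = trans (h x y x₁ y₁ x₂ y₂ x₃ y₃) (cong (ℤ._* x) det)
      where
      h : ∀ x y x₁ y₁ x₂ y₂ x₃ y₃ →
          ((x₂ ℤ.- x) ℤ.* (y₃ ℤ.- y) ℤ.- (y₂ ℤ.- y) ℤ.* (x₃ ℤ.- x)) ℤ.* x₁ ℤ.+
          ((x₃ ℤ.- x) ℤ.* (y₁ ℤ.- y) ℤ.- (y₃ ℤ.- y) ℤ.* (x₁ ℤ.- x)) ℤ.* x₂ ℤ.+
          ((x₁ ℤ.- x) ℤ.* (y₂ ℤ.- y) ℤ.- (y₁ ℤ.- y) ℤ.* (x₂ ℤ.- x)) ℤ.* x₃ ≡
          ((x₂ ℤ.- x₁) ℤ.* (y₃ ℤ.- y₁) ℤ.- (y₂ ℤ.- y₁) ℤ.* (x₃ ℤ.- x₁)) ℤ.* x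
      h = ℤR.solve-∀

    α-y : α₁ ℤ.* y₁ ℤ.+ α₂ ℤ.* y₂ ℤ.+ α₃ ℤ.* y₃ ≡ D ℤ.* y
    α-y = trans (h x y x₁ y₁ x₂ y₂ x₃ y₃) (cong (ℤ._* y) det)
      where
      h : ∀ x y x₁ y₁ x₂ y₂ x₃ y₃ →
          ((x₂ ℤ.- x) ℤ.* (y₃ ℤ.- y) ℤ.- (y₂ ℤ.- y) ℤ.* (x₃ ℤ.- x)) ℤ.* y₁ ℤ.+
          ((x₃ ℤ.- x) ℤ.* (y₁ ℤ.- y) ℤ.- (y₃ ℤ.- y) ℤ.* (x₁ ℤ.- x)) ℤ.* y₂ ℤ.+
          ((x₁ ℤ.- x) ℤ.* (y₂ ℤ.- y) ℤ.- (y₁ ℤ.- y) ℤ.* (x₂ ℤ.- x)) ℤ.* y₃ ≡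
          ((x₂ ℤ.- x₁) ℤ.* (y₃ ℤ.- y₁) ℤ.- (y₂ ℤ.- y₁) ℤ.* (x₃ ℤ.- x₁)) ℤ.* y
      h = ℤR.solve-∀

    a α : Fin 3 → ℚ
    a 0F = a₁
    a 1F = a₂
    a 2F = a₃
    α 0F = ιℤ α₁
    α 1F = ιℤ α₂
    α 2F = ιℤ α₃

    a≥0 : ∀ i → 0ℚ ≤ a i
    a≥0 0F = a₁≥0
    a≥0 1F = a₂≥0
    a≥0 2F = a₃≥0

    private
      ι-sum : ∀ p q s {d} → p ℤ.+ q ℤ.+ s ≡ d → ιℤ p + ιℤ q + ιℤ s ≡ ιℤ d
      ι-sum p q s e = trans (sym (trans (ι-+ (p ℤ.+ q) s) (cong (_+ ιℤ s) (ι-+ p q)))) (cong ιℤ e)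

      ι-weighted : ∀ p q s b c d {z} → p ℤ.* b ℤ.+ q ℤ.* c ℤ.+ s ℤ.* d ≡ D ℤ.* z →
                   ιℤ p * ιℤ b + ιℤ q * ιℤ c + ιℤ s * ιℤ d ≡ ιℤ D * ιℤ z
      ι-weighted p q s b c d {z} e = trans (sym (cong₂ _+_ (cong₂ _+_ (ι-* p b) (ι-* q c)) (ι-* s d)))
        (trans (ι-sum (p ℤ.* b) (q ℤ.* c) (s ℤ.* d) e) (ι-* D z))

    α-sumℚ : α 0F + α 1F + α 2F ≡ ιℤ D
    α-sumℚ = ι-sum α₁ α₂ α₃ α-sum

    α-xℚ : α 0F * ιℤ x₁ + α 1F * ιℤ x₂ + α 2F * ιℤ x₃ ≡ ιℤ D * ιℤ x
    α-xℚ = ι-weighted α₁ α₂ α₃ x₁ x₂ x₃ α-x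

    α-yℚ : α 0F * ιℤ y₁ + α 1F * ιℤ y₂ + α 2F * ιℤ y₃ ≡ ιℤ D * ιℤ y
    α-yℚ = ι-weighted α₁ α₂ α₃ y₁ y₂ y₃ α-y

  -- Moving by `κ` along the relation D (x,y) = α₁ p₁ + α₂ p₂ + α₃ p₃ uses up the weight of p₁,
  -- whose place (x,y) takes. The determinant of the new triangle is α₁ by definition.
  exchange : ∀ {L D r X Y} (T : Covered L D r X Y) {x y c} → L x y → (let open Barycentric T x y) →
             ∀ κ → a₁ ≡ κ * α 0F → 0ℚ ≤ c + κ * ιℤ D → 0ℚ ≤ a₂ - κ * α 1F → 0ℚ ≤ a₃ - κ * α 2F →
             Covered L α₁ (r + c) (X + c * ιℤ x) (Y + c * ιℤ y)
  exchange {L} {D} {r} {X} {Y} T {x} {y} {c} p κ e b₁ b₂ b₃ =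
    covered {x₁ = x} {y} {x₂} {y₂} {x₃} {y₃} {c + κ * ιℤ D} {a₂ - κ * α 1F} {a₃ - κ * α 2F}
      p p₂∈ p₃∈ refl b₁ b₂ b₃
      (trans (h₀ c κ (ιℤ D) (α 0F) (α 1F) (α 2F) a₁ a₂ a₃ e α-sumℚ) (cong (_+ c) sum-r))
      (trans (h c κ (ιℤ D) (α 0F) (α 1F) (α 2F) a₁ a₂ a₃ (ιℤ x₁) (ιℤ x₂) (ιℤ x₃) (ιℤ x) e α-xℚ) (cong (_+ c * ιℤ x) sum-X))
      (trans (h c κ (ιℤ D) (α 0F) (α 1F) (α 2F) a₁ a₂ a₃ (ιℤ y₁) (ιℤ y₂) (ιℤ y₃) (ιℤ y) e α-yℚ) (cong (_+ c * ιℤ y) sum-Y))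
    where
    open Barycentric T x y
    h₀ : ∀ c κ D α₁ α₂ α₃ a₁ a₂ a₃ → a₁ ≡ κ * α₁ → α₁ + α₂ + α₃ ≡ D →
         c + κ * D + (a₂ - κ * α₂) + (a₃ - κ * α₃) ≡ a₁ + a₂ + a₃ + c
    h₀ c κ _ α₁ α₂ α₃ _ a₂ a₃ refl refl = k c κ α₁ α₂ α₃ a₂ a₃
      where
      k : ∀ c κ α₁ α₂ α₃ a₂ a₃ → c + κ * (α₁ + α₂ + α₃) + (a₂ - κ * α₂) + (a₃ - κ * α₃) ≡ κ * α₁ + a₂ + a₃ + c
      k = solve-∀ ℚ-ring
    h : ∀ c κ D α₁ α₂ α₃ a₁ a₂ a₃ x₁ x₂ x₃ x → a₁ ≡ κ * α₁ → α₁ * x₁ + α₂ * x₂ + α₃ * x₃ ≡ D * x →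
        (c + κ * D) * x + (a₂ - κ * α₂) * x₂ + (a₃ - κ * α₃) * x₃ ≡ a₁ * x₁ + a₂ * x₂ + a₃ * x₃ + c * x
    h c κ D α₁ α₂ α₃ _ a₂ a₃ x₁ x₂ x₃ x refl f =
      trans (k c κ D α₂ α₃ a₂ a₃ x₂ x₃ x) (trans (cong (λ u → c * x + κ * u + (a₂ - κ * α₂) * x₂ + (a₃ - κ * α₃) * x₃) (sym f))
        (k′ c κ α₁ α₂ α₃ a₂ a₃ x₁ x₂ x₃ x))
      where
      k : ∀ c κ D α₂ α₃ a₂ a₃ x₂ x₃ x → (c + κ * D) * x + (a₂ - κ * α₂) * x₂ + (a₃ - κ * α₃) * x₃ ≡
          c * x + κ * (D * x) + (a₂ - κ * α₂) * x₂ + (a₃ - κ * α₃) * x₃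
      k = solve-∀ ℚ-ring
      k′ : ∀ c κ α₁ α₂ α₃ a₂ a₃ x₁ x₂ x₃ x →
           c * x + κ * (α₁ * x₁ + α₂ * x₂ + α₃ * x₃) + (a₂ - κ * α₂) * x₂ + (a₃ - κ * α₃) * x₃ ≡
           κ * α₁ * x₁ + a₂ * x₂ + a₃ * x₃ + c * x
      k′ = solve-∀ ℚ-ring

  exchange-at : ∀ {L D r X Y} (T : Covered L D r X Y) {x y c} → L x y → (let open Barycentric T x y) →
                ∀ i κ → a i ≡ κ * α i → 0ℚ ≤ c + κ * ιℤ D → (∀ j → 0ℚ ≤ a j - κ * α j) →
                ∃ λ A → ιℤ A ≡ α i × (A ≡ α₁ ⊎ (A ≡ α₂ ⊎ A ≡ α₃)) ×
                        Covered L A (r + c) (X + c * ιℤ x) (Y + c * ιℤ y)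
  exchange-at T {x} {y} {c} p 0F κ e b₁ b = α₁ , refl , inj₁ refl , exchange T {x} {y} {c} p κ e b₁ (b 1F) (b 2F)
    where open Barycentric T x y
  exchange-at T {x} {y} {c} p 1F κ e b₁ b = α₂ , refl , inj₂ (inj₁ refl) , exchange (rotate T) {x} {y} {c} p κ e b₁ (b 2F) (b 0F)
    where open Barycentric T x y
  exchange-at T {x} {y} {c} p 2F κ e b₁ b = α₃ , refl , inj₂ (inj₂ refl) , exchange (rotate (rotate T)) {x} {y} {c} p κ e b₁ (b 0F) (b 1F)
    where open Barycentric T x y

  Positive : (ℤ → ℤ → Set) → ℚ → ℚ → ℚ → Set
  Positive L r X Y = ∃ λ D → 0ℤ ℤ.≤ D ℤ.- 1ℤ × Covered L D r X Y

  ι-pos⁻¹ : ∀ {A} → 0ℚ < ιℤ A → 0ℤ ℤ.≤ A ℤ.- 1ℤ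
  ι-pos⁻¹ {A} p = go (split₁ A)
    where
    go : _ → 0ℤ ℤ.≤ A ℤ.- 1ℤ
    go (inj₁ q) = q
    go (inj₂ q) = ⊥-elim (pos≰0 p (ι-mono q by ι-neg A))

  ≥1⇒ι-pos : ∀ {A} → 0ℤ ℤ.≤ A ℤ.- 1ℤ → 0ℚ < ιℤ A
  ≥1⇒ι-pos {A} p = ι-pos {A} (ℤP.0≤i-j⇒j≤i p)

  -- Carathéodory's theorem in the plane, one point at a time. Adding c (x,y) changes the weights by
  -- (c / D) αᵢ. If one of them would become negative, the first to reach zero names the vertex to
  -- replace, and what is left of `c` becomes the weight of (x,y). That αᵢ is negative, so the
  -- orientation is restored by `swap`.
  enlarge : ∀ {L r X Y} → Positive L r X Y → ∀ {x y c} → 0ℚ ≤ c → L x y →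
            Positive L (r + c) (X + c * ιℤ x) (Y + c * ιℤ y)
  enlarge {L} {r} {X} {Y} (D , D≥1 , T) {x} {y} {c} c≥0 p =
      go (minimal-ratio a (λ j → - α j) a≥0)
    where
    open Barycentric T x y
    inv = pos⇒inverse (ιℤ D) (≥1⇒ι-pos {D} D≥1)
    d = proj₁ inv
    d>0 = proj₁ (proj₂ inv)
    c′ = c * d
    c′≥0 : 0ℚ ≤ c′
    c′≥0 = c≥0 ⊛ ℚP.<⇒≤ d>0
    c′D : c′ * ιℤ D ≡ c
    c′D = trans (ℚP.*-assoc c d (ιℤ D)) (trans (cong (c *_) (proj₂ (proj₂ inv))) (ℚP.*-identityʳ c))
    keep : (∀ j → 0ℚ ≤ a j + c′ * α j) → Positive L (r + c) (X + c * ιℤ x) (Y + c * ιℤ y)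
    keep b = D , D≥1 , covered p₁∈ p₂∈ p₃∈ det (b 0F) (b 1F) (b 2F)
        (trans (k a₁ a₂ a₃ c′ (α 0F) (α 1F) (α 2F))
          (cong₂ _+_ sum-r (trans (cong (c′ *_) α-sumℚ) c′D)))
        (trans (k′ a₁ a₂ a₃ c′ (α 0F) (α 1F) (α 2F) (ιℤ x₁) (ιℤ x₂) (ιℤ x₃))
          (cong₂ _+_ sum-X (trans (cong (c′ *_) α-xℚ) (trans (sym (ℚP.*-assoc c′ (ιℤ D) (ιℤ x))) (cong (_* ιℤ x) c′D)))))
        (trans (k′ a₁ a₂ a₃ c′ (α 0F) (α 1F) (α 2F) (ιℤ y₁) (ιℤ y₂) (ιℤ y₃))
          (cong₂ _+_ sum-Y (trans (cong (c′ *_) α-yℚ) (trans (sym (ℚP.*-assoc c′ (ιℤ D) (ιℤ y))) (cong (_* ιℤ y) c′D)))))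
      where
      k : ∀ a₁ a₂ a₃ c p q s → a₁ + c * p + (a₂ + c * q) + (a₃ + c * s) ≡ a₁ + a₂ + a₃ + c * (p + q + s)
      k = solve-∀ ℚ-ring
      k′ : ∀ a₁ a₂ a₃ c p q s x y z → (a₁ + c * p) * x + (a₂ + c * q) * y + (a₃ + c * s) * z ≡
           a₁ * x + a₂ * y + a₃ * z + c * (p * x + q * y + s * z)
      k′ = solve-∀ ℚ-ring
    neg-neg : ∀ a → - (- a) ≡ a
    neg-neg = solve-∀ ℚ-ring
    k₁ : ∀ x κ b → x - κ * - b ≡ x + κ * b
    k₁ = solve-∀ ℚ-ring
    k₂ : ∀ x κ b → x - κ * - b ≡ x - - κ * b
    k₂ = solve-∀ ℚ-ring
    k₃ : ∀ κ b → κ * - b ≡ - κ * b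
    k₃ = solve-∀ ℚ-ring
    go : _ → Positive L (r + c) (X + c * ιℤ x) (Y + c * ιℤ y)
    go (inj₁ all≥0) = keep λ j → a≥0 j ⊹ (c′≥0 ⊛ (all≥0 j by neg-neg (α j)))
    go (inj₂ (i , κ , κ≥0 , αi<0 , e , b)) = compare (nonneg? (c′ - κ))
      where
      compare : _ → Positive L (r + c) (X + c * ιℤ x) (Y + c * ιℤ y)
      compare (inj₂ q) = keep λ j → affine-between {a j} { - α j} {κ} {c′} (a≥0 j) (b j) c′≥0 (ℚP.<⇒≤ q by k₄ c′ κ) by k₁ (a j) c′ (α j)
        where
        k₄ : ∀ a b → - (a - b) ≡ b - a
        k₄ = solve-∀ ℚ-ring
      compare (inj₁ q) = flip (exchange-at T {x} {y} {c} p i (- κ) (trans e (k₃ κ (α i)))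
          ((q ⊛ ℚP.<⇒≤ (≥1⇒ι-pos {D} D≥1)) by trans (k₅ c′ κ (ιℤ D)) (cong (_+ - κ * ιℤ D) c′D))
          (λ j → b j by k₂ (a j) κ (α j)))
        where
        k₅ : ∀ c κ D → (c - κ) * D ≡ c * D + - κ * D
        k₅ = solve-∀ ℚ-ring
        flip : _ → Positive L (r + c) (X + c * ιℤ x) (Y + c * ιℤ y)
        flip (A , A≡ , _ , T′) = ℤ.- A , ι-pos⁻¹ { ℤ.- A} (αi<0 <by trans (cong -_ (sym A≡)) (sym (ι-neg A))) , swap T′

  residue : ∀ D a → 0ℤ ℤ.≤ D ℤ.- 1ℤ → ∃ λ q → ∃ λ s → a ≡ s ℤ.+ q ℤ.* D × 0ℤ ℤ.≤ s × 0ℤ ℤ.≤ D ℤ.- 1ℤ ℤ.- s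
  residue (+ zero) a ()
  residue (+ suc n) a _ = a ℤDM./ℕ suc n , + (a ℤDM.%ℕ suc n) , ℤDM.a≡a%ℕn+[a/ℕn]*n a (suc n) , +≥0 _ ,
    (ℤP.i≤j⇒0≤j-i (ℤ.+≤+ (ℕP.≤-pred (ℤDM.n%ℕd<d a (suc n)))))
  residue -[1+ n ] a ()

  module _ {L} (P : Polygon L) where

    -- The triangles that (x,y) spans with the sides cover the whole. The ratio test selects one
    -- that contains the given point and has positive determinant αᵢ.
    split-at : ∀ {D r X Y} → 0ℤ ℤ.≤ D ℤ.- 1ℤ → (T : Covered L D r X Y) → ∀ x y → (let open Barycentric T x y) →
               0ℤ ℤ.≤ α₁ → 0ℤ ℤ.≤ α₂ → 0ℤ ℤ.≤ α₃ →
               0ℤ ℤ.≤ D ℤ.- 1ℤ ℤ.- α₁ → 0ℤ ℤ.≤ D ℤ.- 1ℤ ℤ.- α₂ → 0ℤ ℤ.≤ D ℤ.- 1ℤ ℤ.- α₃ →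
               ∃ λ A → 0ℤ ℤ.≤ A ℤ.- 1ℤ × 0ℤ ℤ.≤ D ℤ.- 1ℤ ℤ.- A × Covered L A r X Y
    split-at {D} {r} {X} {Y} D≥1 T x y α₁≥0 α₂≥0 α₃≥0 α₁<D α₂<D α₃<D = go (minimal-ratio a α a≥0)
      where
      open Barycentric T x y
      q∈ : L x y
      q∈ = conv P D α₁ α₂ α₃ x₁ y₁ x₂ y₂ x₃ y₃ x y D≥1 α₁≥0 α₂≥0 α₃≥0 p₁∈ p₂∈ p₃∈ α-sum α-x α-y
      go : _ → _
      go (inj₁ none) = ⊥-elim (pos≰0 (≥1⇒ι-pos {D} D≥1)
          (none 0F ⊹ none 1F ⊹ none 2F by trans (k (α 0F) (α 1F) (α 2F)) (cong -_ α-sumℚ)))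
        where
        k : ∀ a b c → - a + - b + - c ≡ - (a + b + c)
        k = solve-∀ ℚ-ring
      go (inj₂ (i , κ , κ≥0 , αi>0 , e , b)) = finish (exchange-at T {x} {y} {0ℚ} q∈ i κ e
          (κ≥0 ⊛ ℚP.<⇒≤ (≥1⇒ι-pos {D} D≥1) by sym (ℚP.+-identityˡ _)) b)
        where
        plus0 : ∀ r x → r + 0ℚ * x ≡ r
        plus0 = solve-∀ ℚ-ring
        transport : ∀ {A r r′ X X′ Y Y′} → r ≡ r′ → X ≡ X′ → Y ≡ Y′ → Covered L A r X Y → Covered L A r′ X′ Y′
        transport refl refl refl T = T
        smaller : ∀ {A} → (A ≡ α₁ ⊎ (A ≡ α₂ ⊎ A ≡ α₃)) → 0ℤ ℤ.≤ D ℤ.- 1ℤ ℤ.- A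
        smaller (inj₁ refl) = α₁<D
        smaller (inj₂ (inj₁ refl)) = α₂<D
        smaller (inj₂ (inj₂ refl)) = α₃<D
        finish : _ → _
        finish (A , A≡ , which , T′) = A , ι-pos⁻¹ {A} (αi>0 <by sym A≡) , smaller which ,
          transport (ℚP.+-identityʳ r) (plus0 X (ιℤ x)) (plus0 Y (ιℤ y)) T′

    -- Two sides of determinant at least 2 span a proper sublattice, which misses one of the unit
    -- vectors; this vector modulo the sides provides the point at which to subdivide.
    find-smaller : ∀ {D r X Y} → 0ℤ ℤ.≤ D ℤ.- 1ℤ → 0ℤ ℤ.≤ D ℤ.- 1ℤ ℤ.- 1ℤ → Covered L D r X Y →
                   ∃ λ A → 0ℤ ℤ.≤ A ℤ.- 1ℤ × 0ℤ ℤ.≤ D ℤ.- 1ℤ ℤ.- A × Covered L A r X Y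
    find-smaller {D} {r} {X} {Y} D≥1 D≥2 T = pick (try 1ℤ 0ℤ) (try 0ℤ 1ℤ)
      where
      open Covered T
      fx fy gx gy : ℤ
      fx = x₂ ℤ.- x₁
      fy = y₂ ℤ.- y₁
      gx = x₃ ℤ.- x₁
      gy = y₃ ℤ.- y₁
      Smaller : Set
      Smaller = ∃ λ A → 0ℤ ℤ.≤ A ℤ.- 1ℤ × 0ℤ ℤ.≤ D ℤ.- 1ℤ ℤ.- A × Covered L A r X Y
      Multiple : ℤ → ℤ → Set
      Multiple zx zy = ∃ λ q → ∃ λ s → zx ℤ.* gy ℤ.- zy ℤ.* gx ≡ q ℤ.* D × fx ℤ.* zy ℤ.- fy ℤ.* zx ≡ s ℤ.* D

      -- A lattice vector z has barycentric coordinates in (1/D)ℤ; its fractional part, or the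
      -- reflection of that in the centre of the parallelogram, lies in the triangle.
      try : ∀ zx zy → Smaller ⊎ Multiple zx zy
      try zx zy = go (residue D (zx ℤ.* gy ℤ.- zy ℤ.* gx) D≥1) (residue D (fx ℤ.* zy ℤ.- fy ℤ.* zx) D≥1)
        where
        go : _ → _ → Smaller ⊎ Multiple zx zy
        go (q , a , ea , a≥0 , a<D) (s , b , eb , b≥0 , b<D) = cases (split₁ a) (split₁ b) (split (D ℤ.- a ℤ.- b))
          where
          x y x′ y′ : ℤ
          x = x₁ ℤ.+ zx ℤ.- q ℤ.* fx ℤ.- s ℤ.* gx
          y = y₁ ℤ.+ zy ℤ.- q ℤ.* fy ℤ.- s ℤ.* gy
          x′ = x₂ ℤ.+ x₃ ℤ.- x
          y′ = y₂ ℤ.+ y₃ ℤ.- y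
          open Barycentric T x y using (α₁; α₂; α₃; α-sum)
          open Barycentric T x′ y′ using () renaming (α₁ to α₁′; α₂ to α₂′; α₃ to α₃′)
          α₂≡ : α₂ ≡ a
          α₂≡ = trans (h x₁ y₁ x₂ y₂ x₃ y₃ zx zy q s)
                 (trans (cong₂ (λ u v → u ℤ.- q ℤ.* v) ea det) (k a q D))
            where
            h : ∀ x₁ y₁ x₂ y₂ x₃ y₃ zx zy q s →
              (x₃ ℤ.- (x₁ ℤ.+ zx ℤ.- q ℤ.* (x₂ ℤ.- x₁) ℤ.- s ℤ.* (x₃ ℤ.- x₁))) ℤ.* (y₁ ℤ.- (y₁ ℤ.+ zy ℤ.- q ℤ.* (y₂ ℤ.- y₁) ℤ.- s ℤ.* (y₃ ℤ.- y₁)))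
              ℤ.- (y₃ ℤ.- (y₁ ℤ.+ zy ℤ.- q ℤ.* (y₂ ℤ.- y₁) ℤ.- s ℤ.* (y₃ ℤ.- y₁))) ℤ.* (x₁ ℤ.- (x₁ ℤ.+ zx ℤ.- q ℤ.* (x₂ ℤ.- x₁) ℤ.- s ℤ.* (x₃ ℤ.- x₁))) ≡
              (zx ℤ.* (y₃ ℤ.- y₁) ℤ.- zy ℤ.* (x₃ ℤ.- x₁)) ℤ.- q ℤ.* ((x₂ ℤ.- x₁) ℤ.* (y₃ ℤ.- y₁) ℤ.- (y₂ ℤ.- y₁) ℤ.* (x₃ ℤ.- x₁))
            h = ℤR.solve-∀
            k : ∀ a q D → (a ℤ.+ q ℤ.* D) ℤ.- q ℤ.* D ≡ a
            k = ℤR.solve-∀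
          α₃≡ : α₃ ≡ b
          α₃≡ = trans (h x₁ y₁ x₂ y₂ x₃ y₃ zx zy q s)
                 (trans (cong₂ (λ u v → u ℤ.- s ℤ.* v) eb det) (k b s D))
            where
            h : ∀ x₁ y₁ x₂ y₂ x₃ y₃ zx zy q s →
              (x₁ ℤ.- (x₁ ℤ.+ zx ℤ.- q ℤ.* (x₂ ℤ.- x₁) ℤ.- s ℤ.* (x₃ ℤ.- x₁))) ℤ.* (y₂ ℤ.- (y₁ ℤ.+ zy ℤ.- q ℤ.* (y₂ ℤ.- y₁) ℤ.- s ℤ.* (y₃ ℤ.- y₁)))
              ℤ.- (y₁ ℤ.- (y₁ ℤ.+ zy ℤ.- q ℤ.* (y₂ ℤ.- y₁) ℤ.- s ℤ.* (y₃ ℤ.- y₁))) ℤ.* (x₂ ℤ.- (x₁ ℤ.+ zx ℤ.- q ℤ.* (x₂ ℤ.- x₁) ℤ.- s ℤ.* (x₃ ℤ.- x₁))) ≡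
              ((x₂ ℤ.- x₁) ℤ.* zy ℤ.- (y₂ ℤ.- y₁) ℤ.* zx) ℤ.- s ℤ.* ((x₂ ℤ.- x₁) ℤ.* (y₃ ℤ.- y₁) ℤ.- (y₂ ℤ.- y₁) ℤ.* (x₃ ℤ.- x₁))
            h = ℤR.solve-∀
            k : ∀ a q D → (a ℤ.+ q ℤ.* D) ℤ.- q ℤ.* D ≡ a
            k = ℤR.solve-∀
          α₁≡ : α₁ ≡ D ℤ.- a ℤ.- b
          α₁≡ = trans (h α₁ α₂ α₃) (trans (cong (λ u → u ℤ.- α₂ ℤ.- α₃) α-sum) (cong₂ (λ u v → D ℤ.- u ℤ.- v) α₂≡ α₃≡))
            where
            h : ∀ a b c → a ≡ a ℤ.+ b ℤ.+ c ℤ.- b ℤ.- c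
            h = ℤR.solve-∀
          reflected : ∀ x₁ y₁ x₂ y₂ x₃ y₃ x y →
            ((x₂ ℤ.- (x₂ ℤ.+ x₃ ℤ.- x)) ℤ.* (y₃ ℤ.- (y₂ ℤ.+ y₃ ℤ.- y)) ℤ.- (y₂ ℤ.- (y₂ ℤ.+ y₃ ℤ.- y)) ℤ.* (x₃ ℤ.- (x₂ ℤ.+ x₃ ℤ.- x)))
              ≡ ℤ.- ((x₂ ℤ.- x) ℤ.* (y₃ ℤ.- y) ℤ.- (y₂ ℤ.- y) ℤ.* (x₃ ℤ.- x))
          reflected = ℤR.solve-∀
          reflected₂ : ∀ x₁ y₁ x₂ y₂ x₃ y₃ x y →
            ((x₃ ℤ.- (x₂ ℤ.+ x₃ ℤ.- x)) ℤ.* (y₁ ℤ.- (y₂ ℤ.+ y₃ ℤ.- y)) ℤ.- (y₃ ℤ.- (y₂ ℤ.+ y₃ ℤ.- y)) ℤ.* (x₁ ℤ.- (x₂ ℤ.+ x₃ ℤ.- x)))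
              ≡ ((x₂ ℤ.- x₁) ℤ.* (y₃ ℤ.- y₁) ℤ.- (y₂ ℤ.- y₁) ℤ.* (x₃ ℤ.- x₁)) ℤ.- ((x₃ ℤ.- x) ℤ.* (y₁ ℤ.- y) ℤ.- (y₃ ℤ.- y) ℤ.* (x₁ ℤ.- x))
          reflected₂ = ℤR.solve-∀
          reflected₃ : ∀ x₁ y₁ x₂ y₂ x₃ y₃ x y →
            ((x₁ ℤ.- (x₂ ℤ.+ x₃ ℤ.- x)) ℤ.* (y₂ ℤ.- (y₂ ℤ.+ y₃ ℤ.- y)) ℤ.- (y₁ ℤ.- (y₂ ℤ.+ y₃ ℤ.- y)) ℤ.* (x₂ ℤ.- (x₂ ℤ.+ x₃ ℤ.- x)))
              ≡ ((x₂ ℤ.- x₁) ℤ.* (y₃ ℤ.- y₁) ℤ.- (y₂ ℤ.- y₁) ℤ.* (x₃ ℤ.- x₁)) ℤ.- ((x₁ ℤ.- x) ℤ.* (y₂ ℤ.- y) ℤ.- (y₁ ℤ.- y) ℤ.* (x₂ ℤ.- x))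
          reflected₃ = ℤR.solve-∀
          α₁′≡ : α₁′ ≡ ℤ.- (D ℤ.- a ℤ.- b)
          α₁′≡ = trans (reflected x₁ y₁ x₂ y₂ x₃ y₃ x y) (cong ℤ.-_ α₁≡)
          α₂′≡ : α₂′ ≡ D ℤ.- a
          α₂′≡ = trans (reflected₂ x₁ y₁ x₂ y₂ x₃ y₃ x y) (cong₂ ℤ._-_ det α₂≡)
          α₃′≡ : α₃′ ≡ D ℤ.- b
          α₃′≡ = trans (reflected₃ x₁ y₁ x₂ y₂ x₃ y₃ x y) (cong₂ ℤ._-_ det α₃≡)

          inside : 0ℤ ℤ.≤ a ℤ.+ b ℤ.- 1ℤ → 0ℤ ℤ.≤ D ℤ.- a ℤ.- b → Smaller
          inside p c = split-at D≥1 T x y (c byᶻ sym α₁≡) (a≥0 byᶻ sym α₂≡) (b≥0 byᶻ sym α₃≡)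
              (p byᶻ trans (k D a b) (cong (λ u → D ℤ.- 1ℤ ℤ.- u) (sym α₁≡)))
              (a<D byᶻ cong (λ u → D ℤ.- 1ℤ ℤ.- u) (sym α₂≡)) (b<D byᶻ cong (λ u → D ℤ.- 1ℤ ℤ.- u) (sym α₃≡))
            where
            k : ∀ D a b → a ℤ.+ b ℤ.- 1ℤ ≡ D ℤ.- 1ℤ ℤ.- (D ℤ.- a ℤ.- b)
            k = ℤR.solve-∀
          k₁ : ∀ a b → a ℤ.- 1ℤ ℤ.+ b ≡ a ℤ.+ b ℤ.- 1ℤ
          k₁ = ℤR.solve-∀
          k₂ : ∀ a b → a ℤ.+ (b ℤ.- 1ℤ) ≡ a ℤ.+ b ℤ.- 1ℤ
          k₂ = ℤR.solve-∀
          outside : 0ℤ ℤ.≤ ℤ.- (D ℤ.- a ℤ.- b) ℤ.- 1ℤ → Smaller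
          outside c = split-at D≥1 T x′ y′
              (≥1⇒≥0 { ℤ.- (D ℤ.- a ℤ.- b)} c byᶻ sym α₁′≡)
              (≥1⇒≥0 {D ℤ.- a} (a<D byᶻ k₃ D a) byᶻ sym α₂′≡)
              (≥1⇒≥0 {D ℤ.- b} (b<D byᶻ k₃ D b) byᶻ sym α₃′≡)
              (a<D ⊹ᶻ b<D ⊹ᶻ 0≤1ᶻ byᶻ trans (k₄ D a b) (cong (λ u → D ℤ.- 1ℤ ℤ.- u) (sym α₁′≡)))
              (c ⊹ᶻ b<D ⊹ᶻ 0≤1ᶻ byᶻ trans (k₅ D a b) (cong (λ u → D ℤ.- 1ℤ ℤ.- u) (sym α₂′≡)))
              (c ⊹ᶻ a<D ⊹ᶻ 0≤1ᶻ byᶻ trans (k₆ D a b) (cong (λ u → D ℤ.- 1ℤ ℤ.- u) (sym α₃′≡)))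
            where
            k₃ : ∀ D a → D ℤ.- 1ℤ ℤ.- a ≡ D ℤ.- a ℤ.- 1ℤ
            k₃ = ℤR.solve-∀
            k₄ : ∀ D a b → (D ℤ.- 1ℤ ℤ.- a) ℤ.+ (D ℤ.- 1ℤ ℤ.- b) ℤ.+ 1ℤ ≡ D ℤ.- 1ℤ ℤ.- ℤ.- (D ℤ.- a ℤ.- b)
            k₄ = ℤR.solve-∀
            k₅ : ∀ D a b → ℤ.- (D ℤ.- a ℤ.- b) ℤ.- 1ℤ ℤ.+ (D ℤ.- 1ℤ ℤ.- b) ℤ.+ 1ℤ ≡ D ℤ.- 1ℤ ℤ.- (D ℤ.- a)
            k₅ = ℤR.solve-∀
            k₆ : ∀ D a b → ℤ.- (D ℤ.- a ℤ.- b) ℤ.- 1ℤ ℤ.+ (D ℤ.- 1ℤ ℤ.- a) ℤ.+ 1ℤ ≡ D ℤ.- 1ℤ ℤ.- (D ℤ.- b)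
            k₆ = ℤR.solve-∀
          cases : _ → _ → _ → Smaller ⊎ Multiple zx zy
          cases _ _ (inj₂ c) = inj₁ (outside c)
          cases (inj₁ a≥1) _ (inj₁ c) = inj₁ (inside (a≥1 ⊹ᶻ b≥0 byᶻ k₁ a b) c)
          cases (inj₂ a≤0) (inj₁ b≥1) (inj₁ c) = inj₁ (inside (a≥0 ⊹ᶻ b≥1 byᶻ k₂ a b) c)
          cases (inj₂ a≤0) (inj₂ b≤0) (inj₁ c) = inj₂ (q , s ,
            trans ea (trans (cong (ℤ._+ q ℤ.* D) (squeeze a≥0 a≤0)) (ℤP.+-identityˡ _)) ,
            trans eb (trans (cong (ℤ._+ s ℤ.* D) (squeeze b≥0 b≤0)) (ℤP.+-identityˡ _)))

      pick : Smaller ⊎ Multiple 1ℤ 0ℤ → Smaller ⊎ Multiple 0ℤ 1ℤ → Smaller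
      pick (inj₁ p) _ = p
      pick (inj₂ _) (inj₁ p) = p
      pick (inj₂ (q , s , e₁ , e₂)) (inj₂ (q′ , s′ , e₃ , e₄)) = ⊥-elim (not-unit (split m))
        where
        -- The determinant of the unit vectors written in the sides. It would be an inverse of D,
        -- which `factor` states after multiplication by D.
        m = s′ ℤ.* q ℤ.- s ℤ.* q′
        factor : D ≡ D ℤ.* (m ℤ.* D)
        factor = trans (sym det) (trans (k fx fy gx gy)
            (trans (cong₂ ℤ._-_ (cong₂ ℤ._*_ e₄ e₁) (cong₂ ℤ._*_ e₂ e₃)) (k′ s′ q s q′ D)))
          where
          k : ∀ fx fy gx gy → fx ℤ.* gy ℤ.- fy ℤ.* gx ≡
              (fx ℤ.* 1ℤ ℤ.- fy ℤ.* 0ℤ) ℤ.* (1ℤ ℤ.* gy ℤ.- 0ℤ ℤ.* gx) ℤ.- (fx ℤ.* 0ℤ ℤ.- fy ℤ.* 1ℤ) ℤ.* (0ℤ ℤ.* gy ℤ.- 1ℤ ℤ.* gx)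
          k = ℤR.solve-∀
          k′ : ∀ a b c d D → (a ℤ.* D) ℤ.* (b ℤ.* D) ℤ.- (c ℤ.* D) ℤ.* (d ℤ.* D) ≡ D ℤ.* ((a ℤ.* b ℤ.- c ℤ.* d) ℤ.* D)
          k′ = ℤR.solve-∀
        not-unit : 0ℤ ℤ.≤ m ⊎ 0ℤ ℤ.≤ ℤ.- m ℤ.- 1ℤ → ⊥
        not-unit (inj₂ p) = absurdᶻ (D≥1 ⊹ᶻ (≥1⇒≥0 {D} D≥1 ⊛ᶻ (≥1⇒≥0 { ℤ.- m} p ⊛ᶻ ≥1⇒≥0 {D} D≥1)))
            (trans (k D m) (trans (cong (λ u → D ℤ.- 1ℤ ℤ.- u) (sym factor)) (k′ D)))
          where
          k : ∀ D m → D ℤ.- 1ℤ ℤ.+ D ℤ.* (ℤ.- m ℤ.* D) ≡ D ℤ.- 1ℤ ℤ.- D ℤ.* (m ℤ.* D)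
          k = ℤR.solve-∀
          k′ : ∀ D → D ℤ.- 1ℤ ℤ.- D ≡ ℤ.- 1ℤ
          k′ = ℤR.solve-∀
        not-unit (inj₁ m≥0) = positive (split₁ m)
          where
          positive : _ → ⊥
          positive (inj₂ m≤0) = absurdᶻ D≥1 (trans (cong (ℤ._- 1ℤ) (trans factor (trans (cong (λ u → D ℤ.* (u ℤ.* D)) (squeeze m≥0 m≤0)) (ℤP.*-zeroʳ D)))) refl)
          positive (inj₁ m≥1) = absurdᶻ
              ((≥1⇒≥0 {D} D≥1 ⊛ᶻ D≥2) ⊹ᶻ (≥1⇒≥0 {D} D≥1 ⊛ᶻ (m≥1 ⊛ᶻ ≥1⇒≥0 {D} D≥1)) ⊹ᶻ D≥1)
              (trans (k D m) (trans (cong (λ u → u ℤ.- D ℤ.- 1ℤ) (sym factor)) (k′ D)))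
            where
            k : ∀ D m → D ℤ.* (D ℤ.- 1ℤ ℤ.- 1ℤ) ℤ.+ D ℤ.* ((m ℤ.- 1ℤ) ℤ.* D) ℤ.+ (D ℤ.- 1ℤ) ≡ D ℤ.* (m ℤ.* D) ℤ.- D ℤ.- 1ℤ
            k = ℤR.solve-∀
            k′ : ∀ D → D ℤ.- D ℤ.- 1ℤ ≡ ℤ.- 1ℤ
            k′ = ℤR.solve-∀

    -- `n` bounds D - 1 and makes the descent structural.
    shrink : ∀ n {D r X Y} → 0ℤ ℤ.≤ D ℤ.- 1ℤ → 0ℤ ℤ.≤ + n ℤ.- (D ℤ.- 1ℤ) → Covered L D r X Y → Covered L 1ℤ r X Y
    shrink n {D} {r} {X} {Y} D≥1 fuel T = go n fuel (split₁ (D ℤ.- 1ℤ))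
      where
      go : ∀ n → 0ℤ ℤ.≤ + n ℤ.- (D ℤ.- 1ℤ) → 0ℤ ℤ.≤ D ℤ.- 1ℤ ℤ.- 1ℤ ⊎ 0ℤ ℤ.≤ ℤ.- (D ℤ.- 1ℤ) → Covered L 1ℤ r X Y
      go _ _ (inj₂ p) = subst (λ D → Covered L D r X Y) (ℤP.i-j≡0⇒i≡j D 1ℤ (squeeze D≥1 p)) T
      go zero fuel (inj₁ p) = ⊥-elim (clash p (fuel byᶻ ℤP.+-identityˡ (ℤ.- (D ℤ.- 1ℤ))))
      go (suc n) fuel (inj₁ p) = next (find-smaller D≥1 p T)
        where
        next : _ → Covered L 1ℤ r X Y
        next (A , A≥1 , A<D , T′) = shrink n A≥1 (fuel ⊹ᶻ A<D byᶻ h (+ n) D A) T′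
          where
          h : ∀ n D A → (1ℤ ℤ.+ n ℤ.- (D ℤ.- 1ℤ)) ℤ.+ (D ℤ.- 1ℤ ℤ.- A) ≡ n ℤ.- (A ℤ.- 1ℤ)
          h = ℤR.solve-∀

    unimodular : ∀ {r X Y} → Positive L r X Y → Covered L 1ℤ r X Y
    unimodular {r} {X} {Y} (D , D≥1 , T) = shrink ∣ D ∣ D≥1 (bound D D≥1) T
      where
      h : ∀ d → d ℤ.- (d ℤ.- 1ℤ) ≡ 1ℤ
      h = ℤR.solve-∀
      bound : ∀ D → 0ℤ ℤ.≤ D ℤ.- 1ℤ → 0ℤ ℤ.≤ + ∣ D ∣ ℤ.- (D ℤ.- 1ℤ)
      bound (+ d) _ = 0≤1ᶻ byᶻ sym (h (+ d))
      bound -[1+ n ] ()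

  record Square (L : ℤ → ℤ → Set) (r X Y : ℚ) : Set where
    field
      ax ay fx fy gx gy : ℤ
      a∈  : L ax ay
      f∈  : L (ax ℤ.+ fx) (ay ℤ.+ fy)
      g∈  : L (ax ℤ.+ gx) (ay ℤ.+ gy)
      fg∈ : L (ax ℤ.+ fx ℤ.+ gx) (ay ℤ.+ fy ℤ.+ gy)
      λ₁ λ₂ : ℚ
      λ₁≥0 : 0ℚ ≤ λ₁
      λ₂≥0 : 0ℚ ≤ λ₂
      λ₁≤r : 0ℚ ≤ r - λ₁
      λ₂≤r : 0ℚ ≤ r - λ₂
      X≡ : r * ιℤ ax + λ₁ * ιℤ fx + λ₂ * ιℤ gx ≡ X
      Y≡ : r * ιℤ ay + λ₁ * ιℤ fy + λ₂ * ιℤ gy ≡ Y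

  -- The added vertex is the reflection of p₁ in the midpoint of the opposite side. The weights of
  -- p₂ and p₃ become the coordinates along the sides, each at most `r` because all weights sum to
  -- `r`.
  complete-square : ∀ {L D r X Y} (T : Covered L D r X Y) → (let open Covered T) →
                    L (x₂ ℤ.+ x₃ ℤ.- x₁) (y₂ ℤ.+ y₃ ℤ.- y₁) → Square L r X Y
  complete-square {L} {D} {r} {X} {Y} T p = record
    { ax = x₁ ; ay = y₁ ; fx = x₂ ℤ.- x₁ ; fy = y₂ ℤ.- y₁ ; gx = x₃ ℤ.- x₁ ; gy = y₃ ℤ.- y₁
    ; a∈ = p₁∈ ; f∈ = subst₂ L (h x₁ x₂) (h y₁ y₂) p₂∈ ; g∈ = subst₂ L (h x₁ x₃) (h y₁ y₃) p₃∈
    ; fg∈ = subst₂ L (h′ x₁ x₂ x₃) (h′ y₁ y₂ y₃) p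
    ; λ₁ = a₂ ; λ₂ = a₃ ; λ₁≥0 = a₂≥0 ; λ₂≥0 = a₃≥0
    ; λ₁≤r = a₁≥0 ⊹ a₃≥0 by trans (k₁ a₁ a₂ a₃) (cong (_- a₂) sum-r)
    ; λ₂≤r = a₁≥0 ⊹ a₂≥0 by trans (k₂ a₁ a₂ a₃) (cong (_- a₃) sum-r)
    ; X≡ = trans (coord x₁ x₂ x₃) sum-X
    ; Y≡ = trans (coord y₁ y₂ y₃) sum-Y
    }
    where
    open Covered T
    h : ∀ a b → b ≡ a ℤ.+ (b ℤ.- a)
    h = ℤR.solve-∀
    h′ : ∀ a b c → b ℤ.+ c ℤ.- a ≡ a ℤ.+ (b ℤ.- a) ℤ.+ (c ℤ.- a)
    h′ = ℤR.solve-∀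
    k₁ : ∀ a b c → a + c ≡ a + b + c - b
    k₁ = solve-∀ ℚ-ring
    k₂ : ∀ a b c → a + b ≡ a + b + c - c
    k₂ = solve-∀ ℚ-ring
    coord : ∀ z₁ z₂ z₃ → r * ιℤ z₁ + a₂ * ιℤ (z₂ ℤ.- z₁) + a₃ * ιℤ (z₃ ℤ.- z₁) ≡
            a₁ * ιℤ z₁ + a₂ * ιℤ z₂ + a₃ * ιℤ z₃
    coord z₁ z₂ z₃ = trans (cong₂ _+_ (cong₂ (λ u v → u * ιℤ z₁ + a₂ * v) (sym sum-r) (ι-- z₂ z₁)) (cong (a₃ *_) (ι-- z₃ z₁)))
        (k a₁ a₂ a₃ (ιℤ z₁) (ιℤ z₂) (ιℤ z₃))
      where
      k : ∀ a b c x y z → (a + b + c) * x + b * (y - x) + c * (z - x) ≡ a * x + b * y + c * z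
      k = solve-∀ ℚ-ring

  square-or-triangle : ∀ {L} → Polygon L → ∀ {r X Y} → Positive L r X Y → Square L r X Y ⊎ Triangle L
  square-or-triangle {L} P {r} {X} {Y} cov = go (unimodular P cov)
    where
    go : Covered L 1ℤ r X Y → Square L r X Y ⊎ Triangle L
    go T = Data.Sum.map squares frame-triangle (reflection-or-triangle (frame P) o e n)
      where
      open Covered T
      open Frame x₁ y₁ (x₂ ℤ.- x₁) (y₂ ℤ.- y₁) (x₃ ℤ.- x₁) (y₃ ℤ.- y₁) det using (L′; frame; frame-triangle)
      h₀₀ : ∀ a b c → a ≡ a ℤ.+ 0ℤ ℤ.* (b ℤ.- a) ℤ.+ 0ℤ ℤ.* (c ℤ.- a)
      h₀₀ = ℤR.solve-∀
      h₁₀ : ∀ a b c → b ≡ a ℤ.+ 1ℤ ℤ.* (b ℤ.- a) ℤ.+ 0ℤ ℤ.* (c ℤ.- a)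
      h₁₀ = ℤR.solve-∀
      h₀₁ : ∀ a b c → c ≡ a ℤ.+ 0ℤ ℤ.* (b ℤ.- a) ℤ.+ 1ℤ ℤ.* (c ℤ.- a)
      h₀₁ = ℤR.solve-∀
      h₁₁ : ∀ a b c → a ℤ.+ 1ℤ ℤ.* (b ℤ.- a) ℤ.+ 1ℤ ℤ.* (c ℤ.- a) ≡ b ℤ.+ c ℤ.- a
      h₁₁ = ℤR.solve-∀
      h↘ : ∀ a b c → a ℤ.+ 1ℤ ℤ.* (b ℤ.- a) ℤ.+ -1ℤ ℤ.* (c ℤ.- a) ≡ a ℤ.+ b ℤ.- c
      h↘ = ℤR.solve-∀
      h↖ : ∀ a b c → a ℤ.+ -1ℤ ℤ.* (b ℤ.- a) ℤ.+ 1ℤ ℤ.* (c ℤ.- a) ≡ c ℤ.+ a ℤ.- b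
      h↖ = ℤR.solve-∀
      o = subst₂ L (h₀₀ x₁ x₂ x₃) (h₀₀ y₁ y₂ y₃) p₁∈
      e = subst₂ L (h₁₀ x₁ x₂ x₃) (h₁₀ y₁ y₂ y₃) p₂∈
      n = subst₂ L (h₀₁ x₁ x₂ x₃) (h₀₁ y₁ y₂ y₃) p₃∈
      squares : L′ {L} 1ℤ 1ℤ ⊎ (L′ {L} 1ℤ -1ℤ ⊎ L′ {L} -1ℤ 1ℤ) → Square L r X Y
      squares (inj₁ p) = complete-square T (subst₂ L (h₁₁ x₁ x₂ x₃) (h₁₁ y₁ y₂ y₃) p)
      squares (inj₂ (inj₁ p)) = complete-square (rotate (rotate T)) (subst₂ L (h↘ x₁ x₂ x₃) (h↘ y₁ y₂ y₃) p)
      squares (inj₂ (inj₂ p)) = complete-square (rotate T) (subst₂ L (h↖ x₁ x₂ x₃) (h↖ y₁ y₂ y₃) p)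

-- Separation from the cone, and decidable membership.

module Separation {m} (V : Fin m → ℤ³) where

  open import Data.Rational using (_+_; _*_; _-_; -_; _≤_; _<_)
  open Vertices V using (coordinates; hat-cong)

  -- Gordan's alternative for the vectors r V k - p: a positive relation among them exhibits a
  -- positive multiple of `p` as a cone point.
  separate : ∀ r p → 0ℚ ≤ r → Cone V p ⊎ (∃ λ φ → ∀ k → 0ℚ < φ ∙ ((r ⊙ hat (V k)) ⊝ p))
  separate r p r≥0 = go (gordan coordinates ds)
    where
    d : Fin m → H
    d k = (r ⊙ hat (V k)) ⊝ p
    ds = map d (allFin m)
    collect : ∀ {x} → PosComb ds x → ∃ λ l → 0ℚ < l × Cone V (x ⊕ (l ⊙ p))
    collect (gen x∈) = at (∈-map⁻ d x∈)
      where
      at : ∀ {x} → (∃ λ k → k ∈ allFin m × x ≡ d k) → ∃ λ l → 0ℚ < l × Cone V (x ⊕ (l ⊙ p))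
      at (k , _ , refl) = 1ℚ , 0<1 , cone-resp {V = V} (λ i → h (r * hat (V k) i) (p i))
                            (cone-⊙ {V = V} {x = hat (V k)} r≥0 (cone-gen V k))
        where
        h : ∀ a b → a ≡ a - b + 1ℚ * b
        h = solve-∀ ℚ-ring
    collect (add {x} {y} p₁ p₂) = join (collect p₁) (collect p₂)
      where
      join : _ → _ → ∃ λ l → 0ℚ < l × Cone V ((x ⊕ y) ⊕ (l ⊙ p))
      join (l , l>0 , c) (l′ , l′>0 , c′) = l + l′ , pos+ l>0 (ℚP.<⇒≤ l′>0) ,
          cone-resp {V = V} (λ i → h (x i) (y i) l l′ (p i)) (cone-⊕ {V = V} {x = x ⊕ (l ⊙ p)} {y = y ⊕ (l′ ⊙ p)} c c′)
        where
        h : ∀ x y l l′ p → x + l * p + (y + l′ * p) ≡ x + y + (l + l′) * p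
        h = solve-∀ ℚ-ring
    collect (scale {t} {x} t>0 q) = stretch (collect q)
      where
      stretch : _ → ∃ λ l → 0ℚ < l × Cone V ((t ⊙ x) ⊕ (l ⊙ p))
      stretch (l , l>0 , c) = t * l , pos* t>0 l>0 ,
          cone-resp {V = V} (λ i → h t (x i) l (p i)) (cone-⊙ {V = V} {x = x ⊕ (l ⊙ p)} (ℚP.<⇒≤ t>0) c)
        where
        h : ∀ t x l p → t * (x + l * p) ≡ t * x + t * l * p
        h = solve-∀ ℚ-ring
    go : _ → Cone V p ⊎ (∃ λ φ → ∀ k → 0ℚ < φ ∙ d k)
    go (inj₁ (φ , P)) = inj₂ (φ , λ k → P (∈-map⁺ d (∈-allFin k)))
    go (inj₂ (x , c , z₀ , z₁ , z₂ , z₃ , _)) = inj₁ (normalise (collect c))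
      where
      x≡0 : ∀ i → x i ≡ 0ℚ
      x≡0 0F = trans (sym (π-∙ 0F x)) z₀
      x≡0 1F = trans (sym (π-∙ 1F x)) z₁
      x≡0 2F = trans (sym (π-∙ 2F x)) z₂
      x≡0 3F = trans (sym (π-∙ 3F x)) z₃
      normalise : _ → Cone V p
      normalise (l , l>0 , c) = cone-resp {V = V} eq (cone-⊙ {V = V} {x = x ⊕ (l ⊙ p)} (ℚP.<⇒≤ (proj₁ (proj₂ inv))) c)
        where
        inv = pos⇒inverse l l>0
        h : ∀ b l p → b * (0ℚ + l * p) ≡ b * l * p
        h = solve-∀ ℚ-ring
        eq : ∀ i → proj₁ inv * (x i + l * p i) ≡ p i
        eq i = trans (cong (λ u → proj₁ inv * (u + l * p i)) (x≡0 i)) (trans (h (proj₁ inv) l (p i))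
                 (trans (cong (_* p i) (proj₂ (proj₂ inv))) (ℚP.*-identityˡ (p i))))

  lattice-point? : ∀ q → Dec (ι q ∈P V)
  lattice-point? q = go (separate 1ℚ (hat q) 0≤1)
    where
    go : _ → Dec (ι q ∈P V)
    go (inj₁ c) = yes c
    go (inj₂ (φ , P)) = no λ c → apart (proj₂ (cone-ind V Q resp base step c) self)
      where
      ψ = φ ⊝ ((φ ∙ hat q) ⊙ π 0F)
      eval : ∀ x → ψ ∙ x ≡ φ ∙ x - (φ ∙ hat q) * x 0F
      eval x = trans (⊝-∙ φ _ x) (cong (λ a → φ ∙ x - a) (trans (⊙-∙ (φ ∙ hat q) (π 0F) x) (cong (λ a → (φ ∙ hat q) * a) (π-∙ 0F x))))
      self : ψ ∙ hat q ≡ 0ℚ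
      self = trans (eval (hat q)) (h (φ ∙ hat q))
        where
        h : ∀ a → a - a * 1ℚ ≡ 0ℚ
        h = solve-∀ ℚ-ring
      ψ>0 : ∀ k → 0ℚ < ψ ∙ hat (V k)
      ψ>0 k = P k <by trans (∙-⊝ φ (1ℚ ⊙ hat (V k)) (hat q)) (trans (cong (_- φ ∙ hat q) (∙-⊙ φ 1ℚ (hat (V k))))
                (trans (h (φ ∙ hat (V k)) (φ ∙ hat q)) (sym (eval (hat (V k))))))
        where
        h : ∀ a b → 1ℚ * a - b ≡ a - b * 1ℚ
        h = solve-∀ ℚ-ring
      -- `ψ` vanishes at `q` and is positive on all generators. Membership of `q` would therefore
      -- force its coordinate 0, which is 1, to vanish.
      Q : H → Set
      Q x = 0ℚ ≤ ψ ∙ x × (ψ ∙ x ≡ 0ℚ → x 0F ≡ 0ℚ)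
      resp : ∀ {x y} → x ≋ y → Q x → Q y
      resp e (p , q) = (p by ∙-cong ψ e) , λ z → trans (sym (e 0F)) (q (trans (∙-cong ψ e) z))
      base : Q 𝟎
      base = (0≤0 by sym (∙-𝟎 ψ)) , λ _ → refl
      step : ∀ k c {x} → 0ℚ ≤ c → Q x → Q ((c ⊙ hat (V k)) ⊕ x)
      step k c {x} c≥0 (x≥0 , q) = (cs≥0 ⊹ x≥0 by sym ev) , λ z → goal (trans (sym ev) z)
        where
        cs≥0 = c≥0 ⊛ ℚP.<⇒≤ (ψ>0 k)
        ev : ψ ∙ ((c ⊙ hat (V k)) ⊕ x) ≡ c * (ψ ∙ hat (V k)) + ψ ∙ x
        ev = trans (∙-⊕ ψ (c ⊙ hat (V k)) x) (cong (_+ ψ ∙ x) (∙-⊙ ψ c (hat (V k))))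
        goal : c * (ψ ∙ hat (V k)) + ψ ∙ x ≡ 0ℚ → c * 1ℚ + x 0F ≡ 0ℚ
        goal z = cong₂ (λ a b → a * 1ℚ + b) c≡0 (q (sum≡0ʳ cs≥0 x≥0 z))
          where
          c≡0 : c ≡ 0ℚ
          c≡0 = *≡0 (ψ>0 k) (trans (ℚP.*-comm (ψ ∙ hat (V k)) c) (sum≡0ˡ cs≥0 x≥0 z))
      apart : 1ℚ ≡ 0ℚ → ⊥
      apart ()

-- The corners of a facet.

module Facets {m} (V : Fin m → ℤ³) (smooth : Smooth V) (j₀ : Fin m) where

  open import Data.Integer using (_+_; _*_; _-_; -_; _≤_)
  open Corners V smooth
  open Vertices V using (hat-cong)
  open Separation V
  open Polygons using (squeeze; pick≡0)
  open UnimodularTriangles using (split₁; ≥1⇒≥0; clash; unit-factors)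

  turn : Fin 3 → Fin 3
  turn 0F = 1F
  turn 1F = 2F
  turn 2F = 0F

  -- Lets each of the three facets at a vertex play the part of the one with normal `u 0F`.
  rot : Corner V → Corner V
  rot C = record
    { v = v ; e = λ i → e (turn i) ; u = λ i → u (turn i) ; v∈P = v∈P ; e∈P = λ i → e∈P (turn i)
    ; dual = λ i j → trans (dual (turn i) (turn j)) (δ-turn i j)
    ; expand = λ z t → trans (k ((u 0F · z) * e 0F t) ((u 1F · z) * e 1F t) ((u 2F · z) * e 2F t)) (expand z t)
    ; inside = λ i → inside (turn i) }
    where
    open Corner C
    δ-turn : ∀ i j → δ (turn i) (turn j) ≡ δ i j
    δ-turn 0F 0F = refl
    δ-turn 0F 1F = refl
    δ-turn 0F 2F = refl
    δ-turn 1F 0F = refl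
    δ-turn 1F 1F = refl
    δ-turn 1F 2F = refl
    δ-turn 2F 0F = refl
    δ-turn 2F 1F = refl
    δ-turn 2F 2F = refl
    k : ∀ a b c → b + (c + a) ≡ a + (b + c)
    k = ℤR.solve-∀

  bounded : ∀ u v → (∀ k → 0ℤ ≤ u · (V k -ᵛ v)) → ∀ q → ι q ∈P V → 0ℤ ≤ u · (q -ᵛ v)
  bounded u v p q q∈ = ι-reflect {u · (q -ᵛ v)} (cone-nonneg {V = V} (fun u v)
    (λ k → ι-mono {u · (V k -ᵛ v)} (p k) by sym (fun-hat u v (V k))) q∈ by fun-hat u v q)

  expand-· : ∀ (C : Corner V) → let open Corner C in ∀ x z →
             x · z ≡ (u 0F · z) * (x · e 0F) + ((u 1F · z) * (x · e 1F) + (u 2F · z) * (x · e 2F))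
  expand-· C x z = ·-expand x (e 0F) (e 1F) (e 2F) (u 0F · z) (u 1F · z) (u 2F · z) (expand z)
    where open Corner C

  -- Both corners encode the same facet. Their normals are compared by their values, as functionals.
  record OnFacet (C D : Corner V) : Set where
    module C = Corner C
    module D = Corner D
    field
      normal : ∀ z → D.u 0F · z ≡ C.u 0F · z
      level  : C.u 0F · (D.v -ᵛ C.v) ≡ 0ℤ

  module _ (C : Corner V) where

    private module C = Corner C
    n = C.u 0F

    above : ∀ q → ι q ∈P V → 0ℤ ≤ n · (q -ᵛ C.v)
    above = bounded n C.v (C.inside 0F)

    private
      v-on : n · (C.v -ᵛ C.v) ≡ 0ℤ
      v-on = trans (·-- n C.v C.v) (ℤP.+-inverseʳ (n · C.v))

      edge-on : ∀ i → n · C.e i ≡ 0ℤ → n · ((C.v +ᵛ C.e i) -ᵛ C.v) ≡ 0ℤ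
      edge-on i z = trans (·-edge n C.v (C.e i) C.v) (trans (cong₂ _+_ v-on z) refl)

    module At (D : Corner V) (level : n · (Corner.v D -ᵛ C.v) ≡ 0ℤ) where
      private module D = Corner D

      slope≥0 : ∀ i → 0ℤ ≤ n · D.e i
      slope≥0 i = above (D.v +ᵛ D.e i) (D.e∈P i) byᶻ trans (·-edge n D.v (D.e i) C.v) (trans (cong (_+ n · D.e i) level) (ℤP.+-identityˡ _))

      -- On the facet the coordinates at `D`, weighted by the slopes of the edges, add up to 0. All
      -- terms are nonnegative, so a positive slope annihilates its coordinate.
      flat-coordinate : ∀ i → 0ℤ ≤ n · D.e i - 1ℤ → ∀ q → ι q ∈P V → n · (q -ᵛ C.v) ≡ 0ℤ → D.u i · (q -ᵛ D.v) ≡ 0ℤ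
      flat-coordinate i steep q q∈ q-on = zero-factor (terms i)
        where
        c : Fin 3 → ℤ
        c j = D.u j · (q -ᵛ D.v)
        c≥0 : ∀ j → 0ℤ ≤ c j
        c≥0 j = bounded (D.u j) D.v (D.inside j) q q∈
        total : c 0F * (n · D.e 0F) + (c 1F * (n · D.e 1F) + c 2F * (n · D.e 2F)) ≡ 0ℤ
        total = trans (sym (expand-· D n (q -ᵛ D.v))) (trans (·-rebase n q D.v C.v) (trans (cong₂ _-_ q-on level) refl))
        t≥0 : ∀ j → 0ℤ ≤ c j * (n · D.e j)
        t≥0 j = c≥0 j ⊛ᶻ slope≥0 j
        k₃ : ∀ a b c → b + (a + c) ≡ a + (b + c)
        k₃ = ℤR.solve-∀
        k₄ : ∀ a b c → c + (a + b) ≡ a + (b + c)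
        k₄ = ℤR.solve-∀
        terms : ∀ i → c i * (n · D.e i) ≡ 0ℤ
        terms 0F = pick≡0 (t≥0 0F) (t≥0 1F ⊹ᶻ t≥0 2F) total
        terms 1F = pick≡0 (t≥0 1F) (t≥0 0F ⊹ᶻ t≥0 2F) (trans (k₃ (c 0F * (n · D.e 0F)) (c 1F * (n · D.e 1F)) (c 2F * (n · D.e 2F))) total)
        terms 2F = pick≡0 (t≥0 2F) (t≥0 0F ⊹ᶻ t≥0 1F) (trans (k₄ (c 0F * (n · D.e 0F)) (c 1F * (n · D.e 1F)) (c 2F * (n · D.e 2F))) total)
        zero-factor : c i * (n · D.e i) ≡ 0ℤ → c i ≡ 0ℤ
        zero-factor z = pick≡0 (c≥0 i) (c≥0 i ⊛ᶻ steep) (trans (k (c i) (n · D.e i)) z)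
          where
          k : ∀ c a → c + c * (a - 1ℤ) ≡ c * a
          k = ℤR.solve-∀

      flat-edge : ∀ i → 0ℤ ≤ n · D.e i - 1ℤ → ∀ j → n · C.e j ≡ 0ℤ → D.u i · C.e j ≡ 0ℤ
      flat-edge i steep j z = trans (sym (ℤP.+-identityˡ _)) (trans (cong (_+ D.u i · C.e j) (sym (flat-coordinate i steep C.v C.v∈P v-on)))
          (trans (sym (·-edge (D.u i) C.v (C.e j) D.v)) (flat-coordinate i steep (C.v +ᵛ C.e j) (C.e∈P j) (edge-on j z))))

      -- the edges e₁ and e₂ of the facet at v cannot both be parallel to the third edge at w
      two-steep : 0ℤ ≤ n · D.e 0F - 1ℤ → 0ℤ ≤ n · D.e 1F - 1ℤ → ⊥
      two-steep s₀ s₁ = k (D.u 2F · C.e 1F) (D.u 2F · C.e 2F) (C.u 1F · D.e 2F) (C.u 2F · D.e 2F)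
          (along 1F 1F (C.dual 0F 1F) (C.dual 1F 1F)) (along 2F 1F (C.dual 0F 1F) (C.dual 2F 1F)) (along 2F 2F (C.dual 0F 2F) (C.dual 2F 2F))
        where
        along : ∀ i j → n · C.e j ≡ 0ℤ → ∀ {d} → C.u i · C.e j ≡ d → (D.u 2F · C.e j) * (C.u i · D.e 2F) ≡ d
        along i j z e = trans (h (C.u i · D.e 0F) (C.u i · D.e 1F) ((D.u 2F · C.e j) * (C.u i · D.e 2F)))
            (trans (cong₂ (λ a b → a * (C.u i · D.e 0F) + (b * (C.u i · D.e 1F) + (D.u 2F · C.e j) * (C.u i · D.e 2F)))
              (sym (flat-edge 0F s₀ j z)) (sym (flat-edge 1F s₁ j z)))
              (trans (sym (expand-· D (C.u i) (C.e j))) e))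
          where
          h : ∀ a b c → c ≡ 0ℤ * a + (0ℤ * b + c)
          h = ℤR.solve-∀
        k : ∀ p q r s → p * r ≡ 1ℤ → p * s ≡ 0ℤ → q * s ≡ 1ℤ → ⊥
        k p q r s e f g = absurd (trans (sym (cong₂ _*_ e g)) (trans (h p q r s) (cong (_* (r * q)) f)))
          where
          h : ∀ p q r s → p * r * (q * s) ≡ p * s * (r * q)
          h = ℤR.solve-∀
          absurd : 1ℤ ≡ 0ℤ → ⊥
          absurd ()

      -- Here `n` is `n · D.e 0F` times the functional `D.u 0F`. Since `n` takes the value 1 at
      -- `C.e 0F`, this factor is 1.
      one-steep : 0ℤ ≤ n · D.e 0F - 1ℤ → 0ℤ ≤ - (n · D.e 1F) → 0ℤ ≤ - (n · D.e 2F) → OnFacet C D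
      one-steep s₀ s₁ s₂ = record { normal = λ z → sym (trans (reduced z) (trans (cong ((D.u 0F · z) *_) unit) (ℤP.*-identityʳ _))) ; level = level }
        where
        reduced : ∀ z → n · z ≡ (D.u 0F · z) * (n · D.e 0F)
        reduced z = trans (expand-· D n z) (trans (cong₂ (λ a b → (D.u 0F · z) * (n · D.e 0F) + ((D.u 1F · z) * a + (D.u 2F · z) * b))
            (squeeze (slope≥0 1F) s₁) (squeeze (slope≥0 2F) s₂)) (h ((D.u 0F · z) * (n · D.e 0F)) (D.u 1F · z) (D.u 2F · z)))
          where
          h : ∀ a b c → a + (b * 0ℤ + c * 0ℤ) ≡ a
          h = ℤR.solve-∀
        product : (D.u 0F · C.e 0F) * (n · D.e 0F) ≡ 1ℤ
        product = trans (sym (reduced (C.e 0F))) (C.dual 0F 0F)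
        unit : n · D.e 0F ≡ 1ℤ
        unit = go (split (D.u 0F · C.e 0F))
          where
          go : _ → n · D.e 0F ≡ 1ℤ
          go (inj₁ p) = proj₂ (unit-factors (D.u 0F · C.e 0F) (n · D.e 0F) p s₀ product)
          go (inj₂ p) = ⊥-elim (absurdᶻ (≥1⇒≥0 { - (D.u 0F · C.e 0F)} p ⊛ᶻ slope≥0 0F)
              (trans (h (D.u 0F · C.e 0F) (n · D.e 0F)) (cong -_ product)))
            where
            h : ∀ a b → - a * b ≡ - (a * b)
            h = ℤR.solve-∀

      all-flat : 0ℤ ≤ - (n · D.e 0F) → 0ℤ ≤ - (n · D.e 1F) → 0ℤ ≤ - (n · D.e 2F) → ⊥
      all-flat s₀ s₁ s₂ = absurd (trans (sym (C.dual 0F 0F)) (trans (expand-· D n (C.e 0F))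
          (trans (cong₂ (λ a b → (D.u 0F · C.e 0F) * a + b) (squeeze (slope≥0 0F) s₀)
             (cong₂ (λ a b → (D.u 1F · C.e 0F) * a + (D.u 2F · C.e 0F) * b) (squeeze (slope≥0 1F) s₁) (squeeze (slope≥0 2F) s₂)))
            (h (D.u 0F · C.e 0F) (D.u 1F · C.e 0F) (D.u 2F · C.e 0F)))))
        where
        h : ∀ a b c → a * 0ℤ + (b * 0ℤ + c * 0ℤ) ≡ 0ℤ
        h = ℤR.solve-∀
        absurd : 1ℤ ≡ 0ℤ → ⊥
        absurd ()

    -- Exactly one of the three edges at a vertex of the facet leaves it, and a rotation puts that
    -- edge first.
    orient : ∀ D → n · (Corner.v D -ᵛ C.v) ≡ 0ℤ → ∃ λ D′ → OnFacet C D′ × Corner.v D′ ≡ Corner.v D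
    orient D level = go (split₁ (n · e 0F)) (split₁ (n · e 1F)) (split₁ (n · e 2F))
      where
      open Corner D using (e)
      go : _ → _ → _ → ∃ λ D′ → OnFacet C D′ × Corner.v D′ ≡ Corner.v D
      go (inj₁ a) (inj₁ b) _ = ⊥-elim (At.two-steep D level a b)
      go (inj₁ a) (inj₂ b) (inj₁ c) = ⊥-elim (At.two-steep (rot (rot D)) level c a)
      go (inj₁ a) (inj₂ b) (inj₂ c) = D , At.one-steep D level a b c , refl
      go (inj₂ a) (inj₁ b) (inj₁ c) = ⊥-elim (At.two-steep (rot D) level b c)
      go (inj₂ a) (inj₁ b) (inj₂ c) = rot D , At.one-steep (rot D) level b c a , refl
      go (inj₂ a) (inj₂ b) (inj₁ c) = rot (rot D) , At.one-steep (rot (rot D)) level c a b , refl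
      go (inj₂ a) (inj₂ b) (inj₂ c) = ⊥-elim (At.all-flat D level a b c)

    -- Minimising first the distance to the facet and then `φ` stays on the facet, so a search over
    -- all of P finds the minimum there.
    facet-corner : ∀ φ → ∃ λ D → OnFacet C D ×
                   (∀ q → ι q ∈P V → n · (q -ᵛ C.v) ≡ 0ℤ → 0ℚ ℚ.≤ φ ∙ hat q ℚ.- φ ∙ hat (Corner.v D))
    facet-corner φ = go (lex-min-corner j₀ (ν ∷ φ ∷ []))
      where
      ν = fun n C.v
      go : _ → _
      go (D , _ , _ , min) = finish (orient D level)
        where
        w = Corner.v D
        T : H → H
        T ψ = ψ ⊝ ((ψ ∙ hat w) ⊙ π 0F)
        T-∙ : ∀ ψ q → T ψ ∙ hat q ≡ ψ ∙ (hat q ⊝ hat w)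
        T-∙ ψ q = trans (⊝-∙ ψ _ (hat q)) (trans (cong (λ a → ψ ∙ hat q ℚ.- a) (trans (⊙-∙ (ψ ∙ hat w) (π 0F) (hat q))
          (trans (cong (λ a → (ψ ∙ hat w) ℚ.* a) (π-∙ 0F (hat q))) (ℚP.*-identityʳ (ψ ∙ hat w))))) (sym (∙-⊝ ψ (hat q) (hat w))))
        lex : ∀ q → ι q ∈P V → LexNN (T ν ∷ T φ ∷ []) (hat q)
        lex q q∈ = cone-lex {V = V} (T ν ∷ T φ ∷ []) (λ k → lex-map T (ν ∷ φ ∷ []) (λ ψ → T-∙ ψ (V k)) (min k)) q∈
        diff-at : ∀ q → T ν ∙ hat q ≡ ν ∙ hat q ℚ.- ν ∙ hat w
        diff-at q = trans (T-∙ ν q) (∙-⊝ ν (hat q) (hat w))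
        v-on′ : ν ∙ hat C.v ≡ 0ℚ
        v-on′ = trans (fun-hat n C.v C.v) (cong ιℤ v-on)
        w∈ = Corner.v∈P D
        level : n · (w -ᵛ C.v) ≡ 0ℤ
        level = squeeze (above w w∈) (ι-reflect {a = - (n · (w -ᵛ C.v))} (lex-head (lex C.v C.v∈P)
          by trans (diff-at C.v) (trans (cong₂ ℚ._-_ v-on′ (fun-hat n C.v w)) (trans (ℚP.+-identityˡ _) (sym (ι-neg (n · (w -ᵛ C.v))))))))
        finish : _ → _
        finish (D′ , on , v≡) = D′ , on , λ q q∈ q-on →
            lex-last (T ν ∷ []) {T φ} {hat q} (on-zero q q-on , tt) (lex q q∈)
              by trans (T-∙ φ q) (trans (∙-⊝ φ (hat q) (hat w)) (cong (λ v → φ ∙ hat q ℚ.- φ ∙ hat v) (sym v≡)))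
          where
          on-zero : ∀ q → n · (q -ᵛ C.v) ≡ 0ℤ → T ν ∙ hat q ≡ 0ℚ
          on-zero q q-on = trans (diff-at q) (trans (cong₂ ℚ._-_ (trans (fun-hat n C.v q) (cong ιℤ q-on)) (trans (fun-hat n C.v w) (cong ιℤ level))) refl)

-- Convexity with integer weights.

module LatticeConvexity {m} (V : Fin m → ℤ³) where

  open Vertices V using (hat-cong)

  P-resp : ∀ {x y : ℤ³} → (∀ i → x i ≡ y i) → ι x ∈P V → ι y ∈P V
  P-resp {x} {y} e = cone-resp {V = V} {hat x} {hat y} (hat-cong e)

  P-convex : ∀ N n₁ n₂ n₃ (q₁ q₂ q₃ q : ℤ³) → 0ℤ ℤ.≤ N ℤ.- 1ℤ → 0ℤ ℤ.≤ n₁ → 0ℤ ℤ.≤ n₂ → 0ℤ ℤ.≤ n₃ →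
             ι q₁ ∈P V → ι q₂ ∈P V → ι q₃ ∈P V → n₁ ℤ.+ n₂ ℤ.+ n₃ ≡ N →
             (∀ i → n₁ ℤ.* q₁ i ℤ.+ n₂ ℤ.* q₂ i ℤ.+ n₃ ℤ.* q₃ i ≡ N ℤ.* q i) → ι q ∈P V
  P-convex N n₁ n₂ n₃ q₁ q₂ q₃ q N≥1 n₁≥0 n₂≥0 n₃≥0 p₁ p₂ p₃ sum comb =
    cone-resp {V = V} {b ⊙ total} {hat q} eq (cone-⊙ {V = V} {b} {total} (ℚP.<⇒≤ (proj₁ (proj₂ inv)))
      (cone-⊕ {V = V} {(ιℤ n₁ ⊙ hat q₁) ⊕ (ιℤ n₂ ⊙ hat q₂)} {ιℤ n₃ ⊙ hat q₃}
        (cone-⊕ {V = V} {ιℤ n₁ ⊙ hat q₁} {ιℤ n₂ ⊙ hat q₂}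
          (cone-⊙ {V = V} {ιℤ n₁} {hat q₁} (ι-mono n₁≥0) p₁) (cone-⊙ {V = V} {ιℤ n₂} {hat q₂} (ι-mono n₂≥0) p₂))
        (cone-⊙ {V = V} {ιℤ n₃} {hat q₃} (ι-mono n₃≥0) p₃)))
    where
    open import Data.Rational using (_+_; _*_)
    total = ((ιℤ n₁ ⊙ hat q₁) ⊕ (ιℤ n₂ ⊙ hat q₂)) ⊕ (ιℤ n₃ ⊙ hat q₃)
    inv = pos⇒inverse (ιℤ N) (ι-pos {N} (ℤP.0≤i-j⇒j≤i N≥1))
    b = proj₁ inv
    cancel : ∀ z → b * (ιℤ N * z) ≡ z
    cancel z = trans (sym (ℚP.*-assoc b (ιℤ N) z)) (trans (cong (_* z) (proj₂ (proj₂ inv))) (ℚP.*-identityˡ z))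
    ι-sum : ∀ x y z → ιℤ x + ιℤ y + ιℤ z ≡ ιℤ (x ℤ.+ y ℤ.+ z)
    ι-sum x y z = sym (trans (ι-+ (x ℤ.+ y) z) (cong (_+ ιℤ z) (ι-+ x y)))
    eq : b ⊙ total ≋ hat q
    eq zero = trans (cong (b *_) (trans (h (ιℤ n₁) (ιℤ n₂) (ιℤ n₃)) (cong (_* 1ℚ) (trans (ι-sum n₁ n₂ n₃) (cong ιℤ sum))))) (cancel 1ℚ)
      where
      h : ∀ x y z → x * 1ℚ + y * 1ℚ + z * 1ℚ ≡ (x + y + z) * 1ℚ
      h = solve-∀ ℚ-ring
    eq (suc i) = trans (cong (b *_) (trans (cong₂ _+_ (cong₂ _+_ (sym (ι-* n₁ (q₁ i))) (sym (ι-* n₂ (q₂ i)))) (sym (ι-* n₃ (q₃ i))))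
      (trans (ι-sum (n₁ ℤ.* q₁ i) (n₂ ℤ.* q₂ i) (n₃ ℤ.* q₃ i)) (trans (cong ιℤ (comb i)) (ι-* N (q i)))))) (cancel (ιℤ (q i)))

-- A facet as a lattice polygon.

module FacetPolygon {m} (V : Fin m → ℤ³) (smooth : Smooth V) (j₀ : Fin m) (C : Corner V) where

  open import Data.Integer using (_+_; _*_; _-_; -_; _≤_)
  open Vertices V using (hat-cong)
  open Separation V
  open LatticeConvexity V
  open Facets V smooth j₀ hiding (n)
  open Polygons
  open UnimodularTriangles using (split₁; ≥1⇒≥0; unit-factors)
  open TriangleDescent
  open Corner C public
  n = u 0F

  pt : ℤ → ℤ → ℤ³
  pt x y i = v i + x * e 1F i + y * e 2F i

  L : ℤ → ℤ → Set
  L x y = ι (pt x y) ∈P V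

  xc yc : ℤ³ → ℤ
  xc q = u 1F · (q -ᵛ v)
  yc q = u 2F · (q -ᵛ v)

  pt-coordinate : ∀ i x y → u i · (pt x y -ᵛ v) ≡ x * (u i · e 1F) + y * (u i · e 2F)
  pt-coordinate i x y = trans (·-expand (u i) (e 0F) (e 1F) (e 2F) 0ℤ x y (λ t → h₀ x y (v t) (e 0F t) (e 1F t) (e 2F t)))
      (h (u i · e 0F) (x * (u i · e 1F)) (y * (u i · e 2F)))
    where
    h₀ : ∀ x y v d e f → 0ℤ * d + (x * e + y * f) ≡ v + x * e + y * f - v
    h₀ = ℤR.solve-∀
    h : ∀ a b c → 0ℤ * a + (b + c) ≡ b + c
    h = ℤR.solve-∀

  pt-on : ∀ x y → n · (pt x y -ᵛ v) ≡ 0ℤ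
  pt-on x y = trans (pt-coordinate 0F x y) (trans (cong₂ (λ a b → x * a + y * b) (dual 0F 1F) (dual 0F 2F)) (h x y))
    where
    h : ∀ x y → x * 0ℤ + y * 0ℤ ≡ 0ℤ
    h = ℤR.solve-∀

  xc-pt : ∀ x y → xc (pt x y) ≡ x
  xc-pt x y = trans (pt-coordinate 1F x y) (trans (cong₂ (λ a b → x * a + y * b) (dual 1F 1F) (dual 1F 2F)) (h x y))
    where
    h : ∀ x y → x * 1ℤ + y * 0ℤ ≡ x
    h = ℤR.solve-∀

  yc-pt : ∀ x y → yc (pt x y) ≡ y
  yc-pt x y = trans (pt-coordinate 2F x y) (trans (cong₂ (λ a b → x * a + y * b) (dual 2F 1F) (dual 2F 2F)) (h x y))
    where
    h : ∀ x y → x * 0ℤ + y * 1ℤ ≡ y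
    h = ℤR.solve-∀

  on-pt : ∀ q → n · (q -ᵛ v) ≡ 0ℤ → ∀ i → q i ≡ pt (xc q) (yc q) i
  on-pt q z i = trans (h₀ (q i) (v i)) (trans (cong (λ a → v i + a) (trans (sym (expand (q -ᵛ v) i))
      (cong (λ a → a * e 0F i + (xc q * e 1F i + yc q * e 2F i)) z))) (h (v i) (e 0F i) (xc q * e 1F i) (yc q * e 2F i)))
    where
    h₀ : ∀ q v → q ≡ v + (q - v)
    h₀ = ℤR.solve-∀
    h : ∀ v a b c → v + (0ℤ * a + (b + c)) ≡ v + b + c
    h = ℤR.solve-∀

  L-of : ∀ q → n · (q -ᵛ v) ≡ 0ℤ → ι q ∈P V → L (xc q) (yc q)
  L-of q z = P-resp (on-pt q z)

  int-unit : ∀ a b → a * b ≡ 1ℤ → a ≡ 1ℤ ⊎ a ≡ - 1ℤ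
  int-unit a b ab = go (split₁ a)
    where
    flip : ∀ a b → - b * - a ≡ a * b
    flip = ℤR.solve-∀
    go : _ → a ≡ 1ℤ ⊎ a ≡ - 1ℤ
    go (inj₁ p) = sgn (split b)
      where
      sgn : _ → a ≡ 1ℤ ⊎ a ≡ - 1ℤ
      sgn (inj₁ q) = inj₁ (proj₂ (unit-factors b a q p (trans (ℤP.*-comm b a) ab)))
      sgn (inj₂ q) = ⊥-elim (absurdᶻ (≥1⇒≥0 {a} p ⊛ᶻ ≥1⇒≥0 { - b} q) (trans (h a b) (cong -_ ab)))
        where
        h : ∀ a b → a * - b ≡ - (a * b)
        h = ℤR.solve-∀
    go (inj₂ p) = sgn (split₁ (- b))
      where
      k : ∀ a b → - a * - (- b) ≡ - (a * b)
      k = ℤR.solve-∀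
      sgn : _ → a ≡ 1ℤ ⊎ a ≡ - 1ℤ
      sgn (inj₁ q) = inj₂ (trans (sym (ℤP.neg-involutive a)) (cong -_ (proj₁ (unit-factors (- a) (- b) p q (trans (ℤP.*-comm (- a) (- b)) (trans (flip a b) ab))))))
      sgn (inj₂ q) = ⊥-elim (absurdᶻ (p ⊛ᶻ q) (trans (k a b) (cong -_ ab)))

  module PlaneCorner (D : Corner V) (on : OnFacet C D) where
    private module D = Corner D
    open OnFacet on using (normal; level)
    w = D.v
    f g : ℤ³
    f = D.e 1F
    g = D.e 2F
    fx = u 1F · f
    fy = u 2F · f
    gx = u 1F · g
    gy = u 2F · g

    n-f : n · f ≡ 0ℤ
    n-f = trans (sym (normal f)) (D.dual 0F 1F)
    n-g : n · g ≡ 0ℤ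
    n-g = trans (sym (normal g)) (D.dual 0F 2F)

    w-L : L (xc w) (yc w)
    w-L = L-of w level D.v∈P
    edge-L : ∀ i → n · D.e i ≡ 0ℤ → L (xc w + u 1F · D.e i) (yc w + u 2F · D.e i)
    edge-L i z = subst₂ L (·-edge (u 1F) w (D.e i) v) (·-edge (u 2F) w (D.e i) v)
      (L-of (w +ᵛ D.e i) (trans (·-edge n w (D.e i) v) (trans (cong₂ _+_ level z) refl)) (D.e∈P i))

    on-plane : ∀ i z → n · z ≡ 0ℤ → D.u i · z ≡ (u 1F · z) * (D.u i · e 1F) + (u 2F · z) * (D.u i · e 2F)
    on-plane i z e₀ = trans (expand-· C (D.u i) z) (trans (cong (λ a → a * (D.u i · e 0F) + ((u 1F · z) * (D.u i · e 1F) + (u 2F · z) * (D.u i · e 2F))) e₀)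
        (h (D.u i · e 0F) ((u 1F · z) * (D.u i · e 1F) + (u 2F · z) * (D.u i · e 2F))))
      where
      h : ∀ a b → 0ℤ * a + b ≡ b
      h = ℤR.solve-∀

    -- The dual vectors of `D`, evaluated on `e 1F` and `e 2F`, give an integer inverse of the
    -- matrix of `f` and `g`.
    det-unit : fx * gy - fy * gx ≡ 1ℤ ⊎ fx * gy - fy * gx ≡ - 1ℤ
    det-unit = int-unit (fx * gy - fy * gx) (p * s - q * r)
        (trans (h fx fy gx gy p q r s) (cong₂ _-_ (cong₂ _*_ (row 1F f n-f (D.dual 1F 1F)) (row 2F g n-g (D.dual 2F 2F)))
                                                   (cong₂ _*_ (row 2F f n-f (D.dual 2F 1F)) (row 1F g n-g (D.dual 1F 2F)))))
      where
      p = D.u 1F · e 1F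
      q = D.u 1F · e 2F
      r = D.u 2F · e 1F
      s = D.u 2F · e 2F
      row : ∀ i z → n · z ≡ 0ℤ → ∀ {d} → D.u i · z ≡ d → (u 1F · z) * (D.u i · e 1F) + (u 2F · z) * (D.u i · e 2F) ≡ d
      row i z e₀ eq = trans (sym (on-plane i z e₀)) eq
      h : ∀ fx fy gx gy p q r s → (fx * gy - fy * gx) * (p * s - q * r) ≡
          (fx * p + fy * q) * (gx * r + gy * s) - (fx * r + fy * s) * (gx * p + gy * q)
      h = ℤR.solve-∀

    μ ν : ℤ → ℤ → ℤ
    μ x y = D.u 1F · (pt x y -ᵛ w)
    ν x y = D.u 2F · (pt x y -ᵛ w)
    μ≥0 : ∀ x y → L x y → 0ℤ ≤ μ x y
    μ≥0 x y p = bounded (D.u 1F) w (D.inside 1F) (pt x y) p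
    ν≥0 : ∀ x y → L x y → 0ℤ ≤ ν x y
    ν≥0 x y p = bounded (D.u 2F) w (D.inside 2F) (pt x y) p

    offset : ∀ i x y → u i · (pt x y -ᵛ w) ≡ μ x y * (u i · f) + ν x y * (u i · g)
    offset i x y = trans (expand-· D (u i) (pt x y -ᵛ w))
        (trans (cong (λ a → a * (u i · D.e 0F) + (μ x y * (u i · f) + ν x y * (u i · g))) flat)
          (h (u i · D.e 0F) (μ x y * (u i · f) + ν x y * (u i · g))))
      where
      flat : D.u 0F · (pt x y -ᵛ w) ≡ 0ℤ
      flat = trans (normal (pt x y -ᵛ w)) (trans (·-rebase n (pt x y) w v) (trans (cong₂ _-_ (pt-on x y) level) refl))
      h : ∀ a b → 0ℤ * a + b ≡ b
      h = ℤR.solve-∀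

    dx : ∀ x y → x - xc w ≡ μ x y * fx + ν x y * gx
    dx x y = trans (cong (_- xc w) (sym (xc-pt x y))) (trans (sym (·-rebase (u 1F) (pt x y) w v)) (offset 1F x y))
    dy : ∀ x y → y - yc w ≡ μ x y * fy + ν x y * gy
    dy x y = trans (cong (_- yc w) (sym (yc-pt x y))) (trans (sym (·-rebase (u 2F) (pt x y) w v)) (offset 2F x y))

    -- Determinant -1 means that the two edges are listed clockwise, so they change places.
    plane-corner : ∀ α β → (∀ x y → L x y → 0ℤ ≤ α * (xc w - x) + β * (yc w - y)) → Corner₂ L α β
    plane-corner α β max = go det-unit
      where
      go : _ → Corner₂ L α β
      go (inj₁ d) = record
        { wx = xc w ; wy = yc w ; fx = fx ; fy = fy ; gx = gx ; gy = gy
        ; w∈ = w-L ; f∈ = edge-L 1F n-f ; g∈ = edge-L 2F n-g ; det = d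
        ; coneᶠ = λ {x} {y} p → μ≥0 x y p byᶻ sym (trans (cong₂ (λ a b → a * gy - b * gx) (dx x y) (dy x y))
                    (trans (h₁ (μ x y) (ν x y) fx fy gx gy) (trans (cong (μ x y *_) d) (ℤP.*-identityʳ (μ x y)))))
        ; coneᵍ = λ {x} {y} p → ν≥0 x y p byᶻ sym (trans (cong₂ (λ a b → fx * b - fy * a) (dx x y) (dy x y))
                    (trans (h₂ (μ x y) (ν x y) fx fy gx gy) (trans (cong (ν x y *_) d) (ℤP.*-identityʳ (ν x y)))))
        ; max = λ {x} {y} p → max x y p }
        where
        h₁ : ∀ μ ν fx fy gx gy → (μ * fx + ν * gx) * gy - (μ * fy + ν * gy) * gx ≡ μ * (fx * gy - fy * gx)
        h₁ = ℤR.solve-∀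
        h₂ : ∀ μ ν fx fy gx gy → fx * (μ * fy + ν * gy) - fy * (μ * fx + ν * gx) ≡ ν * (fx * gy - fy * gx)
        h₂ = ℤR.solve-∀
      go (inj₂ d) = record
        { wx = xc w ; wy = yc w ; fx = gx ; fy = gy ; gx = fx ; gy = fy
        ; w∈ = w-L ; f∈ = edge-L 2F n-g ; g∈ = edge-L 1F n-f
        ; det = trans (h₀ fx fy gx gy) (cong -_ d)
        ; coneᶠ = λ {x} {y} p → ν≥0 x y p byᶻ sym (trans (cong₂ (λ a b → a * fy - b * fx) (dx x y) (dy x y))
                    (trans (h₁ (μ x y) (ν x y) fx fy gx gy) (trans (cong (λ a → ν x y * - a) d) (ℤP.*-identityʳ (ν x y)))))
        ; coneᵍ = λ {x} {y} p → μ≥0 x y p byᶻ sym (trans (cong₂ (λ a b → gx * b - gy * a) (dx x y) (dy x y))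
                    (trans (h₂ (μ x y) (ν x y) fx fy gx gy) (trans (cong (λ a → μ x y * - a) d) (ℤP.*-identityʳ (μ x y)))))
        ; max = λ {x} {y} p → max x y p }
        where
        h₀ : ∀ fx fy gx gy → gx * fy - gy * fx ≡ - (fx * gy - fy * gx)
        h₀ = ℤR.solve-∀
        h₁ : ∀ μ ν fx fy gx gy → (μ * fx + ν * gx) * fy - (μ * fy + ν * gy) * fx ≡ ν * - (fx * gy - fy * gx)
        h₁ = ℤR.solve-∀
        h₂ : ∀ μ ν fx fy gx gy → gx * (μ * fy + ν * gy) - gy * (μ * fx + ν * gx) ≡ μ * - (fx * gy - fy * gx)
        h₂ = ℤR.solve-∀

  functional : ℤ → ℤ → H
  functional α β = (ιℤ α ⊙ fun (u 1F) v) ⊕ (ιℤ β ⊙ fun (u 2F) v)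

  functional-hat : ∀ α β q → functional α β ∙ hat q ≡ ιℤ (α * xc q + β * yc q)
  functional-hat α β q = trans (⊕-∙ (ιℤ α ⊙ fun (u 1F) v) (ιℤ β ⊙ fun (u 2F) v) (hat q))
      (trans (cong₂ ℚ._+_ (part α 1F) (part β 2F)) (sym (ι-+ (α * xc q) (β * yc q))))
    where
    part : ∀ α i → (ιℤ α ⊙ fun (u i) v) ∙ hat q ≡ ιℤ (α * (u i · (q -ᵛ v)))
    part α i = trans (⊙-∙ (ιℤ α) (fun (u i) v) (hat q)) (trans (cong (ιℤ α ℚ.*_) (fun-hat (u i) v q)) (sym (ι-* α (u i · (q -ᵛ v)))))

  minimal-corner : ∀ α β → ∃ λ D → OnFacet C D ×
                   (∀ q → ι q ∈P V → n · (q -ᵛ v) ≡ 0ℤ → 0ℤ ≤ α * (xc q - xc (Corner.v D)) + β * (yc q - yc (Corner.v D)))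
  minimal-corner α β = go (facet-corner C (functional α β))
    where
    go : _ → _
    go (D , on , min) = D , on , λ q q∈ z → ι-reflect {α * (xc q - xc (Corner.v D)) + β * (yc q - yc (Corner.v D))} (min q q∈ z
        by trans (cong₂ ℚ._-_ (functional-hat α β q) (functional-hat α β (Corner.v D)))
          (trans (sym (ι-- (α * xc q + β * yc q) (α * xc (Corner.v D) + β * yc (Corner.v D))))
            (cong ιℤ (h α β (xc q) (yc q) (xc (Corner.v D)) (yc (Corner.v D))))))
      where
      h : ∀ α β x y x′ y′ → (α * x + β * y) - (α * x′ + β * y′) ≡ α * (x - x′) + β * (y - y′)
      h = ℤR.solve-∀

  polygon : Polygon L
  polygon = record
    { dec = λ x y → lattice-point? (pt x y)
    ; convex = λ N {n₁} {n₂} {n₃} {x₁} {y₁} {x₂} {y₂} {x₃} {y₃} {x} {y} N≥1 n₁≥0 n₂≥0 n₃≥0 p q r s sx sy →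
        P-convex N n₁ n₂ n₃ (pt x₁ y₁) (pt x₂ y₂) (pt x₃ y₃) (pt x y) N≥1 n₁≥0 n₂≥0 n₃≥0 p q r s
          (λ i → affine-combination (v i) (e 1F i) (e 2F i) N n₁ n₂ n₃ x₁ y₁ x₂ y₂ x₃ y₃ x y s sx sy)
    -- `Corner₂` maximises, hence the signs.
    ; corner = λ α β → at α β (minimal-corner (- α) (- β))
    }
    where
    at : ∀ α β → _ → Corner₂ L α β
    at α β (D , on , min) = PlaneCorner.plane-corner D on α β (λ x y p →
        min (pt x y) p (pt-on x y) byᶻ trans (cong₂ (λ a b → - α * (a - xc (Corner.v D)) + - β * (b - yc (Corner.v D))) (xc-pt x y) (yc-pt x y))
          (h α β x y (xc (Corner.v D)) (yc (Corner.v D))))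
      where
      h : ∀ α β x y x′ y′ → - α * (x - x′) + - β * (y - y′) ≡ α * (x′ - x) + β * (y′ - y)
      h = ℤR.solve-∀

  X Y : H → ℚ
  X h = fun (u 1F) v ∙ h
  Y h = fun (u 2F) v ∙ h

  -- On the supporting hyperplane only generators of the facet carry positive coefficients, and
  -- `enlarge` absorbs each of them. The induction starts from the triangle of `v` and its two
  -- neighbouring lattice points on the facet, with all weights 0.
  cover : ∀ h → Cone V h → fun n v ∙ h ≡ 0ℚ → Positive L (h 0F) (X h) (Y h)
  cover h c z = proj₂ (cone-ind V Q resp base step c) z
    where
    open import Data.Rational using () renaming (_+_ to _+ℚ_; _*_ to _*ℚ_)
    N = fun n v
    Q : H → Set
    Q h = 0ℚ ℚ.≤ N ∙ h × (N ∙ h ≡ 0ℚ → Positive L (h 0F) (X h) (Y h))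
    transport : ∀ {r r′ X X′ Y Y′} → r ≡ r′ → X ≡ X′ → Y ≡ Y′ → Positive L r X Y → Positive L r′ X′ Y′
    transport refl refl refl p = p
    resp : ∀ {x y} → x ≋ y → Q x → Q y
    resp e (p , q) = (p by ∙-cong N e) , λ z →
      transport (e 0F) (∙-cong (fun (u 1F) v) e) (∙-cong (fun (u 2F) v) e) (q (trans (∙-cong N e) z))
    corner-L : ∀ i → n · e i ≡ 0ℤ → ∀ {x y} → u 1F · e i ≡ x → u 2F · e i ≡ y → L x y
    corner-L i z {x} {y} p q = subst₂ L (trans (·-edge (u 1F) v (e i) v) (trans (cong₂ _+_ (self 1F) p) (ℤP.+-identityˡ x)))
                                (trans (·-edge (u 2F) v (e i) v) (trans (cong₂ _+_ (self 2F) q) (ℤP.+-identityˡ y)))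
        (L-of (v +ᵛ e i) (trans (·-edge n v (e i) v) (trans (cong₂ _+_ (self 0F) z) refl)) (e∈P i))
      where
      self : ∀ i → u i · (v -ᵛ v) ≡ 0ℤ
      self i = trans (·-- (u i) v v) (ℤP.+-inverseʳ (u i · v))
    origin-L : L 0ℤ 0ℤ
    origin-L = P-resp (λ i → h₀ (v i) (e 1F i) (e 2F i)) v∈P
      where
      h₀ : ∀ v a b → v ≡ v + 0ℤ * a + 0ℤ * b
      h₀ = ℤR.solve-∀
    base : Q 𝟎
    base = (0≤0 by sym (∙-𝟎 N)) , λ _ → transport refl (sym (∙-𝟎 (fun (u 1F) v))) (sym (∙-𝟎 (fun (u 2F) v)))
      (1ℤ , 0≤0ᶻ , covered {x₁ = 0ℤ} {0ℤ} {1ℤ} {0ℤ} {0ℤ} {1ℤ} {0ℚ} {0ℚ} {0ℚ} origin-L (corner-L 1F (dual 0F 1F) (dual 1F 1F) (dual 2F 1F))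
        (corner-L 2F (dual 0F 2F) (dual 1F 2F) (dual 2F 2F)) refl 0≤0 0≤0 0≤0 refl refl refl)
    step : ∀ k c {x} → 0ℚ ℚ.≤ c → Q x → Q ((c ⊙ hat (V k)) ⊕ x)
    step k c {x} c≥0 (x≥0 , q) = (cs≥0 ⊹ x≥0 by sym (ev n)) , λ z → grow (trans (sym (ev n)) z)
      where
      ev : ∀ a → fun a v ∙ ((c ⊙ hat (V k)) ⊕ x) ≡ c *ℚ ιℤ (a · (V k -ᵛ v)) +ℚ fun a v ∙ x
      ev a = trans (∙-⊕ (fun a v) (c ⊙ hat (V k)) x) (cong (_+ℚ fun a v ∙ x)
               (trans (∙-⊙ (fun a v) c (hat (V k))) (cong (c *ℚ_) (fun-hat a v (V k)))))
      cs≥0 = c≥0 ⊛ ι-mono (inside 0F k)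
      grow : c *ℚ ιℤ (n · (V k -ᵛ v)) +ℚ N ∙ x ≡ 0ℚ → _
      grow z = decide (sign c)
        where
        rest : Positive L (x 0F) (X x) (Y x)
        rest = q (sum≡0ʳ cs≥0 x≥0 z)
        decide : Sign c → Positive L (c *ℚ 1ℚ +ℚ x 0F) (X ((c ⊙ hat (V k)) ⊕ x)) (Y ((c ⊙ hat (V k)) ⊕ x))
        decide (neg c<0) = ⊥-elim (neg≰ (pos+ c<0 c≥0 <by ℚP.+-inverseˡ c))
        decide (nul c≡0) = transport (trans (h₀ 1ℚ (x 0F)) (cong (λ a → a *ℚ 1ℚ +ℚ x 0F) (sym c≡0)))
            (trans (h₀ (ιℤ (xc (V k))) (X x)) (trans (cong (λ a → a *ℚ ιℤ (xc (V k)) +ℚ X x) (sym c≡0)) (sym (ev (u 1F)))))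
            (trans (h₀ (ιℤ (yc (V k))) (Y x)) (trans (cong (λ a → a *ℚ ιℤ (yc (V k)) +ℚ Y x) (sym c≡0)) (sym (ev (u 2F))))) rest
          where
          h₀ : ∀ a b → b ≡ 0ℚ *ℚ a +ℚ b
          h₀ = solve-∀ ℚ-ring
        decide (pos c>0) = transport (trans (cong (x 0F +ℚ_) (sym (ℚP.*-identityʳ c))) (ℚP.+-comm (x 0F) (c *ℚ 1ℚ)))
            (trans (ℚP.+-comm (X x) (c *ℚ ιℤ (xc (V k)))) (sym (ev (u 1F)))) (trans (ℚP.+-comm (Y x) (c *ℚ ιℤ (yc (V k)))) (sym (ev (u 2F))))
            (enlarge rest {xc (V k)} {yc (V k)} c≥0 (L-of (V k) on (cone-gen V k)))
          where
          on : n · (V k -ᵛ v) ≡ 0ℤ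
          on = ι-injective (*≡0 c>0 (sum≡0ˡ cs≥0 x≥0 z))

-- Lattice parallelepipeds and their antipodal construction.

module Decompositions {m} (V : Fin m → ℤ³) where

  open LatticeConvexity V

  Decomposition : ℕ → ℤ³ → Set
  Decomposition N p = ∃ λ (q : Fin N → ℤ³) → (∀ j → ι (q j) ∈P V) × (∀ i → sumℤ (λ j → q j i) ≡ p i)

  cons : ∀ {N p} q p′ → ι q ∈P V → Decomposition N p′ → (∀ i → q i ℤ.+ p′ i ≡ p i) → Decomposition (suc N) p
  cons q p′ q∈ (qs , qs∈ , s) e = (λ { zero → q ; (suc j) → qs j }) , (λ { zero → q∈ ; (suc j) → qs∈ j }) ,
    λ i → trans (cong (ℤ._+_ (q i)) (s i)) (e i)

  module Parallelepiped where

    open import Data.Rational using (_+_; _*_; _-_; -_; _≤_; _<_)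

    bit : Bool → ℤ
    bit false = 0ℤ
    bit true = 1ℤ

    vertex : (z f g d : ℤ³) → Bool → Bool → Bool → ℤ³
    vertex z f g d s t u i = z i ℤ.+ (bit s ℤ.* f i ℤ.+ (bit t ℤ.* g i ℤ.+ bit u ℤ.* d i))

    mix : ℚ → H → H → H
    mix t x y = ((1ℚ - t) ⊙ x) ⊕ (t ⊙ y)

    cone-mix : ∀ {t x y} → 0ℚ ≤ t → 0ℚ ≤ 1ℚ - t → Cone V x → Cone V y → Cone V (mix t x y)
    cone-mix {t} {x} {y} t≥0 t≤1 c c′ = cone-⊕ {V = V} {(1ℚ - t) ⊙ x} {t ⊙ y} (cone-⊙ {V = V} {1ℚ - t} {x} t≤1 c) (cone-⊙ {V = V} {t} {y} t≥0 c′)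

    -- If nothing is subtracted then a < 1, which is within the next bound `suc N` because that
    -- bound is at least 1. Hence the lemma starts at dilation factor 2.
    digit : ∀ N a → 0ℚ ≤ a → 0ℚ ≤ ιℤ (+ suc (suc N)) - a →
            ∃ λ s → 0ℚ ≤ a - ιℤ (bit s) × 0ℚ ≤ ιℤ (+ suc N) - (a - ιℤ (bit s))
    digit N a a≥0 a≤ = go (nonneg? (a - 1ℚ))
      where
      S = ιℤ (+ suc N)
      S+1 : ιℤ (+ suc (suc N)) ≡ 1ℚ + S
      S+1 = ι-+ 1ℤ (+ suc N)
      go : _ → ∃ λ s → 0ℚ ≤ a - ιℤ (bit s) × 0ℚ ≤ S - (a - ιℤ (bit s))
      go (inj₁ p) = true , p , (a≤ by trans (cong (_- a) S+1) (h S a))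
        where
        h : ∀ S a → 1ℚ + S - a ≡ S - (a - 1ℚ)
        h = solve-∀ ℚ-ring
      go (inj₂ p) = false , (a≥0 by h a) , (ι-mono (+≥0 N) ⊹ ℚP.<⇒≤ p by trans (h′ (ιℤ (+ N)) a) (cong (λ S → S - (a - 0ℚ)) (sym (ι-+ 1ℤ (+ N)))))
        where
        h : ∀ a → a ≡ a - 0ℚ
        h = solve-∀ ℚ-ring
        h′ : ∀ n a → n + - (a - 1ℚ) ≡ 1ℚ + n - (a - 0ℚ)
        h′ = solve-∀ ℚ-ring

    -- Each step removes a vertex, chosen in each coordinate by `digit`. The coordinates stay
    -- rational, and volume is irrelevant: at factor 1 the remainder is itself a lattice point of
    -- the parallelepiped and becomes the last summand.
    parallelepiped : ∀ (z f g d : ℤ³) → (∀ s t u → ι (vertex z f g d s t u) ∈P V) →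
      ∀ N p α β γ → 0ℚ ≤ α → 0ℚ ≤ ιℤ (+ suc N) - α → 0ℚ ≤ β → 0ℚ ≤ ιℤ (+ suc N) - β →
      0ℚ ≤ γ → 0ℚ ≤ ιℤ (+ suc N) - γ →
      (∀ i → ιℤ (p i) ≡ ιℤ (+ suc N) * ιℤ (z i) + (α * ιℤ (f i) + (β * ιℤ (g i) + γ * ιℤ (d i)))) →
      Decomposition (suc N) p
    parallelepiped z f g d vs zero p α β γ α≥0 α≤ β≥0 β≤ γ≥0 γ≤ eq =
        cons p (λ _ → 0ℤ) p∈P ((λ ()) , (λ ()) , λ _ → refl) (λ i → ℤP.+-identityʳ (p i))
      where
      x : Bool → Bool → Bool → H
      x s t u = hat (vertex z f g d s t u)
      line : Bool → Bool → H
      line t u = mix α (x false t u) (x true t u)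
      plane : Bool → H
      plane u = mix β (line false u) (line true u)
      line∈ : ∀ t u → Cone V (line t u)
      line∈ t u = cone-mix {α} {x false t u} {x true t u} α≥0 α≤ (vs false t u) (vs true t u)
      plane∈ : ∀ u → Cone V (plane u)
      plane∈ u = cone-mix {β} {line false u} {line true u} β≥0 β≤ (line∈ false u) (line∈ true u)
      ι-vertex : ∀ s t u i → ιℤ (vertex z f g d s t u i) ≡
                 ιℤ (z i) + (ιℤ (bit s) * ιℤ (f i) + (ιℤ (bit t) * ιℤ (g i) + ιℤ (bit u) * ιℤ (d i)))
      ι-vertex s t u i = trans (ι-+ (z i) _) (cong (_+_ (ιℤ (z i))) (ι-expand (bit s) (bit t) (bit u) (f i) (g i) (d i) refl))
      h₀ : ∀ α β γ → (1ℚ - γ) * ((1ℚ - β) * ((1ℚ - α) * 1ℚ + α * 1ℚ) + β * ((1ℚ - α) * 1ℚ + α * 1ℚ)) +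
                     γ * ((1ℚ - β) * ((1ℚ - α) * 1ℚ + α * 1ℚ) + β * ((1ℚ - α) * 1ℚ + α * 1ℚ)) ≡ 1ℚ
      h₀ = solve-∀ ℚ-ring
      l₁ : ∀ α z f k → (1ℚ - α) * (z + (0ℚ * f + k)) + α * (z + (1ℚ * f + k)) ≡ z + (α * f + k)
      l₁ = solve-∀ ℚ-ring
      l₂ : ∀ α β z f g k → (1ℚ - β) * (z + (α * f + (0ℚ * g + k))) + β * (z + (α * f + (1ℚ * g + k))) ≡ z + (α * f + (β * g + k))
      l₂ = solve-∀ ℚ-ring
      l₃ : ∀ α β γ z f g d → (1ℚ - γ) * (z + (α * f + (β * g + 0ℚ * d))) + γ * (z + (α * f + (β * g + 1ℚ * d))) ≡
           1ℚ * z + (α * f + (β * g + γ * d))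
      l₃ = solve-∀ ℚ-ring
      line≡ : ∀ t u i → line t u (suc i) ≡ ιℤ (z i) + (α * ιℤ (f i) + (ιℤ (bit t) * ιℤ (g i) + ιℤ (bit u) * ιℤ (d i)))
      line≡ t u i = trans (cong₂ (λ a b → (1ℚ - α) * a + α * b) (ι-vertex false t u i) (ι-vertex true t u i)) (l₁ α (ιℤ (z i)) (ιℤ (f i)) _)
      plane≡ : ∀ u i → plane u (suc i) ≡ ιℤ (z i) + (α * ιℤ (f i) + (β * ιℤ (g i) + ιℤ (bit u) * ιℤ (d i)))
      plane≡ u i = trans (cong₂ (λ a b → (1ℚ - β) * a + β * b) (line≡ false u i) (line≡ true u i)) (l₂ α β (ιℤ (z i)) (ιℤ (f i)) (ιℤ (g i)) _)
      mixed : mix γ (plane false) (plane true) ≋ hat p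
      mixed zero = h₀ α β γ
      mixed (suc i) = trans (cong₂ (λ a b → (1ℚ - γ) * a + γ * b) (plane≡ false i) (plane≡ true i))
        (trans (l₃ α β γ (ιℤ (z i)) (ιℤ (f i)) (ιℤ (g i)) (ιℤ (d i))) (sym (eq i)))
      p∈P : ι p ∈P V
      p∈P = cone-resp {V = V} {mix γ (plane false) (plane true)} {hat p} mixed
              (cone-mix {γ} {plane false} {plane true} γ≥0 γ≤ (plane∈ false) (plane∈ true))
    parallelepiped z f g d vs (suc N) p α β γ α≥0 α≤ β≥0 β≤ γ≥0 γ≤ eq =
        go (digit N α α≥0 α≤) (digit N β β≥0 β≤) (digit N γ γ≥0 γ≤)
      where
      go : _ → _ → _ → Decomposition (suc (suc N)) p
      go (s , α′≥0 , α′≤) (t , β′≥0 , β′≤) (u , γ′≥0 , γ′≤) =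
        cons q p′ (vs s t u)
          (parallelepiped z f g d vs N p′ (α - ιℤ (bit s)) (β - ιℤ (bit t)) (γ - ιℤ (bit u)) α′≥0 α′≤ β′≥0 β′≤ γ′≥0 γ′≤ eq′)
          (λ i → h (q i) (p i))
        where
        q p′ : ℤ³
        q = vertex z f g d s t u
        p′ i = p i ℤ.- q i
        h : ∀ q p → q ℤ.+ (p ℤ.- q) ≡ p
        h = ℤR.solve-∀
        k : ∀ S z f g d α β γ s t u → (1ℚ + S) * z + (α * f + (β * g + γ * d)) - (z + (s * f + (t * g + u * d))) ≡
            S * z + ((α - s) * f + ((β - t) * g + (γ - u) * d))
        k = solve-∀ ℚ-ring
        eq′ : ∀ i → ιℤ (p′ i) ≡ ιℤ (+ suc N) * ιℤ (z i) + ((α - ιℤ (bit s)) * ιℤ (f i) + ((β - ιℤ (bit t)) * ιℤ (g i) + (γ - ιℤ (bit u)) * ιℤ (d i)))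
        eq′ i = trans (ι-- (p i) (q i)) (trans (cong₂ _-_ (trans (eq i) (cong (λ S → S * ιℤ (z i) + (α * ιℤ (f i) + (β * ιℤ (g i) + γ * ιℤ (d i)))) (ι-+ 1ℤ (+ suc N))))
            (trans (ι-+ (z i) _) (cong (_+_ (ιℤ (z i))) (ι-expand (bit s) (bit t) (bit u) (f i) (g i) (d i) refl))))
          (k (ιℤ (+ suc N)) (ιℤ (z i)) (ιℤ (f i)) (ιℤ (g i)) (ιℤ (d i)) α β γ (ιℤ (bit s)) (ιℤ (bit t)) (ιℤ (bit u))))

  open import Data.Rational using (_+_; _*_; _-_; -_; _≤_; _<_)

  -- p = r y for a point y of a lattice parallelogram a + [0,1] f + [0,1] g in P
  record SquareCover (p : ℤ³) (r : ℚ) : Set where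
    field
      a f g : ℤ³
      a∈  : ι a ∈P V
      f∈  : ι (λ i → a i ℤ.+ f i) ∈P V
      g∈  : ι (λ i → a i ℤ.+ g i) ∈P V
      fg∈ : ι (λ i → a i ℤ.+ f i ℤ.+ g i) ∈P V
      λ₁ λ₂ : ℚ
      λ₁≥0 : 0ℚ ≤ λ₁
      λ₂≥0 : 0ℚ ≤ λ₂
      λ₁≤r : 0ℚ ≤ r - λ₁
      λ₂≤r : 0ℚ ≤ r - λ₂
      p≡ : ∀ i → ιℤ (p i) ≡ r * ιℤ (a i) + λ₁ * ιℤ (f i) + λ₂ * ιℤ (g i)

  -- The parallelogram S and its antipode -S span the parallelepiped z + [0,1]f + [0,1]g + [0,1]d.
  square-decomposition : CentSym V → ∀ N {p r} → 0ℚ ≤ r → 0ℚ ≤ ιℤ (+ suc N) - r → SquareCover p r → Decomposition (suc N) p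
  square-decomposition (neg∈ , _) N {p} {r} r≥0 r≤ S =
      parallelepiped z f g d vs N p (λ₁ + h) (λ₂ + h) (r + h)
        (λ₁≥0 ⊹ h≥0) (λ₁≤r ⊹ h≥0 by k₁ n r λ₁) (λ₂≥0 ⊹ h≥0) (λ₂≤r ⊹ h≥0 by k₁ n r λ₂)
        (r≥0 ⊹ h≥0) (h≥0 by k₂ n r) eq
    where
    open SquareCover S
    open Parallelepiped
    n = ιℤ (+ suc N)
    -- Comparing coefficients of `a` requires -n + 2 (r + h) = r, which fixes `h`; those of `f` and
    -- `g` then agree as well.
    h = ½ * (n - r)
    h≥0 : 0ℚ ≤ h
    h≥0 = ℚP.nonNegative⁻¹ ½ ⊛ r≤
    halves : ∀ x → x ≡ ½ * x + ½ * x
    halves x = trans (sym (ℚP.*-identityˡ x)) (ℚP.*-distribʳ-+ x ½ ½)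
    k₁ : ∀ n r l → r - l + ½ * (n - r) ≡ n - (l + ½ * (n - r))
    k₁ n r l = trans (k n r l (½ * (n - r))) (trans (cong (λ x → r - l + x - ½ * (n - r)) (sym (halves (n - r)))) (k′ n r l (½ * (n - r))))
      where
      k : ∀ n r l h → r - l + h ≡ r - l + (h + h) - h
      k = solve-∀ ℚ-ring
      k′ : ∀ n r l h → r - l + (n - r) - h ≡ n - (l + h)
      k′ = solve-∀ ℚ-ring
    k₂ : ∀ n r → ½ * (n - r) ≡ n - (r + ½ * (n - r))
    k₂ n r = trans (k (½ * (n - r))) (trans (cong (λ x → x - ½ * (n - r)) (sym (halves (n - r)))) (k′ n r (½ * (n - r))))
      where
      k : ∀ h → h ≡ (h + h) - h
      k = solve-∀ ℚ-ring
      k′ : ∀ n r h → (n - r) - h ≡ n - (r + h)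
      k′ = solve-∀ ℚ-ring
    -- Based at its vertex `z`, -S has the same edge vectors `f` and `g` as S, and S is its
    -- translate by `d`.
    z d : ℤ³
    z i = ℤ.- (a i ℤ.+ f i ℤ.+ g i)
    d i = a i ℤ.+ a i ℤ.+ f i ℤ.+ g i
    antipode : ∀ (q : ℤ³) → ι q ∈P V → ι (λ i → ℤ.- q i) ∈P V
    antipode q q∈ = cone-resp {V = V} {hom 1ℚ (λ i → - ι q i)} {hat (λ i → ℤ.- q i)}
      (λ { zero → refl ; (suc i) → sym (ι-neg (q i)) }) (neg∈ (ι q) q∈)
    vs : ∀ s t u → ι (vertex z f g d s t u) ∈P V
    vs false false false = P-resp (λ i → e (a i) (f i) (g i)) (antipode (λ i → a i ℤ.+ f i ℤ.+ g i) fg∈)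
      where
      e : ∀ a f g → ℤ.- (a ℤ.+ f ℤ.+ g) ≡ ℤ.- (a ℤ.+ f ℤ.+ g) ℤ.+ (0ℤ ℤ.* f ℤ.+ (0ℤ ℤ.* g ℤ.+ 0ℤ ℤ.* (a ℤ.+ a ℤ.+ f ℤ.+ g)))
      e = ℤR.solve-∀
    vs true false false = P-resp (λ i → e (a i) (f i) (g i)) (antipode (λ i → a i ℤ.+ g i) g∈)
      where
      e : ∀ a f g → ℤ.- (a ℤ.+ g) ≡ ℤ.- (a ℤ.+ f ℤ.+ g) ℤ.+ (1ℤ ℤ.* f ℤ.+ (0ℤ ℤ.* g ℤ.+ 0ℤ ℤ.* (a ℤ.+ a ℤ.+ f ℤ.+ g)))
      e = ℤR.solve-∀
    vs false true false = P-resp (λ i → e (a i) (f i) (g i)) (antipode (λ i → a i ℤ.+ f i) f∈)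
      where
      e : ∀ a f g → ℤ.- (a ℤ.+ f) ≡ ℤ.- (a ℤ.+ f ℤ.+ g) ℤ.+ (0ℤ ℤ.* f ℤ.+ (1ℤ ℤ.* g ℤ.+ 0ℤ ℤ.* (a ℤ.+ a ℤ.+ f ℤ.+ g)))
      e = ℤR.solve-∀
    vs true true false = P-resp (λ i → e (a i) (f i) (g i)) (antipode a a∈)
      where
      e : ∀ a f g → ℤ.- a ≡ ℤ.- (a ℤ.+ f ℤ.+ g) ℤ.+ (1ℤ ℤ.* f ℤ.+ (1ℤ ℤ.* g ℤ.+ 0ℤ ℤ.* (a ℤ.+ a ℤ.+ f ℤ.+ g)))
      e = ℤR.solve-∀
    vs false false true = P-resp (λ i → e (a i) (f i) (g i)) a∈
      where
      e : ∀ a f g → a ≡ ℤ.- (a ℤ.+ f ℤ.+ g) ℤ.+ (0ℤ ℤ.* f ℤ.+ (0ℤ ℤ.* g ℤ.+ 1ℤ ℤ.* (a ℤ.+ a ℤ.+ f ℤ.+ g)))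
      e = ℤR.solve-∀
    vs true false true = P-resp (λ i → e (a i) (f i) (g i)) f∈
      where
      e : ∀ a f g → a ℤ.+ f ≡ ℤ.- (a ℤ.+ f ℤ.+ g) ℤ.+ (1ℤ ℤ.* f ℤ.+ (0ℤ ℤ.* g ℤ.+ 1ℤ ℤ.* (a ℤ.+ a ℤ.+ f ℤ.+ g)))
      e = ℤR.solve-∀
    vs false true true = P-resp (λ i → e (a i) (f i) (g i)) g∈
      where
      e : ∀ a f g → a ℤ.+ g ≡ ℤ.- (a ℤ.+ f ℤ.+ g) ℤ.+ (0ℤ ℤ.* f ℤ.+ (1ℤ ℤ.* g ℤ.+ 1ℤ ℤ.* (a ℤ.+ a ℤ.+ f ℤ.+ g)))
      e = ℤR.solve-∀
    vs true true true = P-resp (λ i → e (a i) (f i) (g i)) fg∈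
      where
      e : ∀ a f g → a ℤ.+ f ℤ.+ g ≡ ℤ.- (a ℤ.+ f ℤ.+ g) ℤ.+ (1ℤ ℤ.* f ℤ.+ (1ℤ ℤ.* g ℤ.+ 1ℤ ℤ.* (a ℤ.+ a ℤ.+ f ℤ.+ g)))
      e = ℤR.solve-∀
    eq : ∀ i → ιℤ (p i) ≡ n * ιℤ (z i) + ((λ₁ + h) * ιℤ (f i) + ((λ₂ + h) * ιℤ (g i) + (r + h) * ιℤ (d i)))
    eq i = trans (p≡ i) (trans (e₁ n r λ₁ λ₂ (ιℤ (a i)) (ιℤ (f i)) (ιℤ (g i)))
      (trans (cong (λ x → n * - (ιℤ (a i) + ιℤ (f i) + ιℤ (g i)) + (r * (ιℤ (a i) + ιℤ (a i) + ιℤ (f i) + ιℤ (g i)) + (λ₁ * ιℤ (f i) + λ₂ * ιℤ (g i)) + x * (ιℤ (a i) + ιℤ (f i) + ιℤ (g i)))) (halves (n - r)))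
        (trans (e₂ n r λ₁ λ₂ h (ιℤ (a i)) (ιℤ (f i)) (ιℤ (g i))) (cong₂ (λ x y → n * x + ((λ₁ + h) * ιℤ (f i) + ((λ₂ + h) * ιℤ (g i) + (r + h) * y))) (sym ιz) (sym ιd)))))
      where
      ιz : ιℤ (z i) ≡ - (ιℤ (a i) + ιℤ (f i) + ιℤ (g i))
      ιz = trans (ι-neg (a i ℤ.+ f i ℤ.+ g i)) (cong -_ (trans (ι-+ (a i ℤ.+ f i) (g i)) (cong (_+ ιℤ (g i)) (ι-+ (a i) (f i)))))
      ιd : ιℤ (d i) ≡ ιℤ (a i) + ιℤ (a i) + ιℤ (f i) + ιℤ (g i)
      ιd = trans (ι-+ (a i ℤ.+ a i ℤ.+ f i) (g i)) (cong (_+ ιℤ (g i)) (trans (ι-+ (a i ℤ.+ a i) (f i)) (cong (_+ ιℤ (f i)) (ι-+ (a i) (a i)))))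
      e₁ : ∀ n r l m a f g → r * a + l * f + m * g ≡
           n * - (a + f + g) + (r * (a + a + f + g) + (l * f + m * g) + (n - r) * (a + f + g))
      e₁ = solve-∀ ℚ-ring
      e₂ : ∀ n r l m h a f g → n * - (a + f + g) + (r * (a + a + f + g) + (l * f + m * g) + (h + h) * (a + f + g)) ≡
           n * - (a + f + g) + ((l + h) * f + ((m + h) * g + (r + h) * (a + a + f + g)))
      e₂ = solve-∀ ℚ-ring

-- The layer next to a triangular facet, and dilated triangles.

module Slices {m} (V : Fin m → ℤ³) where

  open LatticeConvexity V
  open Decompositions V
  open Polygons using (squeeze; pick≡0)
  open UnimodularTriangles using (split₁; ≥1⇒≥0; clash)

  -- The layer between the triangle v, v + f, v + g and its (1 + k)-fold dilate at height 1. A sum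
  -- of N points at total height `j` takes `j` points from the upper triangle and N - j from the
  -- lower one. Its a + b is then at most (N - j) + j (1 + k) = N + k j, which is the capacity
  -- condition of `strip`.
  module Strip (v f g e : ℤ³) (k : ℤ) (k≥0 : 0ℤ ℤ.≤ k)
    (v∈ : ι v ∈P V) (f∈ : ι (λ i → v i ℤ.+ f i) ∈P V) (g∈ : ι (λ i → v i ℤ.+ g i) ∈P V)
    (e∈ : ι (λ i → v i ℤ.+ e i) ∈P V)
    (ef∈ : ι (λ i → v i ℤ.+ e i ℤ.+ (1ℤ ℤ.+ k) ℤ.* f i) ∈P V)
    (eg∈ : ι (λ i → v i ℤ.+ e i ℤ.+ (1ℤ ℤ.+ k) ℤ.* g i) ∈P V) where

    open import Data.Integer using (_+_; _*_; _-_; -_; _≤_)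

    point : ℤ → ℤ → ℤ → ℤ → ℤ³
    point N a b j i = N * v i + (a * f i + (b * g i + j * e i))

    slice∈ : ∀ x y → 0ℤ ≤ x → 0ℤ ≤ y → 0ℤ ≤ 1ℤ + k - x - y → ι (point 1ℤ x y 1ℤ) ∈P V
    slice∈ x y x≥0 y≥0 s = P-convex (1ℤ + k) (1ℤ + k - x - y) x y _ _ _ (point 1ℤ x y 1ℤ)
        (k≥0 byᶻ h₀ k) s x≥0 y≥0 e∈ ef∈ eg∈ (h₁ k x y) (λ i → h₂ k x y (v i) (f i) (g i) (e i))
      where
      h₀ : ∀ k → k ≡ 1ℤ + k - 1ℤ
      h₀ = ℤR.solve-∀
      h₁ : ∀ k x y → 1ℤ + k - x - y + x + y ≡ 1ℤ + k
      h₁ = ℤR.solve-∀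
      h₂ : ∀ k x y v f g e → (1ℤ + k - x - y) * (v + e) + x * (v + e + (1ℤ + k) * f) + y * (v + e + (1ℤ + k) * g) ≡
           (1ℤ + k) * (1ℤ * v + (x * f + (y * g + 1ℤ * e)))
      h₂ = ℤR.solve-∀

    strip : ∀ N {p} a b j → 0ℤ ≤ a → 0ℤ ≤ b → 0ℤ ≤ j → 0ℤ ≤ + N - j → 0ℤ ≤ + N + k * j - a - b →
            (∀ i → p i ≡ point (+ N) a b j i) → Decomposition N p
    strip zero a b j a≥0 b≥0 j≥0 j≤ cap eq = (λ ()) , (λ ()) , λ i → sym (trans (eq i) (vanish i))
      where
      j≡0 : j ≡ 0ℤ
      j≡0 = squeeze j≥0 (j≤ byᶻ ℤP.+-identityˡ (- j))
      ab≤0 : ∀ j → j ≡ 0ℤ → 0ℤ + k * j - a - b ≡ - (a + b)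
      ab≤0 _ refl = h k a b
        where
        h : ∀ k a b → 0ℤ + k * 0ℤ - a - b ≡ - (a + b)
        h = ℤR.solve-∀
      ab : a + b ≡ 0ℤ
      ab = squeeze (a≥0 ⊹ᶻ b≥0) (cap byᶻ ab≤0 j j≡0)
      a≡0 : a ≡ 0ℤ
      a≡0 = pick≡0 a≥0 b≥0 ab
      b≡0 : b ≡ 0ℤ
      b≡0 = pick≡0 b≥0 a≥0 (trans (ℤP.+-comm b a) ab)
      vanish : ∀ i → point 0ℤ a b j i ≡ 0ℤ
      vanish i = trans (cong₂ (λ a b → 0ℤ * v i + (a * f i + b)) a≡0 (cong₂ (λ b j → b * g i + j * e i) b≡0 j≡0)) (h (v i) (f i) (g i) (e i))
        where
        h : ∀ v f g e → 0ℤ * v + (0ℤ * f + (0ℤ * g + 0ℤ * e)) ≡ 0ℤ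
        h = ℤR.solve-∀
    strip (suc N) {p} a b j a≥0 b≥0 j≥0 j≤ cap eq = level (split (+ N - j))
      where
      take : ∀ x y t → ι (point 1ℤ x y t) ∈P V → 0ℤ ≤ a - x → 0ℤ ≤ b - y → 0ℤ ≤ j - t → 0ℤ ≤ + N - (j - t) →
             0ℤ ≤ + N + k * (j - t) - (a - x) - (b - y) → Decomposition (suc N) p
      take x y t q∈ a′ b′ j′ j≤′ cap′ = cons (point 1ℤ x y t) (point (+ N) (a - x) (b - y) (j - t)) q∈
          (strip N (a - x) (b - y) (j - t) a′ b′ j′ j≤′ cap′ (λ i → refl))
          (λ i → trans (h (+ N) a b j x y t (v i) (f i) (g i) (e i)) (sym (eq i)))
        where
        h : ∀ N a b j x y t v f g e → (1ℤ * v + (x * f + (y * g + t * e))) + (N * v + ((a - x) * f + ((b - y) * g + (j - t) * e))) ≡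
            (1ℤ + N) * v + (a * f + (b * g + j * e))
        h = ℤR.solve-∀
      z : ∀ {a} → 0ℤ ≤ a → 0ℤ ≤ a - 0ℤ
      z {a} p = p byᶻ sym (ℤP.+-identityʳ a)

      -- Lower points are spent first: `v` if the remaining capacity allows it, and otherwise a + b
      -- is exactly the capacity, so `a` or `b` is positive. Once j = N + 1 only upper points are
      -- left, and each takes as much of `a`, then of `b`, as fits.
      level : _ → Decomposition (suc N) p
      level (inj₁ j≤N) = width (split (+ N + k * j - a - b))
        where
        base∈ : ι (point 1ℤ 0ℤ 0ℤ 0ℤ) ∈P V
        base∈ = P-resp (λ i → h (v i) (f i) (g i) (e i)) v∈
          where
          h : ∀ v f g e → v ≡ 1ℤ * v + (0ℤ * f + (0ℤ * g + 0ℤ * e))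
          h = ℤR.solve-∀
        f∈′ : ι (point 1ℤ 1ℤ 0ℤ 0ℤ) ∈P V
        f∈′ = P-resp (λ i → h (v i) (f i) (g i) (e i)) f∈
          where
          h : ∀ v f g e → v + f ≡ 1ℤ * v + (1ℤ * f + (0ℤ * g + 0ℤ * e))
          h = ℤR.solve-∀
        g∈′ : ι (point 1ℤ 0ℤ 1ℤ 0ℤ) ∈P V
        g∈′ = P-resp (λ i → h (v i) (f i) (g i) (e i)) g∈
          where
          h : ∀ v f g e → v + g ≡ 1ℤ * v + (0ℤ * f + (1ℤ * g + 0ℤ * e))
          h = ℤR.solve-∀
        drop : 0ℤ ≤ + N - (j - 0ℤ)
        drop = j≤N byᶻ cong (λ t → + N - t) (sym (ℤP.+-identityʳ j))
        k₁ : ∀ N k j a b → 1ℤ + N + k * j - a - b ≡ N + k * (j - 0ℤ) - (a - 1ℤ) - (b - 0ℤ)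
        k₁ = ℤR.solve-∀
        k₂ : ∀ N k j a b → 1ℤ + N + k * j - a - b ≡ N + k * (j - 0ℤ) - (a - 0ℤ) - (b - 1ℤ)
        k₂ = ℤR.solve-∀
        k₃ : ∀ N k j a b → N + k * j - a - b ≡ N + k * (j - 0ℤ) - (a - 0ℤ) - (b - 0ℤ)
        k₃ = ℤR.solve-∀
        k₄ : ∀ N k j a b → - (N + k * j - a - b) - 1ℤ + (N + k * j + (- a + - b)) ≡ - 1ℤ
        k₄ = ℤR.solve-∀
        width : _ → Decomposition (suc N) p
        width (inj₁ c) = take 0ℤ 0ℤ 0ℤ base∈ (z a≥0) (z b≥0) (z j≥0) drop (c byᶻ k₃ (+ N) k j a b)
        width (inj₂ c) = which (split₁ a) (split₁ b)
          where
          which : _ → _ → Decomposition (suc N) p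
          which (inj₁ a≥1) _ = take 1ℤ 0ℤ 0ℤ f∈′ a≥1 (z b≥0) (z j≥0) drop (cap byᶻ k₁ (+ N) k j a b)
          which (inj₂ _) (inj₁ b≥1) = take 0ℤ 1ℤ 0ℤ g∈′ (z a≥0) b≥1 (z j≥0) drop (cap byᶻ k₂ (+ N) k j a b)
          which (inj₂ a≤0) (inj₂ b≤0) = ⊥-elim (absurdᶻ (c ⊹ᶻ (+≥0 N ⊹ᶻ (k≥0 ⊛ᶻ j≥0) ⊹ᶻ (a≤0 ⊹ᶻ b≤0))) (k₄ (+ N) k j a b))
      level (inj₂ j>N) = wide (split (a - (1ℤ + k)))
        where
        k₀ : ∀ N j → - (N - j) - 1ℤ + N ≡ j - 1ℤ
        k₀ = ℤR.solve-∀
        j≥1 : 0ℤ ≤ j - 1ℤ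
        j≥1 = j>N ⊹ᶻ +≥0 N byᶻ k₀ (+ N) j
        k₁ : ∀ N j → 1ℤ + N - j ≡ N - (j - 1ℤ)
        k₁ = ℤR.solve-∀
        drop : 0ℤ ≤ + N - (j - 1ℤ)
        drop = j≤ byᶻ k₁ (+ N) j
        k₂ : ∀ N k j a b → 1ℤ + N + k * j - a - b ≡ N + k * (j - 1ℤ) - (a - (1ℤ + k)) - (b - 0ℤ)
        k₂ = ℤR.solve-∀
        k₃ : ∀ k a → - (a - (1ℤ + k)) - 1ℤ + 1ℤ ≡ 1ℤ + k - a
        k₃ = ℤR.solve-∀
        wide : _ → Decomposition (suc N) p
        wide (inj₁ c) = take (1ℤ + k) 0ℤ 1ℤ (slice∈ (1ℤ + k) 0ℤ (0≤1ᶻ ⊹ᶻ k≥0) 0≤0ᶻ (0≤0ᶻ byᶻ k₄ k)) c (z b≥0) j≥1 drop (cap byᶻ k₂ (+ N) k j a b)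
          where
          k₄ : ∀ k → 0ℤ ≡ 1ℤ + k - (1ℤ + k) - 0ℤ
          k₄ = ℤR.solve-∀
        wide (inj₂ c) = tall (split (a + b - (1ℤ + k)))
          where
          room : 0ℤ ≤ 1ℤ + k - a
          room = c ⊹ᶻ 0≤1ᶻ byᶻ k₃ k a
          k₄ : ∀ k a → 0ℤ ≡ 1ℤ + k - a - (1ℤ + k - a)
          k₄ = ℤR.solve-∀
          k₅ : ∀ a → 0ℤ ≡ a - a
          k₅ = ℤR.solve-∀
          k₆ : ∀ k a b → a + b - (1ℤ + k) ≡ b - (1ℤ + k - a)
          k₆ = ℤR.solve-∀
          k₇ : ∀ N k j a b → 1ℤ + N + k * j - a - b ≡ N + k * (j - 1ℤ) - (a - a) - (b - (1ℤ + k - a))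
          k₇ = ℤR.solve-∀
          k₈ : ∀ k a b → - (a + b - (1ℤ + k)) - 1ℤ + 1ℤ ≡ 1ℤ + k - a - b
          k₈ = ℤR.solve-∀
          k₉ : ∀ N k j a b → N + k * (j - 1ℤ) ≡ N + k * (j - 1ℤ) - (a - a) - (b - b)
          k₉ = ℤR.solve-∀
          tall : _ → Decomposition (suc N) p
          tall (inj₁ d) = take a (1ℤ + k - a) 1ℤ (slice∈ a (1ℤ + k - a) a≥0 room (0≤0ᶻ byᶻ k₄ k a))
            (0≤0ᶻ byᶻ k₅ a) (d byᶻ k₆ k a b) j≥1 drop (cap byᶻ k₇ (+ N) k j a b)
          tall (inj₂ d) = take a b 1ℤ (slice∈ a b a≥0 b≥0 (d ⊹ᶻ 0≤1ᶻ byᶻ k₈ k a b))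
            (0≤0ᶻ byᶻ k₅ a) (0≤0ᶻ byᶻ k₅ b) j≥1 drop (+≥0 N ⊹ᶻ (k≥0 ⊛ᶻ j≥1) byᶻ k₉ (+ N) k j a b)

  record Halves (K : ℤ) : Set where
    field
      i i′ : ℤ
      i≥1 : 0ℤ ℤ.≤ i ℤ.- 1ℤ
      i≤i′ : 0ℤ ℤ.≤ i′ ℤ.- i
      i′≤1+i : 0ℤ ℤ.≤ 1ℤ ℤ.+ i ℤ.- i′
      sum : i ℤ.+ i′ ≡ K

  halves : ∀ k → 0ℤ ℤ.≤ k ℤ.- 1ℤ → Halves (1ℤ ℤ.+ k)
  halves k k≥1 = go (TriangleDescent.residue (+ 2) (1ℤ ℤ.+ k) (ℤ.+≤+ ℕ.z≤n))
    where
    open import Data.Integer using (_+_; _*_; _-_; -_; _≤_)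
    go : _ → Halves (1ℤ + k)
    go (q , s , e , s≥0 , s≤1) = record { i = q ; i′ = q + s ; i≥1 = q≥1 (split₁ q)
        ; i≤i′ = s≥0 byᶻ h₁ q s ; i′≤1+i = s≤1 byᶻ h₂ q s ; sum = sym (trans e (h₃ q s)) }
      where
      h₁ : ∀ q s → s ≡ q + s - q
      h₁ = ℤR.solve-∀
      h₂ : ∀ q s → + 2 - 1ℤ - s ≡ 1ℤ + q - (q + s)
      h₂ = ℤR.solve-∀
      h₃ : ∀ q s → s + q * + 2 ≡ q + (q + s)
      h₃ = ℤR.solve-∀
      h₄ : ∀ q s k → (k - 1ℤ) + (+ 2 - 1ℤ - s) + - q + - q ≡ (1ℤ + k) - (s + q * + 2) - 1ℤ
      h₄ = ℤR.solve-∀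
      h₅ : ∀ a → a - a - 1ℤ ≡ - 1ℤ
      h₅ = ℤR.solve-∀
      q≥1 : _ → 0ℤ ≤ q - 1ℤ
      q≥1 (inj₁ p) = p
      q≥1 (inj₂ p) = ⊥-elim (absurdᶻ (k≥1 ⊹ᶻ s≤1 ⊹ᶻ p ⊹ᶻ p) (trans (h₄ q s k) (trans (cong (λ x → (1ℤ + k) - x - 1ℤ) (sym e)) (h₅ (1ℤ + k)))))

  open import Data.Rational using (_+_; _*_; _-_; -_; _≤_; _<_)

  -- In a triangle dilated by K = i + i′ ≥ 2 the two smallest barycentric coordinates are at most
  -- K/3 ≤ i and K/2 ≤ i′, so the three corner parallelograms with sides i and i′ cover it.
  module DilatedTriangle (k : ℤ) (k≥1 : 0ℤ ℤ.≤ k ℤ.- 1ℤ) where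

    K = 1ℤ ℤ.+ k
    open Halves (halves k k≥1)

    private
      K≥1 : 0ℤ ℤ.≤ K ℤ.- 1ℤ
      K≥1 = ≥1⇒≥0 {k} k≥1 byᶻ h k
        where
        h : ∀ k → k ≡ 1ℤ ℤ.+ k ℤ.- 1ℤ
        h = ℤR.solve-∀
      i≥0 : 0ℤ ℤ.≤ i
      i≥0 = ≥1⇒≥0 {i} i≥1
      i′≥1 : 0ℤ ℤ.≤ i′ ℤ.- 1ℤ
      i′≥1 = i≤i′ ⊹ᶻ i≥1 byᶻ h i i′
        where
        h : ∀ i i′ → i′ ℤ.- i ℤ.+ (i ℤ.- 1ℤ) ≡ i′ ℤ.- 1ℤ
        h = ℤR.solve-∀
      ιK : ιℤ i + ιℤ i′ ≡ ιℤ K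
      ιK = trans (sym (ι-+ i i′)) (cong ιℤ sum)

    ordered : ∀ (q F G : ℤ³) → ι q ∈P V → ι (λ t → q t ℤ.+ K ℤ.* F t) ∈P V → ι (λ t → q t ℤ.+ K ℤ.* G t) ∈P V →
              ∀ {p r} X Y Z → 0ℚ ≤ r → 0ℚ ≤ X → 0ℚ ≤ Y → X + Y + Z ≡ r * ιℤ K → 0ℚ ≤ Y - X → 0ℚ ≤ Z - Y →
              (∀ t → ιℤ (p t) ≡ r * ιℤ (q t) + X * ιℤ (F t) + Y * ιℤ (G t)) → SquareCover p r
    ordered q F G q∈ F∈ G∈ {p} {r} X Y Z r≥0 X≥0 Y≥0 total X≤Y Y≤Z eq = record
      { a = q ; f = λ t → i ℤ.* F t ; g = λ t → i′ ℤ.* G t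
      ; a∈ = q∈
      ; f∈ = P-convex K i′ i 0ℤ q (λ t → q t ℤ.+ K ℤ.* F t) q _ K≥1 (≥1⇒≥0 {i′} i′≥1) i≥0 0≤0ᶻ q∈ F∈ q∈
               (trans (c₁ i i′) sum) (λ t → trans (c₂ i i′ K (q t) (F t)) (cong (λ u → u ℤ.* q t ℤ.+ i ℤ.* (K ℤ.* F t)) sum ⟫ c₃ i K (q t) (F t)))
      ; g∈ = P-convex K i i′ 0ℤ q (λ t → q t ℤ.+ K ℤ.* G t) q _ K≥1 i≥0 (≥1⇒≥0 {i′} i′≥1) 0≤0ᶻ q∈ G∈ q∈
               (trans (ℤP.+-identityʳ (i ℤ.+ i′)) sum) (λ t → trans (c₂′ i i′ K (q t) (G t)) (cong (λ u → u ℤ.* q t ℤ.+ i′ ℤ.* (K ℤ.* G t)) sum ⟫ c₃ i′ K (q t) (G t)))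
      ; fg∈ = P-convex K i i′ 0ℤ (λ t → q t ℤ.+ K ℤ.* F t) (λ t → q t ℤ.+ K ℤ.* G t) q _ K≥1 i≥0 (≥1⇒≥0 {i′} i′≥1) 0≤0ᶻ F∈ G∈ q∈
               (trans (ℤP.+-identityʳ (i ℤ.+ i′)) sum)
               (λ t → trans (c₄ i i′ K (q t) (F t) (G t)) (cong (λ u → u ℤ.* q t ℤ.+ i ℤ.* (K ℤ.* F t) ℤ.+ i′ ℤ.* (K ℤ.* G t)) sum ⟫ c₅ i i′ K (q t) (F t) (G t)))
      ; λ₁ = X * η ; λ₂ = Y * η′
      ; λ₁≥0 = X≥0 ⊛ ℚP.<⇒≤ η>0 ; λ₂≥0 = Y≥0 ⊛ ℚP.<⇒≤ η′>0
      ; λ₁≤r = X≤ri ⊛ ℚP.<⇒≤ η>0 by cancel r (ιℤ i) η X ηi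
      ; λ₂≤r = Y≤ri′ ⊛ ℚP.<⇒≤ η′>0 by cancel r (ιℤ i′) η′ Y η′i′
      ; p≡ = λ t → trans (eq t) (cong₂ (λ a b → r * ιℤ (q t) + a + b) (side X η i (F t) ηi) (side Y η′ i′ (G t) η′i′))
      }
      where
      infixr 5 _⟫_
      _⟫_ : ∀ {a b c : ℤ} → a ≡ b → b ≡ c → a ≡ c
      _⟫_ = trans
      c₁ : ∀ i i′ → i′ ℤ.+ i ℤ.+ 0ℤ ≡ i ℤ.+ i′
      c₁ = ℤR.solve-∀
      c₂ : ∀ i i′ K q F → i′ ℤ.* q ℤ.+ i ℤ.* (q ℤ.+ K ℤ.* F) ℤ.+ 0ℤ ℤ.* q ≡ (i ℤ.+ i′) ℤ.* q ℤ.+ i ℤ.* (K ℤ.* F)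
      c₂ = ℤR.solve-∀
      c₂′ : ∀ i i′ K q F → i ℤ.* q ℤ.+ i′ ℤ.* (q ℤ.+ K ℤ.* F) ℤ.+ 0ℤ ℤ.* q ≡ (i ℤ.+ i′) ℤ.* q ℤ.+ i′ ℤ.* (K ℤ.* F)
      c₂′ = ℤR.solve-∀
      c₃ : ∀ i K q F → K ℤ.* q ℤ.+ i ℤ.* (K ℤ.* F) ≡ K ℤ.* (q ℤ.+ i ℤ.* F)
      c₃ = ℤR.solve-∀
      c₄ : ∀ i i′ K q F G → i ℤ.* (q ℤ.+ K ℤ.* F) ℤ.+ i′ ℤ.* (q ℤ.+ K ℤ.* G) ℤ.+ 0ℤ ℤ.* q ≡
           (i ℤ.+ i′) ℤ.* q ℤ.+ i ℤ.* (K ℤ.* F) ℤ.+ i′ ℤ.* (K ℤ.* G)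
      c₄ = ℤR.solve-∀
      c₅ : ∀ i i′ K q F G → K ℤ.* q ℤ.+ i ℤ.* (K ℤ.* F) ℤ.+ i′ ℤ.* (K ℤ.* G) ≡ K ℤ.* (q ℤ.+ i ℤ.* F ℤ.+ i′ ℤ.* G)
      c₅ = ℤR.solve-∀
      inv = pos⇒inverse (ιℤ i) (TriangleDescent.≥1⇒ι-pos {i} i≥1)
      inv′ = pos⇒inverse (ιℤ i′) (TriangleDescent.≥1⇒ι-pos {i′} i′≥1)
      η = proj₁ inv
      η′ = proj₁ inv′
      η>0 = proj₁ (proj₂ inv)
      η′>0 = proj₁ (proj₂ inv′)
      ηi = proj₂ (proj₂ inv)
      η′i′ = proj₂ (proj₂ inv′)
      cancel : ∀ r i η X → η * i ≡ 1ℚ → (r * i - X) * η ≡ r - X * η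
      cancel r i η X e = trans (h r i η X) (trans (cong (λ u → r * u - X * η) e) (cong (_- X * η) (ℚP.*-identityʳ r)))
        where
        h : ∀ r i η X → (r * i - X) * η ≡ r * (η * i) - X * η
        h = solve-∀ ℚ-ring
      side : ∀ X η i F → η * ιℤ i ≡ 1ℚ → X * ιℤ F ≡ X * η * ιℤ (i ℤ.* F)
      side X η i F e = trans (cong (_* ιℤ F) (trans (sym (ℚP.*-identityʳ X)) (cong (X *_) (sym e))))
        (trans (h X η (ιℤ i) (ιℤ F)) (cong (X * η *_) (sym (ι-* i F))))
        where
        h : ∀ X η i F → X * (η * i) * F ≡ X * η * (i * F)
        h = solve-∀ ℚ-ring
      three = 1ℚ + 1ℚ + 1ℚ
      two = 1ℚ + 1ℚ
      ι-gap : ∀ a b → 0ℤ ℤ.≤ a ℤ.- b → 0ℚ ≤ ιℤ a - ιℤ b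
      ι-gap a b p = ι-mono {a ℤ.- b} p by ι-- a b
      i′≤1+iℚ : 0ℚ ≤ 1ℚ + ιℤ i - ιℤ i′
      i′≤1+iℚ = ι-gap (1ℤ ℤ.+ i) i′ i′≤1+i by cong (_- ιℤ i′) (ι-+ 1ℤ i)
      -- 3 X ≤ X + Y + Z = r K, and K = i + i′ ≤ 2 i + 1 ≤ 3 i because i ≥ 1.
      X≤ri : 0ℚ ≤ r * ιℤ i - X
      X≤ri = *-nonneg⁻¹ {three} (pos+ (pos+ 0<1 0≤1) 0≤1)
          ((r≥0 ⊛ (i′≤1+iℚ ⊹ ι-gap i 1ℤ i≥1)) ⊹ (X≤Y ⊹ (Y≤Z ⊹ X≤Y)) by
            trans (h₁ r (ιℤ i) (ιℤ i′) X Y Z) (trans (cong₂ (λ a b → r * (ιℤ i + ιℤ i + ιℤ i) - r * a + (b - X - X - X)) ιK total) (h₂ r (ιℤ i) (ιℤ K) X)))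
        where
        h₁ : ∀ r i i′ X Y Z → r * ((1ℚ + i - i′) + (i - 1ℚ)) + ((Y - X) + ((Z - Y) + (Y - X))) ≡
             r * (i + i + i) - r * (i + i′) + ((X + Y + Z) - X - X - X)
        h₁ = solve-∀ ℚ-ring
        h₂ : ∀ r i K X → r * (i + i + i) - r * K + (r * K - X - X - X) ≡ (1ℚ + 1ℚ + 1ℚ) * (r * i - X)
        h₂ = solve-∀ ℚ-ring
      Y≤ri′ : 0ℚ ≤ r * ιℤ i′ - Y
      Y≤ri′ = *-nonneg⁻¹ {two} (pos+ 0<1 0≤1)
          ((r≥0 ⊛ ι-gap i′ i i≤i′) ⊹ (X≥0 ⊹ Y≤Z) by
            trans (h₁ r (ιℤ i) (ιℤ i′) X Y Z) (trans (cong₂ (λ a b → r * (ιℤ i′ + ιℤ i′) - r * a + (b - Y - Y)) ιK total) (h₂ r (ιℤ i′) (ιℤ K) Y)))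
        where
        h₁ : ∀ r i i′ X Y Z → r * (i′ - i) + (X + (Z - Y)) ≡ r * (i′ + i′) - r * (i + i′) + ((X + Y + Z) - Y - Y)
        h₁ = solve-∀ ℚ-ring
        h₂ : ∀ r i K Y → r * (i + i) - r * K + (r * K - Y - Y) ≡ (1ℚ + 1ℚ) * (r * i - Y)
        h₂ = solve-∀ ℚ-ring

    flip-≤ : ∀ {a b} → 0ℚ < - (a - b) → 0ℚ ≤ b - a
    flip-≤ {a} {b} p = ℚP.<⇒≤ p by h a b
      where
      h : ∀ a b → - (a - b) ≡ b - a
      h = solve-∀ ℚ-ring

    largest : ∀ (q F G : ℤ³) → ι q ∈P V → ι (λ t → q t ℤ.+ K ℤ.* F t) ∈P V → ι (λ t → q t ℤ.+ K ℤ.* G t) ∈P V →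
              ∀ {p r} X Y Z → 0ℚ ≤ r → 0ℚ ≤ X → 0ℚ ≤ Y → X + Y + Z ≡ r * ιℤ K → 0ℚ ≤ Z - X → 0ℚ ≤ Z - Y →
              (∀ t → ιℤ (p t) ≡ r * ιℤ (q t) + X * ιℤ (F t) + Y * ιℤ (G t)) → SquareCover p r
    largest q F G q∈ F∈ G∈ {p} {r} X Y Z r≥0 X≥0 Y≥0 total X≤Z Y≤Z eq = go (nonneg? (Y - X))
      where
      swap₁ : ∀ X Y Z → Y + X + Z ≡ X + Y + Z
      swap₁ = solve-∀ ℚ-ring
      swap₂ : ∀ a b c → a + b + c ≡ a + c + b
      swap₂ = solve-∀ ℚ-ring
      go : _ → SquareCover p r
      go (inj₁ c) = ordered q F G q∈ F∈ G∈ X Y Z r≥0 X≥0 Y≥0 total c Y≤Z eq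
      go (inj₂ c) = ordered q G F q∈ G∈ F∈ Y X Z r≥0 Y≥0 X≥0 (trans (swap₁ X Y Z) total) (flip-≤ {Y} {X} c) X≤Z
        (λ t → trans (eq t) (swap₂ (r * ιℤ (q t)) (X * ιℤ (F t)) (Y * ιℤ (G t))))

    -- The vertex with the largest barycentric coordinate is made the origin; `rebase` rewrites the
    -- point in the edge vectors there.
    dilated-cover : ∀ (w f g : ℤ³) → ι w ∈P V → ι (λ t → w t ℤ.+ K ℤ.* f t) ∈P V → ι (λ t → w t ℤ.+ K ℤ.* g t) ∈P V →
              ∀ {p r} X Y Z → 0ℚ ≤ r → 0ℚ ≤ X → 0ℚ ≤ Y → 0ℚ ≤ Z → X + Y + Z ≡ r * ιℤ K →
              (∀ t → ιℤ (p t) ≡ r * ιℤ (w t) + X * ιℤ (f t) + Y * ιℤ (g t)) → SquareCover p r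
    dilated-cover w f g w∈ f∈ g∈ {p} {r} X Y Z r≥0 X≥0 Y≥0 Z≥0 total eq = go (nonneg? (Z - X)) (nonneg? (Z - Y)) (nonneg? (X - Y))
      where
      r₁ : ∀ X Y Z → Z + Y + X ≡ X + Y + Z
      r₁ = solve-∀ ℚ-ring
      r₂ : ∀ X Y Z → Z + X + Y ≡ X + Y + Z
      r₂ = solve-∀ ℚ-ring
      chain : ∀ {a b c} → 0ℚ ≤ a - b → 0ℚ ≤ b - c → 0ℚ ≤ a - c
      chain {a} {b} {c} p q = p ⊹ q by h a b c
        where
        h : ∀ a b c → a - b + (b - c) ≡ a - c
        h = solve-∀ ℚ-ring
      back : ∀ w f → w ≡ w ℤ.+ K ℤ.* f ℤ.+ K ℤ.* ℤ.- f
      back w f = h K w f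
        where
        h : ∀ K w f → w ≡ w ℤ.+ K ℤ.* f ℤ.+ K ℤ.* ℤ.- f
        h = ℤR.solve-∀
      across : ∀ w f g → w ℤ.+ K ℤ.* g ≡ w ℤ.+ K ℤ.* f ℤ.+ K ℤ.* (g ℤ.- f)
      across w f g = h K w f g
        where
        h : ∀ K w f g → w ℤ.+ K ℤ.* g ≡ w ℤ.+ K ℤ.* f ℤ.+ K ℤ.* (g ℤ.- f)
        h = ℤR.solve-∀
      rebase : ∀ w f g X Y Z → X + Y + Z ≡ r * ιℤ K → r * ιℤ w + X * ιℤ f + Y * ιℤ g ≡
               r * ιℤ (w ℤ.+ K ℤ.* f) + Z * ιℤ (ℤ.- f) + Y * ιℤ (g ℤ.- f)
      rebase w f g X Y Z tot = trans (h₁ r (ιℤ w) (ιℤ f) (ιℤ g) X Y Z) (trans (cong (λ a → r * ιℤ w + a * ιℤ f + Z * - ιℤ f + Y * (ιℤ g - ιℤ f)) tot)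
          (trans (h₂ r (ιℤ K) (ιℤ w) (ιℤ f) (ιℤ g) Z Y)
            (cong₂ _+_ (cong₂ (λ a b → r * a + Z * b) (sym (trans (ι-+ w (K ℤ.* f)) (cong (ιℤ w +ℚ_) (ι-* K f)))) (sym (ι-neg f))) (cong (Y *_) (sym (ι-- g f))))))
        where
        _+ℚ_ = _+_
        h₁ : ∀ r w f g X Y Z → r * w + X * f + Y * g ≡ r * w + (X + Y + Z) * f + Z * - f + Y * (g - f)
        h₁ = solve-∀ ℚ-ring
        h₂ : ∀ r K w f g Z Y → r * w + r * K * f + Z * - f + Y * (g - f) ≡ r * (w + K * f) + Z * - f + Y * (g - f)
        h₂ = solve-∀ ℚ-ring
      at-f : 0ℚ ≤ X - Z → 0ℚ ≤ X - Y → SquareCover p r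
      at-f a b = largest (λ t → w t ℤ.+ K ℤ.* f t) (λ t → ℤ.- f t) (λ t → g t ℤ.- f t) f∈
        (P-resp (λ t → back (w t) (f t)) w∈) (P-resp (λ t → across (w t) (f t) (g t)) g∈) Z Y X r≥0 Z≥0 Y≥0
        (trans (r₁ X Y Z) total) a b (λ t → trans (eq t) (rebase (w t) (f t) (g t) X Y Z total))
      at-g : 0ℚ ≤ Y - Z → 0ℚ ≤ Y - X → SquareCover p r
      at-g a b = largest (λ t → w t ℤ.+ K ℤ.* g t) (λ t → ℤ.- g t) (λ t → f t ℤ.- g t) g∈
        (P-resp (λ t → back (w t) (g t)) w∈) (P-resp (λ t → across (w t) (g t) (f t)) f∈) Z X Y r≥0 Z≥0 X≥0
        (trans (r₂ X Y Z) total) a b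
        (λ t → trans (eq t) (trans (sw (r * ιℤ (w t)) (X * ιℤ (f t)) (Y * ιℤ (g t))) (rebase (w t) (g t) (f t) Y X Z (trans (cong (_+ Z) (ℚP.+-comm Y X)) total))))
        where
        sw : ∀ a b c → a + b + c ≡ a + c + b
        sw = solve-∀ ℚ-ring
      go : _ → _ → _ → SquareCover p r
      go (inj₁ a) (inj₁ b) _ = largest w f g w∈ f∈ g∈ X Y Z r≥0 X≥0 Y≥0 total a b eq
      go (inj₁ a) (inj₂ b) _ = at-g (flip-≤ {Z} {Y} b) (chain {Y} {Z} {X} (flip-≤ {Z} {Y} b) a)
      go (inj₂ a) _ (inj₁ c) = at-f (flip-≤ {Z} {X} a) c
      go (inj₂ a) _ (inj₂ c) = at-g (chain {Y} {X} {Z} (flip-≤ {X} {Y} c) (flip-≤ {Z} {X} a)) (flip-≤ {X} {Y} c)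

-- Facets that are unimodular triangles.

module TriangularFacets {m} (V : Fin m → ℤ³) (smooth : Smooth V) (j₀ : Fin m) (symm : CentSym V) where

  open LatticeConvexity V
  open Decompositions V
  open Slices V
  open Polygons using (Triangle; squeeze)
  open UnimodularTriangles using (split₁; ≥1⇒≥0; clash)

  -- A corner of P at a, written in the basis e, f = b - a, g = c - a with dual functionals n, A, B;
  -- n cuts out the facet a b c.
  record TriCorner (n a b c : ℤ³) : Set where
    field
      e A B : ℤ³
      a∈ : ι a ∈P V
      b∈ : ι b ∈P V
      c∈ : ι c ∈P V
      e∈ : ι (a +ᵛ e) ∈P V
      n-e : n · e ≡ 1ℤ
      n-f : n · (b -ᵛ a) ≡ 0ℤ
      n-g : n · (c -ᵛ a) ≡ 0ℤ
      A-e : A · e ≡ 0ℤ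
      A-f : A · (b -ᵛ a) ≡ 1ℤ
      A-g : A · (c -ᵛ a) ≡ 0ℤ
      B-e : B · e ≡ 0ℤ
      B-f : B · (b -ᵛ a) ≡ 0ℤ
      B-g : B · (c -ᵛ a) ≡ 1ℤ
      n-inside : ∀ q → ι q ∈P V → 0ℤ ℤ.≤ n · (q -ᵛ a)
      A-inside : ∀ q → ι q ∈P V → 0ℤ ℤ.≤ A · (q -ᵛ a)
      B-inside : ∀ q → ι q ∈P V → 0ℤ ℤ.≤ B · (q -ᵛ a)
      expand : ∀ z t → (n · z) ℤ.* e t ℤ.+ ((A · z) ℤ.* (b t ℤ.- a t) ℤ.+ (B · z) ℤ.* (c t ℤ.- a t)) ≡ z t

  swap-corner : ∀ {n a b c} → TriCorner n a b c → TriCorner n a c b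
  swap-corner {n} {a} {b} {c} T = record
    { e = e ; A = B ; B = A ; a∈ = a∈ ; b∈ = c∈ ; c∈ = b∈ ; e∈ = e∈
    ; n-e = n-e ; n-f = n-g ; n-g = n-f ; A-e = B-e ; A-f = B-g ; A-g = B-f ; B-e = A-e ; B-f = A-g ; B-g = A-f
    ; n-inside = n-inside ; A-inside = B-inside ; B-inside = A-inside
    ; expand = λ z t → trans (cong (ℤ._+_ ((n · z) ℤ.* e t)) (ℤP.+-comm ((B · z) ℤ.* (c t ℤ.- a t)) ((A · z) ℤ.* (b t ℤ.- a t)))) (expand z t) }
    where
    open TriCorner T

  module _ (C : Corner V) where

    open FacetPolygon V smooth j₀ C using (pt; L; xc; yc; polygon; minimal-corner; xc-pt; yc-pt; pt-on; on-pt; L-of; module PlaneCorner) renaming (n to normal)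
    open Facets V smooth j₀ using (OnFacet; bounded; rot; expand-·)
    private
      module C = Corner C

    triangle-corner : (Δ : Triangle L) → let open Triangle Δ in TriCorner normal (pt x₁ y₁) (pt x₂ y₂) (pt x₃ y₃)
    triangle-corner Δ = build (minimal-corner α β)
      where
      open import Data.Integer using (_+_; _*_; _-_; -_; _≤_)
      open Triangle Δ
      a b c : ℤ³
      a = pt x₁ y₁
      b = pt x₂ y₂
      c = pt x₃ y₃
      -- α x + β y is constant on the side p₂ p₃ and exceeds its value at p₁ there by the
      -- determinant 1, so its minimising corner sits at p₁.
      α = (y₃ - y₁) - (y₂ - y₁)
      β = (x₂ - x₁) - (x₃ - x₁)
      build : (∃ λ D → OnFacet C D × (∀ q → ι q ∈P V → normal · (q -ᵛ C.v) ≡ 0ℤ →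
                0ℤ ≤ α * (xc q - xc (Corner.v D)) + β * (yc q - yc (Corner.v D)))) → TriCorner normal a b c
      build (D , on , min) = finish (edge 1F n-f) (edge 2F n-g)
        where
        module D = Corner D
        open OnFacet on using (level) renaming (normal to normal≡)
        open PlaneCorner D on using (n-f; n-g; w-L; edge-L)
        w = D.v
        beaten : ∀ {x y} → xc w ≡ x × yc w ≡ y → 0ℤ ≤ α * (x₁ - x) + β * (y₁ - y)
        beaten (refl , refl) = min a p₁∈ (pt-on x₁ y₁) byᶻ cong₂ (λ x y → α * (x - xc w) + β * (y - yc w)) (xc-pt x₁ y₁) (yc-pt x₁ y₁)
        w-at : xc w ≡ x₁ × yc w ≡ y₁
        w-at = which (only w-L)
          where
          h₂ : ∀ x₁ y₁ x₂ y₂ x₃ y₃ → ((y₃ - y₁) - (y₂ - y₁)) * (x₁ - x₂) + ((x₂ - x₁) - (x₃ - x₁)) * (y₁ - y₂) ≡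
               - ((x₂ - x₁) * (y₃ - y₁) - (y₂ - y₁) * (x₃ - x₁))
          h₂ = ℤR.solve-∀
          h₃ : ∀ x₁ y₁ x₂ y₂ x₃ y₃ → ((y₃ - y₁) - (y₂ - y₁)) * (x₁ - x₃) + ((x₂ - x₁) - (x₃ - x₁)) * (y₁ - y₃) ≡
               - ((x₂ - x₁) * (y₃ - y₁) - (y₂ - y₁) * (x₃ - x₁))
          h₃ = ℤR.solve-∀
          which : _ → xc w ≡ x₁ × yc w ≡ y₁
          which (inj₁ p) = p
          which (inj₂ (inj₁ p)) = ⊥-elim (absurdᶻ (beaten p) (trans (h₂ x₁ y₁ x₂ y₂ x₃ y₃) (cong -_ det)))
          which (inj₂ (inj₂ p)) = ⊥-elim (absurdᶻ (beaten p) (trans (h₃ x₁ y₁ x₂ y₂ x₃ y₃) (cong -_ det)))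
        w≡a : ∀ t → w t ≡ a t
        w≡a t = trans (on-pt w level t) (cong₂ (λ x y → pt x y t) (proj₁ w-at) (proj₂ w-at))

        flat-eq : ∀ z → normal · z ≡ 0ℤ → ∀ t → z t ≡ (C.u 1F · z) * C.e 1F t + (C.u 2F · z) * C.e 2F t
        flat-eq z e₀ t = trans (sym (C.expand z t)) (trans (cong (λ s → s * C.e 0F t + ((C.u 1F · z) * C.e 1F t + (C.u 2F · z) * C.e 2F t)) e₀)
            (h (C.e 0F t) ((C.u 1F · z) * C.e 1F t + (C.u 2F · z) * C.e 2F t)))
          where
          h : ∀ a b → 0ℤ * a + b ≡ b
          h = ℤR.solve-∀

        Is : ℤ³ → ℤ³ → Set
        Is z d = ∀ t → z t ≡ d t
        -- A primitive step along an edge of the facet ends at a lattice point of the facet, of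
        -- which there are only three.
        edge : ∀ i → normal · D.e i ≡ 0ℤ → Is (D.e i) (λ _ → 0ℤ) ⊎ (Is (D.e i) (b -ᵛ a) ⊎ Is (D.e i) (c -ᵛ a))
        edge i e₀ = Data.Sum.map zero-edge (Data.Sum.map (along x₂ y₂) (along x₃ y₃)) (only (edge-L i e₀))
          where
          k : ∀ x y z → x + y ≡ z → y ≡ z - x
          k x y _ refl = h x y
            where
            h : ∀ x y → y ≡ x + y - x
            h = ℤR.solve-∀
          along : ∀ x y → xc w + C.u 1F · D.e i ≡ x × yc w + C.u 2F · D.e i ≡ y → Is (D.e i) (pt x y -ᵛ a)
          along x y (p , q) t = trans (flat-eq (D.e i) e₀ t) (trans (cong₂ (λ x y → x * C.e 1F t + y * C.e 2F t)
              (trans (k _ _ _ p) (cong (λ k → x - k) (proj₁ w-at))) (trans (k _ _ _ q) (cong (λ k → y - k) (proj₂ w-at))))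
              (h x y x₁ y₁ (C.v t) (C.e 1F t) (C.e 2F t)))
            where
            h : ∀ x y x₁ y₁ v e f → (x - x₁) * e + (y - y₁) * f ≡ v + x * e + y * f - (v + x₁ * e + y₁ * f)
            h = ℤR.solve-∀
          zero-edge : xc w + C.u 1F · D.e i ≡ x₁ × yc w + C.u 2F · D.e i ≡ y₁ → Is (D.e i) (λ _ → 0ℤ)
          zero-edge p t = trans (along x₁ y₁ p t) (ℤP.+-inverseʳ (a t))

        nonzero : ∀ i → D.u i · D.e i ≡ 1ℤ → Is (D.e i) (λ _ → 0ℤ) → ⊥
        nonzero i d z = absurd (trans (sym d) (trans (·-cong (D.u i) z) (h (D.u i 0F) (D.u i 1F) (D.u i 2F))))
          where
          h : ∀ a b c → a * 0ℤ + (b * 0ℤ + c * 0ℤ) ≡ 0ℤ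
          h = ℤR.solve-∀
          absurd : 1ℤ ≡ 0ℤ → ⊥
          absurd ()
        same : ∀ {d} → Is (D.e 1F) d → Is (D.e 2F) d → ⊥
        same p q = absurd (trans (sym (D.dual 1F 1F)) (trans (·-cong (D.u 1F) (λ t → trans (p t) (sym (q t)))) (D.dual 1F 2F)))
          where
          absurd : 1ℤ ≡ 0ℤ → ⊥
          absurd ()

        shift-base : ∀ x q → x · (q -ᵛ w) ≡ x · (q -ᵛ a)
        shift-base x q = ·-cong x (λ t → cong (λ k → q t - k) (w≡a t))
        inside : ∀ i q → ι q ∈P V → 0ℤ ≤ D.u i · (q -ᵛ a)
        inside i q q∈ = bounded (D.u i) w (D.inside i) q q∈ byᶻ shift-base (D.u i) q

        good : ∀ b c → ι b ∈P V → ι c ∈P V → Is (D.e 1F) (b -ᵛ a) → Is (D.e 2F) (c -ᵛ a) → TriCorner normal a b c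
        good b c b∈ c∈ p q = record
          { e = D.e 0F ; A = D.u 1F ; B = D.u 2F ; a∈ = p₁∈ ; b∈ = b∈ ; c∈ = c∈
          ; e∈ = P-resp (λ t → cong (_+ D.e 0F t) (w≡a t)) (D.e∈P 0F)
          ; n-e = trans (sym (normal≡ (D.e 0F))) (D.dual 0F 0F)
          ; n-f = trans (sym (·-cong normal p)) n-f ; n-g = trans (sym (·-cong normal q)) n-g
          ; A-e = D.dual 1F 0F ; A-f = trans (sym (·-cong (D.u 1F) p)) (D.dual 1F 1F) ; A-g = trans (sym (·-cong (D.u 1F) q)) (D.dual 1F 2F)
          ; B-e = D.dual 2F 0F ; B-f = trans (sym (·-cong (D.u 2F) p)) (D.dual 2F 1F) ; B-g = trans (sym (·-cong (D.u 2F) q)) (D.dual 2F 2F)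
          ; n-inside = λ q q∈ → inside 0F q q∈ byᶻ normal≡ (q -ᵛ a)
          ; A-inside = inside 1F ; B-inside = inside 2F
          ; expand = λ z t → trans (cong₂ (λ x y → x * D.e 0F t + y) (sym (normal≡ z))
              (cong₂ (λ x y → (D.u 1F · z) * x + (D.u 2F · z) * y) (sym (p t)) (sym (q t)))) (D.expand z t) }

        finish : _ → _ → TriCorner normal a b c
        finish (inj₁ z) _ = ⊥-elim (nonzero 1F (D.dual 1F 1F) z)
        finish _ (inj₁ z) = ⊥-elim (nonzero 2F (D.dual 2F 2F) z)
        finish (inj₂ (inj₁ p)) (inj₂ (inj₁ q)) = ⊥-elim (same p q)
        finish (inj₂ (inj₂ p)) (inj₂ (inj₂ q)) = ⊥-elim (same p q)
        finish (inj₂ (inj₁ p)) (inj₂ (inj₂ q)) = good b c p₂∈ p₃∈ p q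
        finish (inj₂ (inj₂ p)) (inj₂ (inj₁ q)) = swap-corner (good c b p₃∈ p₂∈ p q)

    turn-triangle : Triangle L → Triangle L
    turn-triangle Δ = record
      { x₁ = x₂ ; y₁ = y₂ ; x₂ = x₃ ; y₂ = y₃ ; x₃ = x₁ ; y₃ = y₁ ; p₁∈ = p₂∈ ; p₂∈ = p₃∈ ; p₃∈ = p₁∈
      ; det = trans (h x₁ y₁ x₂ y₂ x₃ y₃) det
      ; only = λ p → cycle (only p) }
      where
      open import Data.Integer using (_+_; _*_; _-_; -_; _≤_)
      open Triangle Δ
      h : ∀ x₁ y₁ x₂ y₂ x₃ y₃ → (x₃ - x₂) * (y₁ - y₂) - (y₃ - y₂) * (x₁ - x₂) ≡ (x₂ - x₁) * (y₃ - y₁) - (y₂ - y₁) * (x₃ - x₁)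
      h = ℤR.solve-∀
      cycle : ∀ {A B C : Set} → A ⊎ (B ⊎ C) → B ⊎ (C ⊎ A)
      cycle (inj₁ a) = inj₂ (inj₂ a)
      cycle (inj₂ (inj₁ b)) = inj₁ b
      cycle (inj₂ (inj₂ c)) = inj₂ (inj₁ c)

  -- The corners at `a` and `b` compared along their common edge. `t` and `B` belong to the same
  -- neighbouring facet, through a and b, while `s` belongs to the one through b and c. The slope
  -- `σ` of `s` measures the growth of the slices: in the coordinates at `a`, the points of P
  -- satisfy A + B ≤ 1 + σ n.
  module Side {n a b c : ℤ³} (T₁ : TriCorner n a b c) (T₂ : TriCorner n b c a) where

    open import Data.Integer using (_+_; _*_; _-_; -_; _≤_)
    private
      module T₁ = TriCorner T₁
      module T₂ = TriCorner T₂
    open T₁ using (A; B; e)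

    ·-flip : ∀ (x q w : ℤ³) → x · (q -ᵛ w) ≡ - (x · (w -ᵛ q))
    ·-flip x q w = trans (·-- x q w) (trans (h (x · q) (x · w)) (cong -_ (sym (·-- x w q))))
      where
      h : ∀ a b → a - b ≡ - (b - a)
      h = ℤR.solve-∀
    t s : ℤ³
    t = T₂.A
    s = T₂.B
    τ σ : ℤ
    τ = t · e
    σ = s · e

    linear : ∀ x {f g} → x · (b -ᵛ a) ≡ f → x · (c -ᵛ a) ≡ g → ∀ z → x · z ≡ (n · z) * (x · e) + ((A · z) * f + (B · z) * g)
    linear x {f} {g} xf xg z = trans (·-expand x e (b -ᵛ a) (c -ᵛ a) (n · z) (A · z) (B · z) (T₁.expand z))
      (cong₂ (λ f g → (n · z) * (x · e) + ((A · z) * f + (B · z) * g)) xf xg)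

    t-f : t · (b -ᵛ a) ≡ 0ℤ
    t-f = trans (·-flip t b a) (cong -_ T₂.A-g)
    t-g : t · (c -ᵛ a) ≡ 1ℤ
    t-g = trans (·-rebase t c a b) (trans (cong₂ _-_ T₂.A-f T₂.A-g) refl)
    s-f : s · (b -ᵛ a) ≡ - 1ℤ
    s-f = trans (·-flip s b a) (cong -_ T₂.B-g)
    s-g : s · (c -ᵛ a) ≡ - 1ℤ
    s-g = trans (·-rebase s c a b) (trans (cong₂ _-_ T₂.B-f T₂.B-g) refl)

    e₂ = T₂.e

    τ≥0 : 0ℤ ≤ τ
    τ≥0 = T₂.A-inside (a +ᵛ e) T₁.e∈ byᶻ trans (·-edge t a e b) (trans (cong (_+ τ) T₂.A-g) (ℤP.+-identityˡ τ))
    B-e₂≥0 : 0ℤ ≤ B · e₂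
    B-e₂≥0 = T₁.B-inside (b +ᵛ e₂) T₂.e∈ byᶻ trans (·-edge B b e₂ a) (trans (cong (_+ B · e₂) T₁.B-f) (ℤP.+-identityˡ (B · e₂)))
    -- `t` vanishes on `e₂`, and its expansion there has two nonnegative terms. So both vanish, and
    -- `e₂` is parallel to the facet B = 0.
    tilt : 0ℤ ≡ τ + B · e₂
    tilt = trans (sym T₂.A-e) (trans (linear t t-f t-g e₂) (trans (cong (λ m → m * τ + ((A · e₂) * 0ℤ + (B · e₂) * 1ℤ)) T₂.n-e) (h τ (A · e₂) (B · e₂))))
      where
      h : ∀ τ a b → 1ℤ * τ + (a * 0ℤ + b * 1ℤ) ≡ τ + b
      h = ℤR.solve-∀
    B-e₂ : B · e₂ ≡ 0ℤ
    B-e₂ = squeeze B-e₂≥0 (τ≥0 byᶻ trans (h τ (B · e₂)) (trans (cong (_- B · e₂) (sym tilt)) (ℤP.+-identityˡ (- (B · e₂)))))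
      where
      h : ∀ a b → a ≡ a + b - b
      h = ℤR.solve-∀
    A-e₂ : A · e₂ ≡ σ
    A-e₂ = trans (h σ (A · e₂) (B · e₂)) (trans (cong₂ (λ x y → σ - x - y) (sym zero-s) B-e₂) (h′ σ))
      where
      h : ∀ σ a b → a ≡ σ - (1ℤ * σ + (a * - 1ℤ + b * - 1ℤ)) - b
      h = ℤR.solve-∀
      h′ : ∀ σ → σ - 0ℤ - 0ℤ ≡ σ
      h′ = ℤR.solve-∀
      zero-s : 0ℤ ≡ 1ℤ * σ + ((A · e₂) * - 1ℤ + (B · e₂) * - 1ℤ)
      zero-s = trans (sym T₂.B-e) (trans (linear s s-f s-g e₂) (cong (λ m → m * σ + ((A · e₂) * - 1ℤ + (B · e₂) * - 1ℤ)) T₂.n-e))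

    s-value : ∀ z → s · z ≡ σ * (n · z) - A · z - B · z
    s-value z = trans (linear s s-f s-g z) (h σ (n · z) (A · z) (B · z))
      where
      h : ∀ σ n a b → n * σ + (a * - 1ℤ + b * - 1ℤ) ≡ σ * n - a - b
      h = ℤR.solve-∀

    s-at : ∀ q → s · (q -ᵛ b) ≡ 1ℤ + σ * (n · (q -ᵛ a)) - A · (q -ᵛ a) - B · (q -ᵛ a)
    s-at q = trans (·-rebase s q b a) (trans (cong₂ _-_ (s-value (q -ᵛ a)) s-f) (h (σ * (n · (q -ᵛ a))) (A · (q -ᵛ a)) (B · (q -ᵛ a))))
      where
      h : ∀ x a b → x - a - b - - 1ℤ ≡ 1ℤ + x - a - b
      h = ℤR.solve-∀

    bound : ∀ q → ι q ∈P V → 0ℤ ≤ 1ℤ + σ * (n · (q -ᵛ a)) - A · (q -ᵛ a) - B · (q -ᵛ a)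
    bound q q∈ = T₂.B-inside q q∈ byᶻ s-at q

    apex≡ : ∀ i → b i + e₂ i ≡ a i + e i + (1ℤ + σ) * (b i - a i)
    apex≡ i = trans (cong (λ z → b i + z) (trans (sym (T₁.expand e₂ i)) (cong₂ (λ x y → x * e i + y) T₂.n-e
        (cong₂ (λ x y → x * (b i - a i) + y * (c i - a i)) A-e₂ B-e₂)))) (h (a i) (b i) (c i) (e i) σ)
      where
      h : ∀ a b c e σ → b + (1ℤ * e + (σ * (b - a) + 0ℤ * (c - a))) ≡ a + e + (1ℤ + σ) * (b - a)
      h = ℤR.solve-∀
    apex∈ : ι (λ i → a i + e i + (1ℤ + σ) * (b i - a i)) ∈P V
    apex∈ = P-resp apex≡ T₂.e∈

    -- The bound with slope `σ` is attained at `b +ᵛ e₂`. Applied in both directions, this shows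
    -- that the corners at b and c see the same slope.
    apex-bound : ∀ σ′ → (∀ q → ι q ∈P V → 0ℤ ≤ 1ℤ + σ′ * (n · (q -ᵛ a)) - A · (q -ᵛ a) - B · (q -ᵛ a)) → 0ℤ ≤ σ′ - σ
    apex-bound σ′ p = p (b +ᵛ e₂) T₂.e∈ byᶻ trans (cong₂ (λ x y → x - y) (cong₂ (λ x y → 1ℤ + σ′ * x - y) n-val A-val) B-val) (h σ σ′)
      where
      n-val : n · ((b +ᵛ e₂) -ᵛ a) ≡ 1ℤ
      n-val = trans (·-edge n b e₂ a) (trans (cong₂ _+_ T₁.n-f T₂.n-e) refl)
      A-val : A · ((b +ᵛ e₂) -ᵛ a) ≡ 1ℤ + σ
      A-val = trans (·-edge A b e₂ a) (cong₂ _+_ T₁.A-f A-e₂)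
      B-val : B · ((b +ᵛ e₂) -ᵛ a) ≡ 0ℤ
      B-val = trans (·-edge B b e₂ a) (trans (cong₂ _+_ T₁.B-f B-e₂) refl)
      h : ∀ σ σ′ → 1ℤ + σ′ * 1ℤ - (1ℤ + σ) - 0ℤ ≡ σ′ - σ
      h = ℤR.solve-∀

  0ᵛ : ℤ³
  0ᵛ _ = 0ℤ

  -- x (q - a) + x (-q - a) = 2 x (0 - a), and x is integral.
  centre : ∀ (x a : ℤ³) → (∀ q → ι q ∈P V → 0ℤ ℤ.≤ x · (q -ᵛ a)) → ∀ q → ι q ∈P V → 0ℤ ℤ.≤ x · (q -ᵛ a) ℤ.- 1ℤ →
           0ℤ ℤ.≤ x · (0ᵛ -ᵛ a) ℤ.- 1ℤ
  centre x a p q q∈ q≥1 = go (split₁ (x · (0ᵛ -ᵛ a)))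
    where
    open import Data.Integer using (_+_; _*_; _-_; -_; _≤_)
    antipode : ℤ³
    antipode i = - q i
    antipode∈ : ι antipode ∈P V
    antipode∈ = cone-resp {V = V} {hom 1ℚ (λ i → ℚ.- ι q i)} {hat antipode} (λ { zero → refl ; (suc i) → sym (ι-neg (q i)) }) (proj₁ symm (ι q) q∈)
    double : x · (q -ᵛ a) + x · (antipode -ᵛ a) ≡ x · (0ᵛ -ᵛ a) + x · (0ᵛ -ᵛ a)
    double = h (x 0F) (x 1F) (x 2F) (q 0F) (q 1F) (q 2F) (a 0F) (a 1F) (a 2F)
      where
      h : ∀ x y z p q r a b c →
          (x * (p - a) + (y * (q - b) + z * (r - c))) + (x * (- p - a) + (y * (- q - b) + z * (- r - c))) ≡
          (x * (0ℤ - a) + (y * (0ℤ - b) + z * (0ℤ - c))) + (x * (0ℤ - a) + (y * (0ℤ - b) + z * (0ℤ - c)))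
      h = ℤR.solve-∀
    go : _ → 0ℤ ≤ x · (0ᵛ -ᵛ a) - 1ℤ
    go (inj₁ r) = r
    go (inj₂ r) = ⊥-elim (absurdᶻ (q≥1 ⊹ᶻ p antipode antipode∈ ⊹ᶻ r ⊹ᶻ r) (trans (k (x · (q -ᵛ a)) (x · (antipode -ᵛ a)) (x · (0ᵛ -ᵛ a)))
        (trans (cong (λ u → u - 1ℤ + - (x · (0ᵛ -ᵛ a)) + - (x · (0ᵛ -ᵛ a))) double) (k′ (x · (0ᵛ -ᵛ a))))))
      where
      k : ∀ a b c → a - 1ℤ + b + - c + - c ≡ (a + b) - 1ℤ + - c + - c
      k = ℤR.solve-∀
      k′ : ∀ c → c + c - 1ℤ + - c + - c ≡ - 1ℤ
      k′ = ℤR.solve-∀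

  fun-lattice : ∀ x a r p → fun x a ∙ hom r (ι p) ≡ ιℤ (x · p) ℚ.- r ℚ.* ιℤ (x · a)
  fun-lattice x a r p = trans (fun-hom x a (hom r (ι p))) (cong (ℚ._- r ℚ.* ιℤ (x · a)) (sym (ι-· x p)))

  cone-above : ∀ x a → (∀ q → ι q ∈P V → 0ℤ ℤ.≤ x · (q -ᵛ a)) → ∀ r p → Cone V (hom r (ι p)) →
               0ℚ ℚ.≤ ιℤ (x · p) ℚ.- r ℚ.* ιℤ (x · a)
  cone-above x a above r p c =
    cone-nonneg {V = V} (fun x a) (λ k → ι-mono (above (V k) (cone-gen V k)) by sym (fun-hat x a (V k))) c by fun-lattice x a r p

  module TriangleDecomposition {n a b c : ℤ³} (T₁ : TriCorner n a b c) (T₂ : TriCorner n b c a) (T₃ : TriCorner n c a b) where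

    private
      module S₁ = Side T₁ T₂
      module S₂ = Side (swap-corner T₁) (swap-corner T₃)
    open TriCorner T₁
    open S₁ using (s) renaming (σ to k)

    f g : ℤ³
    f i = b i ℤ.- a i
    g i = c i ℤ.- a i

    module _ where
      open import Data.Integer using (_+_; _*_; _-_; -_; _≤_)

      k≡ : S₂.σ ≡ k
      k≡ = ℤP.i-j≡0⇒i≡j S₂.σ k (squeeze
          (S₁.apex-bound S₂.σ (λ q q∈ → S₂.bound q q∈ byᶻ h (S₂.σ * (n · (q -ᵛ a))) (A · (q -ᵛ a)) (B · (q -ᵛ a))))
          (S₂.apex-bound k (λ q q∈ → S₁.bound q q∈ byᶻ h (k * (n · (q -ᵛ a))) (B · (q -ᵛ a)) (A · (q -ᵛ a))) byᶻ h′ k S₂.σ))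
        where
        h : ∀ x a b → 1ℤ + x - b - a ≡ 1ℤ + x - a - b
        h = ℤR.solve-∀
        h′ : ∀ k l → k - l ≡ - (l - k)
        h′ = ℤR.solve-∀

      η₀ a₀ b₀ : ℤ
      η₀ = n · (0ᵛ -ᵛ a)
      a₀ = A · (0ᵛ -ᵛ a)
      b₀ = B · (0ᵛ -ᵛ a)

      reaches : ∀ {x} → x ≡ 1ℤ → 0ℤ ≤ x - 1ℤ
      reaches refl = 0≤0ᶻ

      n-apex : n · ((a +ᵛ e) -ᵛ a) ≡ 1ℤ
      n-apex = trans (·-cong n (λ i → h (a i) (e i))) n-e
        where
        h : ∀ a e → a + e - a ≡ e
        h = ℤR.solve-∀

      η₀≥1 : 0ℤ ≤ η₀ - 1ℤ
      η₀≥1 = centre n a n-inside (a +ᵛ e) e∈ (reaches n-apex)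
      a₀≥1 : 0ℤ ≤ a₀ - 1ℤ
      a₀≥1 = centre A a A-inside b b∈ (reaches A-f)
      b₀≥1 : 0ℤ ≤ b₀ - 1ℤ
      b₀≥1 = centre B a B-inside c c∈ (reaches B-g)
      s-centre : 0ℤ ≤ 1ℤ + k * η₀ - a₀ - b₀ - 1ℤ
      s-centre = centre s b (TriCorner.B-inside T₂) a a∈ (reaches (TriCorner.B-g T₂)) byᶻ cong (_- 1ℤ) (S₁.s-at 0ᵛ)

      -- The origin has distance at least 1 from the facets of n, A, B and s. In the bound for `s`
      -- this gives k η₀ ≥ a₀ + b₀ ≥ 2 with η₀ positive.
      k≥1 : 0ℤ ≤ k - 1ℤ
      k≥1 = go (split₁ k)
        where
        h : ∀ k η a b → 1ℤ + k * η - a - b - 1ℤ + - k * ((η - 1ℤ) + 1ℤ) + (a - 1ℤ) + (b - 1ℤ) + 1ℤ ≡ - 1ℤ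
        h = ℤR.solve-∀
        go : _ → 0ℤ ≤ k - 1ℤ
        go (inj₁ p) = p
        go (inj₂ p) = ⊥-elim (absurdᶻ (s-centre ⊹ᶻ (p ⊛ᶻ (η₀≥1 ⊹ᶻ 0≤1ᶻ)) ⊹ᶻ a₀≥1 ⊹ᶻ b₀≥1 ⊹ᶻ 0≤1ᶻ) (h k η₀ a₀ b₀))

      at-0 : ∀ x y → x · (0ᵛ -ᵛ y) ≡ - (x · y)
      at-0 x y = h (x 0F) (x 1F) (x 2F) (y 0F) (y 1F) (y 2F)
        where
        h : ∀ a b c x y z → a * (0ℤ - x) + (b * (0ℤ - y) + c * (0ℤ - z)) ≡ - (a * x + (b * y + c * z))
        h = ℤR.solve-∀

    ef∈ : ι (λ i → a i ℤ.+ e i ℤ.+ (1ℤ ℤ.+ k) ℤ.* f i) ∈P V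
    ef∈ = S₁.apex∈
    eg∈ : ι (λ i → a i ℤ.+ e i ℤ.+ (1ℤ ℤ.+ k) ℤ.* g i) ∈P V
    eg∈ = P-resp (λ i → cong (λ k → a i ℤ.+ e i ℤ.+ (1ℤ ℤ.+ k) ℤ.* g i) k≡) S₂.apex∈

    -- `n · z` is the height of `p` above N F. Up to height N the point lies in the layer of
    -- `Strip`. Above it, the ray through `p` is cut with the slice at height 1 in place of F.
    decompose : ∀ M {p r} → Cone V (hom (ιℤ (+ suc M)) (ι p)) → Cone V (hom r (ι p)) →
                ιℤ (n · p) ℚ.- r ℚ.* ιℤ (n · a) ≡ 0ℚ → 0ℚ ℚ.≤ r → Decomposition (suc M) p
    decompose M {p} {r} inN inr on r≥0 = go (split (+ suc M ℤ.- n · z))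
      where
      N = + suc M
      z : ℤ³
      z i = p i ℤ.- N ℤ.* a i
      ·-z : ∀ x → x · z ≡ x · p ℤ.- N ℤ.* (x · a)
      ·-z x = h N (x 0F) (x 1F) (x 2F) (p 0F) (p 1F) (p 2F) (a 0F) (a 1F) (a 2F)
        where
        open import Data.Integer using (_+_; _*_; _-_; -_; _≤_)
        h : ∀ N x y z p q r a b c → x * (p - N * a) + (y * (q - N * b) + z * (r - N * c)) ≡
            (x * p + (y * q + z * r)) - N * (x * a + (y * b + z * c))
        h = ℤR.solve-∀
      ι-z : ∀ x → ιℤ (x · z) ≡ ιℤ (x · p) ℚ.- ιℤ N ℚ.* ιℤ (x · a)
      ι-z x = trans (cong ιℤ (·-z x)) (trans (ι-- (x · p) (N ℤ.* (x · a))) (cong (λ y → ιℤ (x · p) ℚ.- y) (ι-* N (x · a))))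
      z≥0 : ∀ x → (∀ q → ι q ∈P V → 0ℤ ℤ.≤ x · (q -ᵛ a)) → 0ℤ ℤ.≤ x · z
      z≥0 x above = ι-reflect {x · z} (cone-above x a above (ιℤ N) p inN by sym (ι-z x))
      J≥0 = z≥0 n n-inside
      A≥0 = z≥0 A A-inside
      B≥0 = z≥0 B B-inside
      cap : 0ℤ ℤ.≤ N ℤ.+ k ℤ.* (n · z) ℤ.- A · z ℤ.- B · z
      cap = ι-reflect {N ℤ.+ k ℤ.* (n · z) ℤ.- A · z ℤ.- B · z} (cone-above s b (TriCorner.B-inside T₂) (ιℤ N) p inN
            by trans (sym (trans (ι-- (s · p) (N ℤ.* (s · b))) (cong (λ y → ιℤ (s · p) ℚ.- y) (ι-* N (s · b))))) (cong ιℤ s-z))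
        where
        open import Data.Integer using (_+_; _*_; _-_; -_; _≤_)
        sb : s · b ≡ s · a - 1ℤ
        sb = trans (h (s · b) (s · a)) (cong (λ y → s · a + y) (trans (sym (·-- s b a)) S₁.s-f))
          where
          h : ∀ x y → x ≡ y + (x - y)
          h = ℤR.solve-∀
        s-z : s · p - N * (s · b) ≡ N + k * (n · z) - A · z - B · z
        s-z = trans (cong (λ y → s · p - N * y) sb) (trans (h (s · p) N (s · a)) (trans (cong (λ y → N + y) (trans (sym (·-z s)) (S₁.s-value z)))
                (h′ N (k * (n · z)) (A · z) (B · z))))
          where
          h : ∀ sp N sa → sp - N * (sa - 1ℤ) ≡ N + (sp - N * sa)
          h = ℤR.solve-∀
          h′ : ∀ N x a b → N + (x - a - b) ≡ N + x - a - b
          h′ = ℤR.solve-∀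

      go : _ → Decomposition (suc M) p
      go (inj₁ J≤N) = Strip.strip a f g e k (≥1⇒≥0 {k} k≥1) a∈ (P-resp (λ i → h (a i) (b i)) b∈) (P-resp (λ i → h (a i) (c i)) c∈) e∈ ef∈ eg∈
          (suc M) (A · z) (B · z) (n · z) A≥0 B≥0 J≥0 J≤N cap
          (λ i → trans (h′ (p i) (N ℤ.* a i)) (cong (λ y → N ℤ.* a i ℤ.+ y) (trans (sym (expand z i)) (h″ ((n · z) ℤ.* e i) ((A · z) ℤ.* f i) ((B · z) ℤ.* g i)))))
        where
        h : ∀ a b → b ≡ a ℤ.+ (b ℤ.- a)
        h = ℤR.solve-∀
        h′ : ∀ p q → p ≡ q ℤ.+ (p ℤ.- q)
        h′ = ℤR.solve-∀
        h″ : ∀ x y z → x ℤ.+ (y ℤ.+ z) ≡ y ℤ.+ (z ℤ.+ x)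
        h″ = ℤR.solve-∀
      go (inj₂ J>N) = square-decomposition symm M {p} {r′} r′≥0 r′≤N
          (DilatedTriangle.dilated-cover k k≥1 (a +ᵛ e) f g e∈ ef∈ eg∈ X Y Z r′≥0 X≥0 Y≥0 Z≥0 (total X Y (r′ * ιℤ (1ℤ ℤ.+ k))) coordinates)
        where
        open import Data.Rational using (_+_; _*_; _-_; -_; _≤_; _<_)
        E = ιℤ η₀
        A₀ = ιℤ a₀
        B₀ = ιℤ b₀
        np = ιℤ (n · p)
        Ap = ιℤ (A · p)
        Bp = ιℤ (B · p)
        κ = ιℤ k
        ι-at : ∀ x y → ιℤ (x · y) ≡ - ιℤ (x · (0ᵛ -ᵛ y))
        ι-at x y = trans (h (ιℤ (x · y))) (cong -_ (sym (trans (cong ιℤ (at-0 x y)) (ι-neg (x · y)))))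
          where
          h : ∀ a → a ≡ - (- a)
          h = solve-∀ ℚ-ring
        np≡ : np ≡ - (r * E)
        np≡ = trans (h np (r * ιℤ (n · a))) (trans (cong (_+ r * ιℤ (n · a)) on) (trans (ℚP.+-identityˡ _) (trans (cong (r *_) (ι-at n a)) (h′ r E))))
          where
          h : ∀ x y → x ≡ x - y + y
          h = solve-∀ ℚ-ring
          h′ : ∀ r E → r * - E ≡ - (r * E)
          h′ = solve-∀ ℚ-ring
        J≡ : ιℤ (n · z) ≡ ιℤ N * E - r * E
        J≡ = trans (ι-z n) (trans (cong₂ (λ x y → x - ιℤ N * y) np≡ (ι-at n a)) (h (ιℤ N) r E))
          where
          h : ∀ N r E → - (r * E) - N * - E ≡ N * E - r * E
          h = solve-∀ ℚ-ring
        J-N≥0 : 0ℚ ≤ (ιℤ N * E - r * E) - ιℤ N - 1ℚ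
        J-N≥0 = ι-mono { ℤ.- (N ℤ.- n · z) ℤ.- 1ℤ} J>N by trans (ι-- (ℤ.- (N ℤ.- n · z)) 1ℤ) (cong (_- 1ℚ)
            (trans (ι-neg (N ℤ.- n · z)) (trans (cong -_ (ι-- N (n · z))) (trans (h (ιℤ N) (ιℤ (n · z))) (cong (_- ιℤ N) J≡)))))
          where
          h : ∀ x y → - (x - y) ≡ y - x
          h = solve-∀ ℚ-ring
        -- With η₀ = 1 the height would be N - r, which does not exceed N.
        deep : 0ℤ ℤ.≤ η₀ ℤ.- 1ℤ ℤ.- 1ℤ
        deep = decide (split₁ (η₀ ℤ.- 1ℤ))
          where
          h : ∀ N r → N * 1ℚ - r * 1ℚ - N - 1ℚ + r ≡ - 1ℚ
          h = solve-∀ ℚ-ring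
          decide : _ → 0ℤ ℤ.≤ η₀ ℤ.- 1ℤ ℤ.- 1ℤ
          decide (inj₁ q) = q
          decide (inj₂ q) = ⊥-elim (pos≰0 0<1 (J-N≥0 ⊹ r≥0 by
            trans (cong (λ E → ιℤ N * E - r * E - ιℤ N - 1ℚ + r) (cong ιℤ (ℤP.i-j≡0⇒i≡j η₀ 1ℤ (squeeze η₀≥1 q)))) (h (ιℤ N) r)))
        G = ιℤ (η₀ ℤ.- 1ℤ)
        G≡ : G ≡ E - 1ℚ
        G≡ = ι-- η₀ 1ℤ
        inv = pos⇒inverse G (TriangleDescent.≥1⇒ι-pos {η₀ ℤ.- 1ℤ} deep)
        η = proj₁ inv
        η≥0 : 0ℚ ≤ η
        η≥0 = ℚP.<⇒≤ (proj₁ (proj₂ inv))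
        ηG : η * (E - 1ℚ) ≡ 1ℚ
        ηG = trans (cong (η *_) (sym G≡)) (proj₂ (proj₂ inv))
        -- The factor that puts `p` on r′ times the plane at height 1: -r E = r′ (1 - E) gives r′ =
        -- r E / (E - 1), and `η` is 1 / (E - 1).
        r′ = r + r * η
        r′≥0 : 0ℚ ≤ r′
        r′≥0 = r≥0 ⊹ (r≥0 ⊛ η≥0)
        r′≤N : 0ℚ ≤ ιℤ N - r′
        r′≤N = (J-N≥0 ⊹ 0≤1) ⊛ η≥0 by trans (h (ιℤ N) r E η) (trans (cong (λ u → ιℤ N * u - r * u - r * η) ηG) (h′ (ιℤ N) r η))
          where
          h : ∀ N r E η → (N * E - r * E - N - 1ℚ + 1ℚ) * η ≡ N * (η * (E - 1ℚ)) - r * (η * (E - 1ℚ)) - r * η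
          h = solve-∀ ℚ-ring
          h′ : ∀ N r η → N * 1ℚ - r * 1ℚ - r * η ≡ N - (r + r * η)
          h′ = solve-∀ ℚ-ring
        above-r : ∀ x → (∀ q → ι q ∈P V → 0ℤ ℤ.≤ x · (q -ᵛ a)) → 0ℚ ≤ ιℤ (x · p) + r * ιℤ (x · (0ᵛ -ᵛ a))
        above-r x above = cone-above x a above r p inr by trans (cong (λ y → ιℤ (x · p) - r * y) (ι-at x a)) (h (ιℤ (x · p)) r (ιℤ (x · (0ᵛ -ᵛ a))))
          where
          h : ∀ p r y → p - r * - y ≡ p + r * y
          h = solve-∀ ℚ-ring
        -- X, Y, Z are the barycentric coordinates of `p` in r′ times the slice triangle. Each is
        -- the corresponding value for `r` plus r η times that of the origin, both nonnegative: the
        -- slice is met between the exit point and 0.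
        X = Ap + r′ * A₀
        Y = Bp + r′ * B₀
        Z = r′ * ιℤ (1ℤ ℤ.+ k) - X - Y
        total : ∀ X Y T → X + Y + (T - X - Y) ≡ T
        total = solve-∀ ℚ-ring
        grow : ∀ P r η q → P + r * q + r * η * q ≡ P + (r + r * η) * q
        grow = solve-∀ ℚ-ring
        X≥0 : 0ℚ ≤ X
        X≥0 = above-r A A-inside ⊹ ((r≥0 ⊛ η≥0) ⊛ ι-mono {a₀} (≥1⇒≥0 {a₀} a₀≥1)) by grow Ap r η A₀
        Y≥0 : 0ℚ ≤ Y
        Y≥0 = above-r B B-inside ⊹ ((r≥0 ⊛ η≥0) ⊛ ι-mono {b₀} (≥1⇒≥0 {b₀} b₀≥1)) by grow Bp r η B₀
        s₀ = 1ℤ ℤ.+ k ℤ.* η₀ ℤ.- a₀ ℤ.- b₀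
        ιs₀ : ιℤ s₀ ≡ 1ℚ + κ * E - A₀ - B₀
        ιs₀ = trans (ι-- (1ℤ ℤ.+ k ℤ.* η₀ ℤ.- a₀) b₀) (cong (_- B₀) (trans (ι-- (1ℤ ℤ.+ k ℤ.* η₀) a₀) (cong (_- A₀) (trans (ι-+ 1ℤ (k ℤ.* η₀)) (cong (_+_ 1ℚ) (ι-* k η₀))))))
        ιsp : ιℤ (s · p) ≡ κ * np - Ap - Bp
        ιsp = trans (cong ιℤ (S₁.s-value p)) (trans (ι-- (k ℤ.* (n · p) ℤ.- A · p) (B · p)) (cong (_- Bp) (trans (ι-- (k ℤ.* (n · p)) (A · p)) (cong (_- Ap) (ι-* k (n · p))))))
        ιsb : ιℤ (s · b) ≡ - (1ℚ + κ * E - A₀ - B₀)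
        ιsb = trans (ι-at s b) (cong -_ (trans (cong ιℤ (S₁.s-at 0ᵛ)) ιs₀))
        cap-r : 0ℚ ≤ κ * - (r * E) - Ap - Bp - r * - (1ℚ + κ * E - A₀ - B₀)
        cap-r = cone-above s b (TriCorner.B-inside T₂) r p inr by trans (cong₂ (λ x y → x - r * y) ιsp ιsb)
                  (cong (λ x → κ * x - Ap - Bp - r * - (1ℚ + κ * E - A₀ - B₀)) np≡)
        Z≥0 : 0ℚ ≤ Z
        Z≥0 = cap-r ⊹ ((r≥0 ⊛ η≥0) ⊛ (ι-mono {s₀} (≥1⇒≥0 {s₀} s-centre) by ιs₀))
          by trans (h κ E Ap Bp A₀ B₀ r η) (trans (cong (λ u → (r + r * η) + κ * (r * u + r * η) - (Ap + (r + r * η) * A₀) - (Bp + (r + r * η) * B₀)) ηG)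
            (trans (h′ κ Ap Bp A₀ B₀ r η) (cong (λ u → r′ * u - X - Y) (sym (ι-+ 1ℤ k)))))
          where
          h : ∀ κ E Ap Bp A₀ B₀ r η → κ * - (r * E) - Ap - Bp - r * - (1ℚ + κ * E - A₀ - B₀) + r * η * (1ℚ + κ * E - A₀ - B₀) ≡
              (r + r * η) + κ * (r * (η * (E - 1ℚ)) + r * η) - (Ap + (r + r * η) * A₀) - (Bp + (r + r * η) * B₀)
          h = solve-∀ ℚ-ring
          h′ : ∀ κ Ap Bp A₀ B₀ r η → (r + r * η) + κ * (r * 1ℚ + r * η) - (Ap + (r + r * η) * A₀) - (Bp + (r + r * η) * B₀) ≡
               (r + r * η) * (1ℚ + κ) - (Ap + (r + r * η) * A₀) - (Bp + (r + r * η) * B₀)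
          h′ = solve-∀ ℚ-ring
        frame : ∀ y t → ιℤ (y t) ≡ ιℤ (n · y) * ιℤ (e t) + (ιℤ (A · y) * ιℤ (f t) + ιℤ (B · y) * ιℤ (g t))
        frame y t = ι-expand (n · y) (A · y) (B · y) (e t) (f t) (g t) (expand y t)
        coordinates : ∀ t → ιℤ (p t) ≡ r′ * ιℤ (a t ℤ.+ e t) + X * ιℤ (f t) + Y * ιℤ (g t)
        coordinates t = trans (frame p t) (trans (cong (λ u → u * ιℤ (e t) + (Ap * ιℤ (f t) + Bp * ιℤ (g t))) np≡)
            (sym (trans (cong (λ u → r′ * u + X * ιℤ (f t) + Y * ιℤ (g t)) (trans (ι-+ (a t) (e t)) (cong (_+ ιℤ (e t)) (trans (frame a t)
                (cong₂ (λ x y → x * ιℤ (e t) + y) (ι-at n a) (cong₂ (λ x y → x * ιℤ (f t) + y * ιℤ (g t)) (ι-at A a) (ι-at B a)))))))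
              (trans (h r η E A₀ B₀ Ap Bp (ιℤ (e t)) (ιℤ (f t)) (ιℤ (g t)))
                (trans (cong (λ u → - (r * (E - 1ℚ) + r * u) * ιℤ (e t) + (Ap * ιℤ (f t) + Bp * ιℤ (g t))) ηG)
                  (h′ r E Ap Bp (ιℤ (e t)) (ιℤ (f t)) (ιℤ (g t))))))))
          where
          h : ∀ r η E A₀ B₀ Ap Bp e f g → (r + r * η) * (- E * e + (- A₀ * f + - B₀ * g) + e) + (Ap + (r + r * η) * A₀) * f + (Bp + (r + r * η) * B₀) * g ≡
              - (r * (E - 1ℚ) + r * (η * (E - 1ℚ))) * e + (Ap * f + Bp * g)
          h = solve-∀ ℚ-ring
          h′ : ∀ r E Ap Bp e f g → - (r * (E - 1ℚ) + r * 1ℚ) * e + (Ap * f + Bp * g) ≡ - (r * E) * e + (Ap * f + Bp * g)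
          h′ = solve-∀ ℚ-ring

-- The exit facet of a lattice point, and the theorem.

module Assembly {m} (V : Fin m → ℤ³) (smooth : Smooth V) (j₀ : Fin m) (symm : CentSym V) where

  open Corners V smooth using (corners; lex-min-corner)
  open Facets V smooth j₀ using (rot; turn; expand-·; bounded)
  open Separation V using (separate)
  open LatticeConvexity V
  open Decompositions V
  open TriangularFacets V smooth j₀ symm
  open Polygons using (Triangle; squeeze; pick≡0)
  open UnimodularTriangles using (split₁; ≥1⇒≥0; clash)

  module OnFacetCone (C : Corner V) where

    open FacetPolygon V smooth j₀ C using (pt; L; polygon; cover; X; Y; n; v; e; u; pt-on; dual; expand)
    open TriangleDescent using (Square; square-or-triangle)

    decompose-on-facet : ∀ M {p r} → Cone V (hom (ιℤ (+ suc M)) (ι p)) → Cone V (hom r (ι p)) →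
      fun n v ∙ hom r (ι p) ≡ 0ℚ → 0ℚ ℚ.≤ r → 0ℚ ℚ.≤ ιℤ (+ suc M) ℚ.- r → Decomposition (suc M) p
    decompose-on-facet M {p} {r} inN inr on r≥0 r≤N = go (square-or-triangle polygon (cover (hom r (ι p)) inr on))
      where
      go : Square L r (X (hom r (ι p))) (Y (hom r (ι p))) ⊎ Triangle L → Decomposition (suc M) p
      go (inj₁ S) = square-decomposition symm M {p} {r} r≥0 r≤N record
        { a = pt ax ay ; f = λ i → fx ℤ.* e 1F i ℤ.+ fy ℤ.* e 2F i ; g = λ i → gx ℤ.* e 1F i ℤ.+ gy ℤ.* e 2F i
        ; a∈ = a∈
        ; f∈ = P-resp (λ i → h₁ (v i) ax ay fx fy (e 1F i) (e 2F i)) f∈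
        ; g∈ = P-resp (λ i → h₁ (v i) ax ay gx gy (e 1F i) (e 2F i)) g∈
        ; fg∈ = P-resp (λ i → h₂ (v i) ax ay fx fy gx gy (e 1F i) (e 2F i)) fg∈
        ; λ₁ = λ₁ ; λ₂ = λ₂ ; λ₁≥0 = λ₁≥0 ; λ₂≥0 = λ₂≥0 ; λ₁≤r = λ₁≤r ; λ₂≤r = λ₂≤r
        ; p≡ = coordinates }
        where
        open Square S
        h₁ : ∀ v a b x y e f → v ℤ.+ (a ℤ.+ x) ℤ.* e ℤ.+ (b ℤ.+ y) ℤ.* f ≡ v ℤ.+ a ℤ.* e ℤ.+ b ℤ.* f ℤ.+ (x ℤ.* e ℤ.+ y ℤ.* f)
        h₁ = ℤR.solve-∀
        h₂ : ∀ v a b x y x′ y′ e f → v ℤ.+ (a ℤ.+ x ℤ.+ x′) ℤ.* e ℤ.+ (b ℤ.+ y ℤ.+ y′) ℤ.* f ≡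
             v ℤ.+ a ℤ.* e ℤ.+ b ℤ.* f ℤ.+ (x ℤ.* e ℤ.+ y ℤ.* f) ℤ.+ (x′ ℤ.* e ℤ.+ y′ ℤ.* f)
        h₂ = ℤR.solve-∀
        open import Data.Rational using (_+_; _*_; _-_; -_; _≤_; _<_)
        frame : ∀ z t → ιℤ (z t) ≡ ιℤ (n · z) * ιℤ (e 0F t) + (ιℤ (u 1F · z) * ιℤ (e 1F t) + ιℤ (u 2F · z) * ιℤ (e 2F t))
        frame z t = ι-expand (n · z) (u 1F · z) (u 2F · z) (e 0F t) (e 1F t) (e 2F t) (expand z t)
        ι-plane : ∀ x y t → ιℤ (x ℤ.* e 1F t ℤ.+ y ℤ.* e 2F t) ≡ ιℤ x * ιℤ (e 1F t) + ιℤ y * ιℤ (e 2F t)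
        ι-plane x y t = trans (ι-+ (x ℤ.* e 1F t) (y ℤ.* e 2F t)) (cong₂ _+_ (ι-* x (e 1F t)) (ι-* y (e 2F t)))
        move : ∀ a b c → a - b ≡ c → a ≡ b + c
        move a b _ refl = h a b
          where
          h : ∀ a b → a ≡ b + (a - b)
          h = solve-∀ ℚ-ring
        dotted : ∀ i {c} → fun (u i) v ∙ hom r (ι p) ≡ c → ιℤ (u i · p) ≡ r * ιℤ (u i · v) + c
        dotted i eq = move (ιℤ (u i · p)) (r * ιℤ (u i · v)) _ (trans (sym (fun-lattice (u i) v r p)) eq)
        coordinates : ∀ t → ιℤ (p t) ≡ r * ιℤ (pt ax ay t) + λ₁ * ιℤ (fx ℤ.* e 1F t ℤ.+ fy ℤ.* e 2F t) + λ₂ * ιℤ (gx ℤ.* e 1F t ℤ.+ gy ℤ.* e 2F t)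
        coordinates t = trans (frame p t)
          (trans (cong₂ (λ x y → x * ιℤ (e 0F t) + y) (dotted 0F on) (cong₂ (λ x y → x * ιℤ (e 1F t) + y * ιℤ (e 2F t)) (dotted 1F (sym X≡)) (dotted 2F (sym Y≡))))
            (trans (h r λ₁ λ₂ (ιℤ (n · v)) (ιℤ (u 1F · v)) (ιℤ (u 2F · v)) (ιℤ ax) (ιℤ ay) (ιℤ fx) (ιℤ fy) (ιℤ gx) (ιℤ gy) (ιℤ (e 0F t)) (ιℤ (e 1F t)) (ιℤ (e 2F t)))
              (cong₂ _+_ (cong₂ (λ x y → r * x + λ₁ * y) (sym (trans (cong ιℤ (ℤP.+-assoc (v t) (ax ℤ.* e 1F t) (ay ℤ.* e 2F t))) (trans (ι-+ (v t) _) (cong₂ _+_ (frame v t) (ι-plane ax ay t))))) (sym (ι-plane fx fy t)))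
                (cong (λ₂ *_) (sym (ι-plane gx gy t))))))
          where
          h : ∀ r l m n₀ u₁ u₂ ax ay fx fy gx gy e₀ e₁ e₂ →
              (r * n₀ + 0ℚ) * e₀ + ((r * u₁ + (r * ax + l * fx + m * gx)) * e₁ + (r * u₂ + (r * ay + l * fy + m * gy)) * e₂) ≡
              r * ((n₀ * e₀ + (u₁ * e₁ + u₂ * e₂)) + (ax * e₁ + ay * e₂)) + l * (fx * e₁ + fy * e₂) + m * (gx * e₁ + gy * e₂)
          h = solve-∀ ℚ-ring
      go (inj₂ Δ) = TriangleDecomposition.decompose (triangle-corner C Δ) (triangle-corner C (turn-triangle C Δ))
          (triangle-corner C (turn-triangle C (turn-triangle C Δ))) M {p} {r} inN inr (trans (cong (λ y → ιℤ (n · p) ℚ.- r ℚ.* ιℤ y) same) (trans (sym (fun-lattice n v r p)) on)) r≥0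
        where
        open Triangle Δ
        same : n · pt x₁ y₁ ≡ n · v
        same = ℤP.i-j≡0⇒i≡j (n · pt x₁ y₁) (n · v) (trans (sym (·-- n (pt x₁ y₁) v)) (pt-on x₁ y₁))

  -- A facet appears once for each listed corner on it; repetitions do not affect the maximum taken
  -- over the list.
  facets : List (Corner V)
  facets = concatMap (λ C → C ∷ rot C ∷ rot (rot C) ∷ []) corners

  facet∈ : ∀ {C} → C ∈ corners → ∀ i → ∃ λ D → D ∈ facets × (∀ z → Corner.u D 0F · z ≡ Corner.u C i · z) × Corner.v D ≡ Corner.v C
  facet∈ {C} C∈ 0F = C , ∈-concatMap⁺ (λ C → C ∷ rot C ∷ rot (rot C) ∷ []) (lose C∈ (here refl)) , (λ z → refl) , refl
  facet∈ {C} C∈ 1F = rot C , ∈-concatMap⁺ (λ C → C ∷ rot C ∷ rot (rot C) ∷ []) (lose C∈ (there (here refl))) , (λ z → refl) , refl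
  facet∈ {C} C∈ 2F = rot (rot C) , ∈-concatMap⁺ (λ C → C ∷ rot C ∷ rot (rot C) ∷ []) (lose C∈ (there (there (here refl)))) , (λ z → refl) , refl

  module Gauge (M : ℕ) (p : ℤ³) (inN : Cone V (hom (ιℤ (+ suc M)) (ι p))) where

    open import Data.Rational using (_+_; _*_; _-_; -_; _≤_; _<_)

    height : Corner V → ℤ
    height C = let open Corner C in u 0F · (0ᵛ -ᵛ v)

    height≥1 : ∀ C → 0ℤ ℤ.≤ height C ℤ.- 1ℤ
    height≥1 C = centre (u 0F) v (bounded (u 0F) v (inside 0F)) (v +ᵛ e 0F) (e∈P 0F) (reach (trans (·-cong (u 0F) (λ i → h (v i) (e 0F i))) (dual 0F 0F)))
      where
      open Corner C
      h : ∀ v e → v ℤ.+ e ℤ.- v ≡ e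
      h = ℤR.solve-∀
      reach : ∀ {x} → x ≡ 1ℤ → 0ℤ ℤ.≤ x ℤ.- 1ℤ
      reach refl = 0≤0ᶻ

    height-pos : ∀ C → 0ℚ < ιℤ (height C)
    height-pos C = TriangleDescent.≥1⇒ι-pos {height C} (height≥1 C)

    -- For the facet of `C`, the inequality u · p ≥ r (u · v) says that r is at least this ratio,
    -- since `height` is -u · v. The maximum over all facets is the Minkowski gauge of `p`, attained
    -- at the exit facet.
    ratio : Corner V → ℚ
    ratio C = - ιℤ (Corner.u C 0F · p) * recip (ιℤ (height C))

    ratio-height : ∀ C → ratio C * ιℤ (height C) ≡ - ιℤ (Corner.u C 0F · p)
    ratio-height C = trans (ℚP.*-assoc (- ιℤ (Corner.u C 0F · p)) (recip (ιℤ (height C))) (ιℤ (height C)))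
      (trans (cong (λ x → - ιℤ (Corner.u C 0F · p) * x) (proj₂ (recip-pos (height-pos C)))) (ℚP.*-identityʳ _))

    height≡ : ∀ C → ιℤ (height C) ≡ - ιℤ (Corner.u C 0F · Corner.v C)
    height≡ C = trans (cong ιℤ (at-zero (u 0F) v)) (ι-neg (u 0F · v))
      where
      open Corner C
      at-zero : ∀ x y → x · (0ᵛ -ᵛ y) ≡ ℤ.- (x · y)
      at-zero x y = h (x 0F) (x 1F) (x 2F) (y 0F) (y 1F) (y 2F)
        where
        h : ∀ a b c x y z → a ℤ.* (0ℤ ℤ.- x) ℤ.+ (b ℤ.* (0ℤ ℤ.- y) ℤ.+ c ℤ.* (0ℤ ℤ.- z)) ≡ ℤ.- (a ℤ.* x ℤ.+ (b ℤ.* y ℤ.+ c ℤ.* z))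
        h = ℤR.solve-∀

    margin : ∀ C r → (r - ratio C) * ιℤ (height C) ≡ ιℤ (Corner.u C 0F · p) - r * ιℤ (Corner.u C 0F · Corner.v C)
    margin C r = trans (h r (ratio C) (ιℤ (height C))) (trans (cong₂ (λ x y → r * x - y) (height≡ C) (ratio-height C)) (h′ r (ιℤ (u 0F · v)) (ιℤ (u 0F · p))))
      where
      open Corner C
      h : ∀ r q H → (r - q) * H ≡ r * H - q * H
      h = solve-∀ ℚ-ring
      h′ : ∀ r V P → r * - V - - P ≡ P - r * V
      h′ = solve-∀ ℚ-ring

    some-facet : ∃ λ C → C ∈ facets
    some-facet = go (lex-min-corner j₀ [])
      where
      go : _ → ∃ λ C → C ∈ facets
      go (C , C∈ , _) = let D , D∈ , _ = facet∈ C∈ 0F in D , D∈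

    -- `lex-min` minimises functionals of vectors, so the ratio is negated and stored in coordinate
    -- 0.
    key : Corner V → H
    key C = hom (- ratio C) (λ _ → 0ℚ)

    found = lex-min (π 0F ∷ []) key (proj₁ some-facet) facets
    best = proj₁ found
    r = ratio best

    r-max : ∀ {C} → C ∈ facets → 0ℚ ≤ r - ratio C
    r-max {C} C∈ = lex-head (proj₂ (proj₂ found) (there C∈)) by trans (π-∙ 0F (key C ⊝ key best)) (h (ratio C) r)
      where
      h : ∀ a b → - a - - b ≡ b - a
      h = solve-∀ ℚ-ring

    within : ∀ {C} → C ∈ corners → ∀ i → 0ℚ ≤ ιℤ (Corner.u C i · p) - r * ιℤ (Corner.u C i · Corner.v C)
    within {C} C∈ i = go (facet∈ C∈ i)
      where
      go : _ → 0ℚ ≤ ιℤ (Corner.u C i · p) - r * ιℤ (Corner.u C i · Corner.v C)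
      go (D , D∈ , u≡ , v≡) = r-max D∈ ⊛ ℚP.<⇒≤ (height-pos D)
        by trans (margin D r) (cong₂ (λ x y → ιℤ x - r * ιℤ y) (u≡ p) (trans (cong (λ v → Corner.u D 0F · v) v≡) (u≡ (Corner.v C))))

    -- At the vertex farthest in the direction of `p` every edge has p · e i ≤ 0. Were all u i · p
    -- positive, expanding p · p in the edges would give p · p ≤ 0, hence p = 0 and u 0F · p = 0.
    some-nonpositive : ∃ λ D → D ∈ facets × 0ℤ ℤ.≤ ℤ.- (Corner.u D 0F · p)
    some-nonpositive = go (lex-min-corner j₀ (fun (λ i → ℤ.- p i) 0ᵛ ∷ []))
      where
      go : _ → ∃ λ D → D ∈ facets × 0ℤ ℤ.≤ ℤ.- (Corner.u D 0F · p)
      go (C , C∈ , _ , min) = choose (split₁ (u 0F · p)) (split₁ (u 1F · p)) (split₁ (u 2F · p))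
        where
        open Corner C
        -p : ℤ³
        -p i = ℤ.- p i
        gens : ∀ k → 0ℤ ℤ.≤ -p · (V k -ᵛ v)
        gens k = ι-reflect { -p · (V k -ᵛ v)} (lex-head (min k) by trans (∙-⊝ (fun -p 0ᵛ) (hat (V k)) (hat v))
          (trans (cong₂ _-_ (fun-hat -p 0ᵛ (V k)) (fun-hat -p 0ᵛ v)) (trans (sym (ι-- (-p · (V k -ᵛ 0ᵛ)) (-p · (v -ᵛ 0ᵛ))))
            (cong ιℤ (trans (sym (·-- -p (V k -ᵛ 0ᵛ) (v -ᵛ 0ᵛ))) (·-cong -p (λ i → h (V k i) (v i))))))))
          where
          h : ∀ a b → (a ℤ.- 0ℤ) ℤ.- (b ℤ.- 0ℤ) ≡ a ℤ.- b
          h = ℤR.solve-∀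
        descent : ∀ i → 0ℤ ℤ.≤ ℤ.- (p · e i)
        descent i = bounded -p v gens (v +ᵛ e i) (e∈P i) byᶻ h (p 0F) (p 1F) (p 2F) (v 0F) (v 1F) (v 2F) (e i 0F) (e i 1F) (e i 2F)
          where
          h : ∀ p q r a b c x y z → ℤ.- p ℤ.* (a ℤ.+ x ℤ.- a) ℤ.+ (ℤ.- q ℤ.* (b ℤ.+ y ℤ.- b) ℤ.+ ℤ.- r ℤ.* (c ℤ.+ z ℤ.- c)) ≡
              ℤ.- (p ℤ.* x ℤ.+ (q ℤ.* y ℤ.+ r ℤ.* z))
          h = ℤR.solve-∀
        wrap : ∀ i → 0ℤ ℤ.≤ ℤ.- (u i · p) → ∃ λ D → D ∈ facets × 0ℤ ℤ.≤ ℤ.- (Corner.u D 0F · p)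
        wrap i q = pack (facet∈ C∈ i)
          where
          pack : _ → ∃ λ D → D ∈ facets × 0ℤ ℤ.≤ ℤ.- (Corner.u D 0F · p)
          pack (D , D∈ , u≡ , _) = D , D∈ , (q byᶻ cong ℤ.-_ (sym (u≡ p)))
        square≥0 : ∀ x → 0ℤ ℤ.≤ x ℤ.* x
        square≥0 x = cases (split x)
          where
          h : ∀ x → ℤ.- x ℤ.* ℤ.- x ≡ x ℤ.* x
          h = ℤR.solve-∀
          cases : _ → 0ℤ ℤ.≤ x ℤ.* x
          cases (inj₁ q) = q ⊛ᶻ q
          cases (inj₂ q) = ≥1⇒≥0 {ℤ.- x} q ⊛ᶻ ≥1⇒≥0 {ℤ.- x} q byᶻ h x
        zero-square : ∀ x → x ℤ.* x ≡ 0ℤ → x ≡ 0ℤ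
        zero-square x q = Data.Sum.[ (λ e → e) , (λ e → e) ]′ (ℤP.i*j≡0⇒i≡0∨j≡0 x q)
        choose : _ → _ → _ → ∃ λ D → D ∈ facets × 0ℤ ℤ.≤ ℤ.- (Corner.u D 0F · p)
        choose (inj₂ q) _ _ = wrap 0F q
        choose (inj₁ _) (inj₂ q) _ = wrap 1F q
        choose (inj₁ _) (inj₁ _) (inj₂ q) = wrap 2F q
        choose (inj₁ c₀) (inj₁ c₁) (inj₁ c₂) = ⊥-elim (clash c₀ (0≤0ᶻ byᶻ sym (cong ℤ.-_ (trans (·-cong (u 0F) p≡0) (h₀ (u 0F 0F) (u 0F 1F) (u 0F 2F))))))
          where
          h₀ : ∀ a b c → a ℤ.* 0ℤ ℤ.+ (b ℤ.* 0ℤ ℤ.+ c ℤ.* 0ℤ) ≡ 0ℤ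
          h₀ = ℤR.solve-∀
          h₁ : ∀ a b c x y z → a ℤ.* ℤ.- x ℤ.+ (b ℤ.* ℤ.- y ℤ.+ c ℤ.* ℤ.- z) ≡ ℤ.- (a ℤ.* x ℤ.+ (b ℤ.* y ℤ.+ c ℤ.* z))
          h₁ = ℤR.solve-∀
          pp≤0 : 0ℤ ℤ.≤ ℤ.- (p · p)
          pp≤0 = (≥1⇒≥0 {u 0F · p} c₀ ⊛ᶻ descent 0F) ⊹ᶻ ((≥1⇒≥0 {u 1F · p} c₁ ⊛ᶻ descent 1F) ⊹ᶻ (≥1⇒≥0 {u 2F · p} c₂ ⊛ᶻ descent 2F))
            byᶻ trans (h₁ (u 0F · p) (u 1F · p) (u 2F · p) (p · e 0F) (p · e 1F) (p · e 2F)) (cong ℤ.-_ (sym (expand-· C p p)))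
          s₀ = square≥0 (p 0F)
          s₁ = square≥0 (p 1F)
          s₂ = square≥0 (p 2F)
          pp≡0 : p · p ≡ 0ℤ
          pp≡0 = squeeze (s₀ ⊹ᶻ (s₁ ⊹ᶻ s₂)) pp≤0
          tail≡0 : p 1F ℤ.* p 1F ℤ.+ p 2F ℤ.* p 2F ≡ 0ℤ
          tail≡0 = pick≡0 (s₁ ⊹ᶻ s₂) s₀ (trans (ℤP.+-comm (p 1F ℤ.* p 1F ℤ.+ p 2F ℤ.* p 2F) (p 0F ℤ.* p 0F)) pp≡0)
          p≡0 : ∀ i → p i ≡ 0ℤ
          p≡0 0F = zero-square (p 0F) (pick≡0 s₀ (s₁ ⊹ᶻ s₂) pp≡0)
          p≡0 1F = zero-square (p 1F) (pick≡0 s₁ s₂ tail≡0)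
          p≡0 2F = zero-square (p 2F) (pick≡0 s₂ s₁ (trans (ℤP.+-comm (p 2F ℤ.* p 2F) (p 1F ℤ.* p 1F)) tail≡0))

    r≥0 : 0ℚ ≤ r
    r≥0 = go some-nonpositive
      where
      h : ∀ r q → r - q + q ≡ r
      h = solve-∀ ℚ-ring
      go : _ → 0ℚ ≤ r
      go (D , D∈ , q) = r-max D∈ ⊹ (*-nonneg⁻¹ (height-pos D) (ι-mono {ℤ.- (Corner.u D 0F · p)} q
          by trans (ι-neg (Corner.u D 0F · p)) (trans (sym (ratio-height D)) (ℚP.*-comm (ratio D) (ιℤ (height D)))))) by h r (ratio D)

    r≤N : 0ℚ ≤ ιℤ (+ suc M) - r
    r≤N = *-nonneg⁻¹ (height-pos best) (cone-above (u 0F) v (bounded (u 0F) v (inside 0F)) (ιℤ (+ suc M)) p inN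
            by trans (sym (margin best (ιℤ (+ suc M)))) (ℚP.*-comm (ιℤ (+ suc M) - r) (ιℤ (height best))))
      where open Corner best

    on-facet : fun (Corner.u best 0F) (Corner.v best) ∙ hom r (ι p) ≡ 0ℚ
    on-facet = trans (fun-lattice (Corner.u best 0F) (Corner.v best) r p) (trans (sym (margin best r)) (h r (ιℤ (height best))))
      where
      h : ∀ r H → (r - r) * H ≡ 0ℚ
      h = solve-∀ ℚ-ring

    -- The facet inequalities at the corners describe P. If `φ` separated `p` from r P, consider the
    -- corner `v` that minimises `φ`: by `within`, p - r v is a nonnegative combination of its
    -- edges, on which `φ` is nonnegative, so `p` does not lie below r v.
    in-cone : Cone V (hom r (ι p))
    in-cone = go (separate r (hom r (ι p)) r≥0)
      where
      go : _ → Cone V (hom r (ι p))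
      go (inj₁ c) = c
      go (inj₂ (φ , apart)) = ⊥-elim (contradict (lex-min-corner j₀ (φ ∷ [])))
        where
        contradict : _ → ⊥
        contradict (C , C∈ , (j , v≡) , min) = neg≰ (pos+ (apart j) climb <by trans (cong (λ w → φ ∙ ((r ⊙ hat w) ⊝ hom r (ι p)) + φ ∙ (hom r (ι p) ⊝ (r ⊙ hat v))) (sym v≡))
            (trans (cong₂ _+_ (∙-⊝ φ (r ⊙ hat v) (hom r (ι p))) (∙-⊝ φ (hom r (ι p)) (r ⊙ hat v))) (h (φ ∙ (r ⊙ hat v)) (φ ∙ hom r (ι p)))))
          where
          open Corner C
          h : ∀ a b → a - b + (b - a) ≡ 0ℚ
          h = solve-∀ ℚ-ring
          T = φ ⊝ ((φ ∙ hat v) ⊙ π 0F)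
          T-∙ : ∀ q → T ∙ hat q ≡ φ ∙ (hat q ⊝ hat v)
          T-∙ q = trans (⊝-∙ φ _ (hat q)) (trans (cong (λ a → φ ∙ hat q - a) (trans (⊙-∙ (φ ∙ hat v) (π 0F) (hat q))
            (trans (cong (λ a → (φ ∙ hat v) * a) (π-∙ 0F (hat q))) (ℚP.*-identityʳ (φ ∙ hat v))))) (sym (∙-⊝ φ (hat q) (hat v))))
          d : Fin 3 → H
          d i = hat (v +ᵛ e i) ⊝ hat v
          rising : ∀ i → 0ℚ ≤ φ ∙ d i
          rising i = cone-nonneg {V = V} T (λ k → lex-head (min k) by sym (T-∙ (V k))) (e∈P i) by T-∙ (v +ᵛ e i)
          c : Fin 3 → ℚ
          c i = ιℤ (u i · p) - r * ιℤ (u i · v)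
          frame : ∀ z t → ιℤ (z t) ≡ ιℤ (u 0F · z) * ιℤ (e 0F t) + (ιℤ (u 1F · z) * ιℤ (e 1F t) + ιℤ (u 2F · z) * ιℤ (e 2F t))
          frame z t = ι-expand (u 0F · z) (u 1F · z) (u 2F · z) (e 0F t) (e 1F t) (e 2F t) (expand z t)
          combination : ((c 0F ⊙ d 0F) ⊕ ((c 1F ⊙ d 1F) ⊕ (c 2F ⊙ d 2F))) ≋ hom r (ι p) ⊝ (r ⊙ hat v)
          combination zero = h₀ (c 0F) (c 1F) (c 2F) r
            where
            h₀ : ∀ a b c r → a * (1ℚ - 1ℚ) + (b * (1ℚ - 1ℚ) + c * (1ℚ - 1ℚ)) ≡ r - r * 1ℚ
            h₀ = solve-∀ ℚ-ring
          combination (suc t) = trans (cong₂ _+_ (part 0F) (cong₂ _+_ (part 1F) (part 2F)))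
              (trans (h₁ r (ιℤ (u 0F · p)) (ιℤ (u 1F · p)) (ιℤ (u 2F · p)) (ιℤ (u 0F · v)) (ιℤ (u 1F · v)) (ιℤ (u 2F · v)) (ιℤ (e 0F t)) (ιℤ (e 1F t)) (ιℤ (e 2F t)))
                (cong₂ (λ x y → x - r * y) (sym (frame p t)) (sym (frame v t))))
            where
            part : ∀ i → c i * (ιℤ (v t ℤ.+ e i t) - ιℤ (v t)) ≡ c i * ιℤ (e i t)
            part i = cong (λ x → c i * x) (trans (cong (_- ιℤ (v t)) (ι-+ (v t) (e i t))) (h₂ (ιℤ (v t)) (ιℤ (e i t))))
              where
              h₂ : ∀ v e → v + e - v ≡ e
              h₂ = solve-∀ ℚ-ring
            h₁ : ∀ r p₀ p₁ p₂ v₀ v₁ v₂ e₀ e₁ e₂ → (p₀ - r * v₀) * e₀ + ((p₁ - r * v₁) * e₁ + (p₂ - r * v₂) * e₂) ≡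
                 (p₀ * e₀ + (p₁ * e₁ + p₂ * e₂)) - r * (v₀ * e₀ + (v₁ * e₁ + v₂ * e₂))
            h₁ = solve-∀ ℚ-ring
          climb : 0ℚ ≤ φ ∙ (hom r (ι p) ⊝ (r ⊙ hat v))
          climb = (within C∈ 0F ⊛ rising 0F) ⊹ ((within C∈ 1F ⊛ rising 1F) ⊹ (within C∈ 2F ⊛ rising 2F))
            by trans (sym (trans (∙-⊕ φ (c 0F ⊙ d 0F) ((c 1F ⊙ d 1F) ⊕ (c 2F ⊙ d 2F))) (cong₂ _+_ (∙-⊙ φ (c 0F) (d 0F))
                 (trans (∙-⊕ φ (c 1F ⊙ d 1F) (c 2F ⊙ d 2F)) (cong₂ _+_ (∙-⊙ φ (c 1F) (d 1F)) (∙-⊙ φ (c 2F) (d 2F)))))))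
               (∙-cong φ combination)

    decomposition : Decomposition (suc M) p
    decomposition = OnFacetCone.decompose-on-facet best M {p} {r} inN in-cone on-facet r≥0 r≤N

theorem1p4 : (m : ℕ) (V : Fin m → ℤ³) → Dim3 V → Smooth V → CentSym V → IDP V
theorem1p4 zero V (_ , q∈ , _) _ _ = ⊥-elim (empty (q∈ zero))
  where
  empty : ∀ {x} → x ∈P V → ⊥
  empty (_ , _ , () , _)
theorem1p4 (suc m) V _ smooth symm (suc M) _ p (x , x∈ , x≡) =
  Assembly.Gauge.decomposition V smooth zero symm M p (cone-resp {V = V} {ιℤ (+ suc M) ⊙ hom 1ℚ x} {hom (ιℤ (+ suc M)) (ι p)}
    (λ { zero → ℚP.*-identityʳ (ιℤ (+ suc M)) ; (suc i) → x≡ i })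
    (cone-⊙ {V = V} {ιℤ (+ suc M)} {hom 1ℚ x} (ι-mono (+≥0 (suc M))) x∈))
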